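{- Let $k\ge2$ and let $n$ be an odd integer with $n>4k$. Then $$P\big(n(n+4)\cdots(n+4(k-1))\big)>4(k+1)$$ unless $k=2$ and $n\in\{11,21,45,77,121\}$, or $k=3$ and $n=117$.
   Context: For an integer $m>1$, $P(m)$ denotes the greatest prime factor of $m$, and $P(1)=1$. -}

module Defs where

open import Data.Nat using (ℕ; zero; suc; _+_; _*_; _≤_; _<_)
open import Data.Nat.Divisibility using (_∣_)
open import Data.Nat.Primality using (Prime)
open import Data.Product using (_×_)
open import Relation.Binary.PropositionalEquality using (_≡_)
open import Data.Sum using (_⊎_)

prodAP4 : ℕ → ℕ → ℕ
prodAP4 n zero    = 1
prodAP4 n (suc k) = prodAP4 n k * (n + 4 * k)

GreatestPrimeFactor : ℕ → ℕ → Set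
GreatestPrimeFactor m q =
  (m ≡ 1 × q ≡ 1) ⊎
  (1 < m × Prime q × q ∣ m × (∀ p → Prime p → p ∣ m → p ≤ q))

{-# OPTIONS --safe #-}

-- Suppose that all prime factors of Δ = n(n+4)⋯(n+4(k−1)) are at most 4(k+1). Partial fractions show that Δ divides
-- E (k−1)! 4^(k−1) for every common multiple E of the terms, so Δ, being odd, is at most E times the odd part of (k−1)!.
--
-- For k ≤ 30 the pigeonhole principle gives adjacent terms a, a + 4 whose product involves at most three (four if k ≤ 7)
-- primes. Then a (a + 4) = D y² with one of finitely many D, a Pell equation (a + 2)² − D y² = 4. Following Størmer, its
-- solutions are y = p U_t for a Lucas sequence U, and only finitely many U_t are smooth; the fundamental solution is found
-- by walking along Conway's river of the form x² + xy − ((D−1)/4) y².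
--
-- For large n, Erdős' choice of E as the product of the largest prime powers ≤ n + 4k contradicts n^k ≤ Δ. When k is
-- large and n < 32k, a prime p > √(n + 4k) divides a term c p only with c ≥ 3 or c ≥ 5, according to its class modulo 4, and a
-- Chebyshev bound for the primes in each class suffices. In the remaining finite range, either a term is itself a prime
-- (n ≤ 64k), or a precomputed chain of multiples of primes > 4(k+1), with gaps at most 4k, meets every block.
module Submission where

open import Defs
open import Data.Bool using (Bool; true; false; if_then_else_; T; _∧_; _∨_; not)
open import Data.Empty using (⊥; ⊥-elim)
open import Data.List using (List; []; _∷_)
open import Data.List.Membership.Propositional using (_∈_)
open import Data.List.Relation.Unary.All as All using (All; []; _∷_)
open import Data.List.Relation.Unary.Any using (here; there)
open import Data.Maybe using (Maybe; just; nothing)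
open import Data.Nat
open import Data.Nat.Coprimality using (Coprime; coprime-Bézout; coprime-divisor; prime⇒coprime)
open import Data.Nat.Divisibility
open import Data.Nat.DivMod
open import Data.Nat.GCD using (module Bézout)
open import Data.Nat.Induction using (<-rec)
open import Data.Nat.Primality
open import Data.Nat.Properties
open import Data.Nat.Solver using (module +-*-Solver)
open import Data.Product using (_×_; _,_; ∃-syntax; proj₁; proj₂)
open import Data.Sum using (_⊎_; inj₁; inj₂)
open import Data.Unit using (tt)
open import Function using (_∘_; case_of_)
open import Relation.Binary.PropositionalEquality
open import Relation.Nullary using (¬_; yes; no)
open import Relation.Nullary.Negation using (contradiction)

open +-*-Solver using (solve; _:=_; _:+_; _:*_; con)

-- The product divides its common multiple times an odd factorial

-- The margin is thinnest where n is close to 4k. There the lower bound for Δ demands only about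
-- 4.98k bits of E, whereas the class-wise prime bounds that are proved, 51 bits per 60 units in
-- each class, would allow 6.8k bits for all primes up to 4k. So the primes that can divide no term
-- have to be removed from E. Which ones they are depends on the cofactor c of a term c p, and c p ≡
-- n (mod 4) ties the class of p to that of c; hence a separate Chebyshev bound for each class.
--
-- No logarithm occurs. A rational bound for a logarithm to base 2 is an inequality between integer
-- powers, and the outer exponents 5, 16, 80 and 100 are the denominators of these rationals. Spare
-- bits per block absorb every polynomial factor.
--
-- Each finite computation is a Boolean function evaluated by `refl`, paired with a lemma that turns
-- the value `true` into a statement.

prodAP4-front : ∀ n k → prodAP4 n (suc k) ≡ n * prodAP4 (n + 4) k
prodAP4-front n zero = solve 1 (λ n → con 1 :* (n :+ con 0) := n :* con 1) refl n
prodAP4-front n (suc k) = begin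
  prodAP4 n (suc k) * (n + 4 * suc k)          ≡⟨ cong (_* (n + 4 * suc k)) (prodAP4-front n k) ⟩
  n * prodAP4 (n + 4) k * (n + 4 * suc k)
    ≡⟨ solve 3 (λ n k x → n :* x :* (n :+ con 4 :* (con 1 :+ k)) := n :* (x :* (n :+ con 4 :+ con 4 :* k))) refl n k (prodAP4 (n + 4) k) ⟩
  n * (prodAP4 (n + 4) k * (n + 4 + 4 * k)) ∎
  where open ≡-Reasoning

shift-term : ∀ n i → n + 4 + 4 * i ≡ n + 4 * suc i
shift-term n i = solve 2 (λ n i → n :+ con 4 :+ con 4 :* i := n :+ con 4 :* (con 1 :+ i)) refl n i

-- With a_i = n + 4i, the partial fraction 4(k+1)/(a_0⋯a_{k+1}) = 1/(a_0⋯a_k) − 1/(a_1⋯a_{k+1}).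
prodAP4∣ : ∀ k n E → (∀ i → i < suc k → n + 4 * i ∣ E) → prodAP4 n (suc k) ∣ E * (k ! * 4 ^ k)
prodAP4∣ zero n E d =
  subst₂ _∣_ (solve 1 (λ n → n :+ con 0 := con 1 :* (n :+ con 0)) refl n) (sym (*-identityʳ E)) (d 0 (s≤s z≤n))
prodAP4∣ (suc k) n E d
  with prodAP4∣ k n E (λ i i< → d i (m<n⇒m<1+n i<))
     | prodAP4∣ k (n + 4) E (λ i i< → subst (_∣ E) (sym (shift-term n i)) (d (suc i) (s≤s i<)))
... | p | q = subst (prodAP4 n (2 + k) ∣_) e3 (∣m+n∣m⇒∣n (subst (prodAP4 n (2 + k) ∣_) e2 (*-monoˡ-∣ (n + 4 * suc k) p)) q′)
  where
  F = E * (k ! * 4 ^ k)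
  e2 : F * (n + 4 * suc k) ≡ n * F + F * (4 * suc k)
  e2 = solve 3 (λ n f c → f :* (n :+ c) := n :* f :+ f :* c) refl n F (4 * suc k)
  q′ : prodAP4 n (2 + k) ∣ n * F
  q′ = subst (_∣ n * F) (sym (prodAP4-front n (suc k))) (*-monoʳ-∣ n q)
  e3 : F * (4 * suc k) ≡ E * (suc k ! * 4 ^ suc k)
  e3 = solve 4 (λ e f g k → e :* (f :* g) :* (con 4 :* (con 1 :+ k)) := e :* ((con 1 :+ k) :* f :* (con 4 :* g))) refl E (k !) (4 ^ k) k

Odd : ℕ → Set
Odd n = ¬ (2 ∣ n)

odd-∣-cancel : ∀ m x → Odd m → m ∣ 2 * x → m ∣ x
odd-∣-cancel m x o d = coprime-divisor cop d
  where
  cop : Coprime m 2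
  cop {i} (i∣m , i∣2) with prime⇒irreducible prime[2] i∣2
  ... | inj₁ e = e
  ... | inj₂ refl = contradiction i∣m o

odd-∣-cancel-^ : ∀ m v x → Odd m → m ∣ 2 ^ v * x → m ∣ x
odd-∣-cancel-^ m zero x o d = subst (m ∣_) (+-identityʳ x) d
odd-∣-cancel-^ m (suc v) x o d =
  odd-∣-cancel-^ m v x o (odd-∣-cancel m (2 ^ v * x) o (subst (m ∣_) (*-assoc 2 (2 ^ v) x) d))

odd-* : ∀ m n → Odd m → Odd n → Odd (m * n)
odd-* m n om on d with euclidsLemma m n prime[2] d
... | inj₁ x = om x
... | inj₂ y = on y

odd-term : ∀ n i → Odd n → Odd (n + 4 * i)
odd-term n i o d = o (∣m+n∣m⇒∣n (subst (2 ∣_) (+-comm n (4 * i)) d) (∣-trans (divides 2 refl) (m∣m*n i)))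

odd-prod : ∀ n k → Odd n → Odd (prodAP4 n k)
odd-prod n zero o = λ d → contradiction (∣⇒≤ d) λ { (s≤s ()) }
odd-prod n (suc k) o = odd-* (prodAP4 n k) (n + 4 * k) (odd-prod n k o) (odd-term n k o)

even? : ℕ → Bool
even? n = (n % 2) ≡ᵇ 0

oddPart-fuel : ℕ → ℕ → ℕ
oddPart-fuel zero    m = m
oddPart-fuel (suc f) m = if even? m then oddPart-fuel f (m / 2) else m

oddPart : ℕ → ℕ
oddPart m = oddPart-fuel m m

oddFac : ℕ → ℕ
oddFac zero    = 1
oddFac (suc k) = oddFac k * oddPart (suc k)

even?-double : ∀ m → even? (2 * m) ≡ true
even?-double m = cong (_≡ᵇ 0) (trans (cong (_% 2) (*-comm 2 m)) (m*n%n≡0 m 2))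

even?-odd : ∀ m → even? (suc (2 * m)) ≡ false
even?-odd m = cong (_≡ᵇ 0) (trans (cong (λ z → suc z % 2) (*-comm 2 m)) ([m+kn]%n≡m%n 1 m 2))

half-double : ∀ m → (2 * m) / 2 ≡ m
half-double m = trans (cong (_/ 2) (*-comm 2 m)) (m*n/n≡m m 2)

halves : ∀ m → ∃[ h ] (m ≡ 2 * h ⊎ m ≡ suc (2 * h))
halves zero = 0 , inj₁ refl
halves (suc m) with halves m
... | h , inj₁ e = h , inj₂ (cong suc e)
... | h , inj₂ e = suc h , inj₁ (trans (cong suc e) (solve 1 (λ h → con 2 :+ con 2 :* h := con 2 :* (con 1 :+ h)) refl h))

oddPart-stable : ∀ f g m → 0 < m → m ≤ f → m ≤ g → oddPart-fuel f m ≡ oddPart-fuel g m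
oddPart-stable zero g m m>0 m≤f m≤g = contradiction (≤-trans m>0 m≤f) (λ ())
oddPart-stable (suc f) zero m m>0 m≤f m≤g = contradiction (≤-trans m>0 m≤g) (λ ())
oddPart-stable (suc f) (suc g) m m>0 m≤f m≤g with halves m
... | h , inj₂ refl rewrite even?-odd h = refl
... | suc h , inj₁ refl rewrite even?-double (suc h) | half-double (suc h) =
  oddPart-stable f g (suc h) (s≤s z≤n) (lem m≤f) (lem m≤g)
  where
  lem : ∀ {f} → 2 * suc h ≤ suc f → suc h ≤ f
  lem {f} p = ≤-trans (s≤s (m≤m+n h (h + 0))) (≤-trans (≤-reflexive (sym (+-suc h (h + 0)))) (s≤s⁻¹ p))

oddPart-double : ∀ m → 0 < m → oddPart (2 * m) ≡ oddPart m
oddPart-double (suc h) m>0 rewrite even?-double (suc h) | half-double (suc h) =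
  oddPart-stable (h + suc (h + 0)) (suc h) (suc h) m>0 (≤-trans (s≤s (m≤m+n h (h + 0))) (≤-reflexive (sym (+-suc h (h + 0))))) ≤-refl

oddPart-odd : ∀ m → oddPart (suc (2 * m)) ≡ suc (2 * m)
oddPart-odd m rewrite even?-odd m = refl

-- The double factorial 1·3⋯(2m-1): the odd numbers up to 2m, which both the factorial and its odd
-- part gain when m is doubled.
oddFacts : ℕ → ℕ
oddFacts zero    = 1
oddFacts (suc m) = oddFacts m * suc (2 * m)

oddFac-double : ∀ m → oddFac (2 * m) ≡ oddFac m * oddFacts m
oddFac-double zero = refl
oddFac-double (suc m) = begin
  oddFac (2 * suc m)                                          ≡⟨ cong oddFac (solve 1 (λ m → con 2 :* (con 1 :+ m) := con 2 :+ con 2 :* m) refl m) ⟩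
  oddFac (2 * m) * oddPart (suc (2 * m)) * oddPart (2 + 2 * m)
    ≡⟨ cong₂ (λ a b → oddFac (2 * m) * a * b) (oddPart-odd m) (trans (cong oddPart (sym (solve 1 (λ m → con 2 :* (con 1 :+ m) := con 2 :+ con 2 :* m) refl m))) (oddPart-double (suc m) (s≤s z≤n))) ⟩
  oddFac (2 * m) * suc (2 * m) * oddPart (suc m)              ≡⟨ cong (λ a → a * suc (2 * m) * oddPart (suc m)) (oddFac-double m) ⟩
  oddFac m * oddFacts m * suc (2 * m) * oddPart (suc m)
    ≡⟨ solve 4 (λ a b c d → a :* b :* c :* d := a :* d :* (b :* c)) refl (oddFac m) (oddFacts m) (suc (2 * m)) (oddPart (suc m)) ⟩
  oddFac m * oddPart (suc m) * (oddFacts m * suc (2 * m)) ∎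
  where open ≡-Reasoning

fac-double : ∀ m → (2 * m) ! ≡ 2 ^ m * (m ! * oddFacts m)
fac-double zero = refl
fac-double (suc m) = begin
  (2 * suc m) !  ≡⟨ cong _! (solve 1 (λ m → con 2 :* (con 1 :+ m) := con 2 :+ con 2 :* m) refl m) ⟩
  (2 + 2 * m) * (suc (2 * m) * (2 * m) !) ≡⟨ cong (λ z → (2 + 2 * m) * (suc (2 * m) * z)) (fac-double m) ⟩
  (2 + 2 * m) * (suc (2 * m) * (2 ^ m * (m ! * oddFacts m)))
    ≡⟨ solve 4 (λ m a b c → (con 2 :+ con 2 :* m) :* ((con 1 :+ con 2 :* m) :* (a :* (b :* c))) := con 2 :* a :* ((con 1 :+ m) :* b :* (c :* (con 1 :+ con 2 :* m)))) refl m (2 ^ m) (m !) (oddFacts m) ⟩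
  2 ^ suc m * (suc m ! * oddFacts (suc m)) ∎
  where open ≡-Reasoning

half< : ∀ h → 0 < h → h < 2 * h
half< (suc h) _ = s≤s (≤-trans (s≤s (m≤m+n h (h + 0))) (≤-reflexive (sym (+-suc h (h + 0)))))

-- Legendre: the exponent of 2 in k! is k minus the binary digit sum of k.
record OddFacBounds (k : ℕ) : Set where
  field
    two-exp : ℕ
    fac≡    : k ! ≡ 2 ^ two-exp * oddFac k
    lower   : k ! ≤ 2 ^ k * oddFac k
    upper   : 2 ^ k * oddFac k ≤ suc k * k !

oddFacBounds : ∀ k → OddFacBounds k
oddFacBounds = <-rec OddFacBounds step
  where
  open OddFacBounds
  open ≤-Reasoning
  dbl : ∀ h → OddFacBounds h → OddFacBounds (2 * h)
  dbl h r = record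
    { two-exp = h + two-exp r
    ; fac≡ = trans (fac-double h) (trans (cong (λ z → 2 ^ h * (z * oddFacts h)) (fac≡ r)) (trans
        (solve 4 (λ a b c d → a :* (b :* c :* d) := a :* b :* (c :* d)) refl (2 ^ h) (2 ^ two-exp r) (oddFac h) (oddFacts h))
        (cong₂ _*_ (sym (^-distribˡ-+-* 2 h (two-exp r))) (sym (oddFac-double h)))))
    ; lower = begin
        (2 * h) !                                ≡⟨ fac-double h ⟩
        2 ^ h * (h ! * oddFacts h)               ≤⟨ *-monoʳ-≤ (2 ^ h) (*-monoˡ-≤ (oddFacts h) (lower r)) ⟩
        2 ^ h * (2 ^ h * oddFac h * oddFacts h)  ≡⟨ e h ⟩
        2 ^ (2 * h) * oddFac (2 * h)             ∎
    ; upper = begin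
        2 ^ (2 * h) * oddFac (2 * h)             ≡⟨ sym (e h) ⟩
        2 ^ h * (2 ^ h * oddFac h * oddFacts h)  ≤⟨ *-monoʳ-≤ (2 ^ h) (*-monoˡ-≤ (oddFacts h) (upper r)) ⟩
        2 ^ h * (suc h * h ! * oddFacts h)       ≡⟨ solve 4 (λ a b c d → a :* (b :* c :* d) := b :* (a :* (c :* d))) refl (2 ^ h) (suc h) (h !) (oddFacts h) ⟩
        suc h * (2 ^ h * (h ! * oddFacts h))     ≡⟨ cong (suc h *_) (sym (fac-double h)) ⟩
        suc h * (2 * h) !                        ≤⟨ *-monoˡ-≤ ((2 * h) !) (s≤s (m≤m+n h (h + 0))) ⟩
        suc (2 * h) * (2 * h) !                  ∎
    }
    where
    e : ∀ h → 2 ^ h * (2 ^ h * oddFac h * oddFacts h) ≡ 2 ^ (2 * h) * oddFac (2 * h)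
    e h = trans (solve 3 (λ a c d → a :* (a :* c :* d) := (a :* a) :* (c :* d)) refl (2 ^ h) (oddFac h) (oddFacts h))
      (cong₂ _*_ (trans (sym (^-distribˡ-+-* 2 h h)) (cong (λ z → 2 ^ (h + z)) (sym (+-identityʳ h)))) (sym (oddFac-double h)))
  dbl+1 : ∀ h → OddFacBounds h → OddFacBounds (suc (2 * h))
  dbl+1 h r = record
    { two-exp = two-exp r′
    ; fac≡ = trans (cong (suc (2 * h) *_) (fac≡ r′)) (trans
        (solve 3 (λ a b c → a :* (b :* c) := b :* (c :* a)) refl (suc (2 * h)) (2 ^ two-exp r′) (oddFac (2 * h)))
        (cong (λ z → 2 ^ two-exp r′ * (oddFac (2 * h) * z)) (sym (oddPart-odd h))))
    ; lower = begin
        suc (2 * h) * (2 * h) !                   ≤⟨ *-monoʳ-≤ (suc (2 * h)) (lower r′) ⟩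
        suc (2 * h) * (2 ^ (2 * h) * oddFac (2 * h)) ≤⟨ m≤m+n _ _ ⟩
        2 * (suc (2 * h) * (2 ^ (2 * h) * oddFac (2 * h)))
          ≡⟨ solve 3 (λ a b c → con 2 :* (a :* (b :* c)) := con 2 :* b :* (c :* a)) refl (suc (2 * h)) (2 ^ (2 * h)) (oddFac (2 * h)) ⟩
        2 ^ suc (2 * h) * (oddFac (2 * h) * suc (2 * h)) ≡⟨ cong (λ z → 2 ^ suc (2 * h) * (oddFac (2 * h) * z)) (sym (oddPart-odd h)) ⟩
        2 ^ suc (2 * h) * oddFac (suc (2 * h))    ∎
    -- The bound is taken at h, not at 2h: the factor 2 for the new binary digit turns h + 1 into
    -- exactly 2h + 2, whereas the bound at 2h would lead to 4h + 2.
    ; upper = begin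
        2 ^ suc (2 * h) * oddFac (suc (2 * h))    ≡⟨ cong (λ z → 2 ^ suc (2 * h) * (oddFac (2 * h) * z)) (oddPart-odd h) ⟩
        2 ^ suc (2 * h) * (oddFac (2 * h) * suc (2 * h))
          ≡⟨ cong (λ z → 2 ^ suc (2 * h) * (z * suc (2 * h))) (oddFac-double h) ⟩
        2 ^ suc (2 * h) * (oddFac h * oddFacts h * suc (2 * h))
          ≡⟨ cong (λ z → 2 * z * (oddFac h * oddFacts h * suc (2 * h))) (trans (cong (λ z → 2 ^ (h + z)) (+-identityʳ h)) (^-distribˡ-+-* 2 h h)) ⟩
        2 * (2 ^ h * 2 ^ h) * (oddFac h * oddFacts h * suc (2 * h))
          ≡⟨ solve 4 (λ a b c d → con 2 :* (a :* a) :* (b :* c :* d) := con 2 :* d :* (a :* ((a :* b) :* c))) refl (2 ^ h) (oddFac h) (oddFacts h) (suc (2 * h)) ⟩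
        2 * suc (2 * h) * (2 ^ h * (2 ^ h * oddFac h * oddFacts h))
          ≤⟨ *-monoʳ-≤ (2 * suc (2 * h)) (*-monoʳ-≤ (2 ^ h) (*-monoˡ-≤ (oddFacts h) (upper r))) ⟩
        2 * suc (2 * h) * (2 ^ h * (suc h * h ! * oddFacts h))
          ≡⟨ solve 5 (λ a b c d g → con 2 :* d :* (a :* ((con 1 :+ b) :* c :* g)) := (con 2 :+ con 2 :* b) :* (d :* (a :* (c :* g)))) refl (2 ^ h) h (h !) (suc (2 * h)) (oddFacts h) ⟩
        (2 + 2 * h) * (suc (2 * h) * (2 ^ h * (h ! * oddFacts h))) ≡⟨ cong (λ z → (2 + 2 * h) * (suc (2 * h) * z)) (sym (fac-double h)) ⟩
        suc (suc (2 * h)) * (suc (2 * h)) !       ∎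
    }
    where r′ = dbl h r
  step : ∀ k → (∀ {j} → j < k → OddFacBounds j) → OddFacBounds k
  step zero rec = record { two-exp = 0 ; fac≡ = refl ; lower = ≤-refl ; upper = ≤-refl }
  step k@(suc k-1) rec with halves k
  ... | zero , inj₂ refl = dbl+1 0 (rec (s≤s z≤n))
  ... | suc h , inj₁ refl = dbl (suc h) (rec (half< (suc h) (s≤s z≤n)))
  ... | suc h , inj₂ refl = dbl+1 (suc h) (rec (m<n⇒m<1+n (half< (suc h) (s≤s z≤n))))

-- Boolean tests, remainders and trial division

T⇒≡ : ∀ {b} → T b → b ≡ true
T⇒≡ {true} _ = refl

≡⇒T : ∀ {b} → b ≡ true → T b
≡⇒T refl = tt

<ᵇ-true : ∀ {m n} → (m <ᵇ n) ≡ true → m < n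
<ᵇ-true {m} {n} e = <ᵇ⇒< m n (≡⇒T e)

<ᵇ-false : ∀ {m n} → (m <ᵇ n) ≡ false → n ≤ m
<ᵇ-false {m} {n} e with n ≤? m
... | yes p = p
... | no ¬p = contradiction (trans (sym e) (T⇒≡ (<⇒<ᵇ (≰⇒> ¬p)))) (λ ())

≡ᵇ-true : ∀ {m n} → (m ≡ᵇ n) ≡ true → m ≡ n
≡ᵇ-true {m} {n} e = ≡ᵇ⇒≡ m n (≡⇒T e)

≡ᵇ-false : ∀ {m n} → (m ≡ᵇ n) ≡ false → m ≢ n
≡ᵇ-false {m} {n} e p = contradiction (trans (sym e) (T⇒≡ (≡⇒≡ᵇ m n p))) (λ ())

∧-split : ∀ {a b} → (a ∧ b) ≡ true → a ≡ true × b ≡ true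
∧-split {true} {true} _ = refl , refl

-- The value m for the divisor 0 makes `rem m d ≡ 0` equivalent to `d ∣ m` for every d, without a
-- side condition.
rem : ℕ → ℕ → ℕ
rem m zero    = m
rem m (suc d) = m % suc d

rem≡0⇒∣ : ∀ m d → rem m d ≡ 0 → d ∣ m
rem≡0⇒∣ m zero e = subst (0 ∣_) (sym e) ∣-refl
rem≡0⇒∣ m (suc d) e = m%n≡0⇒n∣m m (suc d) e

∣⇒rem≡0 : ∀ m d → d ∣ m → rem m d ≡ 0
∣⇒rem≡0 m zero d = 0∣⇒≡0 d
∣⇒rem≡0 m (suc d) x = n∣m⇒m%n≡0 m (suc d) x

odd⇒rem : ∀ n → Odd n → even? n ≡ false
odd⇒rem n o with even? n in e
... | false = refl
... | true = contradiction (m%n≡0⇒n∣m n 2 (≡ᵇ-true e)) o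

even?⇒∣ : ∀ n → even? n ≡ true → 2 ∣ n
even?⇒∣ n e = m%n≡0⇒n∣m n 2 (≡ᵇ-true e)

even?-false⇒odd : ∀ n → even? n ≡ false → Odd n
even?-false⇒odd n e d = ≡ᵇ-false e (n∣m⇒m%n≡0 n 2 d)

-- Exhausted fuel counts as success: as long as n < d + f holds, it means that d has passed n. The
-- divisor may jump by 2 because the even number in between cannot divide an odd n.
trial : ℕ → ℕ → ℕ → Bool
trial zero    d n = true
trial (suc f) d n = if n <ᵇ d * d then true else (if rem n d ≡ᵇ 0 then false else trial f (2 + d) n)

oddPrime? : ℕ → Bool
oddPrime? n = if even? n then false else (if n <ᵇ 3 then false else trial n 3 n)

trial-sound : ∀ f d n → Odd n → 1 < n → Odd d → 2 ≤ d → d Rough n → n < d + f → trial f d n ≡ true → Prime n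
trial-sound zero d n on n>1 od d≥2 r n< _ =
  rough∧square>⇒prime {{n>1⇒nonTrivial n>1}} r (≤-trans (subst (n <_) (+-identityʳ d) n<) (m≤m*n d d {{>-nonZero (<-trans z<s d≥2)}}))
trial-sound (suc f) d n on n>1 od d≥2 r n< t with n <ᵇ d * d in e
... | true = rough∧square>⇒prime {{n>1⇒nonTrivial n>1}} r (<ᵇ-true e)
... | false with rem n d ≡ᵇ 0 in e₂
... | false = trial-sound f (2 + d) n on n>1 (λ x → od (∣m+n∣m⇒∣n x ∣-refl)) (m≤n⇒m≤1+n (m≤n⇒m≤1+n d≥2))
    (∤⇒rough-suc (λ x → on (∣-trans 2∣1+d x)) (∤⇒rough-suc (λ x → ≡ᵇ-false e₂ (∣⇒rem≡0 n d x)) r))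
    (≤-trans n< (≤-trans (≤-reflexive (+-suc d f)) (n≤1+n _))) t
  where
  2∣1+d : 2 ∣ suc d
  2∣1+d with halves d
  ... | h , inj₁ refl = contradiction (m∣m*n h) od
  ... | h , inj₂ refl = subst (2 ∣_) (solve 1 (λ h → con 2 :* (con 1 :+ h) := con 2 :+ con 2 :* h) refl h) (m∣m*n (suc h))

odd3 : Odd 3
odd3 d = contradiction (∣⇒≤ (∣m+n∣m⇒∣n {2} {2} {1} d ∣-refl)) λ { (s≤s ()) }

odd1 : Odd 1
odd1 d = contradiction (∣⇒≤ d) λ { (s≤s ()) }

oddPrime?-sound : ∀ n → oddPrime? n ≡ true → Prime n
oddPrime?-sound n t with even? n in e
... | false with n <ᵇ 3 in e₂
... | false = trial-sound n 3 n on (<-trans (s≤s (s≤s z≤n)) (<ᵇ-false e₂)) odd3 (s≤s (s≤s z≤n))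
                 (∤⇒rough-suc (λ x → on x) 2-rough) (m≤n+m (suc n) 2) t
  where on = even?-false⇒odd n e

oddPrime?-odd : ∀ n → oddPrime? n ≡ true → Odd n
oddPrime?-odd n t with even? n in e
... | false = even?-false⇒odd n e

trial-complete : ∀ f d n → Prime n → 1 < d → trial f d n ≡ true
trial-complete zero d n pn d>1 = refl
trial-complete (suc f) d n pn d>1 with n <ᵇ d * d in e
... | true = refl
... | false with rem n d ≡ᵇ 0 in e₂
... | false = trial-complete f (2 + d) n pn (m≤n⇒m≤1+n (m≤n⇒m≤1+n d>1))
... | true with prime⇒irreducible pn (rem≡0⇒∣ n d (≡ᵇ-true e₂))
... | inj₁ refl = contradiction d>1 λ { (s≤s ()) }
... | inj₂ refl = contradiction (<-≤-trans (m<m*n d d {{>-nonZero (<-trans z<s d>1)}} d>1) (<ᵇ-false {n} {d * d} e)) (<-irrefl refl)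

oddPrime?-complete : ∀ n → Prime n → Odd n → oddPrime? n ≡ true
oddPrime?-complete n pn on rewrite odd⇒rem n on with n <ᵇ 3 in e
... | false = trial-complete n 3 n pn (s≤s (s≤s z≤n))
oddPrime?-complete zero pn on | true = contradiction pn ¬prime[0]
oddPrime?-complete (suc zero) pn on | true = contradiction pn ¬prime[1]
oddPrime?-complete (suc (suc zero)) pn on | true = contradiction ∣-refl on

-- Smooth numbers and products of prime powers

prime>1 : ∀ {p} → Prime p → 1 < p
prime>1 {p} pp = nonTrivial⇒n>1 p {{prime⇒nonTrivial pp}}

prime∣^⇒∣ : ∀ {p} → Prime p → ∀ q e → p ∣ q ^ e → p ∣ q
prime∣^⇒∣ {p} pp q zero d = contradiction (∣⇒≤ d) (<⇒≱ (prime>1 pp))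
prime∣^⇒∣ pp q (suc e) d with euclidsLemma q (q ^ e) pp d
... | inj₁ x = x
... | inj₂ y = prime∣^⇒∣ pp q e y

record Split (p m : ℕ) : Set where
  constructor mkSplit
  field
    ex cof : ℕ
    eq     : m ≡ p ^ ex * cof
    cop    : ¬ (p ∣ cof)

split : ∀ p m → 1 < p → 0 < m → Split p m
split p = <-rec (λ m → 1 < p → 0 < m → Split p m) step
  where
  step : ∀ m → (∀ {j} → j < m → 1 < p → 0 < j → Split p j) → 1 < p → 0 < m → Split p m
  step m rec p>1 m>0 with p ∣? m
  ... | no ¬d = mkSplit 0 m (sym (+-identityʳ m)) ¬d
  ... | yes (divides q refl) with q | m>0
  ... | zero | ()
  ... | suc q′ | _ with rec {suc q′} (m<m*n (suc q′) p p>1) p>1 z<s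
  ... | mkSplit e c eq cop = mkSplit (suc e) c
          (trans (cong (_* p) eq) (solve 3 (λ a b p → a :* b :* p := p :* a :* b) refl (p ^ e) c p)) cop

coprime-*-∣ : ∀ {p} → Prime p → ∀ e a b → ¬ p ∣ a → p ^ e ∣ b → a ∣ b → p ^ e * a ∣ b
coprime-*-∣ {p} pp zero a b ¬d d₁ d₂ = subst (_∣ b) (sym (+-identityʳ a)) d₂
coprime-*-∣ {p} pp (suc e) a b ¬d d₁ (divides q refl) with euclidsLemma q a pp (∣-trans (m∣m*n (p ^ e)) d₁)
... | inj₂ y = contradiction y ¬d
... | inj₁ (divides r refl) = subst₂ _∣_ (sym (*-assoc p (p ^ e) a)) (solve 3 (λ p r a → p :* (r :* a) := r :* p :* a) refl p r a)
        (*-monoʳ-∣ p (coprime-*-∣ pp e a (r * a) ¬d (*-cancelˡ-∣ p {{prime⇒nonZero pp}} (subst (p ^ suc e ∣_) (solve 3 (λ r p a → r :* p :* a := p :* (r :* a)) refl r p a) d₁)) (n∣m*n r)))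

prodOver : (ℕ → Bool) → (ℕ → ℕ) → ℕ → ℕ
prodOver t E zero    = 1
prodOver t E (suc b) = if t (suc b) then E (suc b) * prodOver t E b else prodOver t E b

countOver : (ℕ → Bool) → ℕ → ℕ
countOver t zero    = 0
countOver t (suc b) = if t (suc b) then suc (countOver t b) else countOver t b

Smooth : ℕ → ℕ → Set
Smooth b m = ∀ p → Prime p → p ∣ m → p ≤ b

smooth-0 : ∀ {m} → 0 < m → Smooth 1 m → m ≡ 1
smooth-0 {suc zero} _ _ = refl
smooth-0 {suc (suc m)} _ s with composite? (2 + m)
... | no ¬c = contradiction (s (2 + m) (¬composite⇒prime ¬c) ∣-refl) λ { (s≤s ()) }
... | yes c = ⊥-elim (go (2 + m) (s≤s (s≤s z≤n)) s)
  where
  go : ∀ m → 1 < m → Smooth 1 m → ⊥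
  go = <-rec _ λ m rec m>1 s → case composite? m of λ
    { (no ¬c) → <⇒≱ m>1 (s m (¬composite⇒prime {{n>1⇒nonTrivial m>1}} ¬c) ∣-refl)
    ; (yes (hasNonTrivialDivisor {divisor = d} d<m d∣m)) → rec d<m (nonTrivial⇒n>1 d) (λ p pp p∣ → s p pp (∣-trans p∣ d∣m)) }

hasPrimeFactor : ∀ m → 1 < m → ∃[ p ] Prime p × p ∣ m
hasPrimeFactor = <-rec _ λ m rec m>1 → case composite? m of λ
    { (no ¬c) → m , ¬composite⇒prime {{n>1⇒nonTrivial m>1}} ¬c , ∣-refl
    ; (yes (hasNonTrivialDivisor {divisor = d} d<m d∣m)) → case rec d<m (nonTrivial⇒n>1 d) of λ
        { (p , pp , p∣d) → p , pp , ∣-trans p∣d d∣m } }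

-- Induction on the smoothness bound: the part of m belonging to the top prime goes into its own
-- factor E, and the cofactor is smooth for a smaller bound. This is how a product over primes
-- becomes a common multiple of all the terms.
smooth-∣ : ∀ t E b m → 0 < m → (∀ p → Prime p → p ∣ m → t p ≡ true) →
           (∀ p e → Prime p → p ^ e ∣ m → p ^ e ∣ E p) → Smooth b m → m ∣ prodOver t E b
smooth-∣ t E zero m m>0 tt′ ee s = ∣-reflexive (smooth-0 m>0 (λ p pp d → ≤-trans (s p pp d) z≤n))
smooth-∣ t E (suc b) m m>0 ht he s with prime? (suc b)
... | no ¬p = ∣-trans (smooth-∣ t E b m m>0 ht he (λ p pp d → s≤s⁻¹ (≤∧≢⇒< (s p pp d) (λ { refl → ¬p pp })))) dv
  where
  dv : prodOver t E b ∣ prodOver t E (suc b)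
  dv with t (suc b)
  ... | true = n∣m*n (E (suc b))
  ... | false = ∣-refl
... | yes pp with split (suc b) m (prime>1 pp) m>0
... | mkSplit zero c eq cop = ∣-trans (smooth-∣ t E b m m>0 ht he (λ p pq d → s≤s⁻¹ (≤∧≢⇒< (s p pq d) (λ { refl → cop (subst (p ∣_) (trans eq (+-identityʳ c)) d) })))) dv
  where
  dv : prodOver t E b ∣ prodOver t E (suc b)
  dv with t (suc b)
  ... | true = n∣m*n (E (suc b))
  ... | false = ∣-refl
... | mkSplit (suc e) c refl cop rewrite ht (suc b) pp (∣-trans (m∣m*n ((suc b) ^ e)) (m∣m*n c)) =
  coprime-*-∣ pp (suc e) c _ cop (∣-trans (he (suc b) (suc e) pp (m∣m*n c)) (m∣m*n _))
    (∣-trans (smooth-∣ t E b c c>0 (λ p pq d → ht p pq (∣-trans d c∣)) (λ p f pq d → he p f pq (∣-trans d c∣))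
       (λ p pq d → s≤s⁻¹ (≤∧≢⇒< (s p pq (∣-trans d c∣)) (λ { refl → cop d })))) (n∣m*n (E (suc b))))
  where
  c∣ : c ∣ (suc b) ^ suc e * c
  c∣ = n∣m*n ((suc b) ^ suc e)
  c>0 : 0 < c
  c>0 = n≢0⇒n>0 (λ { refl → cop (_ ∣0) })

prodOver-≤ : ∀ t E N b → (∀ p → E p ≤ N) → prodOver t E b ≤ N ^ countOver t b
prodOver-≤ t E N zero h = ≤-refl
prodOver-≤ t E N (suc b) h with t (suc b)
... | true = *-mono-≤ (h (suc b)) (prodOver-≤ t E N b h)
... | false = prodOver-≤ t E N b h

prodOver>0 : ∀ t E b → (∀ p → 0 < E (suc p)) → 0 < prodOver t E b
prodOver>0 t E zero h = z<s
prodOver>0 t E (suc b) h with t (suc b)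
... | true = *-mono-< (h b) (prodOver>0 t E b h)
... | false = prodOver>0 t E b h

-- Starting from a = 1 this reaches the largest power of p up to N. Fuel N is enough, since for p >
-- 1 each multiplication raises a by at least one.
powFloor-fuel : ℕ → ℕ → ℕ → ℕ → ℕ
powFloor-fuel zero    p a N = a
powFloor-fuel (suc f) p a N = if N <ᵇ p * a then a else powFloor-fuel f p (p * a) N

powFloor : ℕ → ℕ → ℕ
powFloor p N = powFloor-fuel N p 1 N

powFloor-spec : ∀ f p i N → 1 < p → p ^ i ≤ N → N ≤ p ^ i + f →
  ∃[ j ] (powFloor-fuel f p (p ^ i) N ≡ p ^ j × p ^ j ≤ N × N < p ^ suc j)
powFloor-spec zero p i N p>1 le lt = i , refl , le , ≤-<-trans lt (subst (_< p * p ^ i) (sym (+-identityʳ (p ^ i))) (subst (_< p * p ^ i) (*-identityˡ (p ^ i)) (*-monoˡ-< (p ^ i) {{m^n≢0 p i {{>-nonZero (<-trans z<s p>1)}}}} p>1)))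
powFloor-spec (suc f) p i N p>1 le lt with N <ᵇ p * p ^ i in e
... | true = i , refl , le , <ᵇ-true e
... | false = powFloor-spec f p (suc i) N p>1 (<ᵇ-false e)
      (≤-trans lt (≤-trans (≤-reflexive (+-suc (p ^ i) f)) (+-monoˡ-≤ f (subst (_< p * p ^ i) (*-identityˡ (p ^ i)) (*-monoˡ-< (p ^ i) {{m^n≢0 p i {{>-nonZero (<-trans z<s p>1)}}}} p>1)))))

^-∣-^ : ∀ p {e j} → e ≤ j → p ^ e ∣ p ^ j
^-∣-^ p {e} {j} le = subst (λ z → p ^ e ∣ p ^ z) (m+[n∸m]≡n le) (subst (p ^ e ∣_) (sym (^-distribˡ-+-* p e (j ∸ e))) (m∣m*n _))

powFloor-∣ : ∀ p e N → 1 < p → 0 < N → p ^ e ≤ N → p ^ e ∣ powFloor p N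
powFloor-∣ p e N p>1 N>0 le with powFloor-spec N p 0 N p>1 N>0 (m≤n+m N 1)
... | j , eq , _ , N< = subst (p ^ e ∣_) (sym eq) (^-∣-^ p {e} {j} (≮⇒≥ λ j<e → <⇒≱ N< (≤-trans (^-monoʳ-≤ p {{>-nonZero (<-trans z<s p>1)}} j<e) le)))

powFloor-≤ : ∀ p N → 0 < N → powFloor p N ≤ N
powFloor-≤ p N N>0 = go N 1 N>0
  where
  go : ∀ f a → a ≤ N → powFloor-fuel f p a N ≤ N
  go zero a le = le
  go (suc f) a le with N <ᵇ p * a in e
  ... | true = le
  ... | false = go f (p * a) (<ᵇ-false e)

powFloor>0 : ∀ p N → 0 < powFloor (suc p) N
powFloor>0 p N = go N 1 z<s
  where
  go : ∀ f a → 0 < a → 0 < powFloor-fuel f (suc p) a N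
  go zero a h = h
  go (suc f) a h with N <ᵇ suc p * a
  ... | true = h
  ... | false = go f (suc p * a) (≤-trans h (m≤m+n a (p * a)))

AllSmooth : ℕ → ℕ → ℕ → Set
AllSmooth b n k = ∀ i → i < k → Smooth b (n + 4 * i)

prodAP4≤ : ∀ k n E → Odd n → 0 < E → (∀ i → i < suc k → n + 4 * i ∣ E) → prodAP4 n (suc k) ≤ E * oddFac k
prodAP4≤ k n E on E>0 d = ∣⇒≤ {{>-nonZero (*-mono-< E>0 oF>0)}} (odd-∣-cancel-^ _ (2 * k + two-exp) (E * oddFac k) (odd-prod n (suc k) on)
    (subst (prodAP4 n (suc k) ∣_) eq (prodAP4∣ k n E d)))
  where
  open OddFacBounds (oddFacBounds k)
  oF>0 : 0 < oddFac k
  oF>0 = n≢0⇒n>0 λ e → n>0⇒n≢0 (1≤n! k) (trans fac≡ (trans (cong (2 ^ two-exp *_) e) (*-zeroʳ (2 ^ two-exp))))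
  eq : E * (k ! * 4 ^ k) ≡ 2 ^ (2 * k + two-exp) * (E * oddFac k)
  eq = trans (cong₂ (λ a b → E * (a * b)) fac≡ (^-*-assoc 2 2 k))
    (trans (solve 4 (λ e a b c → e :* (a :* b :* c) := c :* a :* (e :* b)) refl E (2 ^ two-exp) (oddFac k) (2 ^ (2 * k)))
      (cong (_* (E * oddFac k)) (sym (^-distribˡ-+-* 2 (2 * k) two-exp))))

prodAP4≥ : ∀ k n → n ^ k ≤ prodAP4 n k
prodAP4≥ zero n = ≤-refl
prodAP4≥ (suc k) n = ≤-trans (≤-reflexive (*-comm n (n ^ k))) (*-mono-≤ (prodAP4≥ k n) (m≤m+n n (4 * k)))

-- Representations of 1 by an indefinite form

-- The form a X² + (u − v) X Y − c Y² takes the value 1 at (x , y).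
Represents1 : ℕ → ℕ → ℕ → ℕ → ℕ → ℕ → Set
Represents1 a u v c x y = a * x * x + u * x * y ≡ 1 + (c * y * y + v * x * y)

record Mat : Set where
  constructor mat
  field r s p q : ℕ

mutual
  -- One edge of Conway's topograph per call. The positive value a and the negative value -c sit on
  -- the two banks, and the sign of a + u - v - c, the value at the sum of the two base vectors,
  -- tells which of them is replaced. The middle coefficient is kept as a difference u - v: each
  -- move only enlarges u or v, so everything stays in ℕ. The matrix (r s; p q) expresses the
  -- original coordinates through the current ones.
  river : ℕ → (c₀ a u v c r s p q : ℕ) → Maybe Mat
  river zero c₀ a u v c r s p q = nothing
  river (suc f) c₀ a u v c r s p q =
    if a + u <ᵇ c + v
    then closed f c₀ a (2 * a + u) v (c + v ∸ (a + u)) r (r + s) p (p + q)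
    -- At the value 0 there is no river to follow. The second condition refuses to leave a base
    -- vector with value 1 and p ≠ 0: it would be a nontrivial solution that the walk loses.
    else if (a + u ≡ᵇ c + v) ∨ ((a ≡ᵇ 1) ∧ not (p ≡ᵇ 0)) then nothing
    else closed f c₀ (a + u ∸ (c + v)) u (2 * c + v) c (r + s) s (p + q) q

  closed : ℕ → (c₀ a u v c r s p q : ℕ) → Maybe Mat
  closed f c₀ a u v c r s p q =
    if (a ≡ᵇ 1) ∧ ((u ≡ᵇ suc v) ∧ (c ≡ᵇ c₀)) then just (mat r s p q) else river f c₀ a u v c r s p q

-- A solution is trivial or the image under the matrix of another solution of the original equation:
-- the unit of an infinite descent.
Pulled : ℕ → Mat → (X Y : ℕ) → Set
Pulled c₀ (mat r s p q) X Y = (Y ≡ 0) ⊎ (∃[ x ] ∃[ y ] Represents1 1 1 0 c₀ x y × X ≡ r * x + s * y × Y ≡ p * x + q * y)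

-- On the negative side of the river the form is negative, so x ≥ y there.
right-x≥y : ∀ a u v c x y → a + u < c + v → Represents1 a u v c x y → y ≤ x
right-x≥y a u v c x y lt rep with y ≤? x
... | yes le = le
... | no ¬le = ⊥-elim (<-irrefl rep (begin-strict
    a * x * x + u * x * y               ≡⟨ cong (λ y → a * x * x + u * x * y) (sym y≡) ⟩
    a * x * x + u * x * (x + z)         ≡⟨ solve 4 (λ a u x z → a :* x :* x :+ u :* x :* (x :+ z) := (a :+ u) :* (x :* x) :+ u :* (x :* z)) refl a u x z ⟩
    (a + u) * (x * x) + u * (x * z)     ≤⟨ +-mono-≤ (*-monoˡ-≤ (x * x) (<⇒≤ lt)) (*-monoˡ-≤ (x * z) (≤-trans (m≤n+m u a) (<⇒≤ lt))) ⟩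
    (c + v) * (x * x) + (c + v) * (x * z) ≤⟨ m≤m+n _ _ ⟩
    (c + v) * (x * x) + (c + v) * (x * z) + (c * (x * z) + c * (z * z)) <⟨ n<1+n _ ⟩
    1 + ((c + v) * (x * x) + (c + v) * (x * z) + (c * (x * z) + c * (z * z)))
      ≡⟨ solve 4 (λ c v x z → con 1 :+ ((c :+ v) :* (x :* x) :+ (c :+ v) :* (x :* z) :+ (c :* (x :* z) :+ c :* (z :* z))) := con 1 :+ (c :* (x :+ z) :* (x :+ z) :+ v :* x :* (x :+ z))) refl c v x z ⟩
    1 + (c * (x + z) * (x + z) + v * x * (x + z)) ≡⟨ cong (λ y → 1 + (c * y * y + v * x * y)) y≡ ⟩
    1 + (c * y * y + v * x * y)         ∎))
  where
  open ≤-Reasoning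
  z = y ∸ x
  y≡ : x + z ≡ y
  y≡ = m+[n∸m]≡n (<⇒≤ (≰⇒> ¬le))

right-step : ∀ a u v c x y → a + u < c + v → Represents1 a u v c (x + y) y → Represents1 a (2 * a + u) v (c + v ∸ (a + u)) x y
right-step a u v c x y lt rep = +-cancelʳ-≡ ((a + u) * (y * y)) _ _ (begin
  a * x * x + (2 * a + u) * x * y + (a + u) * (y * y)
    ≡⟨ solve 4 (λ a u x y → a :* x :* x :+ (con 2 :* a :+ u) :* x :* y :+ (a :+ u) :* (y :* y) := a :* (x :+ y) :* (x :+ y) :+ u :* (x :+ y) :* y) refl a u x y ⟩
  a * (x + y) * (x + y) + u * (x + y) * y ≡⟨ rep ⟩
  1 + (c * y * y + v * (x + y) * y) ≡⟨ solve 4 (λ c v x y → con 1 :+ (c :* y :* y :+ v :* (x :+ y) :* y) := con 1 :+ ((c :+ v) :* (y :* y) :+ v :* x :* y)) refl c v x y ⟩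
  1 + ((c + v) * (y * y) + v * x * y) ≡⟨ cong (λ z → 1 + (z * (y * y) + v * x * y)) (sym (m∸n+n≡m (<⇒≤ lt))) ⟩
  1 + ((w + (a + u)) * (y * y) + v * x * y)
    ≡⟨ solve 5 (λ w a v x y → con 1 :+ ((w :+ a) :* (y :* y) :+ v :* x :* y) := con 1 :+ (w :* y :* y :+ v :* x :* y) :+ a :* (y :* y)) refl w (a + u) v x y ⟩
  1 + (w * y * y + v * x * y) + (a + u) * (y * y) ∎)
  where
  open ≡-Reasoning
  w = c + v ∸ (a + u)

left-step : ∀ a u v c x y → c + v < a + u → Represents1 a u v c x (x + y) → Represents1 (a + u ∸ (c + v)) u (2 * c + v) c x y
left-step a u v c x y lt rep = +-cancelʳ-≡ ((c + v) * (x * x)) _ _ (begin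
  w * x * x + u * x * y + (c + v) * (x * x)
    ≡⟨ solve 5 (λ w g u x y → w :* x :* x :+ u :* x :* y :+ g :* (x :* x) := (w :+ g) :* (x :* x) :+ u :* x :* y) refl w (c + v) u x y ⟩
  (w + (c + v)) * (x * x) + u * x * y ≡⟨ cong (λ z → z * (x * x) + u * x * y) (m∸n+n≡m (<⇒≤ lt)) ⟩
  (a + u) * (x * x) + u * x * y ≡⟨ solve 4 (λ a u x y → (a :+ u) :* (x :* x) :+ u :* x :* y := a :* x :* x :+ u :* x :* (x :+ y)) refl a u x y ⟩
  a * x * x + u * x * (x + y) ≡⟨ rep ⟩
  1 + (c * (x + y) * (x + y) + v * x * (x + y))
    ≡⟨ solve 4 (λ c v x y → con 1 :+ (c :* (x :+ y) :* (x :+ y) :+ v :* x :* (x :+ y)) := con 1 :+ (c :* y :* y :+ (con 2 :* c :+ v) :* x :* y) :+ (c :+ v) :* (x :* x)) refl c v x y ⟩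
  1 + (c * y * y + (2 * c + v) * x * y) + (c + v) * (x * x) ∎)
  where
  open ≡-Reasoning
  w = a + u ∸ (c + v)

square-vanishes : ∀ w y k → 0 < w → 0 < k → w * (y * y) + k ≤ 1 → y ≡ 0
square-vanishes w zero k _ _ _ = refl
square-vanishes w (suc y) k w>0 k>0 b =
  contradiction (≤-trans (+-mono-≤ (*-mono-≤ w>0 (s≤s (z≤n {y + y * suc y}))) k>0) b) λ { (s≤s ()) }

-- With x = y + z the form becomes w y² + (2a + u - v) y z + a z², all of whose coefficients are
-- nonnegative because v ≤ c + v < a + u. The value 1 leaves room for z = 1 and y = 0 only.
left-end : ∀ a u v c x y → 0 < a → c + v < a + u → y < x → Represents1 a u v c x y → a ≡ 1 × x ≡ 1 × y ≡ 0
left-end a u v c x y a>0 lt y<x rep = go z z>0 refl bound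
  where
  open ≤-Reasoning
  z = x ∸ y
  z>0 : 0 < z
  z>0 = m<n⇒0<n∸m y<x
  x≡ : y + z ≡ x
  x≡ = m+[n∸m]≡n (<⇒≤ y<x)
  w = a + u ∸ (c + v)
  w>0 : 0 < w
  w>0 = m<n⇒0<n∸m lt
  bound : w * (y * y) + a * (z * z) ≤ 1
  bound = +-cancelʳ-≤ ((c + v) * (y * y) + v * (y * z)) _ _ (begin
    w * (y * y) + a * (z * z) + ((c + v) * (y * y) + v * (y * z))
      ≡⟨ solve 6 (λ w y a z g v → w :* (y :* y) :+ a :* (z :* z) :+ (g :* (y :* y) :+ v :* (y :* z)) := (w :+ g) :* (y :* y) :+ a :* (z :* z) :+ v :* (y :* z)) refl w y a z (c + v) v ⟩
    (w + (c + v)) * (y * y) + a * (z * z) + v * (y * z) ≡⟨ cong (λ h → h * (y * y) + a * (z * z) + v * (y * z)) (m∸n+n≡m (<⇒≤ lt)) ⟩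
    (a + u) * (y * y) + a * (z * z) + v * (y * z) ≤⟨ +-monoʳ-≤ _ (*-monoˡ-≤ (y * z) (≤-trans (≤-trans (m≤n+m v c) (<⇒≤ lt)) (m≤n+m (a + u) a))) ⟩
    (a + u) * (y * y) + a * (z * z) + (a + (a + u)) * (y * z)
      ≡⟨ solve 4 (λ a u y z → (a :+ u) :* (y :* y) :+ a :* (z :* z) :+ (a :+ (a :+ u)) :* (y :* z) := a :* (y :+ z) :* (y :+ z) :+ u :* (y :+ z) :* y) refl a u y z ⟩
    a * (y + z) * (y + z) + u * (y + z) * y ≡⟨ cong (λ x → a * x * x + u * x * y) x≡ ⟩
    a * x * x + u * x * y ≡⟨ rep ⟩
    1 + (c * y * y + v * x * y) ≡⟨ cong (λ x → 1 + (c * y * y + v * x * y)) (sym x≡) ⟩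
    1 + (c * y * y + v * (y + z) * y) ≡⟨ solve 4 (λ c v y z → con 1 :+ (c :* y :* y :+ v :* (y :+ z) :* y) := con 1 :+ ((c :+ v) :* (y :* y) :+ v :* (y :* z))) refl c v y z ⟩
    1 + ((c + v) * (y * y) + v * (y * z)) ∎)
  go : ∀ z′ → 0 < z′ → z ≡ z′ → w * (y * y) + a * (z′ * z′) ≤ 1 → a ≡ 1 × x ≡ 1 × y ≡ 0
  go z′ z′>0 ez b = a≡1 , trans (sym x≡) (cong₂ _+_ y≡0 (trans ez z′≡1)) , y≡0
    where
    y≡0 : y ≡ 0
    y≡0 = square-vanishes w y (a * (z′ * z′)) w>0 (*-mono-≤ a>0 (*-mono-≤ z′>0 z′>0)) b
    az≤1 : a * (z′ * z′) ≤ 1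
    az≤1 = ≤-trans (m≤n+m _ (w * (y * y))) b
    a≡1 : a ≡ 1
    a≡1 = ≤-antisym (≤-trans (m≤m*n a (z′ * z′) {{>-nonZero (*-mono-< z′>0 z′>0)}}) az≤1) a>0
    z′≡1 : z′ ≡ 1
    z′≡1 = ≤-antisym (≤-trans (m≤m*n z′ z′ {{>-nonZero z′>0}}) (≤-trans (m≤n*m (z′ * z′) a {{>-nonZero a>0}}) az≤1)) z′>0

∨-false : ∀ {a b} → (a ∨ b) ≡ false → a ≡ false × b ≡ false
∨-false {false} {false} _ = refl , refl

end-value : ∀ a p q → a ≡ 1 → ((a ≡ᵇ 1) ∧ not (p ≡ᵇ 0)) ≡ false → p * 1 + q * 0 ≡ 0
end-value _ zero    q refl _ = *-zeroʳ q
end-value _ (suc p) q refl ()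

mutual
  -- A given solution travels along: a move to the right subtracts y from x, a move to the left
  -- subtracts x from y, and the represented vector does not change. The subtraction can fail only
  -- on the left, where `left-end` identifies the solution as the base vector (1 , 0); the guard in
  -- `river` then makes its second original coordinate 0.
  river-sound : ∀ f c₀ a u v c r s p q M x y → 0 < a → Represents1 a u v c x y →
                river f c₀ a u v c r s p q ≡ just M → Pulled c₀ M (r * x + s * y) (p * x + q * y)
  river-sound (suc f) c₀ a u v c r s p q M x y a>0 rep eq with a + u <ᵇ c + v in e₁
  ... | true = subst₂ (Pulled c₀ M) (lin r s) (lin p q)
        (closed-sound f c₀ a (2 * a + u) v _ r (r + s) p (p + q) M (x ∸ y) y a>0
          (right-step a u v c (x ∸ y) y lt (subst (λ x → Represents1 a u v c x y) (sym x≡) rep)) eq)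
    where
    lt = <ᵇ-true {a + u} {c + v} e₁
    x≡ : x ∸ y + y ≡ x
    x≡ = m∸n+n≡m (right-x≥y a u v c x y lt rep)
    lin : ∀ r s → r * (x ∸ y) + (r + s) * y ≡ r * x + s * y
    lin r s = trans (solve 4 (λ r s x y → r :* x :+ (r :+ s) :* y := r :* (x :+ y) :+ s :* y) refl r s (x ∸ y) y) (cong (λ x → r * x + s * y) x≡)
  ... | false with (a + u ≡ᵇ c + v) ∨ ((a ≡ᵇ 1) ∧ not (p ≡ᵇ 0)) in e₂
  ... | false with y <? x
  ... | yes y<x = inj₁ (trans (cong₂ (λ x y → p * x + q * y) (proj₁ (proj₂ end)) (proj₂ (proj₂ end))) (end-value a p q (proj₁ end) (proj₂ (∨-false e₂))))
    where
    lt : c + v < a + u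
    lt = ≤∧≢⇒< (<ᵇ-false {a + u} {c + v} e₁) (λ z → ≡ᵇ-false {a + u} (proj₁ (∨-false e₂)) (sym z))
    end = left-end a u v c x y a>0 lt y<x rep
  river-sound (suc f) c₀ a u v c r s p q M x y a>0 rep eq | false | false | no y≮x =
      subst₂ (Pulled c₀ M) (lin r s) (lin p q)
        (closed-sound f c₀ _ u (2 * c + v) c (r + s) s (p + q) q M x (y ∸ x) (m<n⇒0<n∸m lt)
          (left-step a u v c x (y ∸ x) lt (subst (λ y → Represents1 a u v c x y) (sym y≡) rep)) eq)
    where
    lt : c + v < a + u
    lt = ≤∧≢⇒< (<ᵇ-false {a + u} {c + v} e₁) (λ z → ≡ᵇ-false {a + u} (proj₁ (∨-false e₂)) (sym z))
    y≡ : x + (y ∸ x) ≡ y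
    y≡ = m+[n∸m]≡n (≮⇒≥ y≮x)
    lin : ∀ r s → (r + s) * x + s * (y ∸ x) ≡ r * x + s * y
    lin r s = trans (solve 4 (λ r s x y → (r :+ s) :* x :+ s :* y := r :* x :+ s :* (x :+ y)) refl r s x (y ∸ x)) (cong (λ y → r * x + s * y) y≡)

  closed-sound : ∀ f c₀ a u v c r s p q M x y → 0 < a → Represents1 a u v c x y →
                 closed f c₀ a u v c r s p q ≡ just M → Pulled c₀ M (r * x + s * y) (p * x + q * y)
  closed-sound f c₀ a u v c r s p q M x y a>0 rep eq with (a ≡ᵇ 1) ∧ ((u ≡ᵇ suc v) ∧ (c ≡ᵇ c₀)) in e
  closed-sound f c₀ a u v c r s p q M x y a>0 rep refl | true with ∧-split {a ≡ᵇ 1} e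
  ... | e₁ , e₂₃ with ∧-split {u ≡ᵇ suc v} e₂₃
  ... | e₂ , e₃ with ≡ᵇ-true {a} e₁ | ≡ᵇ-true {u} e₂ | ≡ᵇ-true {c} e₃
  ... | refl | refl | refl = inj₂ (x , y , +-cancelʳ-≡ (v * x * y) _ _ rep′ , refl , refl)
    where
    rep′ : 1 * x * x + 1 * x * y + v * x * y ≡ 1 + (c₀ * y * y + 0 * x * y) + v * x * y
    rep′ = trans (solve 3 (λ v x y → con 1 :* x :* x :+ con 1 :* x :* y :+ v :* x :* y := con 1 :* x :* x :+ (con 1 :+ v) :* x :* y) refl v x y)
      (trans rep (solve 4 (λ c v x y → con 1 :+ (c :* y :* y :+ v :* x :* y) := con 1 :+ (c :* y :* y :+ con 0 :* x :* y) :+ v :* x :* y) refl c₀ v x y))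
  closed-sound f c₀ a u v c r s p q M x y a>0 rep eq | false = river-sound f c₀ a u v c r s p q M x y a>0 rep eq

-- The walk starts at the principal form x² + xy - c₀ y² of discriminant 4c₀ + 1 with the identity
-- matrix; the matrix found on return is an automorph of it.
cycle : ℕ → ℕ → Maybe Mat
cycle f c₀ = river f c₀ 1 1 0 c₀ 1 0 0 1

cycle-sound : ∀ f c₀ M x y → cycle f c₀ ≡ just M → Represents1 1 1 0 c₀ x y → Pulled c₀ M x y
cycle-sound f c₀ M x y eq rep = subst₂ (Pulled c₀ M) (solve 2 (λ x y → con 1 :* x :+ con 0 :* y := x) refl x y)
  (solve 2 (λ x y → con 0 :* x :+ con 1 :* y := y) refl x y) (river-sound f c₀ 1 1 0 c₀ 1 0 0 1 M x y z<s rep eq)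

-- Smooth pairs and Lucas sequences

-- The Lucas sequence with parameters (m , 1). For m ≥ 2 it is nondecreasing, so the truncated
-- subtraction is exact.
U : ℕ → ℕ → ℕ
U m zero          = 0
U m (suc zero)    = 1
U m (suc (suc t)) = m * U m (suc t) ∸ U m t

-- Carries two consecutive values; the recursion of `U` branches and would take exponential time.
U-fast-from : ℕ → ℕ → ℕ → ℕ → ℕ
U-fast-from m zero    a b = a
U-fast-from m (suc t) a b = U-fast-from m t b (m * b ∸ a)

U-fast : ℕ → ℕ → ℕ
U-fast m t = U-fast-from m t 0 1

U-fast-from≡ : ∀ m t i → U-fast-from m t (U m i) (U m (suc i)) ≡ U m (t + i)
U-fast-from≡ m zero i = refl
U-fast-from≡ m (suc t) i = trans (U-fast-from≡ m t (suc i)) (cong (U m) (+-suc t i))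

U-fast≡ : ∀ m t → U-fast m t ≡ U m t
U-fast≡ m t = trans (U-fast-from≡ m t 0) (cong (U m) (+-identityʳ t))

module Lucas (m : ℕ) (m≥2 : 2 ≤ m) where

  U-mono : ∀ t → U m t ≤ U m (suc t)
  U-mono zero = z≤n
  U-mono (suc t) = begin
    U m (suc t)                         ≡⟨ sym (m+n∸n≡m _ (U m t)) ⟩
    U m (suc t) + U m t ∸ U m t         ≤⟨ ∸-monoˡ-≤ (U m t) (+-monoʳ-≤ (U m (suc t)) (U-mono t)) ⟩
    U m (suc t) + U m (suc t) ∸ U m t   ≡⟨ cong (λ z → U m (suc t) + z ∸ U m t) (sym (+-identityʳ (U m (suc t)))) ⟩
    2 * U m (suc t) ∸ U m t             ≤⟨ ∸-monoˡ-≤ (U m t) (*-monoˡ-≤ (U m (suc t)) m≥2) ⟩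
    m * U m (suc t) ∸ U m t ∎
    where open ≤-Reasoning

  U-rec : ∀ t → U m (2 + t) + U m t ≡ m * U m (suc t)
  U-rec t = m∸n+n≡m (≤-trans (U-mono t) (m≤n*m (U m (suc t)) m {{>-nonZero (<-≤-trans z<s m≥2)}}))

  U-add : ∀ a b → U m (suc (a + b)) + U m a * U m b ≡ U m (suc a) * U m (suc b)
  U-add zero b = solve 1 (λ x → x :+ con 0 := con 1 :* x) refl (U m (suc b))
  U-add (suc a) b = +-cancelʳ-≡ (U m a * U m (suc b)) _ _ (begin
    u (2 + (a + b)) + u (suc a) * u b + u a * u (suc b)
      ≡⟨ solve 3 (λ x y z → x :+ y :+ z := x :+ z :+ y) refl (u (2 + (a + b))) (u (suc a) * u b) (u a * u (suc b)) ⟩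
    u (2 + (a + b)) + u a * u (suc b) + u (suc a) * u b ≡⟨ cong (λ z → u (suc z) + u a * u (suc b) + u (suc a) * u b) (sym (+-suc a b)) ⟩
    u (suc (a + suc b)) + u a * u (suc b) + u (suc a) * u b ≡⟨ cong (_+ u (suc a) * u b) (U-add a (suc b)) ⟩
    u (suc a) * u (2 + b) + u (suc a) * u b ≡⟨ sym (*-distribˡ-+ (u (suc a)) (u (2 + b)) (u b)) ⟩
    u (suc a) * (u (2 + b) + u b) ≡⟨ cong (u (suc a) *_) (U-rec b) ⟩
    u (suc a) * (m * u (suc b)) ≡⟨ solve 3 (λ x m y → x :* (m :* y) := m :* x :* y) refl (u (suc a)) m (u (suc b)) ⟩
    m * u (suc a) * u (suc b) ≡⟨ cong (_* u (suc b)) (sym (U-rec a)) ⟩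
    (u (2 + a) + u a) * u (suc b) ≡⟨ *-distribʳ-+ (u (suc b)) (u (2 + a)) (u a) ⟩
    u (2 + a) * u (suc b) + u a * u (suc b) ∎)
    where
    open ≡-Reasoning
    u = U m

  U-∣ : ∀ d j → U m d ∣ U m (j * d)
  U-∣ d zero = _ ∣0
  U-∣ zero (suc j) = U-∣ zero j
  U-∣ (suc d) (suc j) = ∣m+n∣m⇒∣n (subst (U m (suc d) ∣_) (trans (sym (U-add (j * suc d) d)) (+-comm _ (U m (j * suc d) * U m d))) (n∣m*n (U m (suc (j * suc d)))))
      (∣-trans (U-∣ (suc d) j) (m∣m*n (U m d))) ⟨subst⟩ cong (λ z → U m (suc z)) (+-comm (j * suc d) d)
    where
    _⟨subst⟩_ : ∀ {x y} → U m (suc d) ∣ x → x ≡ y → U m (suc d) ∣ y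
    p ⟨subst⟩ refl = p

  module _ {π : ℕ} (pπ : Prime π) where

    U-consecutive : ∀ a → π ∣ U m a → π ∣ U m (suc a) → ⊥
    U-consecutive zero _ d = <⇒≱ (prime>1 pπ) (∣⇒≤ d)
    U-consecutive (suc a) d₁ d₂ = U-consecutive a (∣m+n∣m⇒∣n (subst (π ∣_) (sym (U-rec a)) (∣-trans d₁ (n∣m*n m))) d₂) d₁

    -- In U(a+b+1) + U(a) U(b) = U(a+1) U(b+1) the prime divides the left side, and it cannot divide
    -- U(a+1), a neighbour of U(a). So indices of multiples of π can be subtracted as in Euclid's
    -- algorithm.
    U-subtract : ∀ a b → π ∣ U m a → π ∣ U m (a + b) → π ∣ U m b
    U-subtract a zero _ _ = π ∣0
    U-subtract a (suc b) d₁ d₂ with euclidsLemma (U m (suc a)) (U m (suc b)) pπ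
        (subst (π ∣_) (U-add a b) (∣m∣n⇒∣m+n (subst (λ z → π ∣ U m z) (+-suc a b) d₂) (∣-trans d₁ (m∣m*n (U m b)))))
    ... | inj₁ x = ⊥-elim (U-consecutive a d₁ x)
    ... | inj₂ y = y

    -- A Bézout relation produces a multiple of a and a multiple of b that differ by 1; subtracting
    -- them would give a prime divisor of U(1) = 1.
    U-coprime : ∀ a b → Coprime a b → π ∣ U m a → π ∣ U m b → ⊥
    U-coprime a b c d₁ d₂ with coprime-Bézout c
    ... | Bézout.+- x y eq = <⇒≱ (prime>1 pπ) (∣⇒≤ (U-subtract (y * b) 1 (∣-trans d₂ (U-∣ b y))
            (subst (λ z → π ∣ U m z) (trans (sym eq) (+-comm 1 (y * b))) (∣-trans d₁ (U-∣ a x)))))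
    ... | Bézout.-+ x y eq = <⇒≱ (prime>1 pπ) (∣⇒≤ (U-subtract (x * a) 1 (∣-trans d₁ (U-∣ a x))
            (subst (λ z → π ∣ U m z) (trans (sym eq) (+-comm 1 (x * a))) (∣-trans d₂ (U-∣ b y)))))

  U>0 : ∀ t → 0 < U m (suc t)
  U>0 zero = z<s
  U>0 (suc t) = <-≤-trans (U>0 t) (U-mono (suc t))

  U>1 : ∀ t → 1 < U m (2 + t)
  U>1 zero = subst (1 <_) (sym (*-identityʳ m)) m≥2
  U>1 (suc t) = <-≤-trans (U>1 t) (U-mono (2 + t))

orbit : Mat → ℕ → ℕ × ℕ
orbit M zero = 1 , 0
orbit M@(mat r s p q) (suc t) = r * proj₁ (orbit M t) + s * proj₂ (orbit M t) , p * proj₁ (orbit M t) + q * proj₂ (orbit M t)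

module Orbit (r s p q : ℕ) (det : r * q ≡ 1 + s * p) (m≥2 : 2 ≤ r + q) where
  open Lucas (r + q) m≥2
  M = mat r s p q
  X = λ t → proj₁ (orbit M t)
  Y = λ t → proj₂ (orbit M t)

  -- Cayley-Hamilton for a matrix of determinant 1 and trace r + q.
  Y-rec : ∀ t → Y (2 + t) + Y t ≡ (r + q) * Y (suc t)
  Y-rec t = trans (solve 6 (λ r s p q x y →
                p :* (r :* x :+ s :* y) :+ q :* (p :* x :+ q :* y) :+ y := p :* r :* x :+ (con 1 :+ s :* p) :* y :+ q :* (p :* x :+ q :* y)) refl r s p q (X t) (Y t))
    (trans (cong (λ z → p * r * X t + z * Y t + q * (p * X t + q * Y t)) (sym det))
      (solve 5 (λ r p q x y → p :* r :* x :+ r :* q :* y :+ q :* (p :* x :+ q :* y) := (r :+ q) :* (p :* x :+ q :* y)) refl r p q (X t) (Y t)))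

  Y≡ : ∀ t → Y t ≡ p * U (r + q) t × Y (suc t) ≡ p * U (r + q) (suc t)
  Y≡ zero = sym (*-zeroʳ p) , solve 2 (λ p q → p :* con 1 :+ q :* con 0 := p :* con 1) refl p q
  Y≡ (suc t) with Y≡ t
  ... | e₁ , e₂ = e₂ , +-cancelʳ-≡ (p * U (r + q) t) _ _ (begin
      Y (2 + t) + p * U (r + q) t       ≡⟨ cong (Y (2 + t) +_) (sym e₁) ⟩
      Y (2 + t) + Y t                   ≡⟨ Y-rec t ⟩
      (r + q) * Y (suc t)               ≡⟨ cong ((r + q) *_) e₂ ⟩
      (r + q) * (p * U (r + q) (suc t)) ≡⟨ solve 3 (λ m p u → m :* (p :* u) := p :* (m :* u)) refl (r + q) p (U (r + q) (suc t)) ⟩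
      p * ((r + q) * U (r + q) (suc t)) ≡⟨ cong (p *_) (sym (U-rec t)) ⟩
      p * (U (r + q) (2 + t) + U (r + q) t) ≡⟨ *-distribˡ-+ p (U (r + q) (2 + t)) (U (r + q) t) ⟩
      p * U (r + q) (2 + t) + p * U (r + q) t ∎)
    where open ≡-Reasoning

rep-x>0 : ∀ c₀ x y → Represents1 1 1 0 c₀ x y → 0 < x
rep-x>0 c₀ zero y ()
rep-x>0 c₀ (suc x) y _ = z<s

rep-y0 : ∀ c₀ x → Represents1 1 1 0 c₀ x 0 → x ≡ 1
rep-y0 c₀ x rep = m*n≡1⇒m≡1 x x (trans (solve 2 (λ c x → x :* x := con 1 :* x :* x :+ con 1 :* x :* con 0) refl c₀ x)
   (trans rep (solve 2 (λ c x → con 1 :+ (c :* con 0 :* con 0 :+ con 0 :* x :* con 0) := con 1) refl c₀ x)))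

-- Infinite descent: `cycle-sound` undoes one application of the matrix, and y strictly drops
-- because p and q are positive and x is never 0. It ends at the trivial solution (1 , 0).
all-in-orbit : ∀ f c₀ r s p q → 0 < p → 0 < q → cycle f c₀ ≡ just (mat r s p q) →
  ∀ y x → Represents1 1 1 0 c₀ x y → ∃[ t ] (x ≡ proj₁ (orbit (mat r s p q) t) × y ≡ proj₂ (orbit (mat r s p q) t))
all-in-orbit f c₀ r s p q p>0 q>0 cyc = <-rec _ step
  where
  M = mat r s p q
  step : ∀ y → (∀ {y′} → y′ < y → ∀ x → Represents1 1 1 0 c₀ x y′ → ∃[ t ] (x ≡ proj₁ (orbit M t) × y′ ≡ proj₂ (orbit M t))) →
         ∀ x → Represents1 1 1 0 c₀ x y → ∃[ t ] (x ≡ proj₁ (orbit M t) × y ≡ proj₂ (orbit M t))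
  step y rec x rep with cycle-sound f c₀ M x y cyc rep
  ... | inj₁ refl = 0 , rep-y0 c₀ x rep , refl
  ... | inj₂ (x′ , y′ , rep′ , refl , refl) with rec y′< x′ rep′
    where
    y′< : y′ < p * x′ + q * y′
    y′< = +-mono-≤ (*-mono-≤ p>0 (rep-x>0 c₀ x′ y′ rep′)) (m≤n*m y′ q {{>-nonZero q>0}})
  ... | t , refl , refl = suc t , refl , refl

-- Testing for smoothness and the search among Lucas indices

divCount : List ℕ → ℕ → ℕ
divCount []       z = 0
divCount (p ∷ ps) z = if rem z p ≡ᵇ 0 then suc (divCount ps z) else divCount ps z

strip : ℕ → ℕ → ℕ → ℕ
strip zero    p z = z
strip (suc f) p z = if rem z p ≡ᵇ 0 then strip f p (quot z p) else z
  where
  quot : ℕ → ℕ → ℕ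
  quot z zero    = z
  quot z (suc d) = z / suc d

stripAll : List ℕ → ℕ → ℕ
stripAll []       z = z
stripAll (p ∷ ps) z = stripAll ps (strip z p z)

ok? : List ℕ → ℕ → ℕ → Bool
ok? ps w z = (stripAll ps z ≡ᵇ 1) ∧ (divCount ps z <ᵇ suc w)

record OK (ps : List ℕ) (w z : ℕ) : Set where
  constructor mkOK
  field
    pos     : 0 < z
    factors : ∀ π → Prime π → π ∣ z → π ∈ ps
    few     : divCount ps z ≤ w

divCount-∣ : ∀ ps d z → d ∣ z → divCount ps d ≤ divCount ps z
divCount-∣ [] d z d∣z = z≤n
divCount-∣ (p ∷ ps) d z d∣z with rem d p ≡ᵇ 0 in e₁ | rem z p ≡ᵇ 0 in e₂
... | true | true = s≤s (divCount-∣ ps d z d∣z)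
... | false | true = m≤n⇒m≤1+n (divCount-∣ ps d z d∣z)
... | false | false = divCount-∣ ps d z d∣z
... | true | false = contradiction (∣⇒rem≡0 z p (∣-trans (rem≡0⇒∣ d p (≡ᵇ-true e₁)) d∣z)) (≡ᵇ-false e₂)

OK-∣ : ∀ {ps w d z} → d ∣ z → OK ps w z → OK ps w d
OK-∣ {ps} {w} {d} {z} d∣z (mkOK pos fac few) =
  mkOK (n≢0⇒n>0 (λ { refl → n>0⇒n≢0 pos (0∣⇒≡0 d∣z) })) (λ π pπ x → fac π pπ (∣-trans x d∣z)) (≤-trans (divCount-∣ ps d z d∣z) few)

strip-spec : ∀ f p z → 1 < p → 0 < z → z ≤ f → (strip f p z ∣ z) × ¬ (p ∣ strip f p z)
strip-spec zero p z p>1 z>0 z≤f = contradiction (<-≤-trans z>0 z≤f) (λ ())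
strip-spec (suc f) (suc p) z p>1 z>0 z≤f with z % suc p ≡ᵇ 0 in e
... | false = ∣-refl , λ d → ≡ᵇ-false e (n∣m⇒m%n≡0 z (suc p) d)
... | true with m%n≡0⇒n∣m z (suc p) (≡ᵇ-true e)
... | divides q refl rewrite m*n/n≡m q (suc p) ⦃ _ ⦄ with strip-spec f (suc p) q p>1 q>0 (s≤s⁻¹ (<-≤-trans (m<m*n q (suc p) ⦃ >-nonZero q>0 ⦄ p>1) z≤f))
  where
  q>0 : 0 < q
  q>0 = n≢0⇒n>0 λ { refl → n>0⇒n≢0 z>0 refl }
... | a , b = ∣-trans a (m∣m*n (suc p)) , b

stripAll-spec : ∀ ps z → All (1 <_) ps → 0 < z → (stripAll ps z ∣ z) × (∀ π → π ∈ ps → ¬ (π ∣ stripAll ps z)) × 0 < stripAll ps z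
stripAll-spec [] z [] z>0 = ∣-refl , (λ π ()) , z>0
stripAll-spec (p ∷ ps) z (p>1 ∷ a) z>0 with strip-spec z p z p>1 z>0 ≤-refl
... | s₁ , s₂ with stripAll-spec ps (strip z p z) a (n≢0⇒n>0 (λ e → n>0⇒n≢0 z>0 (0∣⇒≡0 (subst (_∣ z) e s₁))))
... | t₁ , t₂ , t₃ = ∣-trans t₁ s₁ , (λ { π (here refl) d → s₂ (∣-trans d t₁) ; π (there i) d → t₂ π i d }) , t₃

ok-complete : ∀ ps w z → All (1 <_) ps → OK ps w z → ok? ps w z ≡ true
ok-complete ps w z a (mkOK pos fac few) with stripAll-spec ps z a pos
... | s₁ , s₂ , s₃ = subst (λ v → ((v ≡ᵇ 1) ∧ (divCount ps z <ᵇ suc w)) ≡ true) (sym one) (T⇒≡ (<⇒<ᵇ (s≤s few)))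
  where
  one : stripAll ps z ≡ 1
  one = smooth-0 s₃ (λ p pp d → contradiction d (s₂ p (fac p pp (∣-trans d s₁))))

elem : ℕ → List ℕ → Bool
elem x []       = false
elem x (y ∷ ys) = (x ≡ᵇ y) ∨ elem x ys

elem-sound : ∀ x ys → elem x ys ≡ true → x ∈ ys
elem-sound x (y ∷ ys) e with x ≡ᵇ y in e′
... | true = here (≡ᵇ-true e′)
... | false = there (elem-sound x ys e)

allL : (ℕ → Bool) → List ℕ → Bool
allL f []       = true
allL f (x ∷ xs) = f x ∧ allL f xs

allL-sound : ∀ f xs → allL f xs ≡ true → ∀ {x} → x ∈ xs → f x ≡ true
allL-sound f (x ∷ xs) e (here refl) = proj₁ (∧-split e)
allL-sound f (x ∷ xs) e (there i) = allL-sound f xs (proj₂ (∧-split {f x} e)) i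

allBelow : (ℕ → Bool) → ℕ → Bool
allBelow f zero    = true
allBelow f (suc k) = f k ∧ allBelow f k

allBelow-sound : ∀ f k → allBelow f k ≡ true → ∀ i → i < k → f i ≡ true
allBelow-sound f (suc k) e i i< with i ≟ k
... | yes refl = proj₁ (∧-split e)
... | no ne = allBelow-sound f k (proj₂ (∧-split {f k} e)) i (≤∧≢⇒< (s≤s⁻¹ i<) ne)

filterL : (ℕ → Bool) → List ℕ → List ℕ
filterL f []       = []
filterL f (x ∷ xs) = if f x then x ∷ filterL f xs else filterL f xs

-- Searches for an index ρ with π ∣ U(ρ), so it bounds the rank of apparition of π.
hasRank : ℕ → ℕ → ℕ → ℕ → ℕ → Bool
hasRank zero    m π a b = false
hasRank (suc f) m π a b = (rem a π ≡ᵇ 0) ∨ hasRank f m π b (m * b ∸ a)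

hasRank-sound : ∀ f m π t → hasRank f m π (U m t) (U m (suc t)) ≡ true → ∃[ ρ ] (t ≤ ρ × ρ < t + f × π ∣ U m ρ)
hasRank-sound (suc f) m π t e with rem (U m t) π ≡ᵇ 0 in e′
... | true = t , ≤-refl , m<m+n t z<s , rem≡0⇒∣ _ π (≡ᵇ-true e′)
... | false with hasRank-sound f m π (suc t) e
... | ρ , a , b , c = ρ , ≤-trans (n≤1+n t) a , subst (ρ <_) (sym (+-suc t f)) b , c

oddPrimesTo : ℕ → List ℕ
oddPrimesTo zero    = []
oddPrimesTo (suc b) = if oddPrime? (suc b) then suc b ∷ oddPrimesTo b else oddPrimesTo b

oddPrimesTo-complete : ∀ b p → Prime p → Odd p → p ≤ b → p ∈ oddPrimesTo b
oddPrimesTo-complete zero p pp podd le = contradiction pp (subst (λ p → ¬ Prime p) (sym (n≤0⇒n≡0 le)) ¬prime[0])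
oddPrimesTo-complete (suc b) p pp podd le with p ≟ suc b
... | yes refl rewrite oddPrime?-complete p pp podd = here refl
... | no ne with oddPrime? (suc b)
... | true = there (oddPrimesTo-complete b p pp podd (s≤s⁻¹ (≤∧≢⇒< le ne)))
... | false = oddPrimesTo-complete b p pp podd (s≤s⁻¹ (≤∧≢⇒< le ne))

oddPrimesTo-prime : ∀ b → All (λ p → Prime p × Odd p × p ≤ b) (oddPrimesTo b)
oddPrimesTo-prime zero = []
oddPrimesTo-prime (suc b) with oddPrime? (suc b) in e
... | true = (oddPrime?-sound (suc b) e , oddPrime?-odd (suc b) e , ≤-refl) ∷ All.map (λ (a , b , c) → a , b , m≤n⇒m≤1+n c) (oddPrimesTo-prime b)
... | false = All.map (λ (a , b , c) → a , b , m≤n⇒m≤1+n c) (oddPrimesTo-prime b)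

-- `ps` holds the admissible primes, of which at most `w` may divide a pair; `S` the primes by which
-- indices are multiplied, `I` the candidate indices, `fuel` the length of the walk along the river,
-- `rankFuel` a bound for ranks of apparition, and `bnd` the bound to be proved for a + 2.
module Check (ps S I : List ℕ) (w fuel rankFuel bnd : ℕ) where

  closedUnder : ℕ → ℕ → List ℕ → Bool
  closedUnder z m G = allL (λ g → allL (λ s → elem (g * s) G ∨ not (ok? ps w (z * U-fast m (g * s)))) S) G

  -- G holds the indices t for which D p U_t has few, small primes; no multiple of an index outside G can be such a t,
  -- so G is complete once multiplying its members by primes leads nowhere new.
  checkGood : ℕ → ℕ → ℕ → List ℕ → Bool
  checkGood D p m G = (1 <ᵇ m) ∧ (elem 1 G ∧ (allL (λ π → hasRank rankFuel m π 1 m) ps ∧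
    (closedUnder (D * p) m G ∧ allL (λ g → D * (p * U-fast m g) * (p * U-fast m g) + 4 <ᵇ suc (bnd * bnd)) G)))

  checkMat : ℕ → Maybe Mat → Bool
  checkMat D nothing = false
  checkMat D (just (mat r s p q)) = (0 <ᵇ p) ∧ ((0 <ᵇ q) ∧ ((r * q ≡ᵇ 1 + s * p) ∧ ((1 <ᵇ r + q) ∧ (not (ok? ps w (D * p)) ∨
    checkGood D p (r + q) (filterL (λ g → ok? ps w (D * p * U-fast (r + q) g)) I)))))

  -- Odd squares are 1 modulo 8, so (a + 2)² = D y² + 4 with odd a and y forces D ≡ 5 (mod 8); other
  -- D need no test. For such D the quotient D / 4 is (D - 1) / 4.
  check : ℕ → Bool
  check D = if D % 8 ≡ᵇ 5 then checkMat D (cycle fuel (D / 4)) else true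

  checkSubs : List ℕ → ℕ → ℕ → Bool
  checkSubs qs       zero    D = check D
  checkSubs []       (suc l) D = check D
  checkSubs (q ∷ qs) (suc l) D = checkSubs qs (suc l) D ∧ checkSubs qs l (q * D)

OddPrimes : List ℕ → Set
OddPrimes = All (λ p → Prime p × Odd p)

>1s : ∀ {ps} → OddPrimes ps → All (1 <_) ps
>1s = All.map (λ (pp , _) → prime>1 pp)

not-true : ∀ {b} → not b ≡ true → b ≡ false
not-true {false} _ = refl

∨-true : ∀ {a b} → (a ∨ b) ≡ true → a ≡ true ⊎ b ≡ true
∨-true {true} _ = inj₁ refl
∨-true {false} e = inj₂ e

rankPrimes : ℕ → List ℕ
rankPrimes b = 2 ∷ oddPrimesTo b

rankPrimes-complete : ∀ b s → Prime s → s ≤ b → s ∈ rankPrimes b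
rankPrimes-complete b s ps le with 2 ∣? s
... | no o = there (oddPrimesTo-complete b s ps o le)
... | yes d with prime⇒irreducible ps d
... | inj₂ e = here (sym e)

module CheckSound (ps S I : List ℕ) (w fuel rankFuel bnd : ℕ) (ops : OddPrimes ps)
                  (S-complete : ∀ s → Prime s → s ≤ rankFuel → s ∈ S) where
  open Check ps S I w fuel rankFuel bnd

  good-sound : ∀ D p m G → checkGood D p m G ≡ true →
    ∀ t → 0 < t → OK ps w (D * p * U m t) → D * (p * U m t) * (p * U m t) + 4 ≤ bnd * bnd
  good-sound D p m G chk t t>0 okt
    with ∧-split {1 <ᵇ m} chk
  ... | e₁ , r₁ with ∧-split {elem 1 G} r₁
  ... | e₂ , r₂ with ∧-split {allL (λ π → hasRank rankFuel m π 1 m) ps} r₂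
  ... | e₃ , r₃ with ∧-split {closedUnder (D * p) m G} r₃
  ... | e₄ , e₅ = s≤s⁻¹ (<ᵇ-true (subst (λ u → (D * (p * u) * (p * u) + 4 <ᵇ suc (bnd * bnd)) ≡ true) (U-fast≡ m t)
                    (allL-sound _ G e₅ (inG t t>0 okt))))
    where
    open Lucas m (<ᵇ-true {1} {m} e₁)
    inG : ∀ t → 0 < t → OK ps w (D * p * U m t) → t ∈ G
    inG = <-rec _ step
      where
      step : ∀ t → (∀ {g} → g < t → 0 < g → OK ps w (D * p * U m g) → g ∈ G) → 0 < t → OK ps w (D * p * U m t) → t ∈ G
      step (suc zero) rec _ okt = elem-sound 1 G e₂
      step t@(suc (suc t′)) rec _ okt with hasPrimeFactor t (s≤s (s≤s z≤n))
      ... | s , ps′ , divides g eq = elem-case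
        where
        g>0 : 0 < g
        g>0 = n≢0⇒n>0 λ { refl → contradiction eq (λ ()) }
        g<t : g < t
        g<t = subst (g <_) (sym eq) (m<m*n g s ⦃ >-nonZero g>0 ⦄ (prime>1 ps′))
        Us∣ : U m s ∣ U m t
        Us∣ = subst (λ z → U m s ∣ U m z) (sym eq) (U-∣ s g)
        Ug∣ : U m g ∣ U m t
        Ug∣ = subst (λ z → U m g ∣ U m z) (trans (*-comm s g) (sym eq)) (U-∣ g s)
        g∈ : g ∈ G
        g∈ = rec g<t g>0 (OK-∣ (*-monoʳ-∣ (D * p) Ug∣) okt)
        -- A prime index s > `rankFuel` is impossible: a prime π dividing U(s) is one of `ps`, hence
        -- also divides some U(ρ) with 0 < ρ ≤ `rankFuel` < s. As ρ is coprime to s, this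
        -- contradicts `U-coprime`. So multiplying by the primes in `S` misses nothing.
        s≤ : s ≤ rankFuel
        s≤ with s ≤? rankFuel
        ... | yes le = le
        ... | no s≰ = ⊥-elim (absurd s (prime>1 ps′) s≰ ps′ Us∣)
          where
          absurd : ∀ s → 1 < s → ¬ s ≤ rankFuel → Prime s → U m s ∣ U m t → ⊥
          absurd (suc zero) (s≤s ()) _ _ _
          absurd s@(suc (suc s′)) _ s≰ ps′ Us∣ with hasPrimeFactor (U m s) (U>1 s′)
          ... | π , pπ , π∣ with hasRank-sound rankFuel m π 1 (subst (λ b → hasRank rankFuel m π 1 b ≡ true) (sym (*-identityʳ m))
                   (allL-sound _ ps e₃ (OK.factors okt π pπ (∣-trans π∣ (∣-trans Us∣ (n∣m*n (D * p)))))))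
          ... | ρ , ρ>0 , ρ< , π∣ρ = U-coprime pπ s ρ (prime⇒coprime ps′ ⦃ >-nonZero ρ>0 ⦄ (<-≤-trans ρ< (≰⇒> s≰))) π∣ π∣ρ
        elem-case : t ∈ G
        elem-case with ∨-true {elem (g * s) G} (allL-sound _ S (allL-sound _ G e₄ g∈) (S-complete s ps′ s≤))
        ... | inj₁ e = subst (_∈ G) (sym eq) (elem-sound (g * s) G e)
        ... | inj₂ e = contradiction (trans (sym (not-true e)) (ok-complete ps w _ (>1s ops) (subst (λ z → OK ps w (D * p * z)) (sym (trans (U-fast≡ m (g * s)) (cong (U m) (sym eq)))) okt))) (λ ())

  check-sound : ∀ D x y → check D ≡ true → D % 8 ≡ 5 → 0 < D → 0 < y → Represents1 1 1 0 (D / 4) x y → OK ps w (D * y) →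
    D * y * y + 4 ≤ bnd * bnd
  check-sound D x y chk D8 D>0 y>0 rep ok rewrite D8 with cycle fuel (D / 4) in cyc
  ... | just (mat r s p q) with ∧-split {0 <ᵇ p} chk
  ... | e₁ , r₁ with ∧-split {0 <ᵇ q} r₁
  ... | e₂ , r₂ with ∧-split {r * q ≡ᵇ 1 + s * p} r₂
  ... | e₃ , r₃ with ∧-split {1 <ᵇ r + q} r₃
  ... | e₄ , r₄ with all-in-orbit fuel (D / 4) r s p q (<ᵇ-true {0} {p} e₁) (<ᵇ-true {0} {q} e₂) cyc y x rep
  ... | t , _ , y≡ with ∨-true {not (ok? ps w (D * p))} r₄
  ... | inj₁ e = contradiction (trans (sym (not-true e)) (ok-complete ps w (D * p) (>1s ops) (OK-∣ (subst (D * p ∣_) (cong (D *_) (sym yU)) (*-monoʳ-∣ D (m∣m*n (U (r + q) t)))) ok))) (λ ())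
    where
    yU : y ≡ p * U (r + q) t
    yU = trans y≡ (proj₁ (Orbit.Y≡ r s p q (≡ᵇ-true e₃) (<ᵇ-true {1} {r + q} e₄) t))
  ... | inj₂ e = subst (λ z → D * z * z + 4 ≤ bnd * bnd) (sym yU)
        (good-sound D p (r + q) (filterL (λ g → ok? ps w (D * p * U-fast (r + q) g)) I) e t t>0 (subst (OK ps w) (trans (cong (D *_) yU) (sym (*-assoc D p _))) ok))
    where
    yU : y ≡ p * U (r + q) t
    yU = trans y≡ (proj₁ (Orbit.Y≡ r s p q (≡ᵇ-true e₃) (<ᵇ-true {1} {r + q} e₄) t))
    t>0 : 0 < t
    t>0 = n≢0⇒n>0 λ { refl → n>0⇒n≢0 y>0 y≡ }

  data SubProd : List ℕ → ℕ → ℕ → Set where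
    nil  : SubProd [] 0 1
    skip : ∀ {q qs l d} → SubProd qs l d → SubProd (q ∷ qs) l d
    take : ∀ {q qs l d} → SubProd qs l d → SubProd (q ∷ qs) (suc l) (q * d)

  SubProd-0 : ∀ {qs d} → SubProd qs 0 d → d ≡ 1
  SubProd-0 nil = refl
  SubProd-0 (skip s) = SubProd-0 s

  checkSubs-sound : ∀ {qs j d} → SubProd qs j d → ∀ l D → j ≤ l → checkSubs qs l D ≡ true → check (d * D) ≡ true
  checkSubs-sound s zero D z≤n e rewrite SubProd-0 s | +-identityʳ D = e′ s e
    where
    e′ : ∀ {qs d} → SubProd qs 0 d → checkSubs qs 0 D ≡ true → check D ≡ true
    e′ nil e = e
    e′ (skip _) e = e
  checkSubs-sound nil (suc l) D _ e = subst (λ z → check z ≡ true) (sym (+-identityʳ D)) e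
  checkSubs-sound {q ∷ qs} (skip s) (suc l) D le e = checkSubs-sound s (suc l) D le (proj₁ (∧-split e))
  checkSubs-sound {q ∷ qs} (take {d = d} s) (suc l) D (s≤s le) e =
    subst (λ z → check z ≡ true) (solve 3 (λ d q D → d :* (q :* D) := q :* d :* D) refl d q D)
      (checkSubs-sound s l (q * D) le (proj₂ (∧-split {checkSubs qs (suc l) D} e)))

  -- The squarefree part d collects the primes of odd exponent. Being counted by `divCount`, they
  -- number at most w for a light pair, which makes the list of possible d finite.
  decompose : ∀ qs → OddPrimes qs → ∀ z → 0 < z → (∀ π → Prime π → π ∣ z → π ∈ qs) →
    ∃[ d ] ∃[ y ] ∃[ j ] (SubProd qs j d × z ≡ d * (y * y) × j ≤ divCount qs z)
  decompose [] _ z z>0 h = 1 , 1 , 0 , nil , smooth-0 z>0 (λ p pp d → contradiction (h p pp d) (λ ())) , z≤n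
  decompose (q ∷ qs) ((pq , _) ∷ oq) z z>0 h with split q z (prime>1 pq) z>0
  ... | mkSplit e c refl cop with decompose qs oq c c>0 h′
    where
    c>0 : 0 < c
    c>0 = n≢0⇒n>0 λ { refl → cop (q ∣0) }
    h′ : ∀ π → Prime π → π ∣ c → π ∈ qs
    h′ π pπ d with h π pπ (∣-trans d (n∣m*n (q ^ e)))
    ... | here refl = contradiction d cop
    ... | there i = i
  ... | d , y , j , sp , eq , le with halves e
  ... | f , inj₁ refl = d , q ^ f * y , j , skip sp ,
        trans (cong₂ _*_ (trans (cong (q ^_) (cong (f +_) (+-identityʳ f))) (^-distribˡ-+-* q f f)) eq)
          (solve 3 (λ a d y → a :* a :* (d :* (y :* y)) := d :* (a :* y :* (a :* y))) refl (q ^ f) d y) ,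
        ≤-trans (≤-trans le (divCount-∣ qs c _ (n∣m*n (q ^ e)))) (grow (q ^ e * c))
    where
    grow : ∀ z → divCount qs z ≤ divCount (q ∷ qs) z
    grow z with rem z q ≡ᵇ 0
    ... | true = n≤1+n _
    ... | false = ≤-refl
  ... | f , inj₂ refl = q * d , q ^ f * y , suc j , take sp ,
        trans (cong₂ _*_ (cong (q *_) (trans (cong (q ^_) (cong (f +_) (+-identityʳ f))) (^-distribˡ-+-* q f f))) eq)
          (solve 4 (λ q a d y → q :* (a :* a) :* (d :* (y :* y)) := q :* d :* (a :* y :* (a :* y))) refl q (q ^ f) d y) ,
        ≤-trans (s≤s (≤-trans le (divCount-∣ qs c _ (n∣m*n (q ^ e))))) (≤-reflexive (sym (hit (q ^ e * c) (∣-trans (m∣m*n (q ^ (2 * f))) (m∣m*n c)))))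
    where
    hit : ∀ z → q ∣ z → divCount (q ∷ qs) z ≡ suc (divCount qs z)
    hit z d rewrite ∣⇒rem≡0 z q d = refl

  odd-square : ∀ m → Odd m → ∃[ T ] m * m ≡ 8 * T + 1
  odd-square m o with halves m
  ... | h , inj₁ refl = contradiction (m∣m*n h) o
  ... | h , inj₂ refl with halves h
  ... | g , inj₁ refl = g * (2 * g + 1) , solve 1 (λ g → (con 1 :+ con 2 :* (con 2 :* g)) :* (con 1 :+ con 2 :* (con 2 :* g)) := con 8 :* (g :* (con 2 :* g :+ con 1)) :+ con 1) refl g
  ... | g , inj₂ refl = (2 * g + 1) * (g + 1) , solve 1 (λ g → (con 1 :+ con 2 :* (con 1 :+ con 2 :* g)) :* (con 1 :+ con 2 :* (con 1 :+ con 2 :* g)) := con 8 :* ((con 2 :* g :+ con 1) :* (g :+ con 1)) :+ con 1) refl g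

  mod8 : ∀ D S T → 8 * T + 1 ≡ D * (8 * S + 1) + 4 → D % 8 ≡ 5
  mod8 D S T e = go (D % 8) (m%n<n D 8) (trans (sym lhs) (trans (cong (_% 8) e) rhs))
    where
    lhs : (8 * T + 1) % 8 ≡ 1
    lhs = trans (cong (_% 8) (trans (+-comm (8 * T) 1) (cong (1 +_) (*-comm 8 T)))) ([m+kn]%n≡m%n 1 T 8)
    rhs : (D * (8 * S + 1) + 4) % 8 ≡ (D % 8 + 4) % 8
    rhs = trans (cong (_% 8) (solve 2 (λ D S → D :* (con 8 :* S :+ con 1) :+ con 4 := D :+ con 4 :+ D :* S :* con 8) refl D S))
          (trans ([m+kn]%n≡m%n (D + 4) (D * S) 8) (%-distribˡ-+ D 4 8))
    go : ∀ r → r < 8 → 1 ≡ (r + 4) % 8 → r ≡ 5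
    go 0 _ ()
    go 1 _ ()
    go 2 _ ()
    go 3 _ ()
    go 4 _ ()
    go 5 _ _ = refl
    go 6 _ ()
    go 7 _ ()
    go (suc (suc (suc (suc (suc (suc (suc (suc r)))))))) (s≤s (s≤s (s≤s (s≤s (s≤s (s≤s (s≤s (s≤s ())))))))) _

  pair-bounded : checkSubs ps w 1 ≡ true → ∀ a → Odd a → OK ps w (a * (a + 4)) → a + 2 ≤ bnd
  pair-bounded chk a oa ok with decompose ps ops (a * (a + 4)) (OK.pos ok) (OK.factors ok)
  ... | d , y , j , sp , eq , le = ≮⇒≥ λ lt → <⇒≱ (*-mono-< lt lt) (≤-trans (≤-reflexive (sym pell)) bound)
    where
    m = a + 2
    pell : d * y * y + 4 ≡ m * m
    pell = trans (cong (_+ 4) (trans (*-assoc d y y) (sym eq))) (solve 1 (λ a → a :* (a :+ con 4) :+ con 4 := (a :+ con 2) :* (a :+ con 2)) refl a)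
    om : Odd m
    om x = oa (∣m+n∣m⇒∣n (subst (2 ∣_) (+-comm a 2) x) ∣-refl)
    oz : Odd (a * (a + 4))
    oz = odd-* a (a + 4) oa (odd-term a 1 oa)
    oy : Odd y
    oy x = oz (subst (2 ∣_) (sym eq) (∣-trans x (∣-trans (m∣m*n y) (n∣m*n d))))
    y>0 : 0 < y
    y>0 = n≢0⇒n>0 λ { refl → oy (2 ∣0) }
    d>0 : 0 < d
    d>0 = n≢0⇒n>0 λ { refl → n>0⇒n≢0 (OK.pos ok) eq }
    d8 : d % 8 ≡ 5
    d8 with odd-square m om | odd-square y oy
    ... | T , eT | S , eS = mod8 d S T (trans (sym eT) (trans (sym pell) (cong (_+ 4) (trans (*-assoc d y y) (cong (d *_) eS)))))
    y<m : y < m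
    y<m = ≰⇒> λ le → <⇒≱ (<-≤-trans (m<m+n (d * y * y) {4} z<s) (≤-reflexive pell)) (≤-trans (*-mono-≤ le le) (≤-trans (m≤n*m (y * y) d ⦃ >-nonZero d>0 ⦄) (≤-reflexive (sym (*-assoc d y y)))))
    -- Both m and y are odd, so m = 2x + y. This substitution turns m² - d y² = 4 into x² + xy - c₀
    -- y² = 1.
    half-diff : ∃[ x ] m ≡ 2 * x + y
    half-diff with halves (m ∸ y)
    ... | h , inj₁ e = h , trans (sym (m∸n+n≡m (<⇒≤ y<m))) (cong (_+ y) e)
    ... | h , inj₂ e with halves y
    ... | g , inj₁ refl = contradiction (m∣m*n g) oy
    ... | g , inj₂ refl = contradiction (subst (2 ∣_) (sym (trans (sym (m∸n+n≡m (<⇒≤ y<m))) (trans (cong (_+ y) e) (solve 2 (λ h g → con 1 :+ con 2 :* h :+ (con 1 :+ con 2 :* g) := con 2 :* (con 1 :+ h :+ g)) refl h g)))) (m∣m*n (1 + h + g))) om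
    x = proj₁ half-diff
    c₀ = d / 4
    d≡ : d ≡ 4 * c₀ + 1
    d≡ = trans (m≡m%n+[m/n]*n d 4) (trans (cong₂ _+_ d4 (*-comm c₀ 4)) (+-comm 1 (4 * c₀)))
      where
      d4 : d % 4 ≡ 1
      d4 = trans (cong (_% 4) (m≡m%n+[m/n]*n d 8)) (trans (cong (λ z → (z + d / 8 * 8) % 4) d8)
             (trans (cong (_% 4) (solve 1 (λ q → con 5 :+ q :* con 8 := con 1 :+ (con 1 :+ con 2 :* q) :* con 4) refl (d / 8))) ([m+kn]%n≡m%n 1 (1 + 2 * (d / 8)) 4)))
    rep : Represents1 1 1 0 c₀ x y
    rep = *-cancelˡ-≡ _ _ 4 (+-cancelʳ-≡ (y * y) _ _ (begin
      4 * (1 * x * x + 1 * x * y) + y * y ≡⟨ solve 2 (λ x y → con 4 :* (con 1 :* x :* x :+ con 1 :* x :* y) :+ y :* y := (con 2 :* x :+ y) :* (con 2 :* x :+ y)) refl x y ⟩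
      (2 * x + y) * (2 * x + y) ≡⟨ cong₂ _*_ (sym (proj₂ half-diff)) (sym (proj₂ half-diff)) ⟩
      m * m ≡⟨ sym pell ⟩
      d * y * y + 4 ≡⟨ cong (λ d → d * y * y + 4) d≡ ⟩
      (4 * c₀ + 1) * y * y + 4 ≡⟨ solve 3 (λ c x y → (con 4 :* c :+ con 1) :* y :* y :+ con 4 := con 4 :* (con 1 :+ (c :* y :* y :+ con 0 :* x :* y)) :+ y :* y) refl c₀ x y ⟩
      4 * (1 + (c₀ * y * y + 0 * x * y)) + y * y ∎))
      where open ≡-Reasoning
    bound : d * y * y + 4 ≤ bnd * bnd
    bound = check-sound d x y (subst (λ z → check z ≡ true) (*-identityʳ d) (checkSubs-sound sp w 1 (≤-trans le (OK.few ok)) chk)) d8 d>0 y>0 rep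
      (OK-∣ (subst (d * y ∣_) (trans (*-assoc d y y) (sym eq)) (m∣m*n y)) ok)

-- Counting the prime divisors of the terms

sumTo : (ℕ → ℕ) → ℕ → ℕ
sumTo f zero    = 0
sumTo f (suc k) = f k + sumTo f k

sumTo-+ : ∀ f g k → sumTo (λ i → f i + g i) k ≡ sumTo f k + sumTo g k
sumTo-+ f g zero = refl
sumTo-+ f g (suc k) = trans (cong (f k + g k +_) (sumTo-+ f g k))
  (solve 4 (λ a b c d → a :+ b :+ (c :+ d) := a :+ c :+ (b :+ d)) refl (f k) (g k) (sumTo f k) (sumTo g k))

sumTo-cong : ∀ f g k → (∀ i → f i ≡ g i) → sumTo f k ≡ sumTo g k
sumTo-cong f g zero h = refl
sumTo-cong f g (suc k) h = cong₂ _+_ (h k) (sumTo-cong f g k h)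

sumTo-0 : ∀ k → sumTo (λ _ → 0) k ≡ 0
sumTo-0 zero = refl
sumTo-0 (suc k) = sumTo-0 k

hit : ℕ → ℕ → ℕ → ℕ
hit n p i = if rem (n + 4 * i) p ≡ᵇ 0 then 1 else 0

hit-no : ∀ n p i → ¬ p ∣ n + 4 * i → hit n p i ≡ 0
hit-no n p i h with rem (n + 4 * i) p ≡ᵇ 0 in e
... | true = contradiction (rem≡0⇒∣ _ p (≡ᵇ-true e)) h
... | false = refl

hit≤1 : ∀ n p i → hit n p i ≤ 1
hit≤1 n p i with rem (n + 4 * i) p ≡ᵇ 0
... | true = ≤-refl
... | false = z≤n

sumL : (ℕ → ℕ) → List ℕ → ℕ
sumL f []       = 0
sumL f (x ∷ xs) = f x + sumL f xs

incidences : ∀ n k ps → sumTo (λ i → divCount ps (n + 4 * i)) k ≡ sumL (λ p → sumTo (hit n p) k) ps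
incidences n k [] = sumTo-0 k
incidences n k (p ∷ ps) = trans (sumTo-cong _ (λ i → hit n p i + divCount ps (n + 4 * i)) k one)
  (trans (sumTo-+ (hit n p) (λ i → divCount ps (n + 4 * i)) k) (cong (sumTo (hit n p) k +_) (incidences n k ps)))
  where
  one : ∀ i → divCount (p ∷ ps) (n + 4 * i) ≡ hit n p i + divCount ps (n + 4 * i)
  one i with rem (n + 4 * i) p ≡ᵇ 0
  ... | true = refl
  ... | false = refl

odd-prime∣4* : ∀ {p} → Prime p → Odd p → ∀ j → p ∣ 4 * j → p ∣ j
odd-prime∣4* {p} pp podd j d with euclidsLemma 4 j pp d
... | inj₂ x = x
... | inj₁ x with euclidsLemma 2 2 pp x
... | inj₁ y = contradiction (two y) podd
  where
  two : p ∣ 2 → 2 ∣ p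
  two y with prime⇒irreducible prime[2] y
  ... | inj₁ refl = contradiction (prime>1 pp) λ { (s≤s ()) }
  ... | inj₂ refl = ∣-refl
... | inj₂ y = contradiction (two y) podd
  where
  two : p ∣ 2 → 2 ∣ p
  two y with prime⇒irreducible prime[2] y
  ... | inj₁ refl = contradiction (prime>1 pp) λ { (s≤s ()) }
  ... | inj₂ refl = ∣-refl

hits-gap : ∀ n p K j → Prime p → Odd p → p ∣ n + 4 * K → j < p → sumTo (hit n p) K ≡ sumTo (hit n p) (K ∸ j)
hits-gap n p K zero pp podd d lt = refl
hits-gap n p K (suc j) pp podd d lt = trans (hits-gap n p K j pp podd d (<⇒≤ lt)) (step (K ∸ j) refl)
  where
  step : ∀ r → K ∸ j ≡ r → sumTo (hit n p) r ≡ sumTo (hit n p) (K ∸ suc j)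
  step zero e = cong (sumTo (hit n p)) (sym (trans (sym (pred[m∸n]≡m∸[1+n] K j)) (cong pred e)))
  step (suc r) e = trans (cong (_+ sumTo (hit n p) r) (hit-no n p r no-hit)) (cong (sumTo (hit n p)) (sym (trans (sym (pred[m∸n]≡m∸[1+n] K j)) (cong pred e))))
    where
    j≤K : j ≤ K
    j≤K = <⇒≤ (m∸n≢0⇒n<m λ z → contradiction (trans (sym e) z) (λ ()))
    K≡ : K ≡ r + suc j
    K≡ = trans (sym (m∸n+n≡m j≤K)) (trans (cong (_+ j) e) (sym (+-suc r j)))
    no-hit : ¬ p ∣ n + 4 * r
    no-hit d′ = <⇒≱ lt (∣⇒≤ (odd-prime∣4* pp podd (suc j) (∣m+n∣m⇒∣n (subst (p ∣_) (trans (cong (λ K → n + 4 * K) K≡)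
      (solve 3 (λ n r j → n :+ con 4 :* (r :+ j) := n :+ con 4 :* r :+ con 4 :* j) refl n r (suc j))) d) d′)))

-- As p is odd, 4 is invertible modulo p, and two multiples of p among the terms are at least p
-- places apart. The strict inequality says that there are at most ⌈k / p⌉ of them; the induction
-- removes a hit together with the p - 1 places before it.
hits-bound : ∀ n p → Prime p → Odd p → ∀ k → p * sumTo (hit n p) k < k + p
hits-bound n p pp podd = <-rec _ step
  where
  p>0 : 0 < p
  p>0 = <-trans z<s (prime>1 pp)
  step : ∀ k → (∀ {j} → j < k → p * sumTo (hit n p) j < j + p) → p * sumTo (hit n p) k < k + p
  step zero rec = subst (_< p) (sym (*-zeroʳ p)) p>0
  step (suc K) rec with p ∣? n + 4 * K
  ... | no ¬d rewrite hit-no n p K ¬d = m<n⇒m<1+n (rec ≤-refl)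
  ... | yes d with p ≤? suc K
  ... | yes p≤k = begin-strict
      p * (hit n p K + sumTo (hit n p) K)   ≤⟨ *-monoʳ-≤ p (+-mono-≤ (hit≤1 n p K) (≤-reflexive (trans (hits-gap n p K (pred p) pp podd d (≤-reflexive p≡)) (cong (sumTo (hit n p)) K∸)))) ⟩
      p * suc (sumTo (hit n p) (suc K ∸ p)) ≡⟨ *-suc p _ ⟩
      p + p * sumTo (hit n p) (suc K ∸ p)   <⟨ +-monoʳ-< p (rec (∸-monoʳ-< p>0 p≤k)) ⟩
      p + (suc K ∸ p + p)                   ≡⟨ cong (p +_) (m∸n+n≡m p≤k) ⟩
      p + suc K                             ≡⟨ +-comm p (suc K) ⟩
      suc K + p ∎
    where
    open ≤-Reasoning
    p≡ : suc (pred p) ≡ p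
    p≡ = suc-pred p ⦃ >-nonZero p>0 ⦄
    K∸ : K ∸ pred p ≡ suc K ∸ p
    K∸ = cong (suc K ∸_) p≡
  ... | no p≰k = begin-strict
      p * (hit n p K + sumTo (hit n p) K)   ≤⟨ *-monoʳ-≤ p (+-mono-≤ (hit≤1 n p K) (≤-reflexive (trans (hits-gap n p K K pp podd d (<-trans (n<1+n K) (≰⇒> p≰k))) (cong (sumTo (hit n p)) (n∸n≡0 K))))) ⟩
      p * 1                                 ≡⟨ *-identityʳ p ⟩
      p                                     <⟨ m<n+m p z<s ⟩
      suc K + p ∎
    where open ≤-Reasoning

hits-cap : ℕ → ℕ → ℕ → ℕ
hits-cap b k p = if b <ᵇ p then 0 else ceil k p
  where
  ceil : ℕ → ℕ → ℕ
  ceil k zero    = 0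
  ceil k (suc d) = (k + d) / suc d

hits-capped : ∀ b n k p → Prime p → Odd p → AllSmooth b n k → sumTo (hit n p) k ≤ hits-cap b k p
hits-capped b n k zero pp podd sm = contradiction pp ¬prime[0]
hits-capped b n k p@(suc d) pp podd sm with b <ᵇ p in e
... | true = ≤-reflexive (none k ≤-refl)
  where
  none : ∀ j → j ≤ k → sumTo (hit n p) j ≡ 0
  none zero _ = refl
  none (suc j) le = cong₂ _+_ (hit-no n p j (λ x → <⇒≱ (<ᵇ-true {b} {p} e) (sm j le p pp x))) (none j (<⇒≤ le))
... | false = subst (_≤ (k + d) / p) (m*n/n≡m (sumTo (hit n p) k) p)
     (/-monoˡ-≤ p (s≤s⁻¹ (subst₂ _<_ (*-comm p _) (+-suc k d) (hits-bound n p pp podd k))))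

incidences≤ : ∀ b n k ps → OddPrimes ps → AllSmooth b n k → sumTo (λ i → divCount ps (n + 4 * i)) k ≤ sumL (hits-cap b k) ps
incidences≤ b n k ps ops sm = subst (_≤ sumL (hits-cap b k) ps) (sym (incidences n k ps)) (go ps ops)
  where
  go : ∀ ps → OddPrimes ps → sumL (λ p → sumTo (hit n p) k) ps ≤ sumL (hits-cap b k) ps
  go [] [] = z≤n
  go (p ∷ ps) ((pp , podd) ∷ ops) = +-mono-≤ (hits-capped b n k p pp podd sm) (go ps ops)

-- The pairs (2j , 2j + 1) are disjoint, so if all of them are heavier than w, their weights add up
-- to at least (w + 1) h.
light-pair : ∀ f w h → (∃[ j ] (j < h × f (2 * j) + f (suc (2 * j)) ≤ w)) ⊎ suc w * h ≤ sumTo f (2 * h)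
light-pair f w zero = inj₂ (≤-reflexive (*-zeroʳ w))
light-pair f w (suc h) with light-pair f w h
... | inj₁ (j , j< , le) = inj₁ (j , m<n⇒m<1+n j< , le)
... | inj₂ le with f (2 * h) + f (suc (2 * h)) ≤? w
... | yes le′ = inj₁ (h , ≤-refl , le′)
... | no nle = inj₂ (begin
    suc w * suc h                               ≡⟨ *-suc (suc w) h ⟩
    suc w + suc w * h                           ≤⟨ +-mono-≤ (≰⇒> nle) le ⟩
    f (2 * h) + f (suc (2 * h)) + sumTo f (2 * h) ≡⟨ solve 3 (λ a b c → a :+ b :+ c := b :+ (a :+ c)) refl (f (2 * h)) (f (suc (2 * h))) (sumTo f (2 * h)) ⟩
    sumTo f (2 + 2 * h)                         ≡⟨ cong (sumTo f) (solve 1 (λ h → con 2 :+ con 2 :* h := con 2 :* (con 1 :+ h)) refl h) ⟩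
    sumTo f (2 * suc h) ∎)
  where open ≤-Reasoning

divCount-* : ∀ ps a b → OddPrimes ps → divCount ps (a * b) ≤ divCount ps a + divCount ps b
divCount-* [] a b [] = z≤n
divCount-* (p ∷ ps) a b ((pp , _) ∷ ops) with rem (a * b) p ≡ᵇ 0 in e | rem a p ≡ᵇ 0 in e₁ | rem b p ≡ᵇ 0 in e₂
... | true | true | true = s≤s (≤-trans (divCount-* ps a b ops) (+-monoʳ-≤ (divCount ps a) (n≤1+n _)))
... | true | true | false = s≤s (divCount-* ps a b ops)
... | true | false | true = ≤-trans (s≤s (divCount-* ps a b ops)) (≤-reflexive (sym (+-suc _ _)))
... | false | true | true = m≤n⇒m≤1+n (≤-trans (divCount-* ps a b ops) (+-monoʳ-≤ (divCount ps a) (n≤1+n _)))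
... | false | true | false = m≤n⇒m≤1+n (divCount-* ps a b ops)
... | false | false | true = ≤-trans (divCount-* ps a b ops) (+-monoʳ-≤ (divCount ps a) (n≤1+n _))
... | false | false | false = divCount-* ps a b ops
... | true | false | false with euclidsLemma a b pp (rem≡0⇒∣ (a * b) p (≡ᵇ-true e))
... | inj₁ x = contradiction (∣⇒rem≡0 a p x) (≡ᵇ-false e₁)
... | inj₂ x = contradiction (∣⇒rem≡0 b p x) (≡ᵇ-false e₂)

divCount>0 : ∀ ps z π → π ∈ ps → π ∣ z → 0 < divCount ps z
divCount>0 (p ∷ ps) z π (here refl) d rewrite ∣⇒rem≡0 z π d = z<s
divCount>0 (p ∷ ps) z π (there i) d with rem z p ≡ᵇ 0
... | true = z<s
... | false = divCount>0 ps z π i d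

-- The summand `k % 2` stands for the unpaired last term of a block of odd length: it exceeds 1 and
-- so contributes at least one incidence. The test for k needs this unit of slack included.
pigeonhole? : List ℕ → ℕ → ℕ → Bool
pigeonhole? ps w k = sumL (hits-cap (4 * (k + 1)) k) ps <ᵇ suc w * (k / 2) + k % 2

light-pair-exists : ∀ ps w n k → OddPrimes ps → (∀ p → Prime p → Odd p → p ≤ 4 * (k + 1) → p ∈ ps) → Odd n → 1 < n →
  AllSmooth (4 * (k + 1)) n k → pigeonhole? ps w k ≡ true → ∃[ i ] (suc i < k × OK ps w ((n + 4 * i) * (n + 4 * i + 4)))
light-pair-exists ps w n k ops complete on n>1 sm ph with light-pair (λ i → divCount ps (n + 4 * i)) w (k / 2)
... | inj₁ (j , j< , le) = 2 * j , i< , mkOK (*-mono-< (pos (2 * j)) (≤-trans (pos (2 * j)) (m≤m+n _ 4))) fac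
        (≤-trans (divCount-* ps _ _ ops) (subst (λ z → divCount ps (n + 4 * (2 * j)) + divCount ps z ≤ w) (sym (next (2 * j))) le))
  where
  open ≤-Reasoning
  pos : ∀ i → 0 < n + 4 * i
  pos i = <-≤-trans (<-trans z<s n>1) (m≤m+n n (4 * i))
  next : ∀ i → n + 4 * i + 4 ≡ n + 4 * suc i
  next i = solve 2 (λ n i → n :+ con 4 :* i :+ con 4 := n :+ con 4 :* (con 1 :+ i)) refl n i
  i< : suc (2 * j) < k
  i< = begin-strict
    suc (2 * j)       <⟨ n<1+n _ ⟩
    2 + 2 * j         ≡⟨ solve 1 (λ j → con 2 :+ con 2 :* j := (con 1 :+ j) :* con 2) refl j ⟩
    suc j * 2         ≤⟨ *-monoˡ-≤ 2 j< ⟩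
    k / 2 * 2         ≤⟨ m/n*n≤m k 2 ⟩
    k ∎
  fac : ∀ π → Prime π → π ∣ (n + 4 * (2 * j)) * (n + 4 * (2 * j) + 4) → π ∈ ps
  fac π pπ d with euclidsLemma (n + 4 * (2 * j)) _ pπ d
  ... | inj₁ x = complete π pπ (λ y → odd-term n (2 * j) on (∣-trans y x)) (sm (2 * j) (<⇒≤ i<) π pπ x)
  ... | inj₂ x = complete π pπ (λ y → odd-term n (suc (2 * j)) on (∣-trans y (subst (π ∣_) (next (2 * j)) x)))
                   (sm (suc (2 * j)) i< π pπ (subst (π ∣_) (next (2 * j)) x))
... | inj₂ le = ⊥-elim (<⇒≱ (<ᵇ-true {_} {suc w * (k / 2) + k % 2} ph) (begin
    suc w * (k / 2) + k % 2                               ≤⟨ +-mono-≤ le (last (k % 2) (m%n<n k 2) refl) ⟩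
    sumTo f (2 * (k / 2)) + tail (k % 2)                  ≡⟨ +-comm _ (tail (k % 2)) ⟩
    tail (k % 2) + sumTo f (2 * (k / 2))                  ≡⟨ glue (k % 2) (m%n<n k 2) ⟩
    sumTo f (k % 2 + 2 * (k / 2))                         ≡⟨ cong (sumTo f) (sym k≡) ⟩
    sumTo f k                                             ≤⟨ incidences≤ (4 * (k + 1)) n k ps ops sm ⟩
    sumL (hits-cap (4 * (k + 1)) k) ps                    ∎))
  where
  open ≤-Reasoning
  f : ℕ → ℕ
  f i = divCount ps (n + 4 * i)
  k≡ : k ≡ k % 2 + 2 * (k / 2)
  k≡ = trans (m≡m%n+[m/n]*n k 2) (cong (k % 2 +_) (*-comm (k / 2) 2))
  tail : ℕ → ℕ
  tail zero = 0
  tail (suc _) = f (2 * (k / 2))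
  glue : ∀ r → r < 2 → tail r + sumTo f (2 * (k / 2)) ≡ sumTo f (r + 2 * (k / 2))
  glue zero _ = refl
  glue (suc zero) _ = refl
  glue (suc (suc r)) (s≤s (s≤s ()))
  last : ∀ r → r < 2 → k % 2 ≡ r → r ≤ tail r
  last zero _ _ = z≤n
  last (suc (suc r)) (s≤s (s≤s ())) _
  last (suc zero) _ e with hasPrimeFactor (n + 4 * (2 * (k / 2))) (<-≤-trans n>1 (m≤m+n n _))
  ... | π , pπ , d = divCount>0 ps _ π (complete π pπ (λ y → odd-term n (2 * (k / 2)) on (∣-trans y d))
          (sm (2 * (k / 2)) (≤-reflexive (sym (trans k≡ (cong (_+ 2 * (k / 2)) e)))) π pπ d)) d

-- Blocks with k ≤ 30

-- Trial division that divides out what it finds. Once z < d², the rest z is 1 or the largest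
-- remaining prime, and b < z with b ≥ 1 excludes 1.
largeFactor? : ℕ → ℕ → ℕ → ℕ → Bool
largeFactor? zero    d z b = false
largeFactor? (suc f) d z b =
  if z <ᵇ d * d then b <ᵇ z else (if rem z d ≡ᵇ 0 then largeFactor? f d (quot z d) b else largeFactor? f (2 + d) z b)
  where
  quot : ℕ → ℕ → ℕ
  quot z zero    = z
  quot z (suc d) = z / suc d

largeFactor-sound : ∀ f d z b → 0 < b → Odd z → Odd d → d Rough z → largeFactor? f d z b ≡ true → ∃[ p ] (Prime p × p ∣ z × b < p)
largeFactor-sound (suc f) zero z b b>0 oz od r e = contradiction (2 ∣0) od
largeFactor-sound (suc f) d@(suc d′) z b b>0 oz od r e with z <ᵇ d * d in e₁
... | true = z , rough∧square>⇒prime ⦃ n>1⇒nonTrivial (≤-<-trans b>0 (<ᵇ-true e)) ⦄ r (<ᵇ-true e₁) , ∣-refl , <ᵇ-true e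
... | false with z % d ≡ᵇ 0 in e₂
... | true with m%n≡0⇒n∣m z d (≡ᵇ-true e₂)
... | divides q refl with largeFactor-sound f d (q * d / d) b b>0 oz′ od (rough∧∣⇒rough r q∣) e
  where
  q∣ : q * d / d ∣ q * d
  q∣ = subst (_∣ q * d) (sym (m*n/n≡m q d)) (m∣m*n d)
  oz′ : Odd (q * d / d)
  oz′ x = oz (∣-trans x q∣)
... | p , pp , p∣ , lt = p , pp , ∣-trans p∣ (subst (_∣ q * d) (sym (m*n/n≡m q d)) (m∣m*n d)) , lt
largeFactor-sound (suc f) d@(suc d′) z b b>0 oz od r e | false | false =
  largeFactor-sound f (2 + d) z b b>0 oz (λ x → od (∣m+n∣m⇒∣n x ∣-refl))
    (∤⇒rough-suc (λ x → oz (∣-trans 2∣1+d x)) (∤⇒rough-suc (λ x → ≡ᵇ-false e₂ (n∣m⇒m%n≡0 z d x)) r)) e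
  where
  2∣1+d : 2 ∣ suc d
  2∣1+d with halves d
  ... | h , inj₁ eq = contradiction (subst (2 ∣_) (sym eq) (m∣m*n h)) od
  ... | h , inj₂ eq = subst (2 ∣_) (trans (solve 1 (λ h → con 2 :* (con 1 :+ h) := con 2 :+ con 2 :* h) refl h) (cong suc (sym eq))) (m∣m*n (suc h))

anyBelow : (ℕ → Bool) → ℕ → Bool
anyBelow f zero    = false
anyBelow f (suc k) = f k ∨ anyBelow f k

anyBelow-sound : ∀ f k → anyBelow f k ≡ true → ∃[ i ] (i < k × f i ≡ true)
anyBelow-sound f (suc k) e with f k in e′
... | true = k , ≤-refl , e′
... | false with anyBelow-sound f k e
... | i , i< , fi = i , m<n⇒m<1+n i< , fi

Exceptional : ℕ → ℕ → Set
Exceptional k n = (k ≡ 2 × (n ≡ 11 ⊎ n ≡ 21 ⊎ n ≡ 45 ⊎ n ≡ 77 ⊎ n ≡ 121)) ⊎ (k ≡ 3 × n ≡ 117)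

exceptional? : ℕ → ℕ → Bool
exceptional? k n = ((k ≡ᵇ 2) ∧ elem n (11 ∷ 21 ∷ 45 ∷ 77 ∷ 121 ∷ [])) ∨ ((k ≡ᵇ 3) ∧ (n ≡ᵇ 117))

exceptional?-sound : ∀ k n → exceptional? k n ≡ true → Exceptional k n
exceptional?-sound k n e with ∨-true {(k ≡ᵇ 2) ∧ elem n (11 ∷ 21 ∷ 45 ∷ 77 ∷ 121 ∷ [])} e
... | inj₁ x = inj₁ (≡ᵇ-true (proj₁ (∧-split {k ≡ᵇ 2} x)) , mem (elem-sound n _ (proj₂ (∧-split {k ≡ᵇ 2} x))))
  where
  mem : n ∈ 11 ∷ 21 ∷ 45 ∷ 77 ∷ 121 ∷ [] → n ≡ 11 ⊎ n ≡ 21 ⊎ n ≡ 45 ⊎ n ≡ 77 ⊎ n ≡ 121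
  mem (here e) = inj₁ e
  mem (there (here e)) = inj₂ (inj₁ e)
  mem (there (there (here e))) = inj₂ (inj₂ (inj₁ e))
  mem (there (there (there (here e)))) = inj₂ (inj₂ (inj₂ (inj₁ e)))
  mem (there (there (there (there (here e))))) = inj₂ (inj₂ (inj₂ (inj₂ e)))
... | inj₂ y = inj₂ (≡ᵇ-true (proj₁ (∧-split {k ≡ᵇ 3} y)) , ≡ᵇ-true (proj₂ (∧-split {k ≡ᵇ 3} y)))

blockOK? : ℕ → ℕ → ℕ → Bool
blockOK? f k n = even? n ∨ ((n <ᵇ suc (4 * k)) ∨ (exceptional? k n ∨ anyBelow (λ i → largeFactor? f 3 (n + 4 * i) (4 * (k + 1))) k))

blockOK-sound : ∀ f k n → blockOK? f k n ≡ true → Odd n → 4 * k < n → ¬ Exceptional k n → ¬ AllSmooth (4 * (k + 1)) n k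
blockOK-sound f k n e on n> nex sm with ∨-true {even? n} e
... | inj₁ x = on (even?⇒∣ n x)
... | inj₂ e₁ with ∨-true {n <ᵇ suc (4 * k)} e₁
... | inj₁ x = <⇒≱ n> (s≤s⁻¹ (<ᵇ-true {n} x))
... | inj₂ e₂ with ∨-true {exceptional? k n} e₂
... | inj₁ x = nex (exceptional?-sound k n x)
... | inj₂ e₃ with anyBelow-sound _ k e₃
... | i , i< , lf with largeFactor-sound f 3 (n + 4 * i) (4 * (k + 1)) (subst (0 <_) (cong (4 *_) (+-comm 1 k)) z<s) (odd-term n i on) odd3 (∤⇒rough-suc (odd-term n i on) 2-rough) lf
... | p , pp , p∣ , lt = <⇒≱ lt (sm i i< p pp p∣)

module SmallK (ps S I : List ℕ) (w fuel rankFuel bnd f : ℕ) (ops : OddPrimes ps)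
              (S-complete : ∀ s → Prime s → s ≤ rankFuel → s ∈ S)
              (pell : Check.checkSubs ps S I w fuel rankFuel bnd ps w 1 ≡ true) where
  open CheckSound ps S I w fuel rankFuel bnd ops S-complete

  not-smooth : ∀ k n → (∀ p → Prime p → Odd p → p ≤ 4 * (k + 1) → p ∈ ps) → pigeonhole? ps w k ≡ true → allBelow (blockOK? f k) bnd ≡ true →
    Odd n → 4 * k < n → ¬ Exceptional k n → 1 < n → ¬ AllSmooth (4 * (k + 1)) n k
  not-smooth k n complete ph blocks on n> nex n>1 sm with light-pair-exists ps w n k ops complete on n>1 sm ph
  ... | i , i< , ok = blockOK-sound f k n (allBelow-sound _ bnd blocks n n<) on n> nex sm
    where
    n< : n < bnd
    n< = ≤-trans (m<m+n n {2} z<s) (≤-trans (+-monoˡ-≤ 2 (m≤m+n n (4 * i))) (pair-bounded pell (n + 4 * i) (odd-term n i on) ok))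

allFrom : (ℕ → Bool) → ℕ → ℕ → Bool
allFrom f a zero    = true
allFrom f a (suc l) = f a ∧ allFrom f (suc a) l

allFrom-sound : ∀ f a l → allFrom f a l ≡ true → ∀ i → a ≤ i → i < a + l → f i ≡ true
allFrom-sound f a zero e i a≤ i< = contradiction (<-≤-trans i< (≤-trans (≤-reflexive (+-identityʳ a)) a≤)) (<-irrefl refl)
allFrom-sound f a (suc l) e i a≤ i< with a ≟ i
... | yes refl = proj₁ (∧-split e)
... | no ne = allFrom-sound f (suc a) l (proj₂ (∧-split {f a} e)) i (≤∧≢⇒< a≤ ne) (subst (i <_) (+-suc a l) i<)

oddPrimesTo-odd : ∀ b → OddPrimes (oddPrimesTo b)
oddPrimesTo-odd b = All.map (λ (a , b , _) → a , b) (oddPrimesTo-prime b)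

smallK? : ℕ → ℕ → ℕ → ℕ → ℕ → ℕ → Bool
smallK? b w bnd f a l = allFrom (λ k → pigeonhole? (oddPrimesTo b) w k ∧ allBelow (blockOK? f k) bnd) a l

smallK-not-smooth : ∀ b w fuel rankFuel bnd f I a l →
  Check.checkSubs (oddPrimesTo b) (rankPrimes rankFuel) I w fuel rankFuel bnd (oddPrimesTo b) w 1 ≡ true →
  smallK? b w bnd f a l ≡ true → ∀ k n → a ≤ k → k < a + l → 4 * (k + 1) ≤ b →
  Odd n → 4 * k < n → ¬ Exceptional k n → 1 < n → ¬ AllSmooth (4 * (k + 1)) n k
smallK-not-smooth b w fuel rankFuel bnd f I a l pell chk k n a≤ k< kb
  with ∧-split {pigeonhole? (oddPrimesTo b) w k} (allFrom-sound _ a l chk k a≤ k<)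
... | ph , bl = SmallK.not-smooth (oddPrimesTo b) (rankPrimes rankFuel) I w fuel rankFuel bnd f (oddPrimesTo-odd b) (rankPrimes-complete rankFuel) pell
      k n (λ p pp podd le → oddPrimesTo-complete b p pp podd (≤-trans le kb)) ph bl

-- For k ≤ 7 some adjacent pair of terms involves at most 4 primes, otherwise at most 3. All primes concerned are ≤ 113, so
-- they divide some U_ρ with ρ ≤ 114; I lists the indices that occur, and 6891 bounds a + 2 for all a with a (a + 4) of this kind.
pell-4 : Check.checkSubs (oddPrimesTo 32) (rankPrimes 114) (1 ∷ 2 ∷ 4 ∷ 5 ∷ 7 ∷ []) 4 10000 114 6891 (oddPrimesTo 32) 4 1 ≡ true
pell-4 = refl

pell-3 : Check.checkSubs (oddPrimesTo 124) (rankPrimes 114) (1 ∷ 2 ∷ 4 ∷ 5 ∷ 7 ∷ []) 3 10000 114 6891 (oddPrimesTo 124) 3 1 ≡ true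
pell-3 = refl

blocks-4 : smallK? 32 4 6891 200 2 6 ≡ true
blocks-4 = refl

blocks-3 : smallK? 124 3 6891 200 8 23 ≡ true
blocks-3 = refl

not-smooth-k≤30 : ∀ k n → 2 ≤ k → k ≤ 30 → Odd n → 4 * k < n → ¬ Exceptional k n → ¬ AllSmooth (4 * (k + 1)) n k
not-smooth-k≤30 k n k≥2 k≤30 on n> nex with k ≤? 7
... | yes k≤7 = smallK-not-smooth 32 4 10000 114 6891 200 (1 ∷ 2 ∷ 4 ∷ 5 ∷ 7 ∷ []) 2 6 pell-4 blocks-4 k n k≥2 (s≤s k≤7) (*-monoʳ-≤ 4 (+-monoˡ-≤ 1 k≤7)) on n> nex n>1
  where
  n>1 : 1 < n
  n>1 = ≤-<-trans (≤-trans (<⇒≤ k≥2) (m≤n*m k 4)) n>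
... | no k≰7 = smallK-not-smooth 124 3 10000 114 6891 200 (1 ∷ 2 ∷ 4 ∷ 5 ∷ 7 ∷ []) 8 23 pell-3 blocks-3 k n (≰⇒> k≰7) (s≤s k≤30) (*-monoʳ-≤ 4 (+-monoˡ-≤ 1 k≤30)) on n> nex n>1
  where
  n>1 : 1 < n
  n>1 = ≤-<-trans (≤-trans (<⇒≤ k≥2) (m≤n*m k 4)) n>

-- Chebyshev bounds for the primes in a class modulo 4

dv : ℕ → ℕ → ℕ
dv q m = if rem m q ≡ᵇ 0 then 1 else 0

dv-yes : ∀ q m → q ∣ m → dv q m ≡ 1
dv-yes q m d rewrite ∣⇒rem≡0 m q d = refl

dv-no : ∀ q m → ¬ q ∣ m → dv q m ≡ 0
dv-no q m h with rem m q ≡ᵇ 0 in e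
... | true = contradiction (rem≡0⇒∣ m q (≡ᵇ-true e)) h
... | false = refl

dv-⇔ : ∀ q m m′ → (q ∣ m → q ∣ m′) → (q ∣ m′ → q ∣ m) → dv q m ≡ dv q m′
dv-⇔ q m m′ f g with q ∣? m
... | yes d = trans (dv-yes q m d) (sym (dv-yes q m′ (f d)))
... | no ¬d = trans (dv-no q m ¬d) (sym (dv-no q m′ (¬d ∘ g)))

-- The p-adic valuation of m, provided it is at most J.
val : ℕ → ℕ → ℕ → ℕ
val J p m = sumTo (λ j → dv (p ^ suc j) m) J

p^∣⇒≤ : ∀ {p} → Prime p → ∀ j e c → ¬ p ∣ c → p ^ j ∣ p ^ e * c → j ≤ e
p^∣⇒≤ pp zero e c _ _ = z≤n
p^∣⇒≤ {p} pp (suc j) zero c ¬d d = contradiction (∣-trans (m∣m*n (p ^ j)) (subst (p ^ suc j ∣_) (+-identityʳ c) d)) ¬d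
p^∣⇒≤ {p} pp (suc j) (suc e) c ¬d d = s≤s (p^∣⇒≤ pp j e c ¬d (*-cancelˡ-∣ p ⦃ prime⇒nonZero pp ⦄ (subst (p ^ suc j ∣_) (*-assoc p (p ^ e) c) d)))

val-exact : ∀ {p} → Prime p → ∀ J e c → ¬ p ∣ c → val J p (p ^ e * c) ≡ J ⊓ e
val-exact pp zero e c ¬d = refl
val-exact {p} pp (suc J) e c ¬d with suc J ≤? e
... | yes le = trans (cong₂ _+_ (dv-yes (p ^ suc J) _ (∣-trans (^-∣-^ p {suc J} {e} le) (m∣m*n c))) (trans (val-exact pp J e c ¬d) (m≤n⇒m⊓n≡m (<⇒≤ le)))) (sym (m≤n⇒m⊓n≡m le))
... | no nle = trans (cong₂ _+_ (dv-no (p ^ suc J) _ (λ d → nle (p^∣⇒≤ pp (suc J) e c ¬d d))) (trans (val-exact pp J e c ¬d) (m≥n⇒m⊓n≡n (s≤s⁻¹ (≰⇒> nle))))) (sym (m≥n⇒m⊓n≡n (<⇒≤ (≰⇒> nle))))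

coprime-power : ∀ {p q} → Prime p → Prime q → p ≢ q → ∀ e → ¬ q ∣ p ^ e
coprime-power {p} {q} pp pq ne e d with prime⇒irreducible pp (prime∣^⇒∣ pq p e d)
... | inj₁ refl = contradiction pq ¬prime[1]
... | inj₂ refl = ne refl

coprime-part : ∀ {q} → Prime q → ∀ a j c → ¬ q ∣ a → q ^ j ∣ a * c → q ^ j ∣ c
coprime-part pq a zero c ¬d d = 1∣ c
coprime-part {q} pq a (suc j) c ¬d d with euclidsLemma a c pq (∣-trans (m∣m*n (q ^ j)) d)
... | inj₁ x = contradiction x ¬d
... | inj₂ (divides r refl) = subst (q ^ suc j ∣_) (*-comm q r) (*-monoʳ-∣ q (coprime-part pq a j r ¬d
        (*-cancelˡ-∣ q ⦃ prime⇒nonZero pq ⦄ (subst (q ^ suc j ∣_) (solve 3 (λ a r q → a :* (r :* q) := q :* (a :* r)) refl a r q) d))))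

val-coprime : ∀ {q} → Prime q → ∀ J a c → ¬ q ∣ a → val J q (a * c) ≡ val J q c
val-coprime {q} pq J a c ¬d = sumTo-cong _ _ J (λ j → dv-⇔ (q ^ suc j) _ _ (coprime-part pq a (suc j) c ¬d) (λ d → ∣-trans d (n∣m*n a)))

prodOver-cong : ∀ t E F b → (∀ p → p ≤ b → t p ≡ true → E p ≡ F p) → prodOver t E b ≡ prodOver t F b
prodOver-cong t E F zero h = refl
prodOver-cong t E F (suc b) h with t (suc b) in e
... | true = cong₂ _*_ (h (suc b) ≤-refl e) (prodOver-cong t E F b (λ p le → h p (m≤n⇒m≤1+n le)))
... | false = prodOver-cong t E F b (λ p le → h p (m≤n⇒m≤1+n le))

prodOver-mono : ∀ t E F b → (∀ p → p ≤ b → t p ≡ true → E p ≤ F p) → prodOver t E b ≤ prodOver t F b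
prodOver-mono t E F zero h = ≤-refl
prodOver-mono t E F (suc b) h with t (suc b) in e
... | true = *-mono-≤ (h (suc b) ≤-refl e) (prodOver-mono t E F b (λ p le → h p (m≤n⇒m≤1+n le)))
... | false = prodOver-mono t E F b (λ p le → h p (m≤n⇒m≤1+n le))

prodOver-* : ∀ t E F b → prodOver t (λ p → E p * F p) b ≡ prodOver t E b * prodOver t F b
prodOver-* t E F zero = refl
prodOver-* t E F (suc b) with t (suc b)
... | true = trans (cong (E (suc b) * F (suc b) *_) (prodOver-* t E F b))
      (solve 4 (λ a b c d → a :* b :* (c :* d) := a :* c :* (b :* d)) refl (E (suc b)) (F (suc b)) (prodOver t E b) (prodOver t F b))
... | false = prodOver-* t E F b

prodOver-1 : ∀ t b → prodOver t (λ _ → 1) b ≡ 1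
prodOver-1 t zero = refl
prodOver-1 t (suc b) with t (suc b)
... | true = trans (*-identityˡ _) (prodOver-1 t b)
... | false = prodOver-1 t b

n<2^n : ∀ n → n < 2 ^ n
n<2^n zero = z<s
n<2^n (suc n) = ≤-trans (s≤s (n<2^n n)) (≤-trans (+-monoˡ-≤ (2 ^ n) (m^n>0 2 n)) (≤-reflexive (cong (2 ^ n +_) (sym (+-identityʳ (2 ^ n))))))

exponent-bound : ∀ {p} → Prime p → ∀ e c → 0 < c → e ≤ p ^ e * c
exponent-bound {p} pp e c c>0 = ≤-trans (<⇒≤ (n<2^n e)) (≤-trans (^-monoˡ-≤ e (prime>1 pp)) (m≤m*n (p ^ e) c ⦃ >-nonZero c>0 ⦄))

-- The cap J on valuations is harmless because an exponent in m is at most m ≤ J. A common cap lets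
-- the valuations of all factors of a product be summed over the same range of powers.
factorization : ∀ J b m → 0 < m → Odd m → m ≤ J → Smooth b m → m ≡ prodOver oddPrime? (λ p → p ^ val J p m) b
factorization J zero m m>0 om m≤J s = smooth-0 m>0 (λ p pp d → ≤-trans (s p pp d) z≤n)
factorization J (suc b) m m>0 om m≤J s with oddPrime? (suc b) in e
... | false = factorization J b m m>0 om m≤J (λ p pp d → s≤s⁻¹ (≤∧≢⇒< (s p pp d)
        (λ { refl → contradiction (trans (sym e) (oddPrime?-complete p pp (λ x → om (∣-trans x d)))) (λ ()) })))
... | true with split (suc b) m (prime>1 (oddPrime?-sound (suc b) e)) m>0
... | mkSplit f c refl cop = begin
    P ^ f * c ≡⟨ cong₂ (λ z w → P ^ z * w) (sym (trans (val-exact pP J f c cop) (m≥n⇒m⊓n≡n (≤-trans (exponent-bound pP f c c>0) m≤J))))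
                 (factorization J b c c>0 (λ x → om (∣-trans x (n∣m*n (P ^ f)))) (≤-trans (m≤n*m c (P ^ f) ⦃ m^n≢0 P f ⦄) m≤J)
                   (λ p pp d → s≤s⁻¹ (≤∧≢⇒< (s p pp (∣-trans d (n∣m*n (P ^ f)))) (λ { refl → cop d })))) ⟩
    P ^ val J P (P ^ f * c) * prodOver oddPrime? (λ p → p ^ val J p c) b
      ≡⟨ cong (P ^ val J P (P ^ f * c) *_) (prodOver-cong oddPrime? _ _ b (λ p p≤b tp → cong (p ^_)
           (sym (val-coprime (oddPrime?-sound p tp) J (P ^ f) c (coprime-power pP (oddPrime?-sound p tp) (λ z → <⇒≱ (s≤s p≤b) (≤-reflexive z)) f))))) ⟩
    P ^ val J P (P ^ f * c) * prodOver oddPrime? (λ p → p ^ val J p (P ^ f * c)) b ∎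
  where
  open ≡-Reasoning
  P = suc b
  pP : Prime P
  pP = oddPrime?-sound (suc b) e
  c>0 : 0 < c
  c>0 = n≢0⇒n>0 λ { refl → cop (P ∣0) }

prodTo : (ℕ → ℕ) → ℕ → ℕ
prodTo h zero    = 1
prodTo h (suc Y) = h (suc Y) * prodTo h Y

record OddFamily (h : ℕ → ℕ) : Set where
  field
    pos : ∀ m → 0 < h (suc m)
    odd : ∀ m → Odd (h (suc m))
    le  : ∀ m → h (suc m) ≤ suc m

prodTo-val : ∀ h X Y → OddFamily h → Y ≤ X → prodTo h Y ≡ prodOver oddPrime? (λ p → p ^ sumTo (λ i → val X p (h (suc i))) Y) X
prodTo-val h X zero of le = sym (prodOver-1 oddPrime? X)
prodTo-val h X (suc Y) of le = trans (cong₂ _*_ (factorization X X (h (suc Y)) (OddFamily.pos of Y) (OddFamily.odd of Y) h≤ (λ p pp d → ≤-trans (∣⇒≤ ⦃ >-nonZero (OddFamily.pos of Y) ⦄ d) h≤)) (prodTo-val h X Y of (<⇒≤ le)))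
  (trans (sym (prodOver-* oddPrime? _ _ X)) (prodOver-cong oddPrime? _ _ X (λ p _ _ → sym (^-distribˡ-+-* p (val X p (h (suc Y))) _))))
  where
  h≤ : h (suc Y) ≤ X
  h≤ = ≤-trans (OddFamily.le of Y) le

sumTo-swap : ∀ (f : ℕ → ℕ → ℕ) a b → sumTo (λ i → sumTo (f i) b) a ≡ sumTo (λ j → sumTo (λ i → f i j) a) b
sumTo-swap f zero b = sym (sumTo-0 b)
sumTo-swap f (suc a) b = trans (cong (sumTo (f a) b +_) (sumTo-swap f a b)) (sym (sumTo-+ (f a) (λ j → sumTo (λ i → f i j) a) b))

sumTo-mono : ∀ f g k → (∀ i → f i ≤ g i) → sumTo f k ≤ sumTo g k
sumTo-mono f g zero h = z≤n
sumTo-mono f g (suc k) h = +-mono-≤ (h k) (sumTo-mono f g k h)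

ind : Bool → ℕ
ind b = if b then 1 else 0

-- Only the multiples of q contribute.
sum-multiples : ∀ q′ (g : ℕ → ℕ) Y → let q = suc q′ in sumTo (λ i → dv q (suc i) * g (suc i)) Y ≡ sumTo (λ c → g (suc c * q)) (Y / q)
sum-multiples q′ g zero = cong (sumTo (λ c → g (suc c * suc q′))) (sym (0/n≡0 (suc q′)))
sum-multiples q′ g (suc Y) with suc q′ ∣? suc Y
... | no ¬d = trans (cong (λ z → z * g (suc Y) + sumTo (λ i → dv (suc q′) (suc i) * g (suc i)) Y) (dv-no (suc q′) (suc Y) ¬d)) (trans (sum-multiples q′ g Y) (cong (sumTo (λ c → g (suc c * suc q′))) (sym same)))
  where
  same : suc Y / suc q′ ≡ Y / suc q′
  same = trans (+-distrib-/ 1 Y lt) (cong (_+ Y / suc q′) (m<n⇒m/n≡0 1<q))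
    where
    1<q : 1 < suc q′
    1<q = s≤s (n≢0⇒n>0 λ { refl → ¬d (1∣ suc Y) })
    lt : 1 % suc q′ + Y % suc q′ < suc q′
    lt = subst (λ z → z + Y % suc q′ < suc q′) (sym (m<n⇒m%n≡m 1<q)) (≤∧≢⇒< (m%n<n Y (suc q′))
      (λ z → ¬d (m%n≡0⇒n∣m (suc Y) (suc q′) (trans (%-distribˡ-+ 1 Y (suc q′)) (trans (cong (λ w → (w + Y % suc q′) % suc q′) (m<n⇒m%n≡m 1<q)) (trans (cong (_% suc q′) z) (n%n≡0 (suc q′))))))))
... | yes (divides zero ())
... | yes (divides (suc c) eq) = trans (cong₂ (λ z w → z * g (suc Y) + w) (dv-yes (suc q′) (suc Y) (divides (suc c) eq)) (sum-multiples q′ g Y))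
   (trans (cong₂ _+_ (trans (+-identityʳ (g (suc Y))) (cong g eq)) (cong (sumTo (λ c → g (suc c * suc q′))) Y/)) (cong (sumTo (λ c → g (suc c * suc q′))) (sym 1+Y/)))
  where
  1+Y/ : suc Y / suc q′ ≡ suc c
  1+Y/ = trans (cong (_/ suc q′) eq) (m*n/n≡m (suc c) (suc q′))
  Y≡ : Y ≡ q′ + c * suc q′
  Y≡ = suc-injective eq
  Y/ : Y / suc q′ ≡ c
  Y/ = trans (cong (_/ suc q′) Y≡) (trans (+-distrib-/-∣ʳ q′ (n∣m*n c)) (cong₂ _+_ (m<n⇒m/n≡0 (n<1+n q′)) (m*n/n≡m c (suc q′))))

OddClass : ℕ → Set
OddClass a = a ≡ 1 ⊎ a ≡ 3

inClass : ℕ → ℕ → ℕ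
inClass a m = if m % 4 ≡ᵇ a then m else 1

cnt4 : ℕ → ℕ → ℕ
cnt4 r z = sumTo (λ c → ind (suc c % 4 ≡ᵇ r)) z

cnt4-+4 : ∀ r → OddClass r → ∀ z → cnt4 r (4 + z) ≡ suc (cnt4 r z)
cnt4-+4 r cr z = trans (solve 5 (λ a b c d e → a :+ (b :+ (c :+ (d :+ e))) := a :+ b :+ c :+ d :+ e) refl (t 4) (t 3) (t 2) (t 1) (cnt4 r z))
   (cong (_+ cnt4 r z) (trans (cong₂ _+_ (cong₂ _+_ (cong₂ _+_ (t≡ 4) (t≡ 3)) (t≡ 2)) (t≡ 1)) (cycle4 (z % 4) (m%n<n z 4) r cr)))
  where
  t : ℕ → ℕ
  t i = ind ((i + z) % 4 ≡ᵇ r)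
  t≡ : ∀ i → t i ≡ ind ((i + z % 4) % 4 ≡ᵇ r)
  t≡ i = cong (λ w → ind (w ≡ᵇ r)) (trans (%-distribˡ-+ i z 4) (trans (cong (λ w → (i % 4 + w) % 4) (sym (m%n%n≡m%n z 4))) (sym (%-distribˡ-+ i (z % 4) 4))))
  cycle4 : ∀ s → s < 4 → ∀ r → OddClass r → ind ((4 + s) % 4 ≡ᵇ r) + ind ((3 + s) % 4 ≡ᵇ r) + ind ((2 + s) % 4 ≡ᵇ r) + ind ((1 + s) % 4 ≡ᵇ r) ≡ 1
  cycle4 0 _ _ (inj₁ refl) = refl
  cycle4 0 _ _ (inj₂ refl) = refl
  cycle4 1 _ _ (inj₁ refl) = refl
  cycle4 1 _ _ (inj₂ refl) = refl
  cycle4 2 _ _ (inj₁ refl) = refl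
  cycle4 2 _ _ (inj₂ refl) = refl
  cycle4 3 _ _ (inj₁ refl) = refl
  cycle4 3 _ _ (inj₂ refl) = refl
  cycle4 (suc (suc (suc (suc s)))) (s≤s (s≤s (s≤s (s≤s ())))) _ _

cnt4-+4* : ∀ r → OddClass r → ∀ i z → cnt4 r (4 * i + z) ≡ i + cnt4 r z
cnt4-+4* r cr zero z = refl
cnt4-+4* r cr (suc i) z = trans (cong (cnt4 r) (solve 2 (λ i z → con 4 :* (con 1 :+ i) :+ z := con 4 :+ (con 4 :* i :+ z)) refl i z))
  (trans (cnt4-+4 r cr (4 * i + z)) (cong suc (cnt4-+4* r cr i z)))

-- The weights 1, −1, −1, −1, −1 at the scales 1, 1/3, 1/5, 1/15, 1/10 have period 60.
covers : ∀ r s → OddClass r → OddClass s → (f : ℕ → ℕ) → (∀ z → f (60 + z) ≡ 0) →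
  (∀ z → z < 60 → f z + (cnt4 s (z / 3) + (cnt4 r (z / 5) + (cnt4 r (z / 15) + z / 10))) ≤ cnt4 r z) →
  ∀ z → f z + (cnt4 s (z / 3) + (cnt4 r (z / 5) + (cnt4 r (z / 15) + z / 10))) ≤ cnt4 r z
covers r s cr cs f f0 base = <-rec _ step
  where
  step : ∀ z → (∀ {y} → y < z → f y + (cnt4 s (y / 3) + (cnt4 r (y / 5) + (cnt4 r (y / 15) + y / 10))) ≤ cnt4 r y) →
         f z + (cnt4 s (z / 3) + (cnt4 r (z / 5) + (cnt4 r (z / 15) + z / 10))) ≤ cnt4 r z
  step z rec with z <? 60
  ... | yes lt = base z lt
  ... | no nlt = subst (λ z → f z + (cnt4 s (z / 3) + (cnt4 r (z / 5) + (cnt4 r (z / 15) + z / 10))) ≤ cnt4 r z) z≡ (begin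
      f (60 + y) + (cnt4 s ((60 + y) / 3) + (cnt4 r ((60 + y) / 5) + (cnt4 r ((60 + y) / 15) + (60 + y) / 10)))
        ≡⟨ cong₂ _+_ (f0 y) (cong₂ _+_ (cong (cnt4 s) (sh 20 3)) (cong₂ _+_ (cong (cnt4 r) (sh 12 5)) (cong₂ _+_ (cong (cnt4 r) (sh 4 15)) (sh 6 10)))) ⟩
      cnt4 s (20 + y / 3) + (cnt4 r (12 + y / 5) + (cnt4 r (4 + y / 15) + (6 + y / 10)))
        ≡⟨ cong₂ _+_ (cnt4-+4* s cs 5 (y / 3)) (cong₂ _+_ (cnt4-+4* r cr 3 (y / 5)) (cong₂ _+_ (cnt4-+4* r cr 1 (y / 15)) refl)) ⟩
      5 + cnt4 s (y / 3) + (3 + cnt4 r (y / 5) + (1 + cnt4 r (y / 15) + (6 + y / 10)))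
        ≡⟨ solve 4 (λ a b c d → con 5 :+ a :+ (con 3 :+ b :+ (con 1 :+ c :+ (con 6 :+ d))) := con 15 :+ (a :+ (b :+ (c :+ d)))) refl (cnt4 s (y / 3)) (cnt4 r (y / 5)) (cnt4 r (y / 15)) (y / 10) ⟩
      15 + (cnt4 s (y / 3) + (cnt4 r (y / 5) + (cnt4 r (y / 15) + y / 10)))  ≤⟨ +-monoʳ-≤ 15 (≤-trans (m≤n+m _ (f y)) (rec y<)) ⟩
      15 + cnt4 r y                                                    ≡⟨ sym (cnt4-+4* r cr 15 y) ⟩
      cnt4 r (60 + y) ∎)
    where
    open ≤-Reasoning
    y = z ∸ 60
    z≡ : 60 + y ≡ z
    z≡ = m+[n∸m]≡n (≮⇒≥ nlt)
    y< : y < z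
    y< = subst (y <_) z≡ (m<n+m y {60} z<s)
    sh : ∀ i d .⦃ _ : NonZero d ⦄ → (i * d + y) / d ≡ i + y / d
    sh i d = trans (+-distrib-/-∣ˡ y (n∣m*n i)) (cong (_+ y / d) (m*n/n≡m i d))

-- The quotients z = ⌊X / q⌋ from 1 to 8, that is X/9 < q ≤ X: here the periodic combination is at
-- least 1 and not merely nonnegative.
near : ℕ → Bool
near z = (0 <ᵇ z) ∧ (z <ᵇ 9)

covers? : ℕ → ℕ → (ℕ → ℕ) → ℕ → Bool
covers? r s f z = f z + (cnt4 s (z / 3) + (cnt4 r (z / 5) + (cnt4 r (z / 15) + z / 10))) <ᵇ suc (cnt4 r z)

covers-1 : ∀ z → ind (near z) + (cnt4 3 (z / 3) + (cnt4 1 (z / 5) + (cnt4 1 (z / 15) + z / 10))) ≤ cnt4 1 z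
covers-1 = covers 1 3 (inj₁ refl) (inj₂ refl) (λ z → ind (near z)) (λ z → refl)
  (λ z z< → s≤s⁻¹ (<ᵇ-true {_} {suc (cnt4 1 z)} (allBelow-sound (covers? 1 3 (λ z → ind (near z))) 60 refl z z<)))

covers-3 : ∀ z → cnt4 1 (z / 3) + (cnt4 3 (z / 5) + (cnt4 3 (z / 15) + z / 10)) ≤ cnt4 3 z
covers-3 = covers 3 1 (inj₂ refl) (inj₁ refl) (λ _ → 0) (λ z → refl)
  (λ z z< → s≤s⁻¹ (<ᵇ-true {_} {suc (cnt4 3 z)} (allBelow-sound (covers? 3 1 (λ _ → 0)) 60 refl z z<)))

odd%4 : ∀ m → Odd m → OddClass (m % 4)
odd%4 m om = go (m % 4) (m%n<n m 4) refl
  where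
  ev : ∀ r → 2 ∣ r → m % 4 ≡ r → ⊥
  ev r d e = om (subst (2 ∣_) (sym (trans (m≡m%n+[m/n]*n m 4) (cong (_+ m / 4 * 4) e))) (∣m∣n⇒∣m+n d (∣-trans (divides 2 refl) (n∣m*n (m / 4)))))
  go : ∀ r → r < 4 → m % 4 ≡ r → OddClass r
  go 0 _ e = ⊥-elim (ev 0 (2 ∣0) e)
  go 1 _ e = inj₁ refl
  go 2 _ e = ⊥-elim (ev 2 ∣-refl e)
  go 3 _ e = inj₂ refl
  go (suc (suc (suc (suc r)))) (s≤s (s≤s (s≤s (s≤s ())))) _

%4-class-odd : ∀ m a → OddClass a → m % 4 ≡ a → Odd m
%4-class-odd m a ca e d = go a ca (n∣m⇒m%n≡0 a 2 (subst (2 ∣_) e (m%n-even)))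
  where
  m%n-even : 2 ∣ m % 4
  m%n-even = ∣m+n∣m⇒∣n (subst (2 ∣_) (trans (m≡m%n+[m/n]*n m 4) (+-comm (m % 4) _)) d) (∣-trans (divides 2 refl) (n∣m*n (m / 4)))
  go : ∀ a → OddClass a → a % 2 ≡ 0 → ⊥
  go _ (inj₁ refl) ()
  go _ (inj₂ refl) ()

other : ℕ → ℕ
other a = 4 ∸ a

other-class : ∀ {a} → OddClass a → OddClass (other a)
other-class (inj₁ refl) = inj₂ refl
other-class (inj₂ refl) = inj₁ refl

inClass-family : ∀ a → OddClass a → OddFamily (inClass a)
inClass-family a ca = record { pos = p ; odd = o ; le = l }
  where
  p : ∀ m → 0 < inClass a (suc m)
  p m with suc m % 4 ≡ᵇ a
  ... | true = z<s
  ... | false = z<s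
  o : ∀ m → Odd (inClass a (suc m))
  o m with suc m % 4 ≡ᵇ a in e
  ... | true = %4-class-odd (suc m) a ca (≡ᵇ-true e)
  ... | false = odd1
  l : ∀ m → inClass a (suc m) ≤ suc m
  l m with suc m % 4 ≡ᵇ a
  ... | true = ≤-refl
  ... | false = s≤s z≤n

record TwoSplit (m : ℕ) : Set where
  field
    s   : ℕ
    eq  : m ≡ 2 ^ s * oddPart m
    odd : Odd (oddPart m)

oddPart-split : ∀ m → 0 < m → TwoSplit m
oddPart-split = <-rec _ step
  where
  step : ∀ m → (∀ {y} → y < m → 0 < y → TwoSplit y) → 0 < m → TwoSplit m
  step m rec m>0 with halves m
  ... | h , inj₂ refl = record { s = 0 ; eq = sym (trans (+-identityʳ _) (oddPart-odd h)) ; odd = subst Odd (sym (oddPart-odd h))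
          (λ d → odd1 (∣m+n∣m⇒∣n (subst (2 ∣_) (+-comm 1 (2 * h)) d) (m∣m*n h))) }
  ... | zero , inj₁ refl = contradiction m>0 (λ ())
  ... | suc h , inj₁ refl = record { s = suc (TwoSplit.s r)
        ; eq = trans (cong (2 *_) (TwoSplit.eq r)) (trans (sym (*-assoc 2 (2 ^ TwoSplit.s r) _)) (cong (2 ^ suc (TwoSplit.s r) *_) (sym (oddPart-double (suc h) z<s))))
        ; odd = subst Odd (sym (oddPart-double (suc h) z<s)) (TwoSplit.odd r) }
    where r = rec (half< (suc h) z<s) z<s

oddPart-family : OddFamily oddPart
oddPart-family = record { pos = p ; odd = λ m → TwoSplit.odd (oddPart-split (suc m) z<s) ; le = l }
  where
  p : ∀ m → 0 < oddPart (suc m)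
  p m = n≢0⇒n>0 λ e → TwoSplit.odd (oddPart-split (suc m) z<s) (subst (2 ∣_) (sym e) (2 ∣0))
  l : ∀ m → oddPart (suc m) ≤ suc m
  l m = ∣⇒≤ (subst (oddPart (suc m) ∣_) (sym (TwoSplit.eq (oddPart-split (suc m) z<s))) (n∣m*n (2 ^ TwoSplit.s (oddPart-split (suc m) z<s))))

prodTo-oddPart : ∀ Y → prodTo oddPart Y ≡ oddFac Y
prodTo-oddPart zero = refl
prodTo-oddPart (suc Y) = trans (cong (oddPart (suc Y) *_) (prodTo-oddPart Y)) (*-comm (oddPart (suc Y)) (oddFac Y))

odd-power : ∀ p e → Odd p → Odd (p ^ e)
odd-power p zero o = odd1
odd-power p (suc e) o = odd-* p (p ^ e) o (odd-power p e o)

-- Odd q satisfies q² ≡ 1 (mod 4), so c q ≡ a exactly when c ≡ a q.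
class-shift : ∀ a q c → OddClass a → OddClass (q % 4) → ((c * q) % 4 ≡ᵇ a) ≡ (c % 4 ≡ᵇ (a * q) % 4)
class-shift a q c ca cq = trans (cong (_≡ᵇ a) (%-distribˡ-* c q 4)) (trans (go (c % 4) (m%n<n c 4) (q % 4) cq a ca)
   (cong (c % 4 ≡ᵇ_) (trans (cong (_% 4) (cong (_* (q % 4)) (sym (a%4 a ca)))) (sym (%-distribˡ-* a q 4)))))
  where
  a%4 : ∀ a → OddClass a → a % 4 ≡ a
  a%4 _ (inj₁ refl) = refl
  a%4 _ (inj₂ refl) = refl
  go : ∀ c → c < 4 → ∀ q → OddClass q → ∀ a → OddClass a → ((c * q) % 4 ≡ᵇ a) ≡ (c ≡ᵇ (a * q) % 4)
  go 0 _ _ (inj₁ refl) _ (inj₁ refl) = refl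
  go 0 _ _ (inj₁ refl) _ (inj₂ refl) = refl
  go 0 _ _ (inj₂ refl) _ (inj₁ refl) = refl
  go 0 _ _ (inj₂ refl) _ (inj₂ refl) = refl
  go 1 _ _ (inj₁ refl) _ (inj₁ refl) = refl
  go 1 _ _ (inj₁ refl) _ (inj₂ refl) = refl
  go 1 _ _ (inj₂ refl) _ (inj₁ refl) = refl
  go 1 _ _ (inj₂ refl) _ (inj₂ refl) = refl
  go 2 _ _ (inj₁ refl) _ (inj₁ refl) = refl
  go 2 _ _ (inj₁ refl) _ (inj₂ refl) = refl
  go 2 _ _ (inj₂ refl) _ (inj₁ refl) = refl
  go 2 _ _ (inj₂ refl) _ (inj₂ refl) = refl
  go 3 _ _ (inj₁ refl) _ (inj₁ refl) = refl
  go 3 _ _ (inj₁ refl) _ (inj₂ refl) = refl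
  go 3 _ _ (inj₂ refl) _ (inj₁ refl) = refl
  go 3 _ _ (inj₂ refl) _ (inj₂ refl) = refl
  go (suc (suc (suc (suc c)))) (s≤s (s≤s (s≤s (s≤s ())))) _ _ _ _

module Count (q′ : ℕ) (q>1 : 1 < suc q′) (oq : Odd (suc q′)) where
  q = suc q′

  count-class : ∀ a → OddClass a → ∀ Y → sumTo (λ i → dv q (inClass a (suc i))) Y ≡ cnt4 ((a * q) % 4) (Y / q)
  count-class a ca Y = trans (sumTo-cong _ (λ i → dv q (suc i) * ind (suc i % 4 ≡ᵇ a)) Y one)
      (trans (sum-multiples q′ (λ m → ind (m % 4 ≡ᵇ a)) Y) (sumTo-cong _ _ (Y / q) (λ c → cong ind (class-shift a q (suc c) ca (odd%4 q oq)))))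
    where
    one : ∀ i → dv q (inClass a (suc i)) ≡ dv q (suc i) * ind (suc i % 4 ≡ᵇ a)
    one i with suc i % 4 ≡ᵇ a
    ... | true = sym (*-identityʳ _)
    ... | false = trans (dv-no q 1 (λ d → <⇒≱ q>1 (∣⇒≤ d))) (sym (*-zeroʳ (dv q (suc i))))

  count-oddPart : ∀ Y → sumTo (λ i → dv q (oddPart (suc i))) Y ≡ Y / q
  count-oddPart Y = trans (sumTo-cong _ (λ i → dv q (suc i) * 1) Y one) (trans (sum-multiples q′ (λ _ → 1) Y) (sum-1 (Y / q)))
    where
    sum-1 : ∀ k → sumTo (λ _ → 1) k ≡ k
    sum-1 zero = refl
    sum-1 (suc k) = cong suc (sum-1 k)
    one : ∀ i → dv q (oddPart (suc i)) ≡ dv q (suc i) * 1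
    one i = trans (dv-⇔ q _ _ (λ d → subst (q ∣_) (sym eq) (∣-trans d (n∣m*n (2 ^ s)))) (λ d → odd-∣-cancel-^ q s _ oq (subst (q ∣_) eq d))) (sym (*-identityʳ _))
      where open TwoSplit (oddPart-split (suc i) z<s)

  bonus : ℕ → ℕ → ℕ
  bonus a X = ind ((q % 4 ≡ᵇ a) ∧ near (X / q))

  -- A relative of Chebyshev's quotient (30n)! n! / ((15n)! (10n)! (6n)!) for one class modulo 4.
  -- The densities balance, 1/4 = 1/12 + 1/20 + 1/60 + 1/10, where the last is that of odd parts. If
  -- q ≡ a (mod 4), multiples c q in the class have c ≡ 1 and `covers-1` applies, with its bonus;
  -- otherwise c ≡ 3, the bonus is 0 and `covers-3` applies.
  count-covers : ∀ a → OddClass a → ∀ X →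
    bonus a X + (sumTo (λ i → dv q (inClass (other a) (suc i))) (X / 3) + (sumTo (λ i → dv q (inClass a (suc i))) (X / 5) +
      (sumTo (λ i → dv q (inClass a (suc i))) (X / 15) + sumTo (λ i → dv q (oddPart (suc i))) (X / 10))))
    ≤ sumTo (λ i → dv q (inClass a (suc i))) X
  count-covers a ca X = subst₂ (λ u v → bonus a X + u ≤ v)
      (sym (cong₂ _+_ (trans (count-class (other a) (other-class ca) (X / 3)) (cong (cnt4 ((other a * q) % 4)) (flip 3)))
        (cong₂ _+_ (trans (count-class a ca (X / 5)) (cong (cnt4 ((a * q) % 4)) (flip 5)))
        (cong₂ _+_ (trans (count-class a ca (X / 15)) (cong (cnt4 ((a * q) % 4)) (flip 15))) (trans (count-oddPart (X / 10)) (flip 10))))))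
      (sym (count-class a ca X)) (go a ca (q % 4) (odd%4 q oq) refl)
    where
    z = X / q
    flip : ∀ d .⦃ _ : NonZero d ⦄ → X / d / q ≡ X / q / d
    flip d = trans (m/n/o≡m/[n*o] X d q ⦃ _ ⦄ ⦃ _ ⦄ ⦃ m*n≢0 d q ⦄) (trans (/-congʳ {m = X} ⦃ m*n≢0 d q ⦄ ⦃ m*n≢0 q d ⦄ (*-comm d q)) (sym (m/n/o≡m/[n*o] X q d ⦃ _ ⦄ ⦃ _ ⦄ ⦃ m*n≢0 q d ⦄)))
    cls : ∀ a r → q % 4 ≡ r → (a * q) % 4 ≡ (a % 4 * r) % 4
    cls a r e = trans (%-distribˡ-* a q 4) (cong (λ w → (a % 4 * w) % 4) e)
    go : ∀ a → OddClass a → ∀ r → OddClass r → q % 4 ≡ r →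
      bonus a X + (cnt4 ((other a * q) % 4) (z / 3) + (cnt4 ((a * q) % 4) (z / 5) + (cnt4 ((a * q) % 4) (z / 15) + z / 10))) ≤ cnt4 ((a * q) % 4) z
    go _ (inj₁ refl) _ (inj₁ refl) e rewrite cls 3 1 e | cls 1 1 e | e = covers-1 z
    go _ (inj₁ refl) _ (inj₂ refl) e rewrite cls 3 3 e | cls 1 3 e | e = covers-3 z
    go _ (inj₂ refl) _ (inj₁ refl) e rewrite cls 3 1 e | cls 1 1 e | e = covers-3 z
    go _ (inj₂ refl) _ (inj₂ refl) e rewrite cls 3 3 e | cls 1 3 e | e = covers-1 z

nearQuotient : ℕ → ℕ → Bool
nearQuotient X zero    = false
nearQuotient X (suc q) = near (X / suc q)

bonusAt : ℕ → ℕ → ℕ → ℕ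
bonusAt a X p = ind ((p % 4 ≡ᵇ a) ∧ nearQuotient X p)

-- The product of the primes of class a in the interval (X/9, X].
upperPart : ℕ → ℕ → ℕ
upperPart a X = prodOver oddPrime? (λ p → p ^ bonusAt a X p) X

theta : ℕ → ℕ → ℕ
theta a X = prodOver (λ p → oddPrime? p ∧ (p % 4 ≡ᵇ a)) (λ p → p) X

count-covers-at : ∀ q → 1 < q → Odd q → ∀ a → OddClass a → ∀ X →
    bonusAt a X q + (sumTo (λ i → dv q (inClass (other a) (suc i))) (X / 3) + (sumTo (λ i → dv q (inClass a (suc i))) (X / 5) +
      (sumTo (λ i → dv q (inClass a (suc i))) (X / 15) + sumTo (λ i → dv q (oddPart (suc i))) (X / 10))))
    ≤ sumTo (λ i → dv q (inClass a (suc i))) X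
count-covers-at (suc q′) q>1 oq a ca X = Count.count-covers q′ q>1 oq a ca X

sumTo-first : ∀ f k → f 0 ≤ sumTo f (suc k)
sumTo-first f zero = ≤-reflexive (sym (+-identityʳ (f 0)))
sumTo-first f (suc k) = ≤-trans (sumTo-first f k) (m≤n+m _ (f (suc k)))

-- Compared prime by prime: an exponent is a sum over the powers q of p, and `count-covers` holds
-- for each q. Of the bonuses only the one for p itself is kept.
chebyshev : ∀ a X → OddClass a → 0 < X →
  upperPart a X * (prodTo (inClass (other a)) (X / 3) * (prodTo (inClass a) (X / 5) * (prodTo (inClass a) (X / 15) * prodTo oddPart (X / 10))))
  ≤ prodTo (inClass a) X
chebyshev a X ca X>0 = begin
  upperPart a X * (prodTo (inClass (other a)) (X / 3) * (prodTo (inClass a) (X / 5) * (prodTo (inClass a) (X / 15) * prodTo oddPart (X / 10))))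
    ≡⟨ cong (upperPart a X *_) (cong₂ _*_ (prodTo-val _ X (X / 3) fo (m/n≤m X 3)) (cong₂ _*_ (prodTo-val _ X (X / 5) fa (m/n≤m X 5))
         (cong₂ _*_ (prodTo-val _ X (X / 15) fa (m/n≤m X 15)) (prodTo-val _ X (X / 10) oddPart-family (m/n≤m X 10))))) ⟩
  po B * (po (W (inClass (other a)) (X / 3)) * (po (W (inClass a) (X / 5)) * (po (W (inClass a) (X / 15)) * po (W oddPart (X / 10)))))
    ≡⟨ sym (trans (prodOver-* oddPrime? B _ X) (cong (po B *_) (trans (prodOver-* oddPrime? _ _ X) (cong (po (W (inClass (other a)) (X / 3)) *_)
         (trans (prodOver-* oddPrime? _ _ X) (cong (po (W (inClass a) (X / 5)) *_) (prodOver-* oddPrime? _ _ X))))))) ⟩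
  po (λ p → B p * (W (inClass (other a)) (X / 3) p * (W (inClass a) (X / 5) p * (W (inClass a) (X / 15) p * W oddPart (X / 10) p))))
    ≤⟨ prodOver-mono oddPrime? _ _ X at-prime ⟩
  po (W (inClass a) X) ≡⟨ sym (prodTo-val _ X X fa ≤-refl) ⟩
  prodTo (inClass a) X ∎
  where
  open ≤-Reasoning
  fa = inClass-family a ca
  fo = inClass-family (other a) (other-class ca)
  po : (ℕ → ℕ) → ℕ
  po E = prodOver oddPrime? E X
  B : ℕ → ℕ
  B p = p ^ bonusAt a X p
  V : (ℕ → ℕ) → ℕ → ℕ → ℕ
  V h Y p = sumTo (λ i → val X p (h (suc i))) Y
  W : (ℕ → ℕ) → ℕ → ℕ → ℕ
  W h Y p = p ^ V h Y p
  V′ : (ℕ → ℕ) → ℕ → ℕ → ℕ → ℕ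
  V′ h Y p j = sumTo (λ i → dv (p ^ suc j) (h (suc i))) Y
  V≡ : ∀ h Y p → V h Y p ≡ sumTo (V′ h Y p) X
  V≡ h Y p = sumTo-swap (λ i j → dv (p ^ suc j) (h (suc i))) Y X
  exps : ∀ p → Prime p → Odd p → bonusAt a X p + (V (inClass (other a)) (X / 3) p + (V (inClass a) (X / 5) p + (V (inClass a) (X / 15) p + V oddPart (X / 10) p))) ≤ V (inClass a) X p
  exps p pp podd = begin
    bonusAt a X p + (V (inClass (other a)) (X / 3) p + (V (inClass a) (X / 5) p + (V (inClass a) (X / 15) p + V oddPart (X / 10) p)))
      ≤⟨ +-mono-≤ (bonus-sum X X>0) (≤-reflexive (cong₂ _+_ (V≡ (inClass (other a)) (X / 3) p) (cong₂ _+_ (V≡ (inClass a) (X / 5) p) (cong₂ _+_ (V≡ (inClass a) (X / 15) p) (V≡ oddPart (X / 10) p))))) ⟩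
    sumTo bj X + (sumTo f₁ X + (sumTo f₂ X + (sumTo f₃ X + sumTo f₄ X)))
      ≡⟨ sym (trans (sumTo-+ bj _ X) (cong (sumTo bj X +_) (trans (sumTo-+ f₁ _ X) (cong (sumTo f₁ X +_) (trans (sumTo-+ f₂ _ X) (cong (sumTo f₂ X +_) (sumTo-+ f₃ f₄ X))))))) ⟩
    sumTo (λ j → bj j + (f₁ j + (f₂ j + (f₃ j + f₄ j)))) X
      ≤⟨ sumTo-mono _ _ X (λ j → count-covers-at (p ^ suc j) (<-≤-trans (prime>1 pp) (m≤m*n p (p ^ j) ⦃ m^n≢0 p j ⦃ prime⇒nonZero pp ⦄ ⦄)) (odd-power p (suc j) podd) a ca X) ⟩
    sumTo (V′ (inClass a) X p) X ≡⟨ sym (V≡ (inClass a) X p) ⟩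
    V (inClass a) X p ∎
    where
    bj f₁ f₂ f₃ f₄ : ℕ → ℕ
    bj j = bonusAt a X (p ^ suc j)
    f₁ = V′ (inClass (other a)) (X / 3) p
    f₂ = V′ (inClass a) (X / 5) p
    f₃ = V′ (inClass a) (X / 15) p
    f₄ = V′ oddPart (X / 10) p
    bonus-sum : ∀ k → 0 < k → bonusAt a X p ≤ sumTo bj k
    bonus-sum (suc k) _ = ≤-trans (≤-reflexive (cong (bonusAt a X) (sym (*-identityʳ p)))) (sumTo-first bj k)
  at-prime : ∀ p → p ≤ X → oddPrime? p ≡ true →
    B p * (W (inClass (other a)) (X / 3) p * (W (inClass a) (X / 5) p * (W (inClass a) (X / 15) p * W oddPart (X / 10) p))) ≤ W (inClass a) X p
  at-prime p _ tp = ≤-trans (≤-reflexive (sym (trans (^-distribˡ-+-* p (bonusAt a X p) _) (cong (B p *_) (trans (^-distribˡ-+-* p (V (inClass (other a)) (X / 3) p) _)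
      (cong (W (inClass (other a)) (X / 3) p *_) (trans (^-distribˡ-+-* p (V (inClass a) (X / 5) p) _) (cong (W (inClass a) (X / 5) p *_) (^-distribˡ-+-* p (V (inClass a) (X / 15) p) _)))))))))
    (^-monoʳ-≤ p ⦃ prime⇒nonZero pp ⦄ (exps p pp (oddPrime?-odd p tp)))
    where pp = oddPrime?-sound p tp

theta>0 : ∀ a X → 0 < theta a X
theta>0 a X = prodOver>0 _ _ X (λ p → z<s)

theta-mono : ∀ a {X Y} → X ≤ Y → theta a X ≤ theta a Y
theta-mono a {X} {zero} z≤n = ≤-refl
theta-mono a {X} {suc Y} le with X ≟ suc Y
... | yes refl = ≤-refl
... | no ne = ≤-trans (theta-mono a (s≤s⁻¹ (≤∧≢⇒< le ne))) grow
  where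
  grow : theta a Y ≤ theta a (suc Y)
  grow with oddPrime? (suc Y) ∧ (suc Y % 4 ≡ᵇ a)
  ... | true = m≤n*m (theta a Y) (suc Y)
  ... | false = ≤-refl

theta-step : ∀ a X → theta a X ≤ upperPart a X * theta a (X / 9)
theta-step a X = go X ≤-refl
  where
  up : ℕ → ℕ
  up b = prodOver oddPrime? (λ p → p ^ bonusAt a X p) b
  up>0 : ∀ b → 0 < up b
  up>0 b = prodOver>0 _ _ b (λ p → m^n>0 (suc p) (bonusAt a X (suc p)))
  go : ∀ b → b ≤ X → theta a b ≤ up b * theta a (X / 9)
  go zero _ = ≤-trans (theta>0 a (X / 9)) (≤-reflexive (sym (+-identityʳ _)))
  go (suc b) le with suc b ≤? X / 9
  ... | yes small = ≤-trans (theta-mono a small) (m≤n*m (theta a (X / 9)) (up (suc b)) ⦃ >-nonZero (up>0 (suc b)) ⦄)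
  ... | no large with oddPrime? (suc b) | suc b % 4 ≡ᵇ a in e
  ... | false | _ = go b (<⇒≤ le)
  ... | true | false = ≤-trans (go b (<⇒≤ le)) (≤-reflexive (cong (_* theta a (X / 9)) (sym (*-identityˡ (up b)))))
  ... | true | true = ≤-trans (*-monoʳ-≤ (suc b) (go b (<⇒≤ le))) (≤-reflexive (trans (sym (*-assoc (suc b) (up b) _))
          (cong (λ z → z * up b * theta a (X / 9)) (sym (trans (cong (suc b ^_) (cong ind is-near)) (*-identityʳ (suc b)))))))
    where
    is-near : near (X / suc b) ≡ true
    is-near = cong₂ _∧_ (T⇒≡ (<⇒<ᵇ (m≥n⇒m/n>0 le))) (T⇒≡ (<⇒<ᵇ (m<n*o⇒m/o<n {X} {9} {suc b} X<)))
      where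
      X< : X < 9 * suc b
      X< = subst (X <_) (*-comm (suc b) 9) (<-≤-trans (subst (_< suc (X / 9) * 9) (sym (m≡m%n+[m/n]*n X 9)) (+-monoˡ-< (X / 9 * 9) (m%n<n X 9))) (*-monoˡ-≤ 9 (≰⇒> large)))

-- From the Chebyshev quotient to a multinomial coefficient

prodTo-inClass : ∀ a → OddClass a → ∀ k → prodTo (inClass a) (4 * k) ≡ prodAP4 a k
prodTo-inClass a ca zero = refl
prodTo-inClass a ca (suc k) = trans (cong (prodTo (inClass a)) (solve 1 (λ k → con 4 :* (con 1 :+ k) := con 4 :+ con 4 :* k) refl k))
   (trans (four a ca) (cong (_* (a + 4 * k)) (prodTo-inClass a ca k)))
  where
  m4 : ∀ i → (i + 4 * k) % 4 ≡ i % 4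
  m4 i = trans (cong (λ z → (i + z) % 4) (*-comm 4 k)) ([m+kn]%n≡m%n i k 4)
  four : ∀ a → OddClass a → prodTo (inClass a) (4 + 4 * k) ≡ prodTo (inClass a) (4 * k) * (a + 4 * k)
  four _ (inj₁ refl) rewrite m4 4 | m4 3 | m4 2 | m4 1 = solve 2 (λ x y → con 1 :* (con 1 :* (con 1 :* (x :* y))) := y :* x) refl (1 + 4 * k) (prodTo (inClass 1) (4 * k))
  four _ (inj₂ refl) rewrite m4 4 | m4 3 | m4 2 | m4 1 = solve 2 (λ x y → con 1 :* (x :* (con 1 :* (con 1 :* y))) := y :* x) refl (3 + 4 * k) (prodTo (inClass 3) (4 * k))

class≤4 : ∀ {a} → OddClass a → a ≤ 4
class≤4 (inj₁ refl) = s≤s z≤n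
class≤4 (inj₂ refl) = s≤s (s≤s (s≤s z≤n))

class≥1 : ∀ {a} → OddClass a → 1 ≤ a
class≥1 (inj₁ refl) = s≤s z≤n
class≥1 (inj₂ refl) = s≤s z≤n

prodAP4-upper : ∀ a → OddClass a → ∀ k → prodAP4 a k ≤ 4 ^ k * k !
prodAP4-upper a ca zero = ≤-refl
prodAP4-upper a ca (suc k) = ≤-trans (*-mono-≤ (prodAP4-upper a ca k) (+-monoˡ-≤ (4 * k) (class≤4 ca)))
  (≤-reflexive (solve 3 (λ p f k → p :* f :* (con 4 :+ con 4 :* k) := con 4 :* p :* ((con 1 :+ k) :* f)) refl (4 ^ k) (k !) k))

prodAP4-lower : ∀ a → OddClass a → ∀ k → 4 ^ suc k * (suc k) ! ≤ 4 * suc k * prodAP4 a (suc k)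
prodAP4-lower a ca k = ≤-trans (≤-reflexive (solve 3 (λ p f k → con 4 :* p :* ((con 1 :+ k) :* f) := con 4 :* (con 1 :+ k) :* (p :* f)) refl (4 ^ k) (k !) k))
    (*-monoʳ-≤ (4 * suc k) (low k))
  where
  low : ∀ k → 4 ^ k * k ! ≤ prodAP4 a (suc k)
  low zero = ≤-trans (class≥1 ca) (≤-reflexive (solve 1 (λ a → a := con 1 :* (a :+ con 0)) refl a))
  low (suc k) = ≤-trans (≤-reflexive (solve 3 (λ p f k → con 4 :* p :* ((con 1 :+ k) :* f) := p :* f :* (con 4 :* (con 1 :+ k))) refl (4 ^ k) (k !) k))
    (*-mono-≤ (low k) (m≤n+m (4 * suc k) a))

-- One term of the expansion of (x + y)^(a+b) against the whole, with factorials cleared; the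
-- induction step is Pascal's rule.
binomial-bound : ∀ x y a b → (a + b) ! * (x ^ a * y ^ b) ≤ (x + y) ^ (a + b) * (a ! * b !)
binomial-bound x y zero b = begin
  b ! * (1 * y ^ b)       ≡⟨ solve 2 (λ f p → f :* (con 1 :* p) := p :* (con 1 :* f)) refl (b !) (y ^ b) ⟩
  y ^ b * (1 * b !)       ≤⟨ *-monoˡ-≤ (1 * b !) (^-monoˡ-≤ b (m≤n+m y x)) ⟩
  (x + y) ^ b * (1 * b !) ∎
  where open ≤-Reasoning
binomial-bound x y (suc a) zero = begin
  (suc a + 0) ! * (x ^ suc a * 1)       ≡⟨ cong (λ z → z ! * (x ^ suc a * 1)) (+-identityʳ (suc a)) ⟩
  (suc a) ! * (x ^ suc a * 1)           ≡⟨ solve 2 (λ f p → f :* (p :* con 1) := p :* (f :* con 1)) refl ((suc a) !) (x ^ suc a) ⟩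
  x ^ suc a * ((suc a) ! * 1)           ≤⟨ *-monoˡ-≤ ((suc a) ! * 1) (^-monoˡ-≤ (suc a) (m≤m+n x y)) ⟩
  (x + y) ^ suc a * ((suc a) ! * 1)     ≡⟨ cong (λ z → (x + y) ^ z * ((suc a) ! * 1)) (sym (+-identityʳ (suc a))) ⟩
  (x + y) ^ (suc a + 0) * ((suc a) ! * 1) ∎
  where open ≤-Reasoning
binomial-bound x y (suc a) (suc b) = begin
  (suc a + suc b) ! * (x ^ suc a * y ^ suc b)
    ≡⟨ cong (_* (x ^ suc a * y ^ suc b)) (cong (_* (a + suc b) !) (solve 2 (λ a b → con 1 :+ (a :+ (con 1 :+ b)) := con 1 :+ a :+ (con 1 :+ b)) refl a b)) ⟩
  (suc a + suc b) * (a + suc b) ! * (x ^ suc a * y ^ suc b)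
    ≡⟨ solve 7 (λ a′ b′ f x y p q → (a′ :+ b′) :* f :* (x :* p :* (y :* q)) := x :* a′ :* (f :* (p :* (y :* q))) :+ y :* b′ :* (f :* (x :* p :* q))) refl
         (suc a) (suc b) ((a + suc b) !) x y (x ^ a) (y ^ b) ⟩
  x * suc a * ((a + suc b) ! * (x ^ a * y ^ suc b)) + y * suc b * ((a + suc b) ! * (x ^ suc a * y ^ b))
    ≤⟨ +-mono-≤ (*-monoʳ-≤ (x * suc a) (binomial-bound x y a (suc b)))
         (*-monoʳ-≤ (y * suc b) (subst (λ z → z ! * (x ^ suc a * y ^ b) ≤ (x + y) ^ z * ((suc a) ! * b !)) (sym (+-suc a b)) (binomial-bound x y (suc a) b))) ⟩
  x * suc a * (S * (a ! * (suc b) !)) + y * suc b * (S * ((suc a) ! * b !))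
    ≡⟨ solve 7 (λ x y a′ b′ s f g → x :* a′ :* (s :* (f :* (b′ :* g))) :+ y :* b′ :* (s :* (a′ :* f :* g)) := (x :+ y) :* s :* (a′ :* f :* (b′ :* g))) refl
         x y (suc a) (suc b) S (a !) (b !) ⟩
  (x + y) * S * ((suc a) ! * (suc b) !) ∎
  where
  open ≤-Reasoning
  S = (x + y) ^ (a + suc b)

-- At X = 60u the quotient in `chebyshev` is comparable to the multinomial coefficient of 15u over
-- 6u, 5u, 3u, u. It splits into binomials along 15 = 6 + 9, 9 = 5 + 4, 4 = 3 + 1.
multinomial-bound : ∀ u → (15 * u) ! * (6 ^ (6 * u) * (5 ^ (5 * u) * 3 ^ (3 * u))) ≤ 15 ^ (15 * u) * ((6 * u) ! * ((5 * u) ! * ((3 * u) ! * u !)))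
multinomial-bound u = *-cancelˡ-≤ K (begin
  K * ((15 * u) ! * (6 ^ (6 * u) * (5 ^ (5 * u) * 3 ^ (3 * u))))
    ≡⟨ solve 8 (λ f15 f9 f4 p6 p9 p5 p4 p3 → p9 :* p4 :* (f9 :* f4) :* (f15 :* (p6 :* (p5 :* p3))) := f15 :* (p6 :* p9) :* (f9 :* (p5 :* p4) :* (f4 :* (p3 :* con 1)))) refl
        ((15 * u) !) ((9 * u) !) ((4 * u) !) (6 ^ (6 * u)) (9 ^ (9 * u)) (5 ^ (5 * u)) (4 ^ (4 * u)) (3 ^ (3 * u)) ⟩
  (15 * u) ! * (6 ^ (6 * u) * 9 ^ (9 * u)) * ((9 * u) ! * (5 ^ (5 * u) * 4 ^ (4 * u)) * ((4 * u) ! * (3 ^ (3 * u) * 1)))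
    ≡⟨ cong (λ z → (15 * u) ! * (6 ^ (6 * u) * 9 ^ (9 * u)) * ((9 * u) ! * (5 ^ (5 * u) * 4 ^ (4 * u)) * ((4 * u) ! * (3 ^ (3 * u) * z)))) (sym (^-zeroˡ u)) ⟩
  (15 * u) ! * (6 ^ (6 * u) * 9 ^ (9 * u)) * ((9 * u) ! * (5 ^ (5 * u) * 4 ^ (4 * u)) * ((4 * u) ! * (3 ^ (3 * u) * 1 ^ u)))
    ≤⟨ *-mono-≤ (bb 6 9 15 (6 * u) (9 * u) (solve 1 (λ u → con 6 :* u :+ con 9 :* u := con 15 :* u) refl u) refl)
        (*-mono-≤ (bb 5 4 9 (5 * u) (4 * u) (solve 1 (λ u → con 5 :* u :+ con 4 :* u := con 9 :* u) refl u) refl)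
                  (bb 3 1 4 (3 * u) u (solve 1 (λ u → con 3 :* u :+ u := con 4 :* u) refl u) refl)) ⟩
  15 ^ (15 * u) * ((6 * u) ! * (9 * u) !) * (9 ^ (9 * u) * ((5 * u) ! * (4 * u) !) * (4 ^ (4 * u) * ((3 * u) ! * u !)))
    ≡⟨ solve 9 (λ p15 p9 p4 f6 f9 f5 f4 f3 f1 → p15 :* (f6 :* f9) :* (p9 :* (f5 :* f4) :* (p4 :* (f3 :* f1))) := p9 :* p4 :* (f9 :* f4) :* (p15 :* (f6 :* (f5 :* (f3 :* f1))))) refl
        (15 ^ (15 * u)) (9 ^ (9 * u)) (4 ^ (4 * u)) ((6 * u) !) ((9 * u) !) ((5 * u) !) ((4 * u) !) ((3 * u) !) (u !) ⟩
  K * (15 ^ (15 * u) * ((6 * u) ! * ((5 * u) ! * ((3 * u) ! * u !)))) ∎)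
  where
  open ≤-Reasoning
  K = 9 ^ (9 * u) * 4 ^ (4 * u) * ((9 * u) ! * (4 * u) !)
  instance
    K≢0 : NonZero K
    K≢0 = >-nonZero (*-mono-< (*-mono-< (m^n>0 9 (9 * u)) (m^n>0 4 (4 * u))) (*-mono-< (1≤n! (9 * u)) (1≤n! (4 * u))))
  bb : ∀ x y z a b {c} → a + b ≡ c → x + y ≡ z → c ! * (x ^ a * y ^ b) ≤ z ^ c * (a ! * b !)
  bb x y z a b refl refl = binomial-bound x y a b

^-distribʳ-* : ∀ o m n → (m * n) ^ o ≡ m ^ o * n ^ o
^-distribʳ-* zero m n = refl
^-distribʳ-* (suc o) m n = trans (cong (m * n *_) (^-distribʳ-* o m n))
  (solve 4 (λ m n p q → m :* n :* (p :* q) := m :* p :* (n :* q)) refl m n (m ^ o) (n ^ o))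

prodAP4-lower′ : ∀ a → OddClass a → ∀ k → 0 < k → 4 ^ k * k ! ≤ 4 * k * prodAP4 a k
prodAP4-lower′ a ca (suc k) _ = prodAP4-lower a ca k

-- With X = 60u all the quotients X/3, X/5, X/10, X/15 are exact. Replacing three class products by
-- factorials costs 4·5u, 4·3u and 4u, whose product is 960 u³. C is the growth rate of the
-- multinomial coefficient times the powers of 2 that odd parts and classes contribute.
module UpperPart (C : ℕ) (C≡ : 2 ^ 6 * (4 ^ 6 * 15 ^ 15) ≡ 6 ^ 6 * (5 ^ 5 * 3 ^ 3) * C) (a : ℕ) (ca : OddClass a) (u : ℕ) (u>0 : 0 < u) where

  P = upperPart a (60 * u)
  D₁ = prodAP4 (other a) (5 * u)
  D₂ = prodAP4 a (3 * u)
  D₃ = prodAP4 a u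
  O = oddFac (6 * u)
  F = (6 * u) ! * ((5 * u) ! * ((3 * u) ! * u !))
  W = 6 ^ (6 * u) * (5 ^ (5 * u) * 3 ^ (3 * u))

  quo : ∀ c d .⦃ _ : NonZero d ⦄ → c * d ≡ 60 → (60 * u) / d ≡ c * u
  quo c d e = trans (cong (_/ d) (trans (cong (_* u) (sym e)) (solve 3 (λ c d u → c :* d :* u := c :* u :* d) refl c d u))) (m*n/n≡m (c * u) d)

  classes : P * (D₁ * (D₂ * (D₃ * O))) ≤ prodAP4 a (15 * u)
  classes = subst₂ (λ x y → P * x ≤ y)
    (cong₂ _*_ (trans (cong (prodTo (inClass (other a))) (trans (quo 20 3 refl) (*-assoc 4 5 u))) (prodTo-inClass (other a) (other-class ca) (5 * u)))
      (cong₂ _*_ (trans (cong (prodTo (inClass a)) (trans (quo 12 5 refl) (*-assoc 4 3 u))) (prodTo-inClass a ca (3 * u)))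
      (cong₂ _*_ (trans (cong (prodTo (inClass a)) (quo 4 15 refl)) (prodTo-inClass a ca u))
        (trans (cong (prodTo oddPart) (quo 6 10 refl)) (prodTo-oddPart (6 * u))))))
    (trans (cong (prodTo (inClass a)) (*-assoc 4 15 u)) (prodTo-inClass a ca (15 * u)))
    (chebyshev a (60 * u) ca (*-mono-< {0} {60} z<s u>0))

  factorials : P * F ≤ u * u * u * 960 * (2 ^ (6 * u) * 4 ^ (6 * u)) * (15 * u) !
  factorials = *-cancelˡ-≤ X (begin
    X * (P * F)
      ≡⟨ cong (_* (P * F)) X≡ ⟩
    4 ^ (5 * u) * (4 ^ (3 * u) * 4 ^ u) * (P * F)
      ≡⟨ solve 8 (λ q5 q3 q1 p f6 f5 f3 f1 → q5 :* (q3 :* q1) :* (p :* (f6 :* (f5 :* (f3 :* f1)))) := p :* ((q5 :* f5) :* ((q3 :* f3) :* ((q1 :* f1) :* f6)))) refl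
          (4 ^ (5 * u)) (4 ^ (3 * u)) (4 ^ u) P ((6 * u) !) ((5 * u) !) ((3 * u) !) (u !) ⟩
    P * ((4 ^ (5 * u) * (5 * u) !) * ((4 ^ (3 * u) * (3 * u) !) * ((4 ^ u * u !) * (6 * u) !)))
      ≤⟨ *-monoʳ-≤ P (*-mono-≤ (prodAP4-lower′ (other a) (other-class ca) (5 * u) (*-mono-< {0} {5} z<s u>0)) (*-mono-≤ (prodAP4-lower′ a ca (3 * u) (*-mono-< {0} {3} z<s u>0))
           (*-mono-≤ (prodAP4-lower′ a ca u u>0) (OddFacBounds.lower (oddFacBounds (6 * u)))))) ⟩
    P * ((4 * (5 * u) * D₁) * ((4 * (3 * u) * D₂) * ((4 * u * D₃) * (2 ^ (6 * u) * O))))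
      ≡⟨ solve 7 (λ u p d1 d2 d3 o t → p :* ((con 4 :* (con 5 :* u) :* d1) :* ((con 4 :* (con 3 :* u) :* d2) :* ((con 4 :* u :* d3) :* (t :* o)))) := u :* u :* u :* con 960 :* t :* (p :* (d1 :* (d2 :* (d3 :* o))))) refl
          u P D₁ D₂ D₃ O (2 ^ (6 * u)) ⟩
    u * u * u * 960 * 2 ^ (6 * u) * (P * (D₁ * (D₂ * (D₃ * O)))) ≤⟨ *-monoʳ-≤ (u * u * u * 960 * 2 ^ (6 * u)) (≤-trans classes (prodAP4-upper a ca (15 * u))) ⟩
    u * u * u * 960 * 2 ^ (6 * u) * (4 ^ (15 * u) * (15 * u) !) ≡⟨ cong (λ z → u * u * u * 960 * 2 ^ (6 * u) * (z * (15 * u) !)) 4^15 ⟩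
    u * u * u * 960 * 2 ^ (6 * u) * (X * 4 ^ (6 * u) * (15 * u) !)
      ≡⟨ solve 5 (λ n t x q f → n :* t :* (x :* q :* f) := x :* (n :* (t :* q) :* f)) refl (u * u * u * 960) (2 ^ (6 * u)) X (4 ^ (6 * u)) ((15 * u) !) ⟩
    X * (u * u * u * 960 * (2 ^ (6 * u) * 4 ^ (6 * u)) * (15 * u) !) ∎)
    where
    open ≤-Reasoning
    X = 4 ^ (9 * u)
    instance
      X≢0 : NonZero X
      X≢0 = m^n≢0 4 (9 * u)
    X≡ : X ≡ 4 ^ (5 * u) * (4 ^ (3 * u) * 4 ^ u)
    X≡ = trans (cong (4 ^_) (solve 1 (λ u → con 9 :* u := con 5 :* u :+ (con 3 :* u :+ u)) refl u)) (trans (^-distribˡ-+-* 4 (5 * u) (3 * u + u)) (cong (4 ^ (5 * u) *_) (^-distribˡ-+-* 4 (3 * u) u)))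
    4^15 : 4 ^ (15 * u) ≡ X * 4 ^ (6 * u)
    4^15 = trans (cong (4 ^_) (solve 1 (λ u → con 15 :* u := con 9 :* u :+ con 6 :* u) refl u)) (^-distribˡ-+-* 4 (9 * u) (6 * u))

  W≡ : W ≡ (6 ^ 6 * (5 ^ 5 * 3 ^ 3)) ^ u
  W≡ = trans (cong₂ _*_ (sym (^-*-assoc 6 6 u)) (trans (cong₂ _*_ (sym (^-*-assoc 5 5 u)) (sym (^-*-assoc 3 3 u))) (sym (^-distribʳ-* u (5 ^ 5) (3 ^ 3))))) (sym (^-distribʳ-* u (6 ^ 6) (5 ^ 5 * 3 ^ 3)))

  powers : 2 ^ (6 * u) * 4 ^ (6 * u) * 15 ^ (15 * u) ≡ W * C ^ u
  powers = trans (trans (*-assoc (2 ^ (6 * u)) (4 ^ (6 * u)) (15 ^ (15 * u)))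
    (trans (cong₂ _*_ (sym (^-*-assoc 2 6 u)) (trans (cong₂ _*_ (sym (^-*-assoc 4 6 u)) (sym (^-*-assoc 15 15 u))) (sym (^-distribʳ-* u (4 ^ 6) (15 ^ 15))))) (sym (^-distribʳ-* u (2 ^ 6) (4 ^ 6 * 15 ^ 15)))))
    (trans (cong (_^ u) C≡) (trans (^-distribʳ-* u (6 ^ 6 * (5 ^ 5 * 3 ^ 3)) C) (cong (_* C ^ u) (sym W≡))))

  bound : P ≤ u * u * u * 960 * C ^ u
  bound = *-cancelˡ-≤ (W * F) (begin
    W * F * P ≡⟨ solve 3 (λ w f p → w :* f :* p := p :* f :* w) refl W F P ⟩
    P * F * W ≤⟨ *-monoˡ-≤ W factorials ⟩
    n * Z * (15 * u) ! * W ≡⟨ *-assoc (n * Z) ((15 * u) !) W ⟩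
    n * Z * ((15 * u) ! * W) ≤⟨ *-monoʳ-≤ (n * Z) (multinomial-bound u) ⟩
    n * Z * (15 ^ (15 * u) * F) ≡⟨ solve 4 (λ n z p f → n :* z :* (p :* f) := n :* (z :* p) :* f) refl n Z (15 ^ (15 * u)) F ⟩
    n * (Z * 15 ^ (15 * u)) * F ≡⟨ cong (λ z → n * z * F) powers ⟩
    n * (W * C ^ u) * F ≡⟨ solve 4 (λ n w c f → n :* (w :* c) :* f := w :* f :* (n :* c)) refl n W (C ^ u) F ⟩
    W * F * (n * C ^ u) ∎)
    where
    open ≤-Reasoning
    n = u * u * u * 960
    Z = 2 ^ (6 * u) * 4 ^ (6 * u)
    instance
      WF≢0 : NonZero (W * F)
      WF≢0 = >-nonZero (*-mono-< (*-mono-< (m^n>0 6 (6 * u)) (*-mono-< (m^n>0 5 (5 * u)) (m^n>0 3 (3 * u)))) (*-mono-< (1≤n! (6 * u)) (*-mono-< (1≤n! (5 * u)) (*-mono-< (1≤n! (3 * u)) (1≤n! u)))))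

-- Per step the cube grows at most by the factor 8, the power by 32; so one numerical check at q₀
-- suffices.
cube-vs-power : ∀ K q₀ → suc q₀ * suc q₀ * suc q₀ * K ≤ 2 ^ (5 * q₀) → ∀ i → suc (i + q₀) * suc (i + q₀) * suc (i + q₀) * K ≤ 2 ^ (5 * (i + q₀))
cube-vs-power K q₀ base zero = base
cube-vs-power K q₀ base (suc i) = begin
  suc x * suc x * suc x * K                     ≤⟨ *-monoˡ-≤ K (*-mono-≤ (*-mono-≤ le le) le) ⟩
  (x + x) * (x + x) * (x + x) * K               ≡⟨ solve 2 (λ x k → (x :+ x) :* (x :+ x) :* (x :+ x) :* k := con 8 :* (x :* x :* x :* k)) refl x K ⟩
  8 * (x * x * x * K)                           ≤⟨ *-mono-≤ {8} {32} (s≤s (s≤s (s≤s (s≤s (s≤s (s≤s (s≤s (s≤s z≤n)))))))) (cube-vs-power K q₀ base i) ⟩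
  32 * 2 ^ (5 * (i + q₀))                       ≡⟨ sym (^-distribˡ-+-* 2 5 (5 * (i + q₀))) ⟩
  2 ^ (5 + 5 * (i + q₀))                        ≡⟨ cong (2 ^_) (sym (*-suc 5 (i + q₀))) ⟩
  2 ^ (5 * suc (i + q₀)) ∎
  where
  open ≤-Reasoning
  x = suc (i + q₀)
  le : suc x ≤ x + x
  le = s≤s (m≤n+m x (i + q₀))

thetaUp : ℕ → ℕ → ℕ → ℕ → ℕ
thetaUp a X acc zero    = acc
thetaUp a X acc (suc n) = thetaUp a (suc X) (if oddPrime? (suc X) ∧ (suc X % 4 ≡ᵇ a) then suc X * acc else acc) n

thetaUp≡ : ∀ a X n → thetaUp a X (theta a X) n ≡ theta a (n + X)
thetaUp≡ a X zero = refl
thetaUp≡ a X (suc n) = trans (thetaUp≡ a (suc X) n) (cong (theta a) (+-suc n X))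

thetaScan : ℕ → ℕ → ℕ → ℕ → ℕ → ℕ → ℕ → Bool
thetaScan zero    a d w X acc pw = true
thetaScan (suc f) a d w X acc pw = (acc <ᵇ suc pw) ∧ thetaScan f a d w (d + X) (thetaUp a X acc d) (w * pw)

thetaScan-sound : ∀ f a d w X pw → thetaScan f a d w X (theta a X) pw ≡ true → ∀ j → j < f → theta a (j * d + X) ≤ w ^ j * pw
thetaScan-sound (suc f) a d w X pw s zero j< = ≤-trans (s≤s⁻¹ (<ᵇ-true {theta a X} {suc pw} (proj₁ (∧-split s)))) (≤-reflexive (sym (+-identityʳ pw)))
thetaScan-sound (suc f) a d w X pw s (suc j) (s≤s j<) = subst₂ _≤_
  (cong (theta a) (solve 3 (λ j d X → j :+ (d :+ X) := d :+ j :+ X) refl (j * d) d X))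
  (solve 3 (λ p w q → p :* (w :* q) := w :* p :* q) refl (w ^ j) w pw)
  (thetaScan-sound f a d w (d + X) (w * pw) (subst (λ z → thetaScan f a d w (d + X) z (w * pw) ≡ true) (thetaUp≡ a X d) (proj₂ (∧-split {theta a X <ᵇ suc pw} s))) j j<)

cube-scale : ∀ t y m p → t * y * (t * y) * (t * y) * m * p ≡ y * y * y * (t * t * t * m * p)
cube-scale t y m p = solve 4 (λ t y m p → t :* y :* (t :* y) :* (t :* y) :* m :* p := y :* y :* y :* (t :* t :* t :* m :* p)) refl t y m p

-- Iterating `theta-step` multiplies the rate by 9/8. Since log₂ C is about 44.73, this gives 50.3,
-- whence A = 51. In a block of nine values of u, C takes B = 403 bits and the recursive call A = 51
-- out of 9A = 459; the remaining 5 absorb the cubic factor from q₀ on. The 2^A inside K pays for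
-- rounding up in suc (u / 9).
module ThetaBound (C : ℕ) (C≡ : 2 ^ 6 * (4 ^ 6 * 15 ^ 15) ≡ 6 ^ 6 * (5 ^ 5 * 3 ^ 3) * C) (A B K q₀ c : ℕ)
                  (C₉ : C ^ 9 ≤ 2 ^ B) (C₁ : C ≤ 2 ^ A) (AB : 5 + B + A ≡ A * 9) (poly : suc q₀ * suc q₀ * suc q₀ * K ≤ 2 ^ (5 * q₀))
                  (c≡ : c ≡ 960) (K≡ : K ≡ 9 * 9 * 9 * c * 2 ^ A) where

  upper : ∀ a → OddClass a → ∀ u → 0 < u → upperPart a (60 * u) ≤ u * u * u * 960 * C ^ u
  upper a ca u u>0 = UpperPart.bound C C≡ a ca u u>0

  C-power : ∀ u → C ^ u ≤ 2 ^ (A * (u % 9) + B * (u / 9))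
  C-power u = begin
    C ^ u                                   ≡⟨ cong (C ^_) (trans (m≡m%n+[m/n]*n u 9) (cong (u % 9 +_) (*-comm (u / 9) 9))) ⟩
    C ^ (u % 9 + 9 * (u / 9))               ≡⟨ ^-distribˡ-+-* C (u % 9) (9 * (u / 9)) ⟩
    C ^ (u % 9) * C ^ (9 * (u / 9))         ≡⟨ cong (C ^ (u % 9) *_) (sym (^-*-assoc C 9 (u / 9))) ⟩
    C ^ (u % 9) * (C ^ 9) ^ (u / 9)         ≤⟨ *-mono-≤ (^-monoˡ-≤ (u % 9) C₁) (^-monoˡ-≤ (u / 9) C₉) ⟩
    (2 ^ A) ^ (u % 9) * (2 ^ B) ^ (u / 9)   ≡⟨ cong₂ _*_ (^-*-assoc 2 A (u % 9)) (^-*-assoc 2 B (u / 9)) ⟩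
    2 ^ (A * (u % 9)) * 2 ^ (B * (u / 9))   ≡⟨ sym (^-distribˡ-+-* 2 (A * (u % 9)) (B * (u / 9))) ⟩
    2 ^ (A * (u % 9) + B * (u / 9)) ∎
    where open ≤-Reasoning

  poly-bound : ∀ u → q₀ ≤ u / 9 → u * u * u * 960 * 2 ^ A ≤ 2 ^ (5 * (u / 9))
  poly-bound u q≥ = begin
    u * u * u * 960 * 2 ^ A         ≤⟨ *-monoˡ-≤ (2 ^ A) (*-monoˡ-≤ 960 (*-mono-≤ (*-mono-≤ le le) le)) ⟩
    9 * y * (9 * y) * (9 * y) * 960 * 2 ^ A ≡⟨ cong (λ m → 9 * y * (9 * y) * (9 * y) * m * 2 ^ A) (sym c≡) ⟩
    9 * y * (9 * y) * (9 * y) * c * 2 ^ A ≡⟨ cube-scale 9 y c (2 ^ A) ⟩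
    y * y * y * (9 * 9 * 9 * c * 2 ^ A) ≡⟨ cong (y * y * y *_) (sym K≡) ⟩
    y * y * y * K                   ≡⟨ cong (λ q → suc q * suc q * suc q * K) (sym (m∸n+n≡m q≥)) ⟩
    _                               ≤⟨ cube-vs-power K q₀ poly (u / 9 ∸ q₀) ⟩
    2 ^ (5 * (u / 9 ∸ q₀ + q₀))     ≡⟨ cong (λ q → 2 ^ (5 * q)) (m∸n+n≡m q≥) ⟩
    2 ^ (5 * (u / 9)) ∎
    where
    open ≤-Reasoning
    y = suc (u / 9)
    le : u ≤ 9 * y
    le = ≤-trans (≤-reflexive (m≡m%n+[m/n]*n u 9)) (≤-trans (+-mono-≤ (<⇒≤ (m%n<n u 9)) (≤-reflexive (*-comm (u / 9) 9))) (≤-reflexive (sym (*-suc 9 (u / 9)))))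

  step-bound : ∀ u → q₀ ≤ u / 9 → u * u * u * 960 * C ^ u * 2 ^ (A * suc (u / 9)) ≤ 2 ^ (A * u)
  step-bound u q≥ = begin
    n * C ^ u * 2 ^ (A * suc q)                 ≤⟨ *-monoˡ-≤ (2 ^ (A * suc q)) (*-monoʳ-≤ n (C-power u)) ⟩
    n * 2 ^ e * 2 ^ (A * suc q)                 ≡⟨ cong (n * 2 ^ e *_) (trans (cong (2 ^_) (*-suc A q)) (^-distribˡ-+-* 2 A (A * q))) ⟩
    n * 2 ^ e * (2 ^ A * 2 ^ (A * q))           ≡⟨ solve 4 (λ n e a b → n :* e :* (a :* b) := n :* a :* (e :* b)) refl n (2 ^ e) (2 ^ A) (2 ^ (A * q)) ⟩
    n * 2 ^ A * (2 ^ e * 2 ^ (A * q))           ≤⟨ *-monoˡ-≤ _ (poly-bound u q≥) ⟩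
    2 ^ (5 * q) * (2 ^ e * 2 ^ (A * q))         ≡⟨ cong (2 ^ (5 * q) *_) (sym (^-distribˡ-+-* 2 e (A * q))) ⟩
    2 ^ (5 * q) * 2 ^ (e + A * q)               ≡⟨ sym (^-distribˡ-+-* 2 (5 * q) (e + A * q)) ⟩
    2 ^ (5 * q + (e + A * q))                   ≡⟨ cong (2 ^_) exps ⟩
    2 ^ (A * u) ∎
    where
    open ≤-Reasoning
    n = u * u * u * 960
    q = u / 9
    e = A * (u % 9) + B * (u / 9)
    exps : 5 * q + (e + A * q) ≡ A * u
    exps = trans (solve 4 (λ q A r B → con 5 :* q :+ (A :* r :+ B :* q :+ A :* q) := A :* r :+ (con 5 :+ B :+ A) :* q) refl q A (u % 9) B)
      (trans (cong (λ z → A * (u % 9) + z * q) AB) (trans (solve 3 (λ A r q → A :* r :+ A :* con 9 :* q := A :* (r :+ q :* con 9)) refl A (u % 9) q) (cong (A *_) (sym (m≡m%n+[m/n]*n u 9)))))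

  u≤9* : ∀ u → u ≤ 9 * suc (u / 9)
  u≤9* u = ≤-trans (≤-reflexive (m≡m%n+[m/n]*n u 9)) (≤-trans (+-mono-≤ (<⇒≤ (m%n<n u 9)) (≤-reflexive (*-comm (u / 9) 9))) (≤-reflexive (sym (*-suc 9 (u / 9)))))

  theta-bound : ∀ a → OddClass a → 0 < q₀ → (∀ u → u / 9 < q₀ → theta a (60 * u) ≤ 2 ^ (A * u)) → ∀ u → theta a (60 * u) ≤ 2 ^ (A * u)
  theta-bound a ca q₀>0 base = <-rec _ step
    where
    step : ∀ u → (∀ {v} → v < u → theta a (60 * v) ≤ 2 ^ (A * v)) → theta a (60 * u) ≤ 2 ^ (A * u)
    step u rec with u / 9 <? q₀
    ... | yes lt = base u lt
    ... | no nlt = ≤-trans (theta-step a (60 * u)) (≤-trans (*-mono-≤ (upper a ca u (≤-<-trans z≤n lt)) (≤-trans (theta-mono a le) (rec lt))) (step-bound u (≮⇒≥ nlt)))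
      where
      q = u / 9
      q>0 : 0 < q
      q>0 = <-≤-trans q₀>0 (≮⇒≥ nlt)
      le : 60 * u / 9 ≤ 60 * suc q
      le = ≤-trans (/-monoˡ-≤ 9 (≤-trans (*-monoʳ-≤ 60 (u≤9* u)) (≤-reflexive (solve 1 (λ y → con 60 :* (con 9 :* y) := con 60 :* y :* con 9) refl (suc q))))) (≤-reflexive (m*n/n≡m (60 * suc q) 9))
      lt : suc q < u
      lt = <-≤-trans (subst₂ _<_ (+-comm q 1) (solve 1 (λ q → q :+ con 8 :* q := q :* con 9) refl q) (+-monoʳ-< q (<-≤-trans (s≤s (s≤s z≤n)) (*-monoʳ-≤ 8 q>0)))) (m/n*n≤m u 9)

theta-table : ∀ a q₀ f w A → thetaScan f a 60 w 0 1 1 ≡ true → q₀ * 9 ≤ f → w ≡ 2 ^ A → ∀ u → u / 9 < q₀ → theta a (60 * u) ≤ 2 ^ (A * u)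
theta-table a q₀ f w A s le w≡ u lt = subst₂ _≤_ (cong (theta a) (trans (+-identityʳ (u * 60)) (*-comm u 60))) (trans (*-identityʳ (w ^ u)) (trans (cong (_^ u) w≡) (^-*-assoc 2 A u)))
  (thetaScan-sound f a 60 w 0 1 s u (<-≤-trans u< le))
  where
  u< : u < q₀ * 9
  u< = <-≤-trans (subst (_< suc (u / 9) * 9) (sym (m≡m%n+[m/n]*n u 9)) (+-monoˡ-< (u / 9 * 9) (m%n<n u 9))) (*-monoˡ-≤ 9 lt)

≤-by : ∀ m n → (m <ᵇ suc n) ≡ true → m ≤ n
≤-by m n e = s≤s⁻¹ (<ᵇ-true {m} {suc n} e)

-- 2¹² 3⁶ 5¹⁰
chebyshevConstant : ℕ
chebyshevConstant = 29160000000000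

module Chebyshev = ThetaBound chebyshevConstant refl 51 403 (729 * 960 * 2 ^ 51) 17 960 (≤-by _ (2 ^ 403) refl) (≤-by _ (2 ^ 51) refl) refl (≤-by _ (2 ^ 85) refl) refl refl

theta-scan-1 : thetaScan 153 1 60 (2 ^ 51) 0 1 1 ≡ true
theta-scan-1 = refl

theta-scan-3 : thetaScan 153 3 60 (2 ^ 51) 0 1 1 ≡ true
theta-scan-3 = refl

theta≤ : ∀ a → OddClass a → ∀ u → theta a (60 * u) ≤ 2 ^ (51 * u)
theta≤ a ca = Chebyshev.theta-bound a ca (s≤s z≤n) (table a ca)
  where
  table : ∀ a → OddClass a → ∀ u → u / 9 < 17 → theta a (60 * u) ≤ 2 ^ (51 * u)
  table _ (inj₁ refl) = theta-table 1 17 153 (2 ^ 51) 51 theta-scan-1 ≤-refl refl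
  table _ (inj₂ refl) = theta-table 3 17 153 (2 ^ 51) 51 theta-scan-3 ≤-refl refl

-- Counting primes

π′ : ℕ → ℕ
π′ x = countOver oddPrime? x

π′-mono : ∀ {x y} → x ≤ y → π′ x ≤ π′ y
π′-mono {x} {zero} z≤n = ≤-refl
π′-mono {x} {suc y} le with x ≟ suc y
... | yes refl = ≤-refl
... | no ne = ≤-trans (π′-mono (s≤s⁻¹ (≤∧≢⇒< le ne))) grow
  where
  grow : π′ y ≤ π′ (suc y)
  grow with oddPrime? (suc y)
  ... | true = n≤1+n _
  ... | false = ≤-refl

2^-cancel : ∀ a b → 2 ^ a ≤ 2 ^ b → a ≤ b
2^-cancel a b le = ≮⇒≥ λ lt → <⇒≱ (^-monoʳ-< 2 (s≤s (s≤s z≤n)) lt) le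

/-upper : ∀ u d .⦃ _ : NonZero d ⦄ → u ≤ d * suc (u / d)
/-upper u d = ≤-trans (≤-reflexive (m≡m%n+[m/n]*n u d)) (≤-trans (+-mono-≤ (<⇒≤ (m%n<n u d)) (≤-reflexive (*-comm (u / d) d))) (≤-reflexive (sym (*-suc d (u / d)))))

-- The equation 5 + B ≡ A * d reserves five bits in each block of d for the cubic factor, as in
-- `ThetaBound` but without a recursive call to pay for.
power-absorbs : ∀ C d .⦃ _ : NonZero d ⦄ A B K q₀ c → C ^ d ≤ 2 ^ B → C ≤ 2 ^ A → 5 + B ≡ A * d → suc q₀ * suc q₀ * suc q₀ * K ≤ 2 ^ (5 * q₀) → K ≡ d * d * d * c * 1 →
  ∀ u → q₀ ≤ u / d → u * u * u * c * C ^ u ≤ 2 ^ (A * u)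
power-absorbs C d A B K q₀ c Cd C₁ AB poly K≡ u q≥ = begin
  u * u * u * c * C ^ u                              ≤⟨ *-mono-≤ (*-monoˡ-≤ c (*-mono-≤ (*-mono-≤ le le) le)) C-power ⟩
  d * y * (d * y) * (d * y) * c * 2 ^ (A * r + B * q) ≡⟨ cong (_* 2 ^ (A * r + B * q)) (sym (*-identityʳ (d * y * (d * y) * (d * y) * c))) ⟩
  d * y * (d * y) * (d * y) * c * 1 * 2 ^ (A * r + B * q) ≡⟨ cong (_* 2 ^ (A * r + B * q)) (trans (cube-scale d y c 1) (cong (y * y * y *_) (sym K≡))) ⟩
  y * y * y * K * 2 ^ (A * r + B * q)                ≡⟨ cong (λ q → suc q * suc q * suc q * K * 2 ^ (A * r + B * (u / d))) (sym (m∸n+n≡m q≥)) ⟩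
  _                                                  ≤⟨ *-monoˡ-≤ (2 ^ (A * r + B * q)) (cube-vs-power K q₀ poly (q ∸ q₀)) ⟩
  2 ^ (5 * (q ∸ q₀ + q₀)) * 2 ^ (A * r + B * q)      ≡⟨ cong (λ z → 2 ^ (5 * z) * 2 ^ (A * r + B * q)) (m∸n+n≡m q≥) ⟩
  2 ^ (5 * q) * 2 ^ (A * r + B * q)                  ≡⟨ sym (^-distribˡ-+-* 2 (5 * q) _) ⟩
  2 ^ (5 * q + (A * r + B * q))                      ≡⟨ cong (2 ^_) exps ⟩
  2 ^ (A * u) ∎
  where
  open ≤-Reasoning
  q = u / d
  r = u % d
  y = suc q
  le = /-upper u d
  C-power : C ^ u ≤ 2 ^ (A * r + B * q)
  C-power = begin
    C ^ u                     ≡⟨ cong (C ^_) (trans (m≡m%n+[m/n]*n u d) (cong (r +_) (*-comm q d))) ⟩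
    C ^ (r + d * q)           ≡⟨ ^-distribˡ-+-* C r (d * q) ⟩
    C ^ r * C ^ (d * q)       ≡⟨ cong (C ^ r *_) (sym (^-*-assoc C d q)) ⟩
    C ^ r * (C ^ d) ^ q       ≤⟨ *-mono-≤ (^-monoˡ-≤ r C₁) (^-monoˡ-≤ q Cd) ⟩
    (2 ^ A) ^ r * (2 ^ B) ^ q ≡⟨ cong₂ _*_ (^-*-assoc 2 A r) (^-*-assoc 2 B q) ⟩
    2 ^ (A * r) * 2 ^ (B * q) ≡⟨ sym (^-distribˡ-+-* 2 (A * r) (B * q)) ⟩
    2 ^ (A * r + B * q) ∎
  exps : 5 * q + (A * r + B * q) ≡ A * u
  exps = trans (solve 4 (λ q A r B → con 5 :* q :+ (A :* r :+ B :* q) := A :* r :+ (con 5 :+ B) :* q) refl q A r B)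
      (trans (cong (λ z → A * r + z * q) AB) (trans (solve 4 (λ A r d q → A :* r :+ A :* d :* q := A :* (r :+ q :* d)) refl A r d q) (cong (A *_) (sym (m≡m%n+[m/n]*n u d)))))

upperPart≤ : ∀ a → OddClass a → ∀ v → 7 ≤ v / 20 → upperPart a (60 * v) ≤ 2 ^ (45 * v)
upperPart≤ a ca v le = ≤-trans (Chebyshev.upper a ca v v>0)
    (power-absorbs chebyshevConstant 20 45 895 7680000 7 960 (≤-by _ (2 ^ 895) refl) (≤-by _ (2 ^ 45) refl) refl (≤-by _ (2 ^ 35) refl) refl v le)
  where
  v>0 : 0 < v
  v>0 = n≢0⇒n>0 λ { refl → contradiction le (λ ()) }

-- Each prime in (X/9, X] exceeds 2^s and occurs in the upper part of one of the two classes, so s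
-- times their number is at most the 45v + 45v bits of both.
module CountStep (s v : ℕ) (2^s≤ : 2 ^ s ≤ 60 * v / 9) where
  X = 60 * v
  up : ℕ → ℕ → ℕ
  up a b = prodOver oddPrime? (λ p → p ^ bonusAt a X p) b
  up>0 : ∀ a b → 0 < up a b
  up>0 a b = prodOver>0 _ _ b (λ p → m^n>0 (suc p) (bonusAt a X (suc p)))

  go : ∀ b → b ≤ X → (2 ^ s) ^ π′ b ≤ up 1 b * up 3 b * (2 ^ s) ^ π′ (X / 9)
  go zero _ = ≤-trans (m^n>0 (2 ^ s) ⦃ m^n≢0 2 s ⦄ (π′ (X / 9))) (≤-reflexive (sym (+-identityʳ _)))
  go (suc b) le with suc b ≤? X / 9
  ... | yes small = ≤-trans (^-monoʳ-≤ (2 ^ s) ⦃ m^n≢0 2 s ⦄ (π′-mono small))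
        (m≤n*m ((2 ^ s) ^ π′ (X / 9)) (up 1 (suc b) * up 3 (suc b)) ⦃ >-nonZero (*-mono-< (up>0 1 (suc b)) (up>0 3 (suc b))) ⦄)
  ... | no large with oddPrime? (suc b) in e
  ... | false = go b (<⇒≤ le)
  ... | true = ≤-trans (*-mono-≤ (≤-trans 2^s≤ (<⇒≤ (≰⇒> large))) (go b (<⇒≤ le))) (≤-reflexive (place (suc b % 4) (odd%4 (suc b) (oddPrime?-odd (suc b) e)) refl))
    where
    Z = (2 ^ s) ^ π′ (X / 9)
    is-near : near (X / suc b) ≡ true
    is-near = cong₂ _∧_ (T⇒≡ (<⇒<ᵇ (m≥n⇒m/n>0 le))) (T⇒≡ (<⇒<ᵇ (m<n*o⇒m/o<n {X} {9} {suc b} X<)))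
      where
      X< : X < 9 * suc b
      X< = subst (X <_) (*-comm (suc b) 9) (<-≤-trans (subst (_< suc (X / 9) * 9) (sym (m≡m%n+[m/n]*n X 9)) (+-monoˡ-< (X / 9 * 9) (m%n<n X 9))) (*-monoˡ-≤ 9 (≰⇒> large)))
    place₁ : ∀ p x y z → p * (x * y * z) ≡ p * 1 * x * (1 * y) * z
    place₁ = solve 4 (λ p x y z → p :* (x :* y :* z) := p :* con 1 :* x :* (con 1 :* y) :* z) refl
    place₃ : ∀ p x y z → p * (x * y * z) ≡ 1 * x * (p * 1 * y) * z
    place₃ = solve 4 (λ p x y z → p :* (x :* y :* z) := con 1 :* x :* (p :* con 1 :* y) :* z) refl
    place : ∀ r → OddClass r → suc b % 4 ≡ r → suc b * (up 1 b * up 3 b * Z) ≡ (suc b) ^ bonusAt 1 X (suc b) * up 1 b * (suc b ^ bonusAt 3 X (suc b) * up 3 b) * Z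
    place _ (inj₁ refl) e₄ rewrite e₄ | is-near = place₁ (suc b) (up 1 b) (up 3 b) Z
    place _ (inj₂ refl) e₄ rewrite e₄ | is-near = place₃ (suc b) (up 1 b) (up 3 b) Z

  count-step : 7 ≤ v / 20 → s * π′ X ≤ 90 * v + s * π′ (X / 9)
  count-step v≥ = 2^-cancel _ _ (begin
    2 ^ (s * π′ X)                                        ≡⟨ sym (^-*-assoc 2 s (π′ X)) ⟩
    (2 ^ s) ^ π′ X                                        ≤⟨ go X ≤-refl ⟩
    upperPart 1 X * upperPart 3 X * (2 ^ s) ^ π′ (X / 9)
      ≤⟨ *-mono-≤ (*-mono-≤ (upperPart≤ 1 (inj₁ refl) v v≥) (upperPart≤ 3 (inj₂ refl) v v≥)) (≤-reflexive (^-*-assoc 2 s (π′ (X / 9)))) ⟩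
    2 ^ (45 * v) * 2 ^ (45 * v) * 2 ^ (s * π′ (X / 9))    ≡⟨ cong (_* 2 ^ (s * π′ (X / 9))) (sym (^-distribˡ-+-* 2 (45 * v) (45 * v))) ⟩
    2 ^ (45 * v + 45 * v) * 2 ^ (s * π′ (X / 9))          ≡⟨ sym (^-distribˡ-+-* 2 (45 * v + 45 * v) (s * π′ (X / 9))) ⟩
    2 ^ (45 * v + 45 * v + s * π′ (X / 9))                ≡⟨ cong (λ z → 2 ^ (z + s * π′ (X / 9))) (sym (*-distribʳ-+ v 45 45)) ⟩
    2 ^ (90 * v + s * π′ (X / 9)) ∎)
    where open ≤-Reasoning

-- The right-hand side increases with x and the prime count jumps at primes only, so the inequality
-- is tested only there.
piScan : ℕ → ℕ → ℕ → ℕ → ℕ → Bool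
piScan zero    m c x cnt = true
piScan (suc f) m c x cnt = if oddPrime? (suc x) then (m * suc cnt <ᵇ suc (c * suc x + 30 * m)) ∧ piScan f m c (suc x) (suc cnt) else piScan f m c (suc x) cnt

piScan-sound : ∀ f m c x → m * π′ x ≤ c * x + 30 * m → piScan f m c x (π′ x) ≡ true → ∀ y → x ≤ y → y ≤ x + f → m * π′ y ≤ c * y + 30 * m
piScan-sound zero m c x inv s y x≤ y≤ = subst (λ y → m * π′ y ≤ c * y + 30 * m) (≤-antisym x≤ (≤-trans y≤ (≤-reflexive (+-identityʳ x)))) inv
piScan-sound (suc f) m c x inv s y x≤ y≤ with x ≟ y
... | yes refl = inv
... | no ne with oddPrime? (suc x) in e
... | true = piScan-sound f m c (suc x) (subst (λ z → m * z ≤ c * suc x + 30 * m) (sym π≡) (≤-by _ _ (proj₁ (∧-split s)))) (subst (λ z → piScan f m c (suc x) z ≡ true) (sym π≡) (proj₂ (∧-split {m * suc (π′ x) <ᵇ suc (c * suc x + 30 * m)} s))) y (≤∧≢⇒< x≤ ne) (subst (y ≤_) (+-suc x f) y≤)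
  where
  π≡ : π′ (suc x) ≡ suc (π′ x)
  π≡ rewrite e = refl
... | false = piScan-sound f m c (suc x) (subst (λ z → m * z ≤ c * suc x + 30 * m) (sym π≡) (≤-trans inv (+-monoˡ-≤ (30 * m) (*-monoʳ-≤ c (n≤1+n x))))) (subst (λ z → piScan f m c (suc x) z ≡ true) (sym π≡) s) y (≤∧≢⇒< x≤ ne) (subst (y ≤_) (+-suc x f) y≤)
  where
  π≡ : π′ (suc x) ≡ π′ x
  π≡ rewrite e = refl

pi-scan : piScan 40000 1000 142 0 0 ≡ true
pi-scan = refl

module PiStep (x s : ℕ) (2^s≤ : 2 ^ s ≤ x / 9) (big : 140 * 60 ≤ x) (IH : ∀ {y} → y < x → π′ y * 1000 ≤ y * 142 + 30000) where
  v = suc (x / 60)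
  X = 60 * v
  Y = X / 9
  v*60≤ : v * 60 ≤ x + 60
  v*60≤ = ≤-trans (+-monoʳ-≤ 60 (m/n*n≤m x 60)) (≤-reflexive (+-comm 60 x))
  x≤X : x ≤ X
  x≤X = /-upper x 60
  Y*9≤ : Y * 9 ≤ v * 60
  Y*9≤ = ≤-trans (m/n*n≤m X 9) (≤-reflexive (*-comm 60 v))
  v≥140 : 140 ≤ v
  v≥140 = ≤-trans (≤-reflexive (sym (m*n/n≡m 140 60))) (≤-trans (/-monoˡ-≤ 60 big) (n≤1+n _))
  v/20 : 7 ≤ v / 20
  v/20 = ≤-trans (≤-reflexive (sym (m*n/n≡m 7 20))) (/-monoˡ-≤ 20 v≥140)
  Y<x : Y < x
  Y<x = *-cancelʳ-< 9 Y x (≤-<-trans Y*9≤ (≤-<-trans v*60≤ (<-≤-trans (+-monoʳ-< x (<-≤-trans (≤-by 61 (8 * (140 * 60)) refl) (*-monoʳ-≤ 8 big))) (≤-reflexive (solve 1 (λ x → x :+ con 8 :* x := x :* con 9) refl x)))))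
  raw : s * π′ x ≤ 90 * v + s * π′ Y
  raw = ≤-trans (*-monoʳ-≤ s (π′-mono x≤X)) (CountStep.count-step s v (≤-trans 2^s≤ (/-monoˡ-≤ 9 x≤X)) v/20)
  IHY : π′ Y * 1000 ≤ Y * 142 + 30000
  IHY = IH Y<x

pi-arithmetic : ∀ p r v x Y → p * 2 ≤ v * 15 + r * 2 → r * 1000 ≤ Y * 142 + 30000 → Y * 9 ≤ v * 60 → v * 60 ≤ x + 60 → 140 ≤ v → p * 1000 ≤ x * 142 + 30000
pi-arithmetic p r v x Y half IHY Y*9≤ v*60≤ v≥140 = *-cancelʳ-≤ _ _ 9 (begin
      p * 1000 * 9                       ≡⟨ trans (*-assoc p 1000 9) (sym (*-assoc p 2 4500)) ⟩
      p * 2 * 4500                       ≤⟨ *-monoˡ-≤ 4500 half ⟩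
      (v * 15 + r * 2) * 4500            ≡⟨ trans (*-distribʳ-+ 4500 (v * 15) (r * 2)) (cong₂ _+_ (*-assoc v 15 4500) (trans (*-assoc r 2 4500) (sym (*-assoc r 1000 9)))) ⟩
      v * 67500 + r * 1000 * 9           ≤⟨ +-monoʳ-≤ (v * 67500) (*-monoˡ-≤ 9 IHY) ⟩
      v * 67500 + (Y * 142 + 30000) * 9  ≡⟨ cong (v * 67500 +_) (trans (*-distribʳ-+ 9 (Y * 142) 30000) (cong (_+ 270000) (trans (*-assoc Y 142 9) (sym (*-assoc Y 9 142))))) ⟩
      v * 67500 + (Y * 9 * 142 + 270000) ≤⟨ +-monoʳ-≤ (v * 67500) (+-monoˡ-≤ 270000 (*-monoˡ-≤ 142 Y*9≤)) ⟩
      v * 67500 + (v * 60 * 142 + 270000) ≡⟨ trans (cong (λ z → v * 67500 + (z + 270000)) (*-assoc v 60 142)) (trans (sym (+-assoc (v * 67500) (v * 8520) 270000)) (cong (_+ 270000) (sym (*-distribˡ-+ v 67500 8520)))) ⟩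
      v * 76020 + 270000                 ≤⟨ +-monoˡ-≤ 270000 (+-cancelʳ-≤ 76680 (v * 76020) (x * 1278) vx) ⟩
      x * 1278 + 270000                  ≡⟨ sym (trans (*-distribʳ-+ 9 (x * 142) 30000) (cong (_+ 270000) (*-assoc x 142 9))) ⟩
      (x * 142 + 30000) * 9 ∎)
    where
    open ≤-Reasoning
    vx : v * 76020 + 76680 ≤ x * 1278 + 76680
    vx = begin
      v * 76020 + 76680     ≤⟨ +-monoʳ-≤ (v * 76020) (≤-trans (≤-by 76680 (140 * 660) refl) (*-monoˡ-≤ 660 v≥140)) ⟩
      v * 76020 + v * 660   ≡⟨ sym (*-distribˡ-+ v 76020 660) ⟩
      v * 76680             ≡⟨ sym (*-assoc v 60 1278) ⟩
      v * 60 * 1278         ≤⟨ *-monoˡ-≤ 1278 v*60≤ ⟩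
      (x + 60) * 1278       ≡⟨ *-distribʳ-+ 1278 x 60 ⟩
      x * 1278 + 76680 ∎

pi-arithmetic-large : ∀ p r v x Y → p * 8 ≤ v * 45 + r * 8 → r * 1000 ≤ Y * 142 + 30000 → Y * 9 ≤ v * 60 → v * 60 ≤ x + 60 → p * 1000 ≤ x * 110 + 40000
pi-arithmetic-large p r v x Y half IHY Y*9≤ v*60≤ = *-cancelʳ-≤ _ _ 72 (begin
      p * 1000 * 72                       ≡⟨ trans (*-assoc p 1000 72) (sym (*-assoc p 8 9000)) ⟩
      p * 8 * 9000                       ≤⟨ *-monoˡ-≤ 9000 half ⟩
      (v * 45 + r * 8) * 9000            ≡⟨ trans (*-distribʳ-+ 9000 (v * 45) (r * 8)) (cong₂ _+_ (*-assoc v 45 9000) (trans (*-assoc r 8 9000) (sym (*-assoc r 1000 72)))) ⟩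
      v * 405000 + r * 1000 * 72           ≤⟨ +-monoʳ-≤ (v * 405000) (*-monoˡ-≤ 72 IHY) ⟩
      v * 405000 + (Y * 142 + 30000) * 72  ≡⟨ cong (v * 405000 +_) (trans (*-distribʳ-+ 72 (Y * 142) 30000) (cong (_+ 2160000) (trans (*-assoc Y 142 72) (sym (*-assoc Y 9 1136))))) ⟩
      v * 405000 + (Y * 9 * 1136 + 2160000) ≤⟨ +-monoʳ-≤ (v * 405000) (+-monoˡ-≤ 2160000 (*-monoˡ-≤ 1136 Y*9≤)) ⟩
      v * 405000 + (v * 60 * 1136 + 2160000) ≡⟨ trans (cong (λ z → v * 405000 + (z + 2160000)) (*-assoc v 60 1136)) (trans (sym (+-assoc (v * 405000) (v * 68160) 2160000)) (cong (_+ 2160000) (sym (*-distribˡ-+ v 405000 68160)))) ⟩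
      v * 473160 + 2160000                 ≡⟨ cong (_+ 2160000) (sym (*-assoc v 60 7886)) ⟩
      v * 60 * 7886 + 2160000              ≤⟨ +-monoˡ-≤ 2160000 (*-monoˡ-≤ 7886 v*60≤) ⟩
      (x + 60) * 7886 + 2160000            ≡⟨ trans (cong (_+ 2160000) (*-distribʳ-+ 7886 x 60)) (+-assoc (x * 7886) 473160 2160000) ⟩
      x * 7886 + 2633160                   ≤⟨ +-mono-≤ (*-monoʳ-≤ x (≤-by 7886 7920 refl)) (≤-by 2633160 2880000 refl) ⟩
      x * 7920 + 2880000                   ≡⟨ sym (trans (*-distribʳ-+ 72 (x * 110) 40000) (cong (_+ 2880000) (*-assoc x 110 72))) ⟩
      (x * 110 + 40000) * 72 ∎)
    where open ≤-Reasoning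

-- Beyond 40000 one has 2^12 ≤ x/9, so `CountStep` gives 90/(60·12) = 0.125 per unit; the induction
-- hypothesis at x/9 adds 0.142/9 < 0.016. The sum stays below 0.142 and the gap covers rounding x
-- up to a multiple of 60.
pi-bound : ∀ x → π′ x * 1000 ≤ x * 142 + 30000
pi-bound = <-rec _ step
  where
  step : ∀ x → (∀ {y} → y < x → π′ y * 1000 ≤ y * 142 + 30000) → π′ x * 1000 ≤ x * 142 + 30000
  step x IH with x ≤? 40000
  ... | yes small = subst₂ (λ a b → a ≤ b + 30000) (*-comm 1000 (π′ x)) (*-comm 142 x) (piScan-sound 40000 1000 142 0 z≤n pi-scan x z≤n small)
  ... | no large = pi-arithmetic (π′ x) (π′ Y) v x Y half IHY Y*9≤ v*60≤ v≥140
    where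
    big : 40000 ≤ x
    big = <⇒≤ (≰⇒> large)
    open PiStep x 12 (≤-trans (≤-by (2 ^ 12) (40000 / 9) refl) (/-monoˡ-≤ 9 big)) (≤-trans (≤-by (140 * 60) 40000 refl) big) IH
    half : π′ x * 2 ≤ v * 15 + π′ Y * 2
    half = *-cancelˡ-≤ 6 (subst₂ _≤_ (solve 1 (λ p → con 12 :* p := con 6 :* (p :* con 2)) refl (π′ x)) (solve 2 (λ v r → con 90 :* v :+ con 12 :* r := con 6 :* (v :* con 15 :+ r :* con 2)) refl v (π′ Y)) raw)

-- Now 2^16 ≤ x/9, and 90/(60·16) + 0.142/9 < 0.110.
pi-bound-large : ∀ x → 600000 ≤ x → π′ x * 1000 ≤ x * 110 + 40000
pi-bound-large x big = pi-arithmetic-large (π′ x) (π′ Y) v x Y half IHY Y*9≤ v*60≤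
    where
    open PiStep x 16 (≤-trans (≤-by (2 ^ 16) (600000 / 9) refl) (/-monoˡ-≤ 9 big)) (≤-trans (≤-by (140 * 60) 600000 refl) big) (λ {y} _ → pi-bound y)
    half : π′ x * 8 ≤ v * 45 + π′ Y * 8
    half = *-cancelˡ-≤ 2 (subst₂ _≤_ (solve 1 (λ p → con 16 :* p := con 2 :* (p :* con 8)) refl (π′ x)) (solve 2 (λ v r → con 90 :* v :+ con 16 :* r := con 2 :* (v :* con 45 :+ r :* con 8)) refl v (π′ Y)) raw)

-- Blocks with k ≥ 4¹² and n < 32k

-- bin M i = C(M , i) a^i b^(M−i)
module MaxTerm (a b : ℕ) (a>0 : 0 < a) (b>0 : 0 < b) where

  bin : ℕ → ℕ → ℕ
  bin zero    zero    = 1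
  bin zero    (suc i) = 0
  bin (suc M) zero    = b * bin M zero
  bin (suc M) (suc i) = a * bin M i + b * bin M (suc i)

  bin-zero : ∀ M i → M < i → bin M i ≡ 0
  bin-zero zero (suc i) _ = refl
  bin-zero (suc M) (suc i) (s≤s lt) = trans (cong₂ (λ x y → a * x + b * y) (bin-zero M i lt) (bin-zero M (suc i) (m<n⇒m<1+n lt))) (cong₂ _+_ (*-zeroʳ a) (*-zeroʳ b))

  bin-fac : ∀ i j → bin (i + j) i * (i ! * j !) ≡ (i + j) ! * (a ^ i * b ^ j)
  bin-fac zero zero = refl
  bin-fac zero (suc j) = trans (solve 3 (λ b t f → b :* t :* (con 1 :* f) := b :* (t :* (con 1 :* f))) refl b (bin j 0) (suc j !))
    (trans (cong (b *_) (trans (solve 3 (λ t s f → t :* (con 1 :* (s :* f)) := s :* (t :* (con 1 :* f))) refl (bin j 0) (suc j) (j !)) (cong (suc j *_) (bin-fac 0 j))))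
      (solve 4 (λ b s f p → b :* (s :* (f :* (con 1 :* p))) := s :* f :* (con 1 :* (b :* p))) refl b (suc j) (j !) (b ^ j)))
  bin-fac (suc i) zero = trans (cong (_* (suc i ! * 1)) (cong₂ (λ x y → a * x + b * y) refl (bin-zero (i + 0) (suc i) (s≤s (≤-reflexive (+-identityʳ i))))))
    (trans (solve 5 (λ a t b s f → (a :* t :+ b :* con 0) :* (s :* f :* con 1) := a :* s :* (t :* (f :* con 1))) refl a (bin (i + 0) i) b (suc i) (i !))
      (trans (cong (a * suc i *_) (bin-fac i 0)) (trans (solve 4 (λ a s f p → a :* s :* (f :* (p :* con 1)) := s :* f :* (a :* p :* con 1)) refl a (suc i) ((i + 0) !) (a ^ i))
        (cong (λ z → suc z * (i + 0) ! * (a * a ^ i * 1)) (sym (+-identityʳ i))))))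
  bin-fac (suc i) (suc j) = begin
    (a * bin (i + suc j) i + b * bin (i + suc j) (suc i)) * (suc i ! * suc j !)
      ≡⟨ solve 6 (λ a t b u f g → (a :* t :+ b :* u) :* (f :* g) := a :* (t :* (f :* g)) :+ b :* (u :* (f :* g))) refl a (bin (i + suc j) i) b (bin (i + suc j) (suc i)) (suc i !) (suc j !) ⟩
    a * (bin (i + suc j) i * (suc i ! * suc j !)) + b * (bin (i + suc j) (suc i) * (suc i ! * suc j !))
      ≡⟨ cong₂ (λ x y → a * x + b * y)
           (trans (solve 4 (λ t s f g → t :* (s :* f :* g) := s :* (t :* (f :* g))) refl (bin (i + suc j) i) (suc i) (i !) (suc j !)) (cong (suc i *_) (bin-fac i (suc j))))
           (trans (solve 4 (λ t f s g → t :* (f :* (s :* g)) := s :* (t :* (f :* g))) refl (bin (i + suc j) (suc i)) (suc i !) (suc j) (j !))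
             (cong (suc j *_) (subst (λ z → bin z (suc i) * (suc i ! * j !) ≡ z ! * (a ^ suc i * b ^ j)) (sym (+-suc i j)) (bin-fac (suc i) j)))) ⟩
    a * (suc i * ((i + suc j) ! * (a ^ i * b ^ suc j))) + b * (suc j * ((i + suc j) ! * (a ^ suc i * b ^ j)))
      ≡⟨ solve 7 (λ a b s t f p q → a :* (s :* (f :* (p :* (b :* q)))) :+ b :* (t :* (f :* (a :* p :* q))) := (s :+ t) :* f :* (a :* p :* (b :* q))) refl a b (suc i) (suc j) ((i + suc j) !) (a ^ i) (b ^ j) ⟩
    (suc i + suc j) * (i + suc j) ! * (a ^ suc i * b ^ suc j) ∎
    where open ≡-Reasoning

  T-ratio : ∀ i j → bin (i + suc j) (suc i) * (suc i * b) ≡ bin (i + suc j) i * (suc j * a)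
  T-ratio i j = *-cancelʳ-≡ _ _ (i ! * j !) ⦃ >-nonZero (*-mono-< (1≤n! i) (1≤n! j)) ⦄ (begin
    bin (i + suc j) (suc i) * (suc i * b) * (i ! * j !)
      ≡⟨ solve 5 (λ t s b f g → t :* (s :* b) :* (f :* g) := b :* (t :* (s :* f :* g))) refl (bin (i + suc j) (suc i)) (suc i) b (i !) (j !) ⟩
    b * (bin (i + suc j) (suc i) * (suc i ! * j !)) ≡⟨ cong (b *_) (subst (λ z → bin z (suc i) * (suc i ! * j !) ≡ z ! * (a ^ suc i * b ^ j)) (sym (+-suc i j)) (bin-fac (suc i) j)) ⟩
    b * ((i + suc j) ! * (a ^ suc i * b ^ j)) ≡⟨ solve 5 (λ b f a p q → b :* (f :* (a :* p :* q)) := a :* (f :* (p :* (b :* q)))) refl b ((i + suc j) !) a (a ^ i) (b ^ j) ⟩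
    a * ((i + suc j) ! * (a ^ i * b ^ suc j)) ≡⟨ cong (a *_) (sym (bin-fac i (suc j))) ⟩
    a * (bin (i + suc j) i * (i ! * suc j !)) ≡⟨ solve 5 (λ a t f s g → a :* (t :* (f :* (s :* g))) := t :* (s :* a) :* (f :* g)) refl a (bin (i + suc j) i) (i !) (suc j) (j !) ⟩
    bin (i + suc j) i * (suc j * a) * (i ! * j !) ∎)
    where open ≡-Reasoning

  T-rise : ∀ i j → suc i * b ≤ suc j * a → bin (i + suc j) i ≤ bin (i + suc j) (suc i)
  T-rise i j le = *-cancelʳ-≤ _ _ (suc i * b) ⦃ >-nonZero (*-mono-< {0} {suc i} z<s b>0) ⦄
    (≤-trans (*-monoʳ-≤ (bin (i + suc j) i) le) (≤-reflexive (sym (T-ratio i j))))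

  T-fall : ∀ i j → suc j * a ≤ suc i * b → bin (i + suc j) (suc i) ≤ bin (i + suc j) i
  T-fall i j le = *-cancelʳ-≤ _ _ (suc j * a) ⦃ >-nonZero (*-mono-< {0} {suc j} z<s a>0) ⦄
    (≤-trans (*-monoʳ-≤ (bin (i + suc j) (suc i)) le) (≤-reflexive (T-ratio i j)))

  module Peak (k j : ℕ) (j≤ : j * a ≤ k * b) (j≥ : k * b ≤ suc j * a) where
    M = k + j

    below : ∀ d i → i + d ≡ k → bin M i ≤ bin M k
    below zero i e = ≤-reflexive (cong (bin M) (trans (sym (+-identityʳ i)) e))
    below (suc d) i e = ≤-trans (subst (λ z → bin z i ≤ bin z (suc i)) M≡ (T-rise i (d + j) le)) (below d (suc i) (trans (sym (+-suc i d)) e))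
      where
      M≡ : i + suc (d + j) ≡ M
      M≡ = trans (solve 3 (λ i d j → i :+ (con 1 :+ (d :+ j)) := i :+ (con 1 :+ d) :+ j) refl i d j) (cong (_+ j) e)
      le : suc i * b ≤ suc (d + j) * a
      le = ≤-trans (*-monoˡ-≤ b (≤-trans (s≤s (m≤m+n i d)) (≤-reflexive (trans (sym (+-suc i d)) e)))) (≤-trans j≥ (*-monoˡ-≤ a (s≤s (m≤n+m j d))))

    above : ∀ d → bin M (d + k) ≤ bin M k
    above zero = ≤-refl
    above (suc d) with suc d ≤? j
    ... | no nle = ≤-trans (≤-reflexive (bin-zero M (suc d + k) (subst (M <_) (+-comm k (suc d)) (+-monoʳ-< k (≰⇒> nle))))) z≤n
    ... | yes le = ≤-trans (subst (λ z → bin z (suc d + k) ≤ bin z (d + k)) M≡ (T-fall (d + k) (j ∸ suc d) le′)) (above d)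
      where
      M≡ : d + k + suc (j ∸ suc d) ≡ M
      M≡ = trans (solve 3 (λ d k e → d :+ k :+ (con 1 :+ e) := k :+ (con 1 :+ d :+ e)) refl d k (j ∸ suc d)) (cong (k +_) (m+[n∸m]≡n le))
      le′ : suc (j ∸ suc d) * a ≤ suc (d + k) * b
      le′ = ≤-trans (*-monoˡ-≤ a (≤-trans (≤-reflexive (sym (+-∸-assoc 1 le))) (m∸n≤m j d))) (≤-trans j≤ (*-monoˡ-≤ b (m≤n⇒m≤1+n (m≤n+m k d))))

    T-max : ∀ i → bin M i ≤ bin M k
    T-max i with i ≤? k
    ... | yes le = below (k ∸ i) i (m+[n∸m]≡n le)
    ... | no nle = subst (λ z → bin M z ≤ bin M k) (m∸n+n≡m (<⇒≤ (≰⇒> nle))) (above (i ∸ k))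

  row : ℕ → ℕ → ℕ
  row M l = sumTo (bin M) l

  row-step : ∀ M l → row (suc M) (suc l) ≡ a * row M l + b * row M (suc l)
  row-step M zero = solve 3 (λ a b t → b :* t :+ con 0 := a :* con 0 :+ b :* (t :+ con 0)) refl a b (bin M 0)
  row-step M (suc l) = trans (cong (a * bin M l + b * bin M (suc l) +_) (row-step M l))
    (solve 6 (λ a b t u r s → a :* t :+ b :* u :+ (a :* r :+ b :* s) := a :* (t :+ r) :+ b :* (u :+ s)) refl a b (bin M l) (bin M (suc l)) (row M l) (row M (suc l)))

  row-sum : ∀ M → row M (suc M) ≡ (a + b) ^ M
  row-sum zero = refl
  row-sum (suc M) = trans (row-step M (suc M)) (trans (cong₂ (λ x y → a * x + b * y) (row-sum M) (trans (cong (_+ row M (suc M)) (bin-zero M (suc M) ≤-refl)) (row-sum M)))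
    (sym (*-distribʳ-+ ((a + b) ^ M) a b)))

  sum≤ : ∀ f c l → (∀ i → f i ≤ c) → sumTo f l ≤ l * c
  sum≤ f c zero h = z≤n
  sum≤ f c (suc l) h = +-mono-≤ (h l) (sum≤ f c l h)

  -- The M + 1 terms of the expansion of (a + b)^M are unimodal, and the two hypotheses place the
  -- peak at index k, so that term is at least the average. This is the converse of `binomial-bound`
  -- up to the factor M + 1.
  max-term : ∀ k j → j * a ≤ k * b → k * b ≤ suc j * a → (a + b) ^ (k + j) * (k ! * j !) ≤ suc (k + j) * ((k + j) ! * (a ^ k * b ^ j))
  max-term k j j≤ j≥ = begin
    (a + b) ^ M * (k ! * j !)             ≡⟨ cong (_* (k ! * j !)) (sym (row-sum M)) ⟩
    row M (suc M) * (k ! * j !)           ≤⟨ *-monoˡ-≤ (k ! * j !) (sum≤ (bin M) (bin M k) (suc M) T-max) ⟩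
    suc M * bin M k * (k ! * j !)           ≡⟨ *-assoc (suc M) (bin M k) (k ! * j !) ⟩
    suc M * (bin M k * (k ! * j !))         ≡⟨ cong (suc M *_) (bin-fac k j) ⟩
    suc M * (M ! * (a ^ k * b ^ j)) ∎
    where
    open ≤-Reasoning
    open Peak k j j≤ j≥

-- Since n + 4i ≥ 4 (j + 1 + i), the block dominates 4^k (k + j)! / j!. For n close to 4k this is
-- much stronger than n^k.
prodAP4-fac : ∀ n j k → 4 * suc j ≤ n → 4 ^ k * (k + j) ! ≤ prodAP4 n k * j !
prodAP4-fac n j zero le = ≤-refl
prodAP4-fac n j (suc k) le = begin
  4 * 4 ^ k * (suc (k + j) * (k + j) !)      ≡⟨ solve 4 (λ p k j f → con 4 :* p :* ((con 1 :+ (k :+ j)) :* f) := p :* f :* (con 4 :* (con 1 :+ j) :+ con 4 :* k)) refl (4 ^ k) k j ((k + j) !) ⟩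
  4 ^ k * (k + j) ! * (4 * suc j + 4 * k)    ≤⟨ *-mono-≤ (prodAP4-fac n j k le) (+-monoˡ-≤ (4 * k) le) ⟩
  prodAP4 n k * j ! * (n + 4 * k)            ≡⟨ solve 3 (λ p f t → p :* f :* t := p :* t :* f) refl (prodAP4 n k) (j !) (n + 4 * k) ⟩
  prodAP4 n k * (n + 4 * k) * j ! ∎
  where open ≤-Reasoning

-- With k = κ + 1 terms the odd factorial is that of κ, and the factor κ + 1 lost in
-- `OddFacBounds.upper` is just what completes κ! to k!.
doubled-bound : ∀ κ n E → Odd n → 0 < E → (∀ i → i < suc κ → n + 4 * i ∣ E) → 2 ^ suc κ * prodAP4 n (suc κ) ≤ 2 * E * (suc κ) !
doubled-bound κ n E on E>0 d = begin
  2 * 2 ^ κ * prodAP4 n (suc κ)   ≤⟨ *-monoʳ-≤ (2 * 2 ^ κ) (prodAP4≤ κ n E on E>0 d) ⟩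
  2 * 2 ^ κ * (E * oddFac κ)      ≡⟨ solve 3 (λ p e o → con 2 :* p :* (e :* o) := con 2 :* e :* (p :* o)) refl (2 ^ κ) E (oddFac κ) ⟩
  2 * E * (2 ^ κ * oddFac κ)      ≤⟨ *-monoʳ-≤ (2 * E) (OddFacBounds.upper (oddFacBounds κ)) ⟩
  2 * E * (suc κ) ! ∎
  where open ≤-Reasoning

module _ (a b : ℕ) (a>0 : 0 < a) (b>0 : 0 < b) where
  open MaxTerm a b a>0 b>0

  -- Together `prodAP4-fac` and `doubled-bound` give 8^k C(k+j, k) ≤ 2E; the binomial coefficient is
  -- then bounded below by `max-term`.
  entropy-bound : ∀ k n j E → 4 * suc j ≤ n → j * a ≤ k * b → k * b ≤ suc j * a → 2 ^ k * prodAP4 n k ≤ 2 * E * k ! →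
    8 ^ k * (a + b) ^ (k + j) ≤ 2 * suc (k + j) * E * (a ^ k * b ^ j)
  entropy-bound k n j E le j≤ j≥ dbl = *-cancelʳ-≤ _ _ (k ! * j !) ⦃ >-nonZero (*-mono-< (1≤n! k) (1≤n! j)) ⦄ (begin
    8 ^ k * (a + b) ^ (k + j) * (k ! * j !)            ≡⟨ *-assoc (8 ^ k) _ _ ⟩
    8 ^ k * ((a + b) ^ (k + j) * (k ! * j !))          ≤⟨ *-monoʳ-≤ (8 ^ k) (max-term k j j≤ j≥) ⟩
    8 ^ k * (s * ((k + j) ! * w))                      ≡⟨ cong (_* (s * ((k + j) ! * w))) (^-distribʳ-* k 2 4) ⟩
    2 ^ k * 4 ^ k * (s * ((k + j) ! * w))              ≡⟨ solve 5 (λ p q s f w → p :* q :* (s :* (f :* w)) := s :* w :* (p :* (q :* f))) refl (2 ^ k) (4 ^ k) s ((k + j) !) w ⟩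
    s * w * (2 ^ k * (4 ^ k * (k + j) !))              ≤⟨ *-monoʳ-≤ (s * w) (*-monoʳ-≤ (2 ^ k) (prodAP4-fac n j k le)) ⟩
    s * w * (2 ^ k * (prodAP4 n k * j !))              ≡⟨ solve 4 (λ c p d f → c :* (p :* (d :* f)) := c :* (p :* d) :* f) refl (s * w) (2 ^ k) (prodAP4 n k) (j !) ⟩
    s * w * (2 ^ k * prodAP4 n k) * j !                ≤⟨ *-monoˡ-≤ (j !) (*-monoʳ-≤ (s * w) dbl) ⟩
    s * w * (2 * E * k !) * j !                        ≡⟨ solve 5 (λ s w e f g → s :* w :* (con 2 :* e :* f) :* g := con 2 :* s :* e :* w :* (f :* g)) refl s w E (k !) (j !) ⟩
    2 * s * E * w * (k ! * j !) ∎)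
    where
    open ≤-Reasoning
    s = suc (k + j)
    w = a ^ k * b ^ j

module _ (a b : ℕ) (a>0 : 0 < a) (b>0 : 0 < b) where

  -- For n ≈ 4j and j ≈ k b / a this is a lower bound of d/a bits per unit of k for E, with d
  -- certified by one numerical inequality. Taking a-th powers clears the denominator of j / k; the
  -- rounding of j leaves a power of a + b with exponent at most a.
  entropy-power : ∀ d → a ^ a * b ^ b * 2 ^ d ≤ 8 ^ a * (a + b) ^ (a + b) →
    ∀ k n j E → 4 * suc j ≤ n → j * a ≤ k * b → k * b ≤ suc j * a → 2 ^ k * prodAP4 n k ≤ 2 * E * k ! →
    2 ^ (d * k) ≤ ((a + b) * (2 * suc (k + j) * E)) ^ a
  entropy-power d rate k n j E le j≤ j≥ dbl = *-cancelˡ-≤ (H ^ k) ⦃ m^n≢0 H k ⦃ >-nonZero (*-mono-< (m^n>0 a ⦃ >-nonZero a>0 ⦄ a) (m^n>0 b ⦃ >-nonZero b>0 ⦄ b)) ⦄ ⦄ (begin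
    H ^ k * 2 ^ (d * k)                     ≡⟨ cong (H ^ k *_) (sym (^-*-assoc 2 d k)) ⟩
    H ^ k * (2 ^ d) ^ k                     ≡⟨ sym (^-distribʳ-* k H (2 ^ d)) ⟩
    (H * 2 ^ d) ^ k                         ≤⟨ ^-monoˡ-≤ k rate ⟩
    (8 ^ a * c ^ c) ^ k                     ≡⟨ ^-distribʳ-* k (8 ^ a) (c ^ c) ⟩
    (8 ^ a) ^ k * (c ^ c) ^ k               ≡⟨ cong₂ _*_ (swap 8 a k) (trans (^-*-assoc c c k) (trans (cong (c ^_) c*k) (trans (^-distribˡ-+-* c ((k + j) * a) s) (cong (_* c ^ s) (sym (^-*-assoc c (k + j) a)))))) ⟩
    (8 ^ k) ^ a * ((c ^ (k + j)) ^ a * c ^ s) ≡⟨ trans (sym (*-assoc ((8 ^ k) ^ a) _ _)) (cong (_* c ^ s) (sym (^-distribʳ-* a (8 ^ k) (c ^ (k + j))))) ⟩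
    (8 ^ k * c ^ (k + j)) ^ a * c ^ s       ≤⟨ *-mono-≤ (^-monoˡ-≤ a (entropy-bound a b a>0 b>0 k n j E le j≤ j≥ dbl)) (^-monoʳ-≤ c ⦃ >-nonZero (<-≤-trans a>0 (m≤m+n a b)) ⦄ s≤) ⟩
    (Q * (a ^ k * b ^ j)) ^ a * c ^ a       ≡⟨ cong (_* c ^ a) (trans (^-distribʳ-* a Q (a ^ k * b ^ j)) (cong (Q ^ a *_) (^-distribʳ-* a (a ^ k) (b ^ j)))) ⟩
    Q ^ a * ((a ^ k) ^ a * (b ^ j) ^ a) * c ^ a ≤⟨ *-monoˡ-≤ (c ^ a) (*-monoʳ-≤ (Q ^ a) (*-mono-≤ (≤-reflexive (swap a k a)) bpow)) ⟩
    Q ^ a * ((a ^ a) ^ k * (b ^ b) ^ k) * c ^ a ≡⟨ cong (λ z → Q ^ a * z * c ^ a) (sym (^-distribʳ-* k (a ^ a) (b ^ b))) ⟩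
    Q ^ a * H ^ k * c ^ a                   ≡⟨ solve 3 (λ q h c → q :* h :* c := h :* (c :* q)) refl (Q ^ a) (H ^ k) (c ^ a) ⟩
    H ^ k * (c ^ a * Q ^ a)                 ≡⟨ cong (H ^ k *_) (sym (^-distribʳ-* a c Q)) ⟩
    H ^ k * (c * Q) ^ a ∎)
    where
    open ≤-Reasoning
    c = a + b
    H = a ^ a * b ^ b
    Q = 2 * suc (k + j) * E
    s = k * b ∸ j * a
    s≤ : s ≤ a
    s≤ = ≤-trans (∸-monoˡ-≤ (j * a) j≥) (≤-reflexive (m+n∸n≡m a (j * a)))
    swap : ∀ x m n → (x ^ m) ^ n ≡ (x ^ n) ^ m
    swap x m n = trans (^-*-assoc x m n) (trans (cong (x ^_) (*-comm m n)) (sym (^-*-assoc x n m)))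
    c*k : c * k ≡ (k + j) * a + s
    c*k = trans (solve 3 (λ a b k → (a :+ b) :* k := k :* a :+ k :* b) refl a b k) (trans (cong (k * a +_) (sym (m+[n∸m]≡n j≤)))
      (solve 4 (λ k a j s → k :* a :+ (j :* a :+ s) := (k :+ j) :* a :+ s) refl k a j s))
    bpow : (b ^ j) ^ a ≤ (b ^ b) ^ k
    bpow = ≤-trans (≤-reflexive (^-*-assoc b j a)) (≤-trans (^-monoʳ-≤ b ⦃ >-nonZero b>0 ⦄ (≤-trans j≤ (≤-reflexive (*-comm k b)))) (≤-reflexive (sym (^-*-assoc b b k))))

fac-ratio : ∀ k j → (k + j) ! ≤ (k + j) ^ k * j !
fac-ratio zero j = ≤-reflexive (sym (+-identityʳ (j !)))
fac-ratio (suc k) j = ≤-trans (*-monoʳ-≤ (suc (k + j)) (≤-trans (fac-ratio k j) (*-monoˡ-≤ (j !) (^-monoˡ-≤ k (n≤1+n (k + j)))))) (≤-reflexive (sym (*-assoc (suc (k + j)) (suc (k + j) ^ k) (j !))))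

-- Apply `max-term` with weights 1 and b at j = b k, and (k + j)! / j! ≤ (k + j)^k. The result is
-- Stirling's bound with (1 + 1/b)^b in place of the number e.
stirling-upper : ∀ b → 0 < b → ∀ k → suc b ^ (b * k) * k ! ≤ suc (k + b * k) * (k ^ k * b ^ (b * k))
stirling-upper b b>0 k = *-cancelʳ-≤ _ _ (suc b ^ k * j !) ⦃ >-nonZero (*-mono-< (m^n>0 (suc b) k) (1≤n! j)) ⦄ (begin
  suc b ^ j * k ! * (suc b ^ k * j !)       ≡⟨ solve 4 (λ x f y g → x :* f :* (y :* g) := y :* x :* (f :* g)) refl (suc b ^ j) (k !) (suc b ^ k) (j !) ⟩
  suc b ^ k * suc b ^ j * (k ! * j !)       ≡⟨ cong (_* (k ! * j !)) (sym (^-distribˡ-+-* (suc b) k j)) ⟩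
  suc b ^ (k + j) * (k ! * j !)             ≤⟨ MaxTerm.max-term 1 b z<s b>0 k j (≤-reflexive (trans (*-identityʳ j) (*-comm b k))) (≤-trans (≤-reflexive (trans (*-comm k b) (sym (*-identityʳ j)))) (*-monoˡ-≤ 1 (n≤1+n j))) ⟩
  suc (k + j) * ((k + j) ! * (1 ^ k * b ^ j)) ≤⟨ *-monoʳ-≤ (suc (k + j)) (*-mono-≤ (fac-ratio k j) (≤-reflexive (trans (cong (_* b ^ j) (^-zeroˡ k)) (*-identityˡ (b ^ j))))) ⟩
  suc (k + j) * ((k + j) ^ k * j ! * b ^ j) ≡⟨ cong (λ z → suc (k + j) * (z * j ! * b ^ j)) (trans (cong (_^ k) (*-comm (suc b) k)) (^-distribʳ-* k k (suc b))) ⟩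
  suc (k + j) * (k ^ k * suc b ^ k * j ! * b ^ j) ≡⟨ solve 5 (λ s p q f r → s :* (p :* q :* f :* r) := s :* (p :* r) :* (q :* f)) refl (suc (k + j)) (k ^ k) (suc b ^ k) (j !) (b ^ j) ⟩
  suc (k + j) * (k ^ k * b ^ j) * (suc b ^ k * j !) ∎)
  where
  open ≤-Reasoning
  j = b * k

fac-power : ∀ b → 0 < b → ∀ c d → (b ^ b) ^ c * 2 ^ d ≤ (suc b ^ b) ^ c → ∀ k → (k !) ^ c * 2 ^ (d * k) ≤ (suc (k + b * k) * k ^ k) ^ c
fac-power b b>0 c d rate k = *-cancelˡ-≤ (V ^ k) ⦃ m^n≢0 V k ⦃ m^n≢0 (b ^ b) c ⦃ m^n≢0 b b ⦃ >-nonZero b>0 ⦄ ⦄ ⦄ ⦄ (begin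
  V ^ k * ((k !) ^ c * 2 ^ (d * k))            ≡⟨ solve 3 (λ v f p → v :* (f :* p) := v :* p :* f) refl (V ^ k) ((k !) ^ c) (2 ^ (d * k)) ⟩
  V ^ k * 2 ^ (d * k) * (k !) ^ c              ≡⟨ cong (_* (k !) ^ c) (trans (cong (V ^ k *_) (sym (^-*-assoc 2 d k))) (sym (^-distribʳ-* k V (2 ^ d)))) ⟩
  (V * 2 ^ d) ^ k * (k !) ^ c                  ≤⟨ *-monoˡ-≤ ((k !) ^ c) (^-monoˡ-≤ k rate) ⟩
  ((suc b ^ b) ^ c) ^ k * (k !) ^ c            ≡⟨ cong (_* (k !) ^ c) (re (suc b)) ⟩
  (suc b ^ (b * k)) ^ c * (k !) ^ c            ≡⟨ sym (^-distribʳ-* c (suc b ^ (b * k)) (k !)) ⟩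
  (suc b ^ (b * k) * k !) ^ c                  ≤⟨ ^-monoˡ-≤ c (stirling-upper b b>0 k) ⟩
  (S * (k ^ k * b ^ (b * k))) ^ c              ≡⟨ cong (_^ c) (solve 3 (λ s p q → s :* (p :* q) := q :* (s :* p)) refl S (k ^ k) (b ^ (b * k))) ⟩
  (b ^ (b * k) * (S * k ^ k)) ^ c              ≡⟨ ^-distribʳ-* c (b ^ (b * k)) (S * k ^ k) ⟩
  (b ^ (b * k)) ^ c * (S * k ^ k) ^ c          ≡⟨ cong (_* (S * k ^ k) ^ c) (sym (re b)) ⟩
  V ^ k * (S * k ^ k) ^ c ∎)
  where
  open ≤-Reasoning
  V = (b ^ b) ^ c
  S = suc (k + b * k)
  re : ∀ x → ((x ^ b) ^ c) ^ k ≡ (x ^ (b * k)) ^ c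
  re x = trans (^-*-assoc (x ^ b) c k) (trans (cong ((x ^ b) ^_) (*-comm c k)) (trans (sym (^-*-assoc (x ^ b) k c)) (cong (_^ c) (^-*-assoc x b k))))

-- A prime up to s, where (s + 1)² > N, enters E with its largest power; a larger one divides a term
-- once only. If the term is c p with c ≡ 3 (mod 4), then p lies in the class opposite to n and is
-- at most A; if c ≡ 1, then p lies in the class of n and is at most Bq. The premise n ≤ c * p of
-- `hA` lets a caller exclude c = 3 for large n.
module Envelope (b n k N s lg A Bq : ℕ) (on : Odd n) (n≤N : 0 < N) (terms≤ : ∀ i → i < k → n + 4 * i ≤ N) (s² : N < suc s * suc s) (N<2^lg : N ≤ 2 ^ lg)
                (b<n : b < n) (sm : AllSmooth b n k)
                (hA : ∀ p c → c % 4 ≡ 3 → p ≤ b → n ≤ c * p → c * p ≤ N → p ≤ A)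
                (hB : ∀ p c → 5 ≤ c → p ≤ b → c * p ≤ N → p ≤ Bq) where

  cl = n % 4

  e₀ e₁ e₂ E′ : ℕ → ℕ
  e₀ p = if p <ᵇ suc s then powFloor p N else 1
  e₁ p = if (p % 4 ≡ᵇ other cl) ∧ (p <ᵇ suc A) then p else 1
  e₂ p = if (p % 4 ≡ᵇ cl) ∧ (p <ᵇ suc Bq) then p else 1
  E′ p = e₀ p * (e₁ p * e₂ p)

  E = prodOver oddPrime? E′ b

  e₀-small : ∀ b → prodOver oddPrime? e₀ b ≤ 2 ^ (lg * π′ s)
  e₀-small b = ≤-trans (go b) (≤-trans (^-monoˡ-≤ (π′ s) N<2^lg) (≤-reflexive (^-*-assoc 2 lg (π′ s))))
    where
    mono : ∀ b → b ≤ s → prodOver oddPrime? e₀ b ≤ N ^ π′ b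
    mono zero _ = ≤-refl
    mono (suc b) le with oddPrime? (suc b)
    ... | false = mono b (<⇒≤ le)
    ... | true = *-mono-≤ (≤-trans (≤-reflexive (cong (λ z → if z then powFloor (suc b) N else 1) (T⇒≡ (<⇒<ᵇ (s≤s le))))) (powFloor-≤ (suc b) N n≤N)) (mono b (<⇒≤ le))
    go : ∀ b → prodOver oddPrime? e₀ b ≤ N ^ π′ s
    go b with b ≤? s
    ... | yes le = ≤-trans (mono b le) (^-monoʳ-≤ N ⦃ >-nonZero n≤N ⦄ (π′-mono le))
    go zero | no nle = contradiction z≤n nle
    go (suc b) | no nle with oddPrime? (suc b)
    ... | false = go b
    ... | true with suc b <ᵇ suc s in e
    ... | true = contradiction (s≤s⁻¹ (<ᵇ-true {suc b} {suc s} e)) nle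
    ... | false = ≤-trans (≤-reflexive (*-identityˡ _)) (go b)

  class-small : ∀ c Y b → prodOver oddPrime? (λ p → if (p % 4 ≡ᵇ c) ∧ (p <ᵇ suc Y) then p else 1) b ≤ theta c Y
  class-small c Y b with b ≤? Y
  ... | yes le = ≤-trans (go b le) (theta-mono c le)
    where
    go : ∀ b → b ≤ Y → prodOver oddPrime? (λ p → if (p % 4 ≡ᵇ c) ∧ (p <ᵇ suc Y) then p else 1) b ≤ theta c b
    go zero _ = ≤-refl
    go (suc b) le with oddPrime? (suc b) | suc b % 4 ≡ᵇ c
    ... | false | _ = go b (<⇒≤ le)
    ... | true | false = ≤-trans (≤-reflexive (*-identityˡ _)) (go b (<⇒≤ le))
    ... | true | true rewrite T⇒≡ (<⇒<ᵇ (s≤s le)) = *-monoʳ-≤ (suc b) (go b (<⇒≤ le))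
  class-small c Y zero | no nle = contradiction z≤n nle
  class-small c Y (suc b) | no nle with oddPrime? (suc b)
  ... | false = class-small c Y b
  ... | true with suc b % 4 ≡ᵇ c
  ... | false = ≤-trans (≤-reflexive (*-identityˡ _)) (class-small c Y b)
  ... | true with suc b <ᵇ suc Y in e
  ... | true = contradiction (s≤s⁻¹ (<ᵇ-true {suc b} {suc Y} e)) nle
  ... | false = ≤-trans (≤-reflexive (*-identityˡ _)) (class-small c Y b)

  E≤ : E ≤ 2 ^ (lg * π′ s) * (theta (other cl) A * theta cl Bq)
  E≤ = ≤-trans (≤-reflexive (trans (prodOver-* oddPrime? e₀ _ b) (cong (prodOver oddPrime? e₀ b *_) (prodOver-* oddPrime? e₁ e₂ b))))
    (*-mono-≤ (e₀-small b) (*-mono-≤ (class-small (other cl) A b) (class-small cl Bq b)))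

  E>0 : 0 < E
  E>0 = prodOver>0 oddPrime? E′ b (λ p → *-mono-< (pos₀ p) (*-mono-< (pos₁ ((suc p % 4 ≡ᵇ other cl) ∧ (suc p <ᵇ suc A)) p) (pos₁ ((suc p % 4 ≡ᵇ cl) ∧ (suc p <ᵇ suc Bq)) p)))
    where
    pos₀ : ∀ p → 0 < e₀ (suc p)
    pos₀ p with suc p <ᵇ suc s
    ... | true = powFloor>0 p N
    ... | false = z<s
    pos₁ : ∀ t p → 0 < (if t then suc p else 1)
    pos₁ true p = z<s
    pos₁ false p = z<s

  cl-odd : OddClass cl
  cl-odd = odd%4 n on

  term-class : ∀ i → (n + 4 * i) % 4 ≡ cl
  term-class i = trans (cong (λ z → (n + z) % 4) (*-comm 4 i)) ([m+kn]%n≡m%n n i 4)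

  prime-part : ∀ i → i < k → ∀ p e → Prime p → p ^ e ∣ n + 4 * i → p ^ e ∣ E′ p
  prime-part i i< p e pp d with p <ᵇ suc s in es
  ... | true = ∣-trans (powFloor-∣ p e N (prime>1 pp) n≤N (≤-trans (∣⇒≤ ⦃ >-nonZero m>0 ⦄ d) (terms≤ i i<))) (m∣m*n _)
    where
    m>0 : 0 < n + 4 * i
    m>0 = <-≤-trans (≤-<-trans z≤n b<n) (m≤m+n n (4 * i))
  prime-part i i< p zero pp d | false = 1∣ _
  prime-part i i< p (suc (suc e)) pp d | false = contradiction s² (<⇒≱ (s≤s (≤-trans (*-mono-≤ p>s p>s) (≤-trans (≤-trans (∣⇒≤ ⦃ >-nonZero m>0 ⦄ (∣-trans (divides (p ^ e) (solve 2 (λ p q → p :* (p :* q) := q :* (p :* p)) refl p (p ^ e))) d)) (terms≤ i i<)) ≤-refl))))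
    where
    p>s : suc s ≤ p
    p>s = <ᵇ-false {p} {suc s} es
    m>0 : 0 < n + 4 * i
    m>0 = <-≤-trans (≤-<-trans z≤n b<n) (m≤m+n n (4 * i))
  prime-part i i< p (suc zero) pp d | false = subst (_∣ 1 * (e₁ p * e₂ p)) (sym (*-identityʳ p)) (∣-trans (cases d′) (n∣m*n 1))
    where
    d′ : p ∣ n + 4 * i
    d′ = subst (_∣ n + 4 * i) (*-identityʳ p) d
    p≤b : p ≤ b
    p≤b = sm i i< p pp d′
    podd : Odd p
    podd x = odd-term n i on (∣-trans x d′)
    cases : p ∣ n + 4 * i → p ∣ e₁ p * e₂ p
    cases (divides c eq) = pick cl cl-odd refl (p % 4) (odd%4 p podd) refl (c % 4) (odd%4 c codd) refl
      where
      codd : Odd c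
      codd x = odd-term n i on (subst (2 ∣_) (sym eq) (∣-trans x (m∣m*n p)))
      cp≤ : c * p ≤ N
      cp≤ = ≤-trans (≤-reflexive (sym eq)) (terms≤ i i<)
      n≤cp : n ≤ c * p
      n≤cp = ≤-trans (m≤m+n n (4 * i)) (≤-reflexive eq)
      prod4 : (c % 4 * (p % 4)) % 4 ≡ cl
      prod4 = trans (sym (%-distribˡ-* c p 4)) (trans (cong (_% 4) (sym eq)) (term-class i))
      same : p % 4 ≡ cl → 5 ≤ c → p ∣ e₁ p * e₂ p
      same e 5≤c rewrite T⇒≡ (≡⇒≡ᵇ (p % 4) cl e) | T⇒≡ (<⇒<ᵇ (s≤s (hB p c 5≤c p≤b cp≤))) = n∣m*n (e₁ p)
      diff : p % 4 ≡ other cl → c % 4 ≡ 3 → p ∣ e₁ p * e₂ p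
      diff e c3 rewrite T⇒≡ (≡⇒≡ᵇ (p % 4) (other cl) e) | T⇒≡ (<⇒<ᵇ (s≤s (hA p c c3 p≤b n≤cp cp≤))) = m∣m*n (e₂ p)
      -- c = 1 would make the term equal to p, but p ≤ b < n.
      c≥5 : ∀ c → c % 4 ≡ 1 → n ≤ c * p → 5 ≤ c
      c≥5 (suc zero) _ le = contradiction (≤-trans b<n (≤-trans le (≤-trans (≤-reflexive (+-identityʳ p)) p≤b))) (<-irrefl refl)
      c≥5 (suc (suc (suc (suc (suc c))))) _ _ = s≤s (s≤s (s≤s (s≤s (s≤s z≤n))))
      pick : ∀ u → OddClass u → cl ≡ u → ∀ v → OddClass v → p % 4 ≡ v → ∀ w → OddClass w → c % 4 ≡ w → p ∣ e₁ p * e₂ p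
      pick _ (inj₁ refl) eu _ (inj₁ refl) ev _ (inj₁ refl) ew = same (trans ev (sym eu)) (c≥5 c ew n≤cp)
      pick _ (inj₁ refl) eu _ (inj₁ refl) ev _ (inj₂ refl) ew = contradiction (trans (sym (cong₂ (λ x y → (x * y) % 4) ew ev)) (trans prod4 eu)) (λ ())
      pick _ (inj₁ refl) eu _ (inj₂ refl) ev _ (inj₁ refl) ew = contradiction (trans (sym (cong₂ (λ x y → (x * y) % 4) ew ev)) (trans prod4 eu)) (λ ())
      pick _ (inj₁ refl) eu _ (inj₂ refl) ev _ (inj₂ refl) ew = diff (trans ev (cong other (sym eu))) ew
      pick _ (inj₂ refl) eu _ (inj₁ refl) ev _ (inj₁ refl) ew = contradiction (trans (sym (cong₂ (λ x y → (x * y) % 4) ew ev)) (trans prod4 eu)) (λ ())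
      pick _ (inj₂ refl) eu _ (inj₁ refl) ev _ (inj₂ refl) ew = diff (trans ev (cong other (sym eu))) ew
      pick _ (inj₂ refl) eu _ (inj₂ refl) ev _ (inj₁ refl) ew = same (trans ev (sym eu)) (c≥5 c ew n≤cp)
      pick _ (inj₂ refl) eu _ (inj₂ refl) ev _ (inj₂ refl) ew = contradiction (trans (sym (cong₂ (λ x y → (x * y) % 4) ew ev)) (trans prod4 eu)) (λ ())

  terms∣E : ∀ i → i < k → n + 4 * i ∣ E
  terms∣E i i< = smooth-∣ oddPrime? E′ b (n + 4 * i) (<-≤-trans (≤-<-trans z≤n b<n) (m≤m+n n (4 * i)))
    (λ p pp d → oddPrime?-complete p pp (λ x → odd-term n i on (∣-trans x d))) (λ p e pp d → prime-part i i< p e pp d) (sm i i<)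

theta-general : ∀ a → OddClass a → ∀ Y → theta a Y ≤ 2 ^ (51 * suc (Y / 60))
theta-general a ca Y = ≤-trans (theta-mono a (/-upper Y 60)) (theta≤ a ca (suc (Y / 60)))

-- Here 2272 = 16 · 142 comes from the prime bound at 2^(q+4), and 20 = 1000 / 50. Doubling both
-- factors on the left matches the factor 4 on the right.
small-prime-growth : ∀ q₀ → (2 * q₀ + 8) * (2 ^ q₀ * 2272 + 30000) ≤ 4 ^ q₀ * 20 → ∀ i → (2 * (i + q₀) + 8) * (2 ^ (i + q₀) * 2272 + 30000) ≤ 4 ^ (i + q₀) * 20
small-prime-growth q₀ base zero = base
small-prime-growth q₀ base (suc i) = begin
  (2 * suc q + 8) * (2 * 2 ^ q * 2272 + 30000)        ≤⟨ *-mono-≤ le₁ le₂ ⟩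
  2 * (2 * q + 8) * (2 * (2 ^ q * 2272 + 30000))      ≡⟨ solve 2 (λ x y → con 2 :* x :* (con 2 :* y) := con 4 :* (x :* y)) refl (2 * q + 8) (2 ^ q * 2272 + 30000) ⟩
  4 * ((2 * q + 8) * (2 ^ q * 2272 + 30000))          ≤⟨ *-monoʳ-≤ 4 (small-prime-growth q₀ base i) ⟩
  4 * (4 ^ q * 20)                                    ≡⟨ sym (*-assoc 4 (4 ^ q) 20) ⟩
  4 * 4 ^ q * 20 ∎
  where
  open ≤-Reasoning
  q = i + q₀
  le₁ : 2 * suc q + 8 ≤ 2 * (2 * q + 8)
  le₁ = ≤-trans (m≤m+n _ (2 * q + 6)) (≤-reflexive (solve 1 (λ q → con 2 :* (con 1 :+ q) :+ con 8 :+ (con 2 :* q :+ con 6) := con 2 :* (con 2 :* q :+ con 8)) refl q))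
  le₂ : 2 * 2 ^ q * 2272 + 30000 ≤ 2 * (2 ^ q * 2272 + 30000)
  le₂ = ≤-trans (≤-reflexive (cong (_+ 30000) (*-assoc 2 (2 ^ q) 2272))) (≤-trans (+-monoʳ-≤ (2 * (2 ^ q * 2272)) (m≤n*m 30000 2)) (≤-reflexive (sym (*-distribˡ-+ 2 (2 ^ q * 2272) 30000))))

small-primes : ∀ q → 12 ≤ q → (2 * q + 8) * (2 ^ q * 2272 + 30000) ≤ 4 ^ q * 20
small-primes q le = subst (λ q → (2 * q + 8) * (2 ^ q * 2272 + 30000) ≤ 4 ^ q * 20) (m∸n+n≡m le)
  (small-prime-growth 12 (≤-by ((2 * 12 + 8) * (2 ^ 12 * 2272 + 30000)) (4 ^ 12 * 20) refl) (q ∸ 12))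

module _ (q k : ℕ) (q≥ : 12 ≤ q) (k≥ : 4 ^ q ≤ k) where

  small-primes-50 : 50 * ((2 * q + 8) * π′ (2 ^ (q + 4))) ≤ k
  small-primes-50 = ≤-trans (*-cancelʳ-≤ _ _ 20 (begin
    50 * (lg * p) * 20                          ≡⟨ solve 2 (λ l p → con 50 :* (l :* p) :* con 20 := l :* (p :* con 1000)) refl lg p ⟩
    lg * (p * 1000)                             ≤⟨ *-monoʳ-≤ lg (pi-bound (2 ^ (q + 4))) ⟩
    lg * (2 ^ (q + 4) * 142 + 30000)            ≡⟨ cong (λ z → lg * (z + 30000)) (trans (cong (_* 142) (^-distribˡ-+-* 2 q 4)) (*-assoc (2 ^ q) 16 142)) ⟩
    lg * (2 ^ q * 2272 + 30000)                 ≤⟨ small-primes q q≥ ⟩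
    4 ^ q * 20 ∎)) k≥
    where
    open ≤-Reasoning
    lg = 2 * q + 8
    p = π′ (2 ^ (q + 4))

  log-small : (2 * q + 8) * 300 + 33600 ≤ k
  log-small = ≤-trans (*-cancelʳ-≤ _ _ 5 (begin
    (lg * 300 + 33600) * 5         ≡⟨ trans (*-distribʳ-+ 5 (lg * 300) 33600) (cong (_+ 168000) (*-assoc lg 300 5)) ⟩
    lg * 1500 + 168000             ≤⟨ +-mono-≤ lgs (≤-trans (≤-by 168000 (4 ^ 12) refl) (^-monoʳ-≤ 4 q≥)) ⟩
    4 ^ q + 4 ^ q                  ≤⟨ +-monoʳ-≤ (4 ^ q) (m≤m+n (4 ^ q) (3 * 4 ^ q)) ⟩
    4 ^ q + 4 * 4 ^ q              ≡⟨ solve 1 (λ x → x :+ con 4 :* x := x :* con 5) refl (4 ^ q) ⟩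
    4 ^ q * 5 ∎)) k≥
    where
    open ≤-Reasoning
    lg = 2 * q + 8
    lgs : lg * 1500 ≤ 4 ^ q
    lgs = *-cancelʳ-≤ _ _ 20 (≤-trans (≤-reflexive (*-assoc lg 1500 20)) (≤-trans (*-monoʳ-≤ lg (m≤n+m 30000 (2 ^ q * 2272))) (small-primes q q≥)))

-- The numbers come from 255 = 300 · 51/60 for the two classes of large primes, 6k for the primes up
-- to s, and one more k for the logarithmic terms, with 33600 = 300 (10 + 51 + 51).
cell-arithmetic : ∀ dk lg P a b A Bq k → dk ≤ (10 + (lg + (P + (51 * suc a + 51 * suc b)))) * 100 → a * 60 ≤ A → b * 60 ≤ Bq → 50 * P ≤ k → lg * 300 + 33600 ≤ k →
  3 * dk ≤ 255 * (A + Bq) + 7 * k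
cell-arithmetic dk lg P a b A Bq k h ha hb hP hl = begin
  3 * dk                                                                            ≤⟨ *-monoʳ-≤ 3 h ⟩
  3 * ((10 + (lg + (P + (51 * suc a + 51 * suc b)))) * 100)
    ≡⟨ solve 4 (λ l p a b → con 3 :* ((con 10 :+ (l :+ (p :+ (con 51 :* (con 1 :+ a) :+ con 51 :* (con 1 :+ b))))) :* con 100) := con 255 :* (a :* con 60 :+ b :* con 60) :+ (con 6 :* (con 50 :* p) :+ (l :* con 300 :+ con 33600))) refl lg P a b ⟩
  255 * (a * 60 + b * 60) + (6 * (50 * P) + (lg * 300 + 33600))                     ≤⟨ +-mono-≤ (*-monoʳ-≤ 255 (+-mono-≤ ha hb)) (+-mono-≤ (*-monoʳ-≤ 6 hP) hl) ⟩
  255 * (A + Bq) + (6 * k + k)                                                      ≡⟨ cong (255 * (A + Bq) +_) (+-comm (6 * k) k) ⟩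
  255 * (A + Bq) + 7 * k ∎
  where open ≤-Reasoning

-- Fixing q with 4^q ≤ k < 4^(q+1) makes N ≤ 64k a number below 2^lg = s² with lg = 2q + 8, so √N is
-- known within a power of two.
module Cell (q κ n : ℕ) (q≥ : 12 ≤ q) (k≥ : 4 ^ q ≤ suc κ) (k< : suc κ < 4 ^ suc q) (on : Odd n) (n> : 4 * suc κ + 8 < n) (n< : n < 32 * suc κ)
            (sm : AllSmooth (4 * suc κ + 8) n (suc κ)) where
  k = suc κ
  N = n + 4 * k
  s = 2 ^ (q + 4)
  lg = 2 * q + 8

  N≤2^lg : N ≤ 2 ^ lg
  N≤2^lg = begin
    n + 4 * k                 ≤⟨ +-monoˡ-≤ (4 * k) (<⇒≤ n<) ⟩
    32 * k + 4 * k            ≤⟨ m≤m+n _ (28 * k) ⟩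
    32 * k + 4 * k + 28 * k   ≡⟨ solve 1 (λ k → con 32 :* k :+ con 4 :* k :+ con 28 :* k := k :* con 64) refl k ⟩
    k * 64                    ≤⟨ *-monoˡ-≤ 64 (<⇒≤ k<) ⟩
    4 * 4 ^ q * 64            ≡⟨ solve 1 (λ x → con 4 :* x :* con 64 := x :* con 256) refl (4 ^ q) ⟩
    4 ^ q * 256               ≡⟨ cong (_* 256) (^-*-assoc 2 2 q) ⟩
    2 ^ (2 * q) * 2 ^ 8       ≡⟨ sym (^-distribˡ-+-* 2 (2 * q) 8) ⟩
    2 ^ lg ∎
    where open ≤-Reasoning

  N<s² : N < suc s * suc s
  N<s² = ≤-<-trans N≤2^lg (subst (_< suc s * suc s) s*s (*-mono-< (n<1+n s) (n<1+n s)))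
    where
    s*s : s * s ≡ 2 ^ lg
    s*s = trans (sym (^-distribˡ-+-* 2 (q + 4) (q + 4))) (cong (2 ^_) (solve 1 (λ q → q :+ con 4 :+ (q :+ con 4) := con 2 :* q :+ con 8) refl q))

  core : ∀ b d A Bq → 0 < b → b ≤ 900 → 100 ^ 100 * b ^ b * 2 ^ d ≤ 8 ^ 100 * (100 + b) ^ (100 + b) → k * b + 100 ≤ n * 25 →
    (∀ p c → c % 4 ≡ 3 → p ≤ 4 * k + 8 → n ≤ c * p → c * p ≤ N → p ≤ A) → (∀ p c → 5 ≤ c → p ≤ 4 * k + 8 → c * p ≤ N → p ≤ Bq) →
    3 * (d * k) ≤ 255 * (A + Bq) + 7 * k
  core b d A Bq b>0 b≤ rate n≥ hA hB = cell-arithmetic (d * k) lg (lg * π′ s) (A / 60) (Bq / 60) A Bq k bits (m/n*n≤m A 60) (m/n*n≤m Bq 60) (small-primes-50 q k q≥ k≥) (log-small q k q≥ k≥)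
    where
    open ≤-Reasoning
    open Envelope (4 * k + 8) n k N s lg A Bq on (<-≤-trans (≤-<-trans z≤n n>) (m≤m+n n (4 * k))) (λ i i< → +-monoʳ-≤ n (*-monoʳ-≤ 4 (<⇒≤ i<))) N<s² N≤2^lg n> sm hA hB
    -- The summand 100 in `k * b + 100 ≤ n * 25` is what 4 (j + 1) ≤ n requires after rounding down.
    j = k * b / 100
    e = lg * π′ s + (51 * suc (A / 60) + 51 * suc (Bq / 60))
    E≤2^e : E ≤ 2 ^ e
    E≤2^e = begin
      E                                                                              ≤⟨ E≤ ⟩
      2 ^ (lg * π′ s) * (theta (other cl) A * theta cl Bq)                           ≤⟨ *-monoʳ-≤ (2 ^ (lg * π′ s)) (*-mono-≤ (theta-general (other cl) (other-class cl-odd) A) (theta-general cl cl-odd Bq)) ⟩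
      2 ^ (lg * π′ s) * (2 ^ (51 * suc (A / 60)) * 2 ^ (51 * suc (Bq / 60)))         ≡⟨ cong (2 ^ (lg * π′ s) *_) (sym (^-distribˡ-+-* 2 (51 * suc (A / 60)) (51 * suc (Bq / 60)))) ⟩
      2 ^ (lg * π′ s) * 2 ^ (51 * suc (A / 60) + 51 * suc (Bq / 60))                 ≡⟨ sym (^-distribˡ-+-* 2 (lg * π′ s) _) ⟩
      2 ^ e ∎
    4j≤ : 4 * suc j ≤ n
    4j≤ = *-cancelʳ-≤ _ _ 25 (≤-trans (≤-reflexive (solve 1 (λ j → con 4 :* (con 1 :+ j) :* con 25 := j :* con 100 :+ con 100) refl j)) (≤-trans (+-monoˡ-≤ 100 (m/n*n≤m (k * b) 100)) n≥))
    2kj : 2 * suc (k + j) ≤ N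
    2kj = ≤-trans (≤-trans (m≤m+n _ (2 * k + (2 * j + 2))) (≤-reflexive (solve 2 (λ k j → con 2 :* (con 1 :+ (k :+ j)) :+ (con 2 :* k :+ (con 2 :* j :+ con 2)) := con 4 :* (con 1 :+ j) :+ con 4 :* k) refl k j))) (+-monoˡ-≤ (4 * k) 4j≤)
    bits : d * k ≤ (10 + (lg + e)) * 100
    bits = 2^-cancel _ _ (begin
      2 ^ (d * k)                                        ≤⟨ entropy-power 100 b z<s b>0 d rate k n j E 4j≤ (m/n*n≤m (k * b) 100) (≤-trans (/-upper (k * b) 100) (≤-reflexive (*-comm 100 (suc j)))) (doubled-bound κ n E on E>0 terms∣E) ⟩
      ((100 + b) * (2 * suc (k + j) * E)) ^ 100          ≤⟨ ^-monoˡ-≤ 100 (*-mono-≤ (≤-trans (+-monoʳ-≤ 100 b≤) (≤-by 1000 (2 ^ 10) refl)) (*-mono-≤ (≤-trans 2kj N≤2^lg) E≤2^e)) ⟩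
      (2 ^ 10 * (2 ^ lg * 2 ^ e)) ^ 100                  ≡⟨ cong (_^ 100) (trans (cong (2 ^ 10 *_) (sym (^-distribˡ-+-* 2 lg e))) (sym (^-distribˡ-+-* 2 10 (lg + e)))) ⟩
      (2 ^ (10 + (lg + e))) ^ 100                        ≡⟨ ^-*-assoc 2 (10 + (lg + e)) 100 ⟩
      2 ^ ((10 + (lg + e)) * 100) ∎)

close : ∀ D k u v → D * k ≤ u * k + v → v < k → suc u ≤ D → ⊥
close D k u v h v< u< = <⇒≱ (<-≤-trans (+-monoʳ-< (u * k) v<) (≤-trans (≤-reflexive (+-comm (u * k) k)) (*-monoˡ-≤ k u<))) h

case-1 : ∀ d k N b x y → 3 * (d * k) ≤ 255 * (x + y) + 7 * k → x * 3 ≤ N → y * 5 ≤ N → N * 25 ≤ k * (b + 100) + 100 → 13600 < k → suc (136 * (b + 100) + 175) ≤ 75 * d → ⊥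
case-1 d k N b x y h hx hy hN k> num = close (75 * d) k (136 * (b + 100) + 175) 13600 (begin
  75 * d * k                              ≡⟨ solve 2 (λ d k → con 75 :* d :* k := con 25 :* (con 3 :* (d :* k))) refl d k ⟩
  25 * (3 * (d * k))                      ≤⟨ *-monoʳ-≤ 25 h ⟩
  25 * (255 * (x + y) + 7 * k)            ≡⟨ solve 3 (λ x y k → con 25 :* (con 255 :* (x :+ y) :+ con 7 :* k) := con 25 :* (con 85 :* (x :* con 3) :+ con 51 :* (y :* con 5)) :+ con 175 :* k) refl x y k ⟩
  25 * (85 * (x * 3) + 51 * (y * 5)) + 175 * k ≤⟨ +-monoˡ-≤ (175 * k) (*-monoʳ-≤ 25 (+-mono-≤ (*-monoʳ-≤ 85 hx) (*-monoʳ-≤ 51 hy))) ⟩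
  25 * (85 * N + 51 * N) + 175 * k        ≡⟨ solve 2 (λ n k → con 25 :* (con 85 :* n :+ con 51 :* n) :+ con 175 :* k := con 136 :* (n :* con 25) :+ con 175 :* k) refl N k ⟩
  136 * (N * 25) + 175 * k                ≤⟨ +-monoˡ-≤ (175 * k) (*-monoʳ-≤ 136 hN) ⟩
  136 * (k * (b + 100) + 100) + 175 * k   ≡⟨ solve 2 (λ k b → con 136 :* (k :* b :+ con 100) :+ con 175 :* k := (con 136 :* b :+ con 175) :* k :+ con 13600) refl k (b + 100) ⟩
  (136 * (b + 100) + 175) * k + 13600 ∎) k> num
  where open ≤-Reasoning

case-2 : ∀ d k N b y → 3 * (d * k) ≤ 255 * (4 * k + 8 + y) + 7 * k → y * 5 ≤ N → N * 25 ≤ k * (b + 100) + 100 → 56100 < k → suc (51 * (b + 100) + 25675) ≤ 75 * d → ⊥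
case-2 d k N b y h hy hN k> num = close (75 * d) k (51 * (b + 100) + 25675) 56100 (begin
  75 * d * k                              ≡⟨ solve 2 (λ d k → con 75 :* d :* k := con 25 :* (con 3 :* (d :* k))) refl d k ⟩
  25 * (3 * (d * k))                      ≤⟨ *-monoʳ-≤ 25 h ⟩
  25 * (255 * (4 * k + 8 + y) + 7 * k)    ≡⟨ solve 2 (λ y k → con 25 :* (con 255 :* (con 4 :* k :+ con 8 :+ y) :+ con 7 :* k) := con 25 :* (con 51 :* (y :* con 5)) :+ (con 25675 :* k :+ con 51000)) refl y k ⟩
  25 * (51 * (y * 5)) + (25675 * k + 51000) ≤⟨ +-monoˡ-≤ (25675 * k + 51000) (*-monoʳ-≤ 25 (*-monoʳ-≤ 51 hy)) ⟩
  25 * (51 * N) + (25675 * k + 51000)     ≡⟨ solve 2 (λ n k → con 25 :* (con 51 :* n) :+ (con 25675 :* k :+ con 51000) := con 51 :* (n :* con 25) :+ (con 25675 :* k :+ con 51000)) refl N k ⟩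
  51 * (N * 25) + (25675 * k + 51000)     ≤⟨ +-monoˡ-≤ (25675 * k + 51000) (*-monoʳ-≤ 51 hN) ⟩
  51 * (k * (b + 100) + 100) + (25675 * k + 51000) ≡⟨ solve 2 (λ k b → con 51 :* (k :* b :+ con 100) :+ (con 25675 :* k :+ con 51000) := (con 51 :* b :+ con 25675) :* k :+ con 56100) refl k (b + 100) ⟩
  (51 * (b + 100) + 25675) * k + 56100 ∎) k> num
  where open ≤-Reasoning

case-4 : ∀ d k N b x → 3 * (d * k) ≤ 255 * (x + (4 * k + 8)) + 7 * k → x * 7 ≤ N → N * 25 ≤ k * (b + 100) + 100 → 382500 < k → suc (255 * (b + 100) + 179725) ≤ 525 * d → ⊥
case-4 d k N b x h hx hN k> num = close (525 * d) k (255 * (b + 100) + 179725) 382500 (begin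
  525 * d * k                             ≡⟨ solve 2 (λ d k → con 525 :* d :* k := con 175 :* (con 3 :* (d :* k))) refl d k ⟩
  175 * (3 * (d * k))                     ≤⟨ *-monoʳ-≤ 175 h ⟩
  175 * (255 * (x + (4 * k + 8)) + 7 * k) ≡⟨ solve 2 (λ x k → con 175 :* (con 255 :* (x :+ (con 4 :* k :+ con 8)) :+ con 7 :* k) := con 255 :* (con 25 :* (x :* con 7)) :+ (con 179725 :* k :+ con 357000)) refl x k ⟩
  255 * (25 * (x * 7)) + (179725 * k + 357000) ≤⟨ +-monoˡ-≤ (179725 * k + 357000) (*-monoʳ-≤ 255 (*-monoʳ-≤ 25 hx)) ⟩
  255 * (25 * N) + (179725 * k + 357000)  ≡⟨ cong (λ z → 255 * z + (179725 * k + 357000)) (*-comm 25 N) ⟩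
  255 * (N * 25) + (179725 * k + 357000)  ≤⟨ +-monoˡ-≤ (179725 * k + 357000) (*-monoʳ-≤ 255 hN) ⟩
  255 * (k * (b + 100) + 100) + (179725 * k + 357000) ≡⟨ solve 2 (λ k b → con 255 :* (k :* b :+ con 100) :+ (con 179725 :* k :+ con 357000) := (con 255 :* b :+ con 179725) :* k :+ con 382500) refl k (b + 100) ⟩
  (255 * (b + 100) + 179725) * k + 382500 ∎) k> num
  where open ≤-Reasoning

case-5 : ∀ d k → 3 * (d * k) ≤ 255 * (4 * k + 8 + (4 * k + 8)) + 7 * k → 4080 < k → 2048 ≤ 3 * d → ⊥
case-5 d k h k> num = close (3 * d) k 2047 4080 (begin
  3 * d * k                                        ≡⟨ *-assoc 3 d k ⟩
  3 * (d * k)                                      ≤⟨ h ⟩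
  255 * (4 * k + 8 + (4 * k + 8)) + 7 * k          ≡⟨ solve 1 (λ k → con 255 :* (con 4 :* k :+ con 8 :+ (con 4 :* k :+ con 8)) :+ con 7 :* k := con 2047 :* k :+ con 4080) refl k ⟩
  2047 * k + 4080 ∎) k> num
  where open ≤-Reasoning

cell-core : ∀ q k n → 12 ≤ q → 4 ^ q ≤ k → k < 4 ^ suc q → Odd n → 4 * k + 8 < n → n < 32 * k → AllSmooth (4 * k + 8) n k →
  ∀ b d A Bq → 0 < b → b ≤ 900 → 100 ^ 100 * b ^ b * 2 ^ d ≤ 8 ^ 100 * (100 + b) ^ (100 + b) → k * b + 100 ≤ n * 25 →
  (∀ p c → c % 4 ≡ 3 → p ≤ 4 * k + 8 → n ≤ c * p → c * p ≤ n + 4 * k → p ≤ A) → (∀ p c → 5 ≤ c → p ≤ 4 * k + 8 → c * p ≤ n + 4 * k → p ≤ Bq) →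
  3 * (d * k) ≤ 255 * (A + Bq) + 7 * k
cell-core q zero n q≥ k≥ k< on n> n< sm = contradiction k≥ (<⇒≱ (m^n>0 4 q))
cell-core q (suc κ) n q≥ k≥ k< on n> n< sm = Cell.core q κ n q≥ k≥ k< on n> n< sm

≤-quotient : ∀ d .⦃ _ : NonZero d ⦄ p c N → d ≤ c → c * p ≤ N → p ≤ N / d
≤-quotient d p c N d≤c le = ≤-trans (≤-reflexive (sym (m*n/n≡m p d))) (/-monoˡ-≤ d (≤-trans (≤-trans (≤-reflexive (*-comm p d)) (*-monoˡ-≤ p d≤c)) le))

3mod4≥3 : ∀ c → c % 4 ≡ 3 → 3 ≤ c
3mod4≥3 (suc (suc (suc c))) _ = s≤s (s≤s (s≤s z≤n))

3mod4≥7 : ∀ c → c % 4 ≡ 3 → c ≢ 3 → 7 ≤ c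
3mod4≥7 (suc (suc (suc zero))) _ ne = contradiction refl ne
3mod4≥7 (suc (suc (suc (suc (suc (suc (suc c))))))) _ _ = s≤s (s≤s (s≤s (s≤s (s≤s (s≤s (s≤s z≤n))))))

module ClassRange (q k n : ℕ) (q≥ : 12 ≤ q) (k≥ : 4 ^ q ≤ k) (k< : k < 4 ^ suc q) (on : Odd n) (n> : 4 * k + 8 < n) (n< : n < 32 * k)
                  (sm : AllSmooth (4 * k + 8) n k) where
  open ≤-Reasoning

  N = n + 4 * k

  core = cell-core q k n q≥ k≥ k< on n> n< sm

  k>big : ∀ v → (v <ᵇ 4 ^ 12) ≡ true → v < k
  k>big v e = <-≤-trans (<ᵇ-true {v} {4 ^ 12} e) (≤-trans (^-monoʳ-≤ 4 q≥) k≥)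

  N*25 : ∀ b → n * 25 < k * b + 100 → N * 25 ≤ k * (b + 100) + 100
  N*25 b lt = begin
    N * 25                       ≡⟨ solve 2 (λ n k → (n :+ con 4 :* k) :* con 25 := n :* con 25 :+ k :* con 100) refl n k ⟩
    n * 25 + k * 100             ≤⟨ +-monoˡ-≤ (k * 100) (<⇒≤ lt) ⟩
    k * b + 100 + k * 100        ≡⟨ solve 2 (λ k b → k :* b :+ con 100 :+ k :* con 100 := k :* (b :+ con 100) :+ con 100) refl k b ⟩
    k * (b + 100) + 100 ∎

  cell-1 : ∀ b d b′ → 0 < b → b ≤ 900 → 100 ^ 100 * b ^ b * 2 ^ d ≤ 8 ^ 100 * (100 + b) ^ (100 + b) → suc (136 * (b′ + 100) + 175) ≤ 75 * d →
    k * b + 100 ≤ n * 25 → n * 25 < k * b′ + 100 → ⊥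
  cell-1 b d b′ b>0 b≤ rate num lo hi = case-1 d k N b′ (N / 3) (N / 5)
    (core b d (N / 3) (N / 5) b>0 b≤ rate lo (λ p c c3 _ _ le → ≤-quotient 3 p c N (3mod4≥3 c c3) le) (λ p c c5 _ le → ≤-quotient 5 p c N c5 le))
    (m/n*n≤m N 3) (m/n*n≤m N 5) (N*25 b′ hi) (k>big 13600 refl) num

  cell-2 : ∀ b d b′ → 0 < b → b ≤ 900 → 100 ^ 100 * b ^ b * 2 ^ d ≤ 8 ^ 100 * (100 + b) ^ (100 + b) → suc (51 * (b′ + 100) + 25675) ≤ 75 * d →
    k * b + 100 ≤ n * 25 → n * 25 < k * b′ + 100 → ⊥
  cell-2 b d b′ b>0 b≤ rate num lo hi = case-2 d k N b′ (N / 5)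
    (core b d (4 * k + 8) (N / 5) b>0 b≤ rate lo (λ p c _ p≤ _ _ → p≤) (λ p c c5 _ le → ≤-quotient 5 p c N c5 le))
    (m/n*n≤m N 5) (N*25 b′ hi) (k>big 56100 refl) num

  -- Beyond 12k + 24 no term is 3p with p ≤ 4k + 8.
  cell-4 : ∀ b d b′ → 0 < b → b ≤ 900 → 301 ≤ b → 100 ^ 100 * b ^ b * 2 ^ d ≤ 8 ^ 100 * (100 + b) ^ (100 + b) → suc (255 * (b′ + 100) + 179725) ≤ 525 * d →
    k * b + 100 ≤ n * 25 → n * 25 < k * b′ + 100 → ⊥
  cell-4 b d b′ b>0 b≤ b≥ rate num lo hi = case-4 d k N b′ (N / 7)
    (core b d (N / 7) (4 * k + 8) b>0 b≤ rate lo (λ p c c3 p≤ n≤ le → ≤-quotient 7 p c N (3mod4≥7 c c3 (λ { refl → not3 p p≤ n≤ })) le) (λ p c _ p≤ _ → p≤))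
    (m/n*n≤m N 7) (N*25 b′ hi) (k>big 382500 refl) num
    where
    not3 : ∀ p → p ≤ 4 * k + 8 → n ≤ 3 * p → ⊥
    not3 p p≤ n≤ = <⇒≱ (k>big 600 refl) (+-cancelʳ-≤ (k * 300 + 100) k 600 (begin
      k + (k * 300 + 100)      ≡⟨ solve 1 (λ k → k :+ (k :* con 300 :+ con 100) := k :* con 301 :+ con 100) refl k ⟩
      k * 301 + 100            ≤⟨ +-monoˡ-≤ 100 (*-monoʳ-≤ k b≥) ⟩
      k * b + 100              ≤⟨ lo ⟩
      n * 25                   ≤⟨ *-monoˡ-≤ 25 (≤-trans n≤ (*-monoʳ-≤ 3 p≤)) ⟩
      3 * (4 * k + 8) * 25     ≡⟨ solve 1 (λ k → con 3 :* (con 4 :* k :+ con 8) :* con 25 := con 500 :+ (k :* con 300 :+ con 100)) refl k ⟩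
      500 + (k * 300 + 100)    ≤⟨ +-monoˡ-≤ (k * 300 + 100) (≤-by 500 600 refl) ⟩
      600 + (k * 300 + 100) ∎))

  cell-5 : ∀ b d → 0 < b → b ≤ 900 → 100 ^ 100 * b ^ b * 2 ^ d ≤ 8 ^ 100 * (100 + b) ^ (100 + b) → 2048 ≤ 3 * d → k * b + 100 ≤ n * 25 → ⊥
  cell-5 b d b>0 b≤ rate num lo = case-5 d k (core b d (4 * k + 8) (4 * k + 8) b>0 b≤ rate lo (λ p c _ p≤ _ _ → p≤) (λ p c _ p≤ _ → p≤)) (k>big 4080 refl) num

  n-start : k * 99 + 100 ≤ n * 25
  n-start = begin
    k * 99 + 100         ≤⟨ +-mono-≤ (*-monoʳ-≤ k (≤-by 99 100 refl)) (≤-by 100 200 refl) ⟩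
    k * 100 + 200        ≡⟨ solve 1 (λ k → k :* con 100 :+ con 200 := (con 4 :* k :+ con 8) :* con 25) refl k ⟩
    (4 * k + 8) * 25     ≤⟨ *-monoˡ-≤ 25 (<⇒≤ n>) ⟩
    n * 25 ∎

  impossible : ⊥
  -- The range of 25 n / k is cut at 99, 173, 217, 256, 284, 303 and 481. At the left end b of a
  -- cell, d/100 bits per unit of k are guaranteed; the right end is the largest integer for which
  -- these still exceed what E can hold. Up to 173 the cut-offs N/3 and N/5 serve, then 4k + 8 and
  -- N/5, from 303 on N/7 and 4k + 8, and finally 4k + 8 twice.
  impossible with k * 173 + 100 ≤? n * 25
  ... | no h = cell-1 99 498 173 z<s (≤-by 99 900 refl) (≤-by _ (8 ^ 100 * 199 ^ 199) refl) (≤-by _ (75 * 498) refl) n-start (≰⇒> h)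
  ... | yes l₁ with k * 217 + 100 ≤? n * 25
  ... | no h = cell-2 173 558 217 z<s (≤-by 173 900 refl) (≤-by _ (8 ^ 100 * 273 ^ 273) refl) (≤-by _ (75 * 558) refl) l₁ (≰⇒> h)
  ... | yes l₂ with k * 256 + 100 ≤? n * 25
  ... | no h = cell-2 217 585 256 z<s (≤-by 217 900 refl) (≤-by _ (8 ^ 100 * 317 ^ 317) refl) (≤-by _ (75 * 585) refl) l₂ (≰⇒> h)
  ... | yes l₃ with k * 284 + 100 ≤? n * 25
  ... | no h = cell-2 256 604 284 z<s (≤-by 256 900 refl) (≤-by _ (8 ^ 100 * 356 ^ 356) refl) (≤-by _ (75 * 604) refl) l₃ (≰⇒> h)
  ... | yes l₄ with k * 303 + 100 ≤? n * 25
  ... | no h = cell-2 284 617 303 z<s (≤-by 284 900 refl) (≤-by _ (8 ^ 100 * 384 ^ 384) refl) (≤-by _ (75 * 617) refl) l₄ (≰⇒> h)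
  ... | yes l₅ with k * 481 + 100 ≤? n * 25
  ... | no h = cell-4 303 625 481 z<s (≤-by 303 900 refl) (≤-by 301 303 refl) (≤-by _ (8 ^ 100 * 403 ^ 403) refl) (≤-by _ (525 * 625) refl) l₅ (≰⇒> h)
  ... | yes l₆ = cell-5 481 684 z<s (≤-by 481 900 refl) (≤-by _ (8 ^ 100 * 581 ^ 581) refl) (≤-by _ (3 * 684) refl) l₆

-- Blocks with k ≥ 150000 and large n

logFloor : ∀ b → 1 < b → ∀ m → 0 < m → ∃[ l ] (b ^ l ≤ m × m < b ^ suc l)
logFloor b b>1 (suc zero) _ = 0 , ≤-refl , subst (1 <_) (sym (*-identityʳ b)) b>1
logFloor b b>1 (suc (suc m)) _ with logFloor b b>1 (suc m) z<s
... | l , lo , hi with 2 + m <? b ^ suc l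
... | yes lt = l , ≤-trans lo (n≤1+n _) , lt
... | no nlt = suc l , ≮⇒≥ nlt , ≤-<-trans hi (^-monoʳ-< b b>1 (n<1+n (suc l)))

log₂-ratio : ∀ n k → 0 < k → k ≤ n → ∃[ ρ ] (2 ^ ρ * k ≤ n × n < 2 ^ suc ρ * k)
log₂-ratio n k@(suc _) k>0 k≤n with logFloor 2 ≤-refl (n / k) (m≥n⇒m/n>0 k≤n)
... | ρ , lo , hi = ρ , ≤-trans (*-monoˡ-≤ k lo) (m/n*n≤m n k) ,
    <-≤-trans (subst (_< suc (n / k) * k) (sym (m≡m%n+[m/n]*n n k)) (+-monoˡ-< (n / k * k) (m%n<n n k))) (*-monoˡ-≤ k hi)

powEnvelope : ∀ b n k N → Odd n → 0 < n → 0 < N → (∀ i → i < k → n + 4 * i ≤ N) → AllSmooth b n k →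
  (∀ i → i < k → n + 4 * i ∣ prodOver oddPrime? (λ p → powFloor p N) b)
powEnvelope b n k N on n>0 N>0 terms≤ sm i i< = smooth-∣ oddPrime? (λ p → powFloor p N) b (n + 4 * i) m>0
    (λ p pp d → oddPrime?-complete p pp (λ x → odd-term n i on (∣-trans x d)))
    (λ p e pp d → powFloor-∣ p e N (prime>1 pp) N>0 (≤-trans (∣⇒≤ ⦃ >-nonZero m>0 ⦄ d) (terms≤ i i<))) (sm i i<)
  where
  m>0 : 0 < n + 4 * i
  m>0 = <-≤-trans n>0 (m≤m+n n (4 * i))

powEnvelope>0 : ∀ b N → 0 < prodOver oddPrime? (λ p → powFloor p N) b
powEnvelope>0 b N = prodOver>0 oddPrime? _ b (λ p → powFloor>0 p N)

powEnvelope≤ : ∀ b N → 0 < N → prodOver oddPrime? (λ p → powFloor p N) b ≤ N ^ π′ b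
powEnvelope≤ b N N>0 = prodOver-≤ oddPrime? (λ p → powFloor p N) N b (λ p → powFloor-≤ p N N>0)

-- The rate is (101/100)^500 ≥ 2^7, a rational form of e^5 > 2^7.
fac-fifth : ∀ k → (k !) ^ 5 * 2 ^ (7 * k) ≤ (suc (k + 100 * k) * k ^ k) ^ 5
fac-fifth = fac-power 100 z<s 5 7 (≤-by ((100 ^ 100) ^ 5 * 2 ^ 7) ((101 ^ 100) ^ 5) refl)

-- 5-th powers, because k! ≤ (101k + 1) (k 2^(−7/5))^k.
fifth-bits : ∀ k n E e l m → 0 < k → 2 ^ k * prodAP4 n k ≤ 2 * E * k ! → E ≤ 2 ^ e → k < 2 ^ suc l → m ^ k ≤ n ^ k →
  2 ^ (12 * k) * (m ^ k) ^ 5 ≤ 2 ^ ((e + (l + 9)) * 5) * (k ^ k) ^ 5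
fifth-bits k n E e l m k>0 dbl E≤ k< m≤ = begin
  2 ^ (12 * k) * (m ^ k) ^ 5                         ≡⟨ cong (_* (m ^ k) ^ 5) split12 ⟩
  (2 ^ k) ^ 5 * 2 ^ (7 * k) * (m ^ k) ^ 5            ≡⟨ solve 3 (λ a b c → a :* b :* c := a :* c :* b) refl ((2 ^ k) ^ 5) (2 ^ (7 * k)) ((m ^ k) ^ 5) ⟩
  (2 ^ k) ^ 5 * (m ^ k) ^ 5 * 2 ^ (7 * k)            ≡⟨ cong (_* 2 ^ (7 * k)) (sym (^-distribʳ-* 5 (2 ^ k) (m ^ k))) ⟩
  (2 ^ k * m ^ k) ^ 5 * 2 ^ (7 * k)                  ≤⟨ *-monoˡ-≤ (2 ^ (7 * k)) (^-monoˡ-≤ 5 (≤-trans (*-monoʳ-≤ (2 ^ k) (≤-trans m≤ (prodAP4≥ k n))) dbl)) ⟩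
  (2 * E * k !) ^ 5 * 2 ^ (7 * k)                    ≡⟨ trans (cong (_* 2 ^ (7 * k)) (^-distribʳ-* 5 (2 * E) (k !))) (*-assoc ((2 * E) ^ 5) ((k !) ^ 5) (2 ^ (7 * k))) ⟩
  (2 * E) ^ 5 * ((k !) ^ 5 * 2 ^ (7 * k))            ≤⟨ *-monoʳ-≤ ((2 * E) ^ 5) (fac-fifth k) ⟩
  (2 * E) ^ 5 * (S * k ^ k) ^ 5                      ≡⟨ cong ((2 * E) ^ 5 *_) (^-distribʳ-* 5 S (k ^ k)) ⟩
  (2 * E) ^ 5 * (S ^ 5 * (k ^ k) ^ 5)                ≡⟨ trans (sym (*-assoc ((2 * E) ^ 5) (S ^ 5) _)) (cong (_* (k ^ k) ^ 5) (sym (^-distribʳ-* 5 (2 * E) S))) ⟩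
  (2 * E * S) ^ 5 * (k ^ k) ^ 5                      ≤⟨ *-monoˡ-≤ ((k ^ k) ^ 5) (^-monoˡ-≤ 5 (*-mono-≤ (*-monoʳ-≤ 2 E≤) S≤)) ⟩
  (2 * 2 ^ e * 2 ^ (l + 8)) ^ 5 * (k ^ k) ^ 5        ≡⟨ cong (λ z → z ^ 5 * (k ^ k) ^ 5) (trans (sym (^-distribˡ-+-* 2 (suc e) (l + 8))) (cong (2 ^_) (solve 2 (λ e l → con 1 :+ e :+ (l :+ con 8) := e :+ (l :+ con 9)) refl e l))) ⟩
  (2 ^ (e + (l + 9))) ^ 5 * (k ^ k) ^ 5              ≡⟨ cong (_* (k ^ k) ^ 5) (^-*-assoc 2 (e + (l + 9)) 5) ⟩
  2 ^ ((e + (l + 9)) * 5) * (k ^ k) ^ 5 ∎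
  where
  open ≤-Reasoning
  S = suc (k + 100 * k)
  split12 : 2 ^ (12 * k) ≡ (2 ^ k) ^ 5 * 2 ^ (7 * k)
  split12 = trans (cong (2 ^_) (solve 1 (λ k → con 12 :* k := k :* con 5 :+ con 7 :* k) refl k)) (trans (^-distribˡ-+-* 2 (k * 5) (7 * k)) (cong (_* 2 ^ (7 * k)) (sym (^-*-assoc 2 k 5))))
  S≤ : S ≤ 2 ^ (l + 8)
  S≤ = begin
    suc (k + 100 * k)       ≤⟨ +-monoˡ-≤ (k + 100 * k) k>0 ⟩
    k + (k + 100 * k)       ≤⟨ m≤m+n _ (26 * k) ⟩
    k + (k + 100 * k) + 26 * k ≡⟨ solve 1 (λ k → k :+ (k :+ con 100 :* k) :+ con 26 :* k := k :* con 128) refl k ⟩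
    k * 128                 ≤⟨ *-monoˡ-≤ 128 (<⇒≤ k<) ⟩
    2 ^ suc l * 2 ^ 7       ≡⟨ sym (^-distribˡ-+-* 2 (suc l) 7) ⟩
    2 ^ (suc l + 7)         ≡⟨ cong (2 ^_) (sym (+-suc l 7)) ⟩
    2 ^ (l + 8) ∎

ratio-bits : ∀ k n E e l ρ → 0 < k → 2 ^ k * prodAP4 n k ≤ 2 * E * k ! → E ≤ 2 ^ e → k < 2 ^ suc l → 2 ^ ρ * k ≤ n →
  12 * k + ρ * k * 5 ≤ (e + (l + 9)) * 5
ratio-bits k n E e l ρ k>0 dbl E≤ k< n≥ = 2^-cancel _ _ (*-cancelʳ-≤ _ _ ((k ^ k) ^ 5) ⦃ m^n≢0 (k ^ k) 5 ⦃ m^n≢0 k k ⦃ >-nonZero k>0 ⦄ ⦄ ⦄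
  (≤-trans (≤-reflexive eq) (fifth-bits k n E e l (2 ^ ρ * k) k>0 dbl E≤ k< (^-monoˡ-≤ k n≥))))
  where
  eq : 2 ^ (12 * k + ρ * k * 5) * (k ^ k) ^ 5 ≡ 2 ^ (12 * k) * ((2 ^ ρ * k) ^ k) ^ 5
  eq = trans (cong (_* (k ^ k) ^ 5) (^-distribˡ-+-* 2 (12 * k) (ρ * k * 5))) (trans (*-assoc (2 ^ (12 * k)) _ _) (cong (2 ^ (12 * k) *_)
    (sym (trans (cong (_^ 5) (trans (^-distribʳ-* k (2 ^ ρ) k) (cong (_* k ^ k) (^-*-assoc 2 ρ k)))) (trans (^-distribʳ-* 5 (2 ^ (ρ * k)) (k ^ k)) (cong (_* (k ^ k) ^ 5) (^-*-assoc 2 (ρ * k) 5)))))))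

size-bits : ∀ k n E e l f → 0 < k → 2 ^ k * prodAP4 n k ≤ 2 * E * k ! → E ≤ 2 ^ e → k < 2 ^ suc l → 2 ^ f ≤ n →
  12 * k + f * k * 5 ≤ (e + (l + 9)) * 5 + suc l * k * 5
size-bits k n E e l f k>0 dbl E≤ k< n≥ = 2^-cancel _ _ (begin
  2 ^ (12 * k + f * k * 5)                                 ≡⟨ ^-distribˡ-+-* 2 (12 * k) (f * k * 5) ⟩
  2 ^ (12 * k) * 2 ^ (f * k * 5)                           ≡⟨ cong (2 ^ (12 * k) *_) (sym (trans (cong (_^ 5) (^-*-assoc 2 f k)) (^-*-assoc 2 (f * k) 5))) ⟩
  2 ^ (12 * k) * ((2 ^ f) ^ k) ^ 5                         ≤⟨ fifth-bits k n E e l (2 ^ f) k>0 dbl E≤ k< (^-monoˡ-≤ k n≥) ⟩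
  2 ^ ((e + (l + 9)) * 5) * (k ^ k) ^ 5                    ≤⟨ *-monoʳ-≤ (2 ^ ((e + (l + 9)) * 5)) (^-monoˡ-≤ 5 (^-monoˡ-≤ k (<⇒≤ k<))) ⟩
  2 ^ ((e + (l + 9)) * 5) * ((2 ^ suc l) ^ k) ^ 5          ≡⟨ cong (2 ^ ((e + (l + 9)) * 5) *_) (trans (cong (_^ 5) (^-*-assoc 2 (suc l) k)) (^-*-assoc 2 (suc l * k) 5)) ⟩
  2 ^ ((e + (l + 9)) * 5) * 2 ^ (suc l * k * 5)            ≡⟨ sym (^-distribˡ-+-* 2 ((e + (l + 9)) * 5) (suc l * k * 5)) ⟩
  2 ^ ((e + (l + 9)) * 5 + suc l * k * 5) ∎)
  where open ≤-Reasoning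

-- Here f and l stand for log₂ n and log₂ k. E holds at most 0.441 k (f + 2) bits, so 0.559 k f has
-- to be outweighed by about k l. From 2l ≤ f + 4 it is at least about 1.118 k l, and the surplus
-- 0.118 k l beats the linear terms once l ≥ 17.
very-large-arithmetic : ∀ k f l P → 12 * k + f * k * 5 ≤ ((f + 2) * P + (l + 9)) * 5 + suc l * k * 5 → P * 1000 ≤ k * 441 → 2 * l ≤ f + 4 → 17 ≤ l → 1000 ≤ k → ⊥
very-large-arithmetic k f l P h hP hf hl hk = <⇒≱ gap (+-cancelʳ-≤ (k * 882 + k * 1000 + l * k * 1000 + f * k * 441) _ _ (begin
  l * k * 118 + (k * 882 + k * 1000 + l * k * 1000 + f * k * 441)
    ≡⟨ solve 3 (λ k f l → l :* k :* con 118 :+ (k :* con 882 :+ k :* con 1000 :+ l :* k :* con 1000 :+ f :* k :* con 441) := con 2 :* l :* k :* con 559 :+ (k :* con 1882 :+ f :* k :* con 441)) refl k f l ⟩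
  2 * l * k * 559 + (k * 1882 + f * k * 441)                ≤⟨ +-monoˡ-≤ (k * 1882 + f * k * 441) (*-monoˡ-≤ 559 (*-monoˡ-≤ k hf)) ⟩
  (f + 4) * k * 559 + (k * 1882 + f * k * 441)
    ≡⟨ solve 2 (λ k f → (f :+ con 4) :* k :* con 559 :+ (k :* con 1882 :+ f :* k :* con 441) := con 200 :* (con 12 :* k :+ f :* k :* con 5) :+ k :* con 1718) refl k f ⟩
  200 * (12 * k + f * k * 5) + k * 1718                     ≤⟨ +-monoˡ-≤ (k * 1718) (*-monoʳ-≤ 200 h) ⟩
  200 * (((f + 2) * P + (l + 9)) * 5 + suc l * k * 5) + k * 1718
    ≡⟨ solve 4 (λ k f l P → con 200 :* (((f :+ con 2) :* P :+ (l :+ con 9)) :* con 5 :+ (con 1 :+ l) :* k :* con 5) :+ k :* con 1718 := (f :+ con 2) :* (P :* con 1000) :+ (l :* con 1000 :+ con 9000 :+ l :* k :* con 1000 :+ k :* con 2718)) refl k f l P ⟩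
  (f + 2) * (P * 1000) + (l * 1000 + 9000 + l * k * 1000 + k * 2718) ≤⟨ +-monoˡ-≤ _ (*-monoʳ-≤ (f + 2) hP) ⟩
  (f + 2) * (k * 441) + (l * 1000 + 9000 + l * k * 1000 + k * 2718)
    ≡⟨ solve 3 (λ k f l → (f :+ con 2) :* (k :* con 441) :+ (l :* con 1000 :+ con 9000 :+ l :* k :* con 1000 :+ k :* con 2718) := l :* con 1000 :+ con 9000 :+ k :* con 1718 :+ (k :* con 882 :+ k :* con 1000 :+ l :* k :* con 1000 :+ f :* k :* con 441)) refl k f l ⟩
  l * 1000 + 9000 + k * 1718 + (k * 882 + k * 1000 + l * k * 1000 + f * k * 441) ∎))
  where
  open ≤-Reasoning
  m = l ∸ 17
  gap : l * 1000 + 9000 + k * 1718 < l * k * 118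
  gap = subst (λ l → l * 1000 + 9000 + k * 1718 < l * k * 118) (m∸n+n≡m hl) (begin-strict
    (m + 17) * 1000 + 9000 + k * 1718        ≡⟨ solve 2 (λ m k → (m :+ con 17) :* con 1000 :+ con 9000 :+ k :* con 1718 := m :* con 1000 :+ k :* con 1718 :+ con 26000) refl m k ⟩
    m * 1000 + k * 1718 + 26000              <⟨ +-mono-≤-< (+-monoˡ-≤ (k * 1718) (≤-trans (*-monoʳ-≤ m hk) (m≤m*n (m * k) 118))) (<-≤-trans (<ᵇ-true {26000} {1000 * 288} refl) (*-monoˡ-≤ 288 hk)) ⟩
    m * k * 118 + k * 1718 + k * 288         ≡⟨ solve 2 (λ m k → m :* k :* con 118 :+ k :* con 1718 :+ k :* con 288 := (m :+ con 17) :* k :* con 118) refl m k ⟩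
    (m + 17) * k * 118 ∎)

-- The balance for n between 2^(5+r) k and 2^(6+r) k, in thousandths of bits. The block needs (5 + r
-- + 12/5) k bits; the primes of both classes up to 4k + 8 supply 6.8k. The difference (r + 0.6) k
-- must exceed the contribution of the primes up to 2^h, each worth l + r + 8 bits.
Fits : ℕ → ℕ → ℕ → Set
Fits l r h = (l + r + 8) * (2 ^ h * 142 + 30000) + (l * 1000 + 124600) < (r * 1000 + 600) * 2 ^ l

moderate-arithmetic : ∀ k l r a π h → 12 * k + (5 + r) * k * 5 ≤ ((l + r + 8) * π + (51 * suc a + 51 * suc a) + (l + 9)) * 5 → a * 60 ≤ 4 * k + 8 →
  π * 1000 ≤ 2 ^ h * 142 + 30000 → Fits l r h → 2 ^ l ≤ k → ⊥
moderate-arithmetic k l r a π h hb ha hπ fits k≥ = <⇒≱ (<-≤-trans fits (*-monoʳ-≤ (r * 1000 + 600) k≥)) (+-cancelʳ-≤ (k * 6800) _ _ (begin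
  (r * 1000 + 600) * k + k * 6800
    ≡⟨ solve 2 (λ k r → (r :* con 1000 :+ con 600) :* k :+ k :* con 6800 := con 200 :* (con 12 :* k :+ (con 5 :+ r) :* k :* con 5)) refl k r ⟩
  200 * (12 * k + (5 + r) * k * 5)                      ≤⟨ *-monoʳ-≤ 200 hb ⟩
  200 * (((l + r + 8) * π + (51 * suc a + 51 * suc a) + (l + 9)) * 5)
    ≡⟨ solve 4 (λ g π a l → con 200 :* ((g :* π :+ (con 51 :* (con 1 :+ a) :+ con 51 :* (con 1 :+ a)) :+ (l :+ con 9)) :* con 5) := g :* (π :* con 1000) :+ (con 1700 :* (a :* con 60) :+ (l :* con 1000 :+ con 111000))) refl (l + r + 8) π a l ⟩
  (l + r + 8) * (π * 1000) + (1700 * (a * 60) + (l * 1000 + 111000)) ≤⟨ +-mono-≤ (*-monoʳ-≤ (l + r + 8) hπ) (+-monoˡ-≤ (l * 1000 + 111000) (*-monoʳ-≤ 1700 ha)) ⟩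
  g*x + (1700 * (4 * k + 8) + (l * 1000 + 111000))      ≡⟨ cong (g*x +_) (solve 2 (λ k l → con 1700 :* (con 4 :* k :+ con 8) :+ (l :* con 1000 :+ con 111000) := l :* con 1000 :+ con 124600 :+ k :* con 6800) refl k l) ⟩
  g*x + (l * 1000 + 124600 + k * 6800)                  ≡⟨ sym (+-assoc g*x (l * 1000 + 124600) (k * 6800)) ⟩
  g*x + (l * 1000 + 124600) + k * 6800 ∎))
  where
  open ≤-Reasoning
  g*x = (l + r + 8) * (2 ^ h * 142 + 30000)

-- Raising l by 2 and h by 1 multiplies the right side by 4 and the left side by at most 4. The step
-- 2 keeps 2^h at the order of √N, so base cases come in pairs of consecutive l.
fits-step : ∀ l r h → Fits l r h → Fits (2 + l) r (suc h)
fits-step l r h fits = begin-strict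
  (2 + l + r + 8) * (2 * 2 ^ h * 142 + 30000) + ((2 + l) * 1000 + 124600)
    ≤⟨ +-mono-≤ (*-mono-≤ le₁ le₂) le₃ ⟩
  2 * (l + r + 8) * (2 * (2 ^ h * 142 + 30000)) + 4 * (l * 1000 + 124600)
    ≡⟨ solve 3 (λ g x c → con 2 :* g :* (con 2 :* x) :+ con 4 :* c := con 4 :* (g :* x :+ c)) refl (l + r + 8) (2 ^ h * 142 + 30000) (l * 1000 + 124600) ⟩
  4 * ((l + r + 8) * (2 ^ h * 142 + 30000) + (l * 1000 + 124600))     <⟨ *-monoʳ-< 4 fits ⟩
  4 * ((r * 1000 + 600) * 2 ^ l)                                      ≡⟨ solve 2 (λ c x → con 4 :* (c :* x) := c :* (con 2 :* (con 2 :* x))) refl (r * 1000 + 600) (2 ^ l) ⟩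
  (r * 1000 + 600) * 2 ^ (2 + l) ∎
  where
  open ≤-Reasoning
  le₁ : 2 + l + r + 8 ≤ 2 * (l + r + 8)
  le₁ = ≤-trans (m≤m+n _ (l + r + 6)) (≤-reflexive (solve 2 (λ l r → con 2 :+ l :+ r :+ con 8 :+ (l :+ r :+ con 6) := con 2 :* (l :+ r :+ con 8)) refl l r))
  le₂ : 2 * 2 ^ h * 142 + 30000 ≤ 2 * (2 ^ h * 142 + 30000)
  le₂ = ≤-trans (≤-reflexive (cong (_+ 30000) (*-assoc 2 (2 ^ h) 142))) (≤-trans (+-monoʳ-≤ (2 * (2 ^ h * 142)) (m≤n*m 30000 2)) (≤-reflexive (sym (*-distribˡ-+ 2 (2 ^ h * 142) 30000))))
  le₃ : (2 + l) * 1000 + 124600 ≤ 4 * (l * 1000 + 124600)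
  le₃ = ≤-trans (+-monoˡ-≤ 124600 {(2 + l) * 1000} {l * 1000 + 2000} (≤-reflexive (solve 1 (λ l → (con 2 :+ l) :* con 1000 := l :* con 1000 :+ con 2000) refl l)))
    (triple (l * 1000) 2000 124600 (≤-by 2000 124600 refl))
    where
    triple : ∀ a b c → b ≤ c → a + b + c ≤ 4 * (a + c)
    triple a b c b≤c = ≤-trans (+-monoˡ-≤ c (+-monoʳ-≤ a b≤c)) (≤-trans (m≤m+n _ (3 * a + 2 * c)) (≤-reflexive (solve 2 (λ a c → a :+ c :+ c :+ (con 3 :* a :+ con 2 :* c) := con 4 :* (a :+ c)) refl a c)))

-- The first condition guarantees that 2^h is at least √N, since N ≤ 2^(l+r+8).
Suitable : ℕ → ℕ → Set
Suitable l r = ∃[ h ] (l + r + 8 ≤ 2 * h × Fits l r h)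

suitable-step : ∀ l r → Suitable l r → Suitable (2 + l) r
suitable-step l r (h , le , fits) = suc h , ≤-trans (s≤s (s≤s le)) (≤-reflexive (sym (*-suc 2 h))) , fits-step l r h fits

suitable-from : ∀ l₀ r → Suitable l₀ r → Suitable (suc l₀) r → ∀ l → l₀ ≤ l → Suitable l r
suitable-from l₀ r s₀ s₁ l le = subst (λ l → Suitable l r) (m∸n+n≡m le) (go (l ∸ l₀))
  where
  go : ∀ i → Suitable (i + l₀) r
  go zero = s₀
  go (suc zero) = s₁
  go (suc (suc i)) = suitable-step (i + l₀) r (go i)

-- Here y = 2^(r+9) dominates all the lower-order terms.
tail-fits : ∀ r g c w y → 65536 ≤ y → g * 143 + 3 + r + 1 ≤ c → w ≤ r * 1000 + 135600 →
  g * (y * 142 + 30000) + w < c * y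
tail-fits r g c w y y≥ num w≤ = begin-strict
  g * (y * 142 + 30000) + w                ≤⟨ +-mono-≤ (*-monoʳ-≤ g (+-monoʳ-≤ (y * 142) (≤-trans (≤-by 30000 65536 refl) y≥))) w≤ ⟩
  g * (y * 142 + y) + (r * 1000 + 135600)  ≤⟨ +-monoʳ-≤ (g * (y * 142 + y)) (+-mono-≤ (*-monoʳ-≤ r (≤-trans (≤-by 1000 65536 refl) y≥)) (≤-trans (≤-by 135600 (65536 * 3) refl) (*-monoˡ-≤ 3 y≥))) ⟩
  g * (y * 142 + y) + (r * y + y * 3)      <⟨ m<m+n _ (<-≤-trans (<ᵇ-true {0} {65536} refl) y≥) ⟩
  g * (y * 142 + y) + (r * y + y * 3) + y  ≡⟨ solve 3 (λ g y r → g :* (y :* con 142 :+ y) :+ (r :* y :+ y :* con 3) :+ y := (g :* con 143 :+ con 3 :+ r :+ con 1) :* y) refl g y r ⟩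
  (g * 143 + 3 + r + 1) * y                ≤⟨ *-monoˡ-≤ y num ⟩
  c * y ∎
  where open ≤-Reasoning

suitable-tail : ∀ r l h → 7 ≤ r → l + r + 8 ≤ 2 * h → l ≤ r + 11 → h + 1 ≡ l → r + 9 ≤ h → Suitable l r
suitable-tail r l h r≥ lh l≤ h≡ h≥ = h , lh , subst (λ z → (l + r + 8) * (2 ^ h * 142 + 30000) + (l * 1000 + 124600) < (r * 1000 + 600) * z) 2^l
    (subst ((l + r + 8) * (2 ^ h * 142 + 30000) + (l * 1000 + 124600) <_) (*-assoc (r * 1000 + 600) 2 (2 ^ h))
      (tail-fits r (l + r + 8) ((r * 1000 + 600) * 2) (l * 1000 + 124600) (2 ^ h) (≤-trans (≤-by 65536 (2 ^ 16) refl) (^-monoʳ-≤ 2 (≤-trans (+-monoˡ-≤ 9 r≥) h≥))) num w≤))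
  where
  open ≤-Reasoning
  2^l : 2 * 2 ^ h ≡ 2 ^ l
  2^l = cong (2 ^_) (trans (+-comm 1 h) h≡)
  w≤ : l * 1000 + 124600 ≤ r * 1000 + 135600
  w≤ = ≤-trans (+-monoˡ-≤ 124600 (*-monoˡ-≤ 1000 l≤)) (≤-reflexive (trans (cong (_+ 124600) (*-distribʳ-+ 1000 r 11)) (+-assoc (r * 1000) 11000 124600)))
  num : (l + r + 8) * 143 + 3 + r + 1 ≤ (r * 1000 + 600) * 2
  num = begin
    (l + r + 8) * 143 + 3 + r + 1          ≤⟨ +-monoˡ-≤ 1 (+-monoˡ-≤ r (+-monoˡ-≤ 3 (*-monoˡ-≤ 143 (+-monoˡ-≤ 8 (+-monoˡ-≤ r l≤))))) ⟩
    (r + 11 + r + 8) * 143 + 3 + r + 1     ≡⟨ solve 1 (λ r → (r :+ con 11 :+ r :+ con 8) :* con 143 :+ con 3 :+ r :+ con 1 := r :* con 287 :+ con 2721) refl r ⟩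
    r * 287 + 2721                         ≤⟨ +-monoʳ-≤ (r * 287) (≤-trans (≤-by 2721 (7 * 1713) refl) (*-monoˡ-≤ 1713 r≥)) ⟩
    r * 287 + r * 1713                     ≤⟨ m≤m+n _ 1200 ⟩
    r * 287 + r * 1713 + 1200              ≡⟨ solve 1 (λ r → r :* con 287 :+ r :* con 1713 :+ con 1200 := (r :* con 1000 :+ con 600) :* con 2) refl r ⟩
    (r * 1000 + 600) * 2 ∎

suitable-numeric : ∀ l r h → (l + r + 8 <ᵇ suc (2 * h)) ≡ true → ((l + r + 8) * (2 ^ h * 142 + 30000) + (l * 1000 + 124600) <ᵇ (r * 1000 + 600) * 2 ^ l) ≡ true → Suitable l r
suitable-numeric l r h e₁ e₂ = h , ≤-by (l + r + 8) (2 * h) e₁ , <ᵇ-true e₂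

17≤ : ∀ {A : Set} {l} → (A × 17 ≤ l) ⊎ 24 ≤ l → 17 ≤ l
17≤ (inj₁ (_ , l≥)) = l≥
17≤ (inj₂ l≥) = ≤-trans (≤-by 17 24 refl) l≥

-- For r = 0 the margin is only 0.6k, and l must reach 24. For 1 ≤ r ≤ 6 the values 17 and 18 start
-- the induction. For larger r the condition r + 10 ≤ l itself supplies the starting values.
suitable : ∀ l r → r + 10 ≤ l → (1 ≤ r × 17 ≤ l) ⊎ 24 ≤ l → Suitable l r
suitable l 0 le (inj₁ (() , _))
suitable l 0 le (inj₂ l≥) = suitable-from 24 0 (suitable-numeric 24 0 16 refl refl) (suitable-numeric 25 0 17 refl refl) l l≥
suitable l 1 le c = suitable-from 17 1 (suitable-numeric 17 1 13 refl refl) (suitable-numeric 18 1 14 refl refl) l (17≤ c)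
suitable l 2 le c = suitable-from 17 2 (suitable-numeric 17 2 14 refl refl) (suitable-numeric 18 2 14 refl refl) l (17≤ c)
suitable l 3 le c = suitable-from 17 3 (suitable-numeric 17 3 14 refl refl) (suitable-numeric 18 3 15 refl refl) l (17≤ c)
suitable l 4 le c = suitable-from 17 4 (suitable-numeric 17 4 15 refl refl) (suitable-numeric 18 4 15 refl refl) l (17≤ c)
suitable l 5 le c = suitable-from 17 5 (suitable-numeric 17 5 15 refl refl) (suitable-numeric 18 5 16 refl refl) l (17≤ c)
suitable l 6 le c = suitable-from 17 6 (suitable-numeric 17 6 16 refl refl) (suitable-numeric 18 6 16 refl refl) l (17≤ c)
suitable l r@(suc (suc (suc (suc (suc (suc (suc r′))))))) le c = big r r≥7 l le
  where
  r≥7 : 7 ≤ r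
  r≥7 = s≤s (s≤s (s≤s (s≤s (s≤s (s≤s (s≤s z≤n))))))
  big : ∀ r → 7 ≤ r → ∀ l → r + 10 ≤ l → Suitable l r
  big r r≥ l le = suitable-from (r + 10) r
    (suitable-tail r (r + 10) (r + 9) r≥ (≤-reflexive (solve 1 (λ r → r :+ con 10 :+ r :+ con 8 := con 2 :* (r :+ con 9)) refl r)) (+-monoʳ-≤ r (≤-by 10 11 refl)) (+-assoc r 9 1) ≤-refl)
    (subst (λ l → Suitable l r) (+-suc r 10) (suitable-tail r (r + 11) (r + 10) r≥ (≤-trans (n≤1+n _) (≤-reflexive (solve 1 (λ r → con 1 :+ (r :+ con 11 :+ r :+ con 8) := con 2 :* (r :+ con 10)) refl r))) ≤-refl (+-assoc r 10 1) (+-monoʳ-≤ r (≤-by 9 10 refl)))) l le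

moderate : ∀ k n l r → 0 < k → Odd n → 4 * k + 8 < n → AllSmooth (4 * k + 8) n k → 2 ^ l ≤ k → k < 2 ^ suc l →
  2 ^ (5 + r) * k ≤ n → n < 2 ^ (6 + r) * k → Suitable l r → ⊥
moderate zero n l r () on n> sm k≥ k< n≥ n< suit
moderate k@(suc κ) n l r k>0 on n> sm k≥ k< n≥ n< (h , lh , fits) =
  moderate-arithmetic k l r ((4 * k + 8) / 60) (π′ s) h (ratio-bits k n E e l (5 + r) k>0 (doubled-bound κ n E on E>0 terms∣E) E≤2^e k< n≥) (m/n*n≤m (4 * k + 8) 60) (pi-bound (2 ^ h)) fits k≥
  where
  open ≤-Reasoning
  N = n + 4 * k
  s = 2 ^ h
  lg = l + r + 8
  N≤ : N ≤ 2 ^ lg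
  N≤ = begin
    n + 4 * k                                ≤⟨ +-mono-≤ (<⇒≤ n<) (*-monoˡ-≤ k (≤-trans (≤-by 4 (2 ^ 6) refl) (^-monoʳ-≤ 2 (m≤m+n 6 r)))) ⟩
    2 ^ (6 + r) * k + 2 ^ (6 + r) * k        ≡⟨ solve 2 (λ x k → x :* k :+ x :* k := con 2 :* x :* k) refl (2 ^ (6 + r)) k ⟩
    2 ^ (7 + r) * k                          ≤⟨ *-monoʳ-≤ (2 ^ (7 + r)) (<⇒≤ k<) ⟩
    2 ^ (7 + r) * 2 ^ suc l                  ≡⟨ sym (^-distribˡ-+-* 2 (7 + r) (suc l)) ⟩
    2 ^ (7 + r + suc l)                      ≡⟨ cong (2 ^_) (solve 2 (λ r l → con 7 :+ r :+ (con 1 :+ l) := l :+ r :+ con 8) refl r l) ⟩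
    2 ^ lg ∎
  N<s² : N < suc s * suc s
  N<s² = ≤-<-trans (≤-trans N≤ (^-monoʳ-≤ 2 lh)) (subst (_< suc s * suc s) s*s (*-mono-< (n<1+n s) (n<1+n s)))
    where
    s*s : s * s ≡ 2 ^ (2 * h)
    s*s = trans (sym (^-distribˡ-+-* 2 h h)) (cong (λ z → 2 ^ (h + z)) (sym (+-identityʳ h)))
  open Envelope (4 * k + 8) n k N s lg (4 * k + 8) (4 * k + 8) on (<-≤-trans (≤-<-trans z≤n n>) (m≤m+n n (4 * k))) (λ i i< → +-monoʳ-≤ n (*-monoʳ-≤ 4 (<⇒≤ i<))) N<s² N≤ n> sm
    (λ p c _ p≤ _ _ → p≤) (λ p c _ p≤ _ → p≤)
  u = 51 * suc ((4 * k + 8) / 60)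
  e = lg * π′ s + (u + u)
  E≤2^e : E ≤ 2 ^ e
  E≤2^e = begin
    E                                                                      ≤⟨ E≤ ⟩
    2 ^ (lg * π′ s) * (theta (other cl) (4 * k + 8) * theta cl (4 * k + 8)) ≤⟨ *-monoʳ-≤ (2 ^ (lg * π′ s)) (*-mono-≤ (theta-general (other cl) (other-class cl-odd) (4 * k + 8)) (theta-general cl cl-odd (4 * k + 8))) ⟩
    2 ^ (lg * π′ s) * (2 ^ u * 2 ^ u)                                      ≡⟨ cong (2 ^ (lg * π′ s) *_) (sym (^-distribˡ-+-* 2 u u)) ⟩
    2 ^ (lg * π′ s) * 2 ^ (u + u)                                          ≡⟨ sym (^-distribˡ-+-* 2 (lg * π′ s) (u + u)) ⟩
    2 ^ e ∎

very-large : ∀ k n l f → 150000 ≤ k → Odd n → 4 * k ≤ n → AllSmooth (4 * k + 8) n k → 17 ≤ l → k < 2 ^ suc l →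
  2 ^ f ≤ n → n < 2 ^ suc f → 2 * l ≤ f + 4 → ⊥
very-large zero n l f k≥ on n≥ sm l≥ k< n≥f n<f lf = contradiction (≤-trans (≤-by 1 150000 refl) k≥) (λ ())
very-large k@(suc κ) n l f k≥ on n≥ sm l≥ k< n≥f n<f lf =
  very-large-arithmetic k f l (π′ (4 * k + 8)) (size-bits k n E ((f + 2) * π′ (4 * k + 8)) l f z<s (doubled-bound κ n E on (powEnvelope>0 (4 * k + 8) N) terms) E≤ k< n≥f)
    (count k k≥) lf l≥ (≤-trans (≤-by 1000 150000 refl) k≥)
  where
  N = n + 4 * k
  E = prodOver oddPrime? (λ p → powFloor p N) (4 * k + 8)
  n>0 : 0 < n
  n>0 = <-≤-trans z<s n≥
  N>0 : 0 < N
  N>0 = <-≤-trans n>0 (m≤m+n n (4 * k))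
  terms = powEnvelope (4 * k + 8) n k N on n>0 N>0 (λ i i< → +-monoʳ-≤ n (*-monoʳ-≤ 4 (<⇒≤ i<))) sm
  N≤ : N ≤ 2 ^ (f + 2)
  N≤ = ≤-trans (+-monoʳ-≤ n n≥) (≤-trans (+-mono-≤ (<⇒≤ n<f) (<⇒≤ n<f)) (≤-reflexive (trans (cong (2 ^ suc f +_) (sym (+-identityʳ (2 ^ suc f)))) (cong (2 ^_) (+-comm 2 f)))))
  E≤ : E ≤ 2 ^ ((f + 2) * π′ (4 * k + 8))
  E≤ = ≤-trans (powEnvelope≤ (4 * k + 8) N N>0) (≤-trans (^-monoˡ-≤ (π′ (4 * k + 8)) N≤) (≤-reflexive (^-*-assoc 2 (f + 2) (π′ (4 * k + 8)))))
  count : ∀ k → 150000 ≤ k → π′ (4 * k + 8) * 1000 ≤ k * 441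
  count k k≥ = ≤-trans (pi-bound-large (4 * k + 8) (≤-trans (≤-by 600000 (4 * 150000) refl) (≤-trans (*-monoʳ-≤ 4 k≥) (m≤m+n (4 * k) 8))))
    (≤-trans (≤-reflexive (solve 1 (λ k → (con 4 :* k :+ con 8) :* con 110 :+ con 40000 := k :* con 440 :+ con 40880) refl k))
      (≤-trans (+-monoʳ-≤ (k * 440) (≤-trans (≤-by 40880 150000 refl) k≥)) (≤-reflexive (solve 1 (λ k → k :* con 440 :+ k := k :* con 441) refl k))))

-- When n is at least about k²/16, already n^k outweighs an E that grants every prime a full power.
-- Below that, r + 10 ≤ l holds, so large primes can be counted to the first power.
large-n : ∀ k n → 150000 ≤ k → Odd n → 4 * k + 8 < n → AllSmooth (4 * k + 8) n k → 64 * k ≤ n ⊎ (4 ^ 12 ≤ k × 32 * k ≤ n) → ⊥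
large-n k n k≥ on n> sm c = go (logFloor 2 ≤-refl k k>0) (logFloor 2 ≤-refl n (≤-<-trans z≤n n>)) (log₂-ratio n k k>0 (≤-trans (≤-trans (m≤n*m k 4) (m≤m+n (4 * k) 8)) (<⇒≤ n>)))
  where
  k>0 : 0 < k
  k>0 = <-≤-trans (<ᵇ-true {0} {150000} refl) k≥
  exp-bound : ∀ a b x → 2 ^ a ≤ x → x < 2 ^ suc b → a ≤ b
  exp-bound a b x lo hi = ≮⇒≥ λ b<a → <⇒≱ hi (≤-trans (^-monoʳ-≤ 2 b<a) lo)
  ratio-bound : ∀ a ρ → 2 ^ a * k ≤ n → n < 2 ^ suc ρ * k → a ≤ ρ
  ratio-bound a ρ lo hi = ≮⇒≥ λ ρ<a → <⇒≱ hi (≤-trans (*-monoˡ-≤ k (^-monoʳ-≤ 2 ρ<a)) lo)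
  go : ∃[ l ] (2 ^ l ≤ k × k < 2 ^ suc l) → ∃[ f ] (2 ^ f ≤ n × n < 2 ^ suc f) → ∃[ ρ ] (2 ^ ρ * k ≤ n × n < 2 ^ suc ρ * k) → ⊥
  go (l , l₁ , l₂) (f , f₁ , f₂) (ρ , ρ₁ , ρ₂) with 2 * l ≤? f + 4
  ... | yes lf = very-large k n l f k≥ on (≤-trans (m≤m+n (4 * k) 8) (<⇒≤ n>)) sm l≥17 l₂ f₁ f₂ lf
    where
    l≥17 : 17 ≤ l
    l≥17 = exp-bound 17 l k (≤-trans (≤-by (2 ^ 17) 150000 refl) k≥) l₂
  ... | no nlf = moderate k n l r k>0 on n> sm l₁ l₂ (subst (λ z → 2 ^ z * k ≤ n) (sym ρ≡) ρ₁) (subst (λ z → n < 2 ^ suc z * k) (sym ρ≡) ρ₂) (suitable l r r≤ cond)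
    where
    r = ρ ∸ 5
    l≥17 : 17 ≤ l
    l≥17 = exp-bound 17 l k (≤-trans (≤-by (2 ^ 17) 150000 refl) k≥) l₂
    ρ≥5 : 5 ≤ ρ
    ρ≥5 = case c of λ { (inj₁ x) → ≤-trans (≤-by 5 6 refl) (ratio-bound 6 ρ x ρ₂) ; (inj₂ (_ , x)) → ratio-bound 5 ρ x ρ₂ }
    ρ≡ : 5 + r ≡ ρ
    ρ≡ = m+[n∸m]≡n ρ≥5
    r≤ : r + 10 ≤ l
    r≤ = s≤s⁻¹ (+-cancelʳ-≤ l _ _ (begin-strict
      r + 10 + l           ≡⟨ solve 2 (λ r l → r :+ con 10 :+ l := con 5 :+ r :+ l :+ con 5) refl r l ⟩
      5 + r + l + 5        ≡⟨ cong (λ z → z + l + 5) ρ≡ ⟩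
      ρ + l + 5            ≤⟨ +-monoˡ-≤ 5 (exp-bound (ρ + l) f n (≤-trans (≤-reflexive (^-distribˡ-+-* 2 ρ l)) (≤-trans (*-monoʳ-≤ (2 ^ ρ) l₁) ρ₁)) f₂) ⟩
      f + 5                ≡⟨ +-suc f 4 ⟩
      suc (f + 4)          ≤⟨ ≰⇒> nlf ⟩
      2 * l                ≡⟨ cong (l +_) (+-identityʳ l) ⟩
      l + l                <⟨ n<1+n (l + l) ⟩
      suc l + l ∎))
      where open ≤-Reasoning
    cond : (1 ≤ r × 17 ≤ l) ⊎ 24 ≤ l
    cond = case c of λ { (inj₁ x) → inj₁ (m+n≤o⇒m≤o∸n 1 (ratio-bound 6 ρ x ρ₂) , l≥17) ; (inj₂ (x , _)) → inj₂ (exp-bound 24 l k (≤-trans (≤-by (2 ^ 24) (4 ^ 12) refl) x) l₂) }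

-- Chains of multiples of large primes

record Hit (b n K : ℕ) : Set where
  constructor mkHit
  field
    i q   : ℕ
    i<    : i < K
    isPrime : Prime q
    div   : q ∣ n + 4 * i
    large : b < q

hit⇒⊥ : ∀ {b n K k} → K ≤ k → AllSmooth b n k → Hit b n K → ⊥
hit⇒⊥ K≤k sm (mkHit i q i< pq d lt) = <⇒≱ lt (sm i (<-≤-trans i< K≤k) q pq d)

-- A multiple w of a large prime with v < w ≤ v + 4K serves every n with v < n ≤ w.
hit-or-advance : ∀ b K v y x → y < K → (∃[ q ] (Prime q × q ∣ v + 4 * (K ∸ y) × (suc x ≤ K ∸ y → b < q))) →
  Hit b (v + 4 * suc x) K ⊎ (∃[ x′ ] v + 4 * suc x ≡ v + 4 * (K ∸ y) + 4 * suc x′)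
hit-or-advance b K v y x y<K (q , pq , d , lt) with suc x ≤? K ∸ y
... | yes le = inj₁ (mkHit i q (<-≤-trans (∸-monoʳ-< z<s le) (m∸n≤m K y)) pq (subst (q ∣_) w≡ d) (lt le))
  where
  i = K ∸ y ∸ suc x
  w≡ : v + 4 * (K ∸ y) ≡ v + 4 * suc x + 4 * i
  w≡ = trans (cong (λ z → v + 4 * z) (sym (m+[n∸m]≡n le))) (solve 3 (λ v a i → v :+ con 4 :* (a :+ i) := v :+ con 4 :* a :+ con 4 :* i) refl v (suc x) i)
... | no nle = inj₂ (x ∸ (K ∸ y) , trans (cong (λ z → v + 4 * z) (sym (trans (+-suc (K ∸ y) _) (cong suc (m+[n∸m]≡n (s≤s⁻¹ (≰⇒> nle)))))))
    (solve 3 (λ v a i → v :+ con 4 :* (a :+ i) := v :+ con 4 :* a :+ con 4 :* i) refl v (K ∸ y) (suc (x ∸ (K ∸ y)))))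

Pairs : Set
Pairs = List (ℕ × ℕ)

mutual
  -- i is meant to be the inverse of 4 modulo q, so y = t i mod q gives the multiple t - 4y of q
  -- nearest below t in its class. `try` tests the divisibility itself, hence i need not be trusted.
  find : Pairs → ℕ → ℕ → Bool × ℕ
  find []            t K = false , 0
  find ((q , i) ∷ Q) t K = try q (rem (t * i) q) Q t K

  try : ℕ → ℕ → Pairs → ℕ → ℕ → Bool × ℕ
  try q y Q t K = if (y <ᵇ K) ∧ (rem (t ∸ 4 * y) q ≡ᵇ 0) then (true , y) else find Q t K

mutual
  chain : ℕ → ℕ → Pairs → ℕ → ℕ → Bool
  chain zero    K Q top v = false
  chain (suc f) K Q top v = if top <ᵇ suc v then true else link f K Q top v (find Q (v + 4 * K) K)

  link : ℕ → ℕ → Pairs → ℕ → ℕ → Bool × ℕ → Bool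
  link f K Q top v (false , y) = false
  link f K Q top v (true , y)  = chain f K Q top (v + 4 * (K ∸ y))

LargePrimes : ℕ → Pairs → Set
LargePrimes b = All (λ (q , _) → Prime q × b < q)

shift-window : ∀ v K y → y ≤ K → v + 4 * K ∸ 4 * y ≡ v + 4 * (K ∸ y)
shift-window v K y le = trans (+-∸-assoc v (*-monoʳ-≤ 4 le)) (cong (v +_) (sym (*-distribˡ-∸ 4 K y)))

find-sound : ∀ b Q v K y → LargePrimes b Q → find Q (v + 4 * K) K ≡ (true , y) → y < K × (∃[ q ] (Prime q × q ∣ v + 4 * (K ∸ y) × b < q))
find-sound b ((q , i) ∷ Q) v K y ((pq , lt) ∷ lp) e with rem ((v + 4 * K) * i) q
... | y′ with (y′ <ᵇ K) ∧ (rem (v + 4 * K ∸ 4 * y′) q ≡ᵇ 0) in e′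
... | false = find-sound b Q v K y lp e
find-sound b ((q , i) ∷ Q) v K y ((pq , lt) ∷ lp) refl | y | true with ∧-split {y <ᵇ K} e′
... | e₁ , e₂ = y<K , q , pq , subst (q ∣_) (shift-window v K y (<⇒≤ y<K)) (rem≡0⇒∣ _ q (≡ᵇ-true e₂)) , lt
  where
  y<K : y < K
  y<K = <ᵇ-true {y} {K} e₁

chain-sound : ∀ f b K Q top v → LargePrimes b Q → chain f K Q top v ≡ true → ∀ x → v + 4 * suc x ≤ top → Hit b (v + 4 * suc x) K
chain-sound (suc f) b K Q top v lp e x le with top <ᵇ suc v in e₀
... | true = contradiction (≤-trans le (s≤s⁻¹ (<ᵇ-true {top} {suc v} e₀))) (<⇒≱ (m<m+n v (*-mono-< {0} {4} z<s z<s)))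
... | false with find Q (v + 4 * K) K in e₁
... | true , y with find-sound b Q v K y lp e₁
... | y<K , q , pq , d , lt with hit-or-advance b K v y x y<K (q , pq , d , λ _ → lt)
... | inj₁ h = h
... | inj₂ (x′ , eq) = subst (λ n → Hit b n K) (sym eq) (chain-sound f b K Q top (v + 4 * (K ∸ y)) lp e x′ (≤-trans (≤-reflexive (sym eq)) le))

-- One of q + 1 and 3q + 1 is divisible by 4, according to the class of q.
inverse4 : ℕ → ℕ
inverse4 q = if suc q % 4 ≡ᵇ 0 then suc q / 4 else (3 * q + 1) / 4

-- Consecutive primes would have clustered multiples, hence the stride d.
primesFrom : ℕ → ℕ → ℕ → ℕ → Pairs
primesFrom zero    c       d p = []
primesFrom (suc f) zero    d p = []
primesFrom (suc f) (suc c) d p = if oddPrime? p then (p , inverse4 p) ∷ primesFrom f c d (d + p) else primesFrom f (suc c) d (2 + p)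

primesFrom-large : ∀ f c d b p → b < p → LargePrimes b (primesFrom f c d p)
primesFrom-large zero c d b p lt = []
primesFrom-large (suc f) zero d b p lt = []
primesFrom-large (suc f) (suc c) d b p lt with oddPrime? p in e
... | true = (oddPrime?-sound p e , lt) ∷ primesFrom-large f c d b (d + p) (≤-trans lt (m≤n+m p d))
... | false = primesFrom-large f (suc c) d b (2 + p) (m<n⇒m<1+n (m<n⇒m<1+n lt))

-- 60K is divisible by 4, so the two starting points represent the classes 1 and 3 and lie below
-- every n ≥ 60k with k ≥ K.
chains : ℕ → ℕ → ℕ → Pairs → Bool
chains f K top Q = chain f K Q top (60 * K ∸ 3) ∧ chain f K Q top (60 * K ∸ 1)

-- One chain serves a whole range of k: its gaps fit the shortest block K₀, and its primes exceed
-- the smoothness bound of the longest block K₁.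
covered? : ℕ → ℕ → ℕ → ℕ → ℕ → Bool
covered? f c K₀ K₁ top = chains f K₀ top (primesFrom f c (2 * (1 + K₁ / 80)) (4 * (K₁ + 1) + 1))

class-offset : ∀ n v → v % 4 ≡ n % 4 → v < n → ∃[ x ] n ≡ v + 4 * suc x
class-offset n v e lt with m%n≡0⇒n∣m (n ∸ v) 4 ([m-n]%4≡0 n v e (<⇒≤ lt))
  where
  [m-n]%4≡0 : ∀ n v → v % 4 ≡ n % 4 → v ≤ n → (n ∸ v) % 4 ≡ 0
  [m-n]%4≡0 n v e le = trans (cong (_% 4) n∸v) (m*n%n≡0 (n / 4 ∸ v / 4) 4)
    where
    n∸v : n ∸ v ≡ (n / 4 ∸ v / 4) * 4
    n∸v = trans (cong₂ _∸_ (m≡m%n+[m/n]*n n 4) (trans (m≡m%n+[m/n]*n v 4) (cong (_+ v / 4 * 4) e))) (trans ([m+n]∸[m+o]≡n∸o (n % 4) (n / 4 * 4) (v / 4 * 4)) (sym (*-distribʳ-∸ 4 (n / 4) (v / 4))))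
... | divides zero eq = contradiction (m∸n≡0⇒m≤n eq) (<⇒≱ lt)
... | divides (suc x) eq = x , trans (sym (m+[n∸m]≡n (<⇒≤ lt))) (cong (v +_) (trans eq (*-comm (suc x) 4)))

covered-sound : ∀ f c K₀ K₁ top → 0 < K₀ → covered? f c K₀ K₁ top ≡ true → ∀ k n → K₀ ≤ k → k ≤ K₁ → Odd n → 60 * k ≤ n → n ≤ top → ¬ AllSmooth (4 * (k + 1)) n k
covered-sound f c K₀ K₁ top K₀>0 cov k n K₀≤ ≤K₁ on n≥ n≤ sm = hit⇒⊥ {4 * (K₁ + 1)} K₀≤ (λ i i< p pp d → ≤-trans (sm i i< p pp d) (*-monoʳ-≤ 4 (+-monoˡ-≤ 1 ≤K₁))) (find-hit (n % 4) (odd%4 n on) refl)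
  where
  Q = primesFrom f c (2 * (1 + K₁ / 80)) (4 * (K₁ + 1) + 1)
  lp : LargePrimes (4 * (K₁ + 1)) Q
  lp = primesFrom-large f c (2 * (1 + K₁ / 80)) (4 * (K₁ + 1)) _ (m<m+n _ z<s)
  K₀′ = pred K₀
  K₀≡ : suc K₀′ ≡ K₀
  K₀≡ = suc-pred K₀ ⦃ >-nonZero K₀>0 ⦄
  from : ∀ v → v < 60 * K₀ → v % 4 ≡ n % 4 → chain f K₀ Q top v ≡ true → Hit (4 * (K₁ + 1)) n K₀
  from v v< e ch with class-offset n v e (<-≤-trans v< (≤-trans (*-monoʳ-≤ 60 K₀≤) n≥))
  ... | x , eq = subst (λ n → Hit (4 * (K₁ + 1)) n K₀) (sym eq) (chain-sound f (4 * (K₁ + 1)) K₀ Q top v lp ch x (≤-trans (≤-reflexive (sym eq)) n≤))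
  sub : ∀ d → d ≤ 60 → 60 * K₀ ∸ d ≡ 60 ∸ d + K₀′ * 15 * 4
  sub d d≤ = trans (cong (_∸ d) (trans (cong (60 *_) (sym K₀≡)) (trans (*-suc 60 K₀′) (cong (60 +_) (solve 1 (λ k → con 60 :* k := k :* con 15 :* con 4) refl K₀′))))) (+-∸-comm (K₀′ * 15 * 4) d≤)
  res : ∀ d → d ≤ 60 → (60 * K₀ ∸ d) % 4 ≡ (60 ∸ d) % 4
  res d d≤ = trans (cong (_% 4) (sub d d≤)) ([m+kn]%n≡m%n (60 ∸ d) (K₀′ * 15) 4)
  below : ∀ d → 0 < d → d ≤ 60 → 60 * K₀ ∸ d < 60 * K₀
  below d d>0 d≤ = ∸-monoʳ-< d>0 (≤-trans d≤ (m≤m*n 60 K₀ ⦃ >-nonZero K₀>0 ⦄))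
  find-hit : ∀ r → OddClass r → n % 4 ≡ r → Hit (4 * (K₁ + 1)) n K₀
  find-hit _ (inj₁ refl) e = from (60 * K₀ ∸ 3) (below 3 z<s (≤-by 3 60 refl)) (trans (res 3 (≤-by 3 60 refl)) (sym e)) (proj₁ (∧-split cov))
  find-hit _ (inj₂ refl) e = from (60 * K₀ ∸ 1) (below 1 z<s (≤-by 1 60 refl)) (trans (res 1 (≤-by 1 60 refl)) (sym e)) (proj₂ (∧-split {chain f K₀ Q top (60 * K₀ ∸ 3)} cov))

-- Blocks with 31 ≤ k ≤ 150000 and n ≥ 60k

tier-arithmetic : ∀ s p r v x Y → s * p ≤ 90 * v + s * r → r * 1000 ≤ Y * 142 + 30000 → Y * 9 ≤ v * 60 → v * 60 ≤ x + 60 →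
  s * p * 9000 ≤ (x + 60) * 13500 + s * ((x + 60) * 142 + 270000)
tier-arithmetic s p r v x Y raw IHY Y*9≤ v*60≤ = begin
  s * p * 9000                                        ≤⟨ *-monoˡ-≤ 9000 raw ⟩
  (90 * v + s * r) * 9000                             ≡⟨ solve 3 (λ v s r → (con 90 :* v :+ s :* r) :* con 9000 := v :* con 60 :* con 13500 :+ s :* (r :* con 1000 :* con 9)) refl v s r ⟩
  v * 60 * 13500 + s * (r * 1000 * 9)                 ≤⟨ +-mono-≤ (*-monoˡ-≤ 13500 v*60≤) (*-monoʳ-≤ s (*-monoˡ-≤ 9 IHY)) ⟩
  (x + 60) * 13500 + s * ((Y * 142 + 30000) * 9)      ≡⟨ cong (λ z → (x + 60) * 13500 + s * z) (trans (*-distribʳ-+ 9 (Y * 142) 30000) (cong (_+ 270000) (trans (*-assoc Y 142 9) (sym (*-assoc Y 9 142))))) ⟩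
  (x + 60) * 13500 + s * (Y * 9 * 142 + 270000)       ≤⟨ +-monoʳ-≤ ((x + 60) * 13500) (*-monoʳ-≤ s (+-monoˡ-≤ 270000 (*-monoˡ-≤ 142 (≤-trans Y*9≤ v*60≤)))) ⟩
  (x + 60) * 13500 + s * ((x + 60) * 142 + 270000) ∎
  where open ≤-Reasoning

pi-tier : ∀ s x → 2 ^ s ≤ x / 9 → 8400 ≤ x → s * π′ x * 9000 ≤ (x + 60) * 13500 + s * ((x + 60) * 142 + 270000)
pi-tier s x 2^s≤ big = tier-arithmetic s (π′ x) (π′ Y) v x Y raw IHY Y*9≤ v*60≤
  where open PiStep x s 2^s≤ big (λ {y} _ → pi-bound y)

-- For s > 0 one Chebyshev step with primes above 2^s is followed by the general bound at x/9; the
-- slope is 1.5/s + 0.142/9. This improves on 0.142 only from s = 12 on.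
piCap : ℕ → ℕ → ℕ
piCap zero    x = (x * 142 + 30000) / 1000
piCap (suc s) x = ((x + 60) * 13500 + suc s * ((x + 60) * 142 + 270000)) / (suc s * 9000)

piCapValid? : ℕ → ℕ → Bool
piCapValid? zero    x = true
piCapValid? (suc s) x = (2 ^ suc s <ᵇ suc (x / 9)) ∧ (8400 <ᵇ suc x)

piCap-sound : ∀ s x → piCapValid? s x ≡ true → π′ x ≤ piCap s x
piCap-sound zero x _ = ≤-trans (≤-reflexive (sym (m*n/n≡m (π′ x) 1000))) (/-monoˡ-≤ 1000 (pi-bound x))
piCap-sound (suc s) x e with ∧-split {2 ^ suc s <ᵇ suc (x / 9)} e
... | e₁ , e₂ = ≤-trans (≤-reflexive (sym (m*n/n≡m (π′ x) (suc s * 9000)))) (/-monoˡ-≤ (suc s * 9000)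
        (≤-trans (≤-reflexive (solve 3 (λ p s c → p :* (s :* c) := s :* p :* c) refl (π′ x) (suc s) 9000)) (pi-tier (suc s) x (≤-by _ (x / 9) e₁) (≤-by 8400 x e₂))))

-- From n ≥ 60k the ratio (n + 4k)/n is at most 16/15, and (16/15)^8 < 2: replacing N by n costs an
-- eighth of a bit per prime.
eighth-power : ∀ n k → 60 * k ≤ n → (n + 4 * k) ^ 8 ≤ 2 * n ^ 8
eighth-power n k le = *-cancelˡ-≤ (15 ^ 8) (begin
  15 ^ 8 * (n + 4 * k) ^ 8      ≡⟨ sym (^-distribʳ-* 8 15 (n + 4 * k)) ⟩
  (15 * (n + 4 * k)) ^ 8        ≤⟨ ^-monoˡ-≤ 8 (≤-trans (≤-reflexive (solve 2 (λ n k → con 15 :* (n :+ con 4 :* k) := con 15 :* n :+ con 60 :* k) refl n k)) (≤-trans (+-monoʳ-≤ (15 * n) le) (≤-reflexive (+-comm (15 * n) n)))) ⟩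
  (16 * n) ^ 8                  ≡⟨ ^-distribʳ-* 8 16 n ⟩
  16 ^ 8 * n ^ 8                ≤⟨ *-monoˡ-≤ (n ^ 8) (≤-by (16 ^ 8) (15 ^ 8 * 2) refl) ⟩
  15 ^ 8 * 2 * n ^ 8            ≡⟨ *-assoc (15 ^ 8) 2 (n ^ 8) ⟩
  15 ^ 8 * (2 * n ^ 8) ∎)
  where open ≤-Reasoning

-- n^k ≤ Δ is compared with E ≤ N^P after raising to the power c d, which is 80 in the application.
-- This makes e/(c d) a lower bound for log₂ n, κ/d an upper bound for log₂ k, and lets k! (known
-- through its c-th power) and N (known through its g-th power) enter with integer exponents.
module GroupBits (c d g w z : ℕ) (gw : g * w ≡ c * d) (k n E P κ σ e S : ℕ) (n>0 : 0 < n) (P≤k : P ≤ k) (dbl : 2 ^ k * prodAP4 n k ≤ 2 * E * k !) (E≤ : E ≤ (n + 4 * k) ^ P)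
                 (fac : (k !) ^ c * 2 ^ (z * k) ≤ (S * k ^ k) ^ c) (N≤ : (n + 4 * k) ^ g ≤ 2 * n ^ g)
                 (κ≥ : k ^ d ≤ 2 ^ κ) (σ≥ : S ≤ 2 ^ σ) (e≤ : 2 ^ e ≤ n ^ (c * d)) where
  open ≤-Reasoning
  Y = n ^ (c * d)
  Z = 2 * (n + 4 * k) ^ P * (S * k ^ k)

  first : (2 ^ k * n ^ k) ^ c * 2 ^ (z * k) ≤ Z ^ c
  first = begin
    (2 ^ k * n ^ k) ^ c * 2 ^ (z * k)                     ≤⟨ *-monoˡ-≤ (2 ^ (z * k)) (^-monoˡ-≤ c (≤-trans (*-monoʳ-≤ (2 ^ k) (prodAP4≥ k n)) (≤-trans dbl (*-monoˡ-≤ (k !) (*-monoʳ-≤ 2 E≤))))) ⟩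
    (2 * (n + 4 * k) ^ P * k !) ^ c * 2 ^ (z * k)         ≡⟨ trans (cong (_* 2 ^ (z * k)) (^-distribʳ-* c (2 * (n + 4 * k) ^ P) (k !))) (*-assoc ((2 * (n + 4 * k) ^ P) ^ c) ((k !) ^ c) (2 ^ (z * k))) ⟩
    (2 * (n + 4 * k) ^ P) ^ c * ((k !) ^ c * 2 ^ (z * k)) ≤⟨ *-monoʳ-≤ ((2 * (n + 4 * k) ^ P) ^ c) fac ⟩
    (2 * (n + 4 * k) ^ P) ^ c * (S * k ^ k) ^ c           ≡⟨ sym (^-distribʳ-* c (2 * (n + 4 * k) ^ P) (S * k ^ k)) ⟩
    Z ^ c ∎

  reorder : ∀ x a b → (x ^ a) ^ b ≡ (x ^ b) ^ a
  reorder x a b = trans (^-*-assoc x a b) (trans (cong (x ^_) (*-comm a b)) (sym (^-*-assoc x b a)))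

  left : ((2 ^ k * n ^ k) ^ c * 2 ^ (z * k)) ^ d ≡ 2 ^ (k * (c * d) + z * k * d) * Y ^ k
  left = begin-equality
    ((2 ^ k * n ^ k) ^ c * 2 ^ (z * k)) ^ d               ≡⟨ ^-distribʳ-* d ((2 ^ k * n ^ k) ^ c) (2 ^ (z * k)) ⟩
    ((2 ^ k * n ^ k) ^ c) ^ d * (2 ^ (z * k)) ^ d         ≡⟨ cong₂ _*_ (trans (^-*-assoc (2 ^ k * n ^ k) c d) (^-distribʳ-* (c * d) (2 ^ k) (n ^ k))) (^-*-assoc 2 (z * k) d) ⟩
    (2 ^ k) ^ (c * d) * (n ^ k) ^ (c * d) * 2 ^ (z * k * d) ≡⟨ cong₂ (λ x y → x * y * 2 ^ (z * k * d)) (^-*-assoc 2 k (c * d)) (reorder n k (c * d)) ⟩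
    2 ^ (k * (c * d)) * Y ^ k * 2 ^ (z * k * d)           ≡⟨ solve 3 (λ a b c → a :* b :* c := a :* c :* b) refl (2 ^ (k * (c * d))) (Y ^ k) (2 ^ (z * k * d)) ⟩
    2 ^ (k * (c * d)) * 2 ^ (z * k * d) * Y ^ k           ≡⟨ cong (_* Y ^ k) (sym (^-distribˡ-+-* 2 (k * (c * d)) (z * k * d))) ⟩
    2 ^ (k * (c * d) + z * k * d) * Y ^ k ∎

  right : (Z ^ c) ^ d ≤ 2 ^ (c * d + P * w + σ * (c * d) + κ * (k * c)) * Y ^ P
  right = begin
    (Z ^ c) ^ d                                           ≡⟨ ^-*-assoc Z c d ⟩
    Z ^ (c * d)                                           ≡⟨ trans (^-distribʳ-* (c * d) (2 * (n + 4 * k) ^ P) (S * k ^ k)) (cong₂ _*_ (^-distribʳ-* (c * d) 2 ((n + 4 * k) ^ P)) (^-distribʳ-* (c * d) S (k ^ k))) ⟩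
    2 ^ (c * d) * ((n + 4 * k) ^ P) ^ (c * d) * (S ^ (c * d) * (k ^ k) ^ (c * d)) ≤⟨ *-mono-≤ (*-monoʳ-≤ (2 ^ (c * d)) N-part) (*-mono-≤ (≤-trans (^-monoˡ-≤ (c * d) σ≥) (≤-reflexive (^-*-assoc 2 σ (c * d)))) k-part) ⟩
    2 ^ (c * d) * (2 ^ (P * w) * Y ^ P) * (2 ^ (σ * (c * d)) * 2 ^ (κ * (k * c))) ≡⟨ solve 5 (λ a b y c d → a :* (b :* y) :* (c :* d) := a :* b :* c :* d :* y) refl (2 ^ (c * d)) (2 ^ (P * w)) (Y ^ P) (2 ^ (σ * (c * d))) (2 ^ (κ * (k * c))) ⟩
    2 ^ (c * d) * 2 ^ (P * w) * 2 ^ (σ * (c * d)) * 2 ^ (κ * (k * c)) * Y ^ P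
      ≡⟨ cong (_* Y ^ P) (sym (trans (^-distribˡ-+-* 2 (c * d + P * w + σ * (c * d)) (κ * (k * c))) (cong (_* 2 ^ (κ * (k * c))) (trans (^-distribˡ-+-* 2 (c * d + P * w) (σ * (c * d))) (cong (_* 2 ^ (σ * (c * d))) (^-distribˡ-+-* 2 (c * d) (P * w))))))) ⟩
    2 ^ (c * d + P * w + σ * (c * d) + κ * (k * c)) * Y ^ P ∎
    where
    N-part : ((n + 4 * k) ^ P) ^ (c * d) ≤ 2 ^ (P * w) * Y ^ P
    N-part = begin
      ((n + 4 * k) ^ P) ^ (c * d)         ≡⟨ trans (reorder (n + 4 * k) P (c * d)) (cong (_^ P) (trans (cong ((n + 4 * k) ^_) (sym gw)) (sym (^-*-assoc (n + 4 * k) g w)))) ⟩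
      (((n + 4 * k) ^ g) ^ w) ^ P         ≤⟨ ^-monoˡ-≤ P (^-monoˡ-≤ w N≤) ⟩
      ((2 * n ^ g) ^ w) ^ P               ≡⟨ cong (_^ P) (trans (^-distribʳ-* w 2 (n ^ g)) (cong (2 ^ w *_) (trans (^-*-assoc n g w) (cong (n ^_) gw)))) ⟩
      (2 ^ w * Y) ^ P                     ≡⟨ trans (^-distribʳ-* P (2 ^ w) Y) (cong (_* Y ^ P) (trans (reorder 2 w P) (^-*-assoc 2 P w))) ⟩
      2 ^ (P * w) * Y ^ P ∎
    k-part : (k ^ k) ^ (c * d) ≤ 2 ^ (κ * (k * c))
    k-part = begin
      (k ^ k) ^ (c * d)      ≡⟨ trans (^-*-assoc k k (c * d)) (trans (cong (k ^_) (solve 3 (λ k c d → k :* (c :* d) := d :* (k :* c)) refl k c d)) (sym (^-*-assoc k d (k * c)))) ⟩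
      (k ^ d) ^ (k * c)      ≤⟨ ^-monoˡ-≤ (k * c) κ≥ ⟩
      (2 ^ κ) ^ (k * c)      ≡⟨ ^-*-assoc 2 κ (k * c) ⟩
      2 ^ (κ * (k * c)) ∎

  bits : k * (c * d) + z * k * d + e * (k ∸ P) ≤ c * d + P * w + σ * (c * d) + κ * (k * c)
  bits = 2^-cancel _ _ (*-cancelʳ-≤ _ _ (Y ^ P) ⦃ m^n≢0 Y P ⦃ m^n≢0 n (c * d) ⦃ >-nonZero n>0 ⦄ ⦄ ⦄ (begin
    2 ^ (u + e * (k ∸ P)) * Y ^ P                      ≡⟨ trans (cong (_* Y ^ P) (^-distribˡ-+-* 2 u (e * (k ∸ P)))) (*-assoc (2 ^ u) _ _) ⟩
    2 ^ u * (2 ^ (e * (k ∸ P)) * Y ^ P)                ≤⟨ *-monoʳ-≤ (2 ^ u) (*-monoˡ-≤ (Y ^ P) (≤-trans (≤-reflexive (sym (^-*-assoc 2 e (k ∸ P)))) (^-monoˡ-≤ (k ∸ P) e≤))) ⟩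
    2 ^ u * (Y ^ (k ∸ P) * Y ^ P)                      ≡⟨ cong (2 ^ u *_) (trans (sym (^-distribˡ-+-* Y (k ∸ P) P)) (cong (Y ^_) (m∸n+n≡m P≤k))) ⟩
    2 ^ u * Y ^ k                                      ≡⟨ sym left ⟩
    ((2 ^ k * n ^ k) ^ c * 2 ^ (z * k)) ^ d            ≤⟨ ^-monoˡ-≤ d first ⟩
    (Z ^ c) ^ d                                        ≤⟨ right ⟩
    2 ^ (c * d + P * w + σ * (c * d) + κ * (k * c)) * Y ^ P ∎))
    where u = k * (c * d) + z * k * d

-- For k ≥ K₀ the hypothesis num persists because 5κ ≤ 192 + e.
group-arithmetic : ∀ k K₀ P P₁ κ σ e → K₀ ≤ k → P ≤ P₁ → P ≤ k → 5 * κ ≤ 192 + e → P₁ * (e + 10) + 80 * (1 + σ) + 5 * κ * K₀ < (192 + e) * K₀ →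
  k * 80 + 7 * k * 16 + e * (k ∸ P) ≤ 80 + P * 10 + σ * 80 + κ * (k * 5) → ⊥
group-arithmetic k K₀ P P₁ κ σ e K₀≤ P≤ P≤k κ≤ num bits = <⇒≱ gap (begin
  (192 + e) * k                                        ≡⟨ cong (λ z → (192 + e) * z) (sym (m∸n+n≡m P≤k)) ⟩
  (192 + e) * (k ∸ P + P)                              ≡⟨ solve 3 (λ e m P → (con 192 :+ e) :* (m :+ P) := con 192 :* (m :+ P) :+ e :* m :+ e :* P) refl e (k ∸ P) P ⟩
  192 * (k ∸ P + P) + e * (k ∸ P) + e * P              ≡⟨ cong (λ z → 192 * z + e * (k ∸ P) + e * P) (m∸n+n≡m P≤k) ⟩
  192 * k + e * (k ∸ P) + e * P                        ≡⟨ cong (λ z → z + e * (k ∸ P) + e * P) (solve 1 (λ k → con 192 :* k := k :* con 80 :+ con 7 :* k :* con 16) refl k) ⟩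
  k * 80 + 7 * k * 16 + e * (k ∸ P) + e * P            ≤⟨ +-monoˡ-≤ (e * P) bits ⟩
  80 + P * 10 + σ * 80 + κ * (k * 5) + e * P           ≡⟨ solve 5 (λ P σ κ k e → con 80 :+ P :* con 10 :+ σ :* con 80 :+ κ :* (k :* con 5) :+ e :* P := P :* (e :+ con 10) :+ con 80 :* (con 1 :+ σ) :+ con 5 :* κ :* k) refl P σ κ k e ⟩
  P * (e + 10) + 80 * (1 + σ) + 5 * κ * k              ≤⟨ +-monoˡ-≤ (5 * κ * k) (+-monoˡ-≤ (80 * (1 + σ)) (*-monoˡ-≤ (e + 10) P≤)) ⟩
  P₁ * (e + 10) + 80 * (1 + σ) + 5 * κ * k ∎)
  where
  open ≤-Reasoning
  d = k ∸ K₀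
  gap : P₁ * (e + 10) + 80 * (1 + σ) + 5 * κ * k < (192 + e) * k
  gap = subst (λ k → P₁ * (e + 10) + 80 * (1 + σ) + 5 * κ * k < (192 + e) * k) (m+[n∸m]≡n K₀≤) (begin-strict
    P₁ * (e + 10) + 80 * (1 + σ) + 5 * κ * (K₀ + d)        ≡⟨ solve 4 (λ w c K d → w :+ c :* (K :+ d) := w :+ c :* K :+ c :* d) refl (P₁ * (e + 10) + 80 * (1 + σ)) (5 * κ) K₀ d ⟩
    P₁ * (e + 10) + 80 * (1 + σ) + 5 * κ * K₀ + 5 * κ * d  <⟨ +-mono-<-≤ num (*-monoˡ-≤ d κ≤) ⟩
    (192 + e) * K₀ + (192 + e) * d                         ≡⟨ sym (*-distribˡ-+ (192 + e) K₀ d) ⟩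
    (192 + e) * (K₀ + d) ∎)

group-large : ∀ K₀ K₁ P₁ n₀ κ σ e → π′ (4 * (K₁ + 1)) ≤ P₁ → P₁ ≤ K₀ → 2 ^ e ≤ n₀ ^ 80 → K₁ ^ 16 ≤ 2 ^ κ → suc (K₁ + 100 * K₁) ≤ 2 ^ σ → 5 * κ ≤ 192 + e →
  P₁ * (e + 10) + 80 * (1 + σ) + 5 * κ * K₀ < (192 + e) * K₀ →
  ∀ k n → 0 < k → K₀ ≤ k → k ≤ K₁ → Odd n → 60 * k ≤ n → n₀ ≤ n → ¬ AllSmooth (4 * (k + 1)) n k
group-large K₀ K₁ P₁ n₀ κ σ e hP hK hn hκ hσ h5 num zero n () K₀≤ ≤K₁ on n≥ n≥₀ sm
group-large K₀ K₁ P₁ n₀ κ σ e hP hK hn hκ hσ h5 num k@(suc k′) n k>0 K₀≤ ≤K₁ on n≥ n≥₀ sm =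
  group-arithmetic k K₀ P P₁ κ σ e K₀≤ P≤ (≤-trans P≤ (≤-trans hK K₀≤)) h5 num
    (GroupBits.bits 5 16 8 10 7 refl k n E P κ σ e (suc (k + 100 * k)) n>0 (≤-trans P≤ (≤-trans hK K₀≤)) (doubled-bound k′ n E on (powEnvelope>0 (4 * (k + 1)) N) terms) (powEnvelope≤ (4 * (k + 1)) N N>0)
      (fac-fifth k) (eighth-power n k n≥) (≤-trans (^-monoˡ-≤ 16 ≤K₁) hκ) (≤-trans (s≤s (+-mono-≤ ≤K₁ (*-monoʳ-≤ 100 ≤K₁))) hσ) (≤-trans hn (^-monoˡ-≤ 80 n≥₀)))
  where
  N = n + 4 * k
  E = prodOver oddPrime? (λ p → powFloor p N) (4 * (k + 1))
  P = π′ (4 * (k + 1))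
  P≤ : P ≤ P₁
  P≤ = ≤-trans (π′-mono (*-monoʳ-≤ 4 (+-monoˡ-≤ 1 ≤K₁))) hP
  n>0 : 0 < n
  n>0 = <-≤-trans (*-mono-< {0} {60} z<s k>0) n≥
  N>0 : 0 < N
  N>0 = <-≤-trans n>0 (m≤m+n n (4 * k))
  terms = powEnvelope (4 * (k + 1)) n k N on n>0 N>0 (λ i i< → +-monoʳ-≤ n (*-monoʳ-≤ 4 (<⇒≤ i<))) sm

-- A row treats the k from the end of the previous row up to K₁: n ≤ n₀ by a chain of multiples, n ≥ n₀ by group-large.
-- s selects the bound piCap s for the number of primes, and 2^e ≤ n₀^80, K₁^16 ≤ 2^κ, 101 K₁ < 2^σ.
record Row : Set where
  constructor row
  field K₁ s n₀ e κ σ : ℕ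

row? : ℕ → ℕ → ℕ → Row → Bool
row? f c K₀ (row K₁ s n₀ e κ σ) =
  piCapValid? s (4 * (K₁ + 1)) ∧ ((P₁ <ᵇ suc K₀) ∧ ((2 ^ e <ᵇ suc (n₀ ^ 80)) ∧ ((K₁ ^ 16 <ᵇ suc (2 ^ κ)) ∧ ((suc (K₁ + 100 * K₁) <ᵇ suc (2 ^ σ)) ∧
  ((5 * κ <ᵇ suc (192 + e)) ∧ ((P₁ * (e + 10) + 80 * (1 + σ) + 5 * κ * K₀ <ᵇ (192 + e) * K₀) ∧ covered? f c K₀ K₁ n₀))))))
  where P₁ = piCap s (4 * (K₁ + 1))

rows? : ℕ → ℕ → ℕ → List Row → Bool
rows? f c K₀ []       = true
rows? f c K₀ (r ∷ rs) = row? f c K₀ r ∧ rows? f c (suc (Row.K₁ r)) rs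

lastRow : ℕ → List Row → ℕ
lastRow K₀ []       = K₀
lastRow K₀ (r ∷ rs) = lastRow (suc (Row.K₁ r)) rs

row-sound : ∀ f c K₀ r → 0 < K₀ → row? f c K₀ r ≡ true → ∀ k n → K₀ ≤ k → k ≤ Row.K₁ r → Odd n → 60 * k ≤ n → ¬ AllSmooth (4 * (k + 1)) n k
row-sound f c K₀ (row K₁ s n₀ e κ σ) K₀>0 chk k n K₀≤ ≤K₁ on n≥ with ∧-split {piCapValid? s (4 * (K₁ + 1))} chk
... | e₁ , r₁ with ∧-split {piCap s (4 * (K₁ + 1)) <ᵇ suc K₀} r₁
... | e₂ , r₂ with ∧-split {2 ^ e <ᵇ suc (n₀ ^ 80)} r₂
... | e₃ , r₃ with ∧-split {K₁ ^ 16 <ᵇ suc (2 ^ κ)} r₃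
... | e₄ , r₄ with ∧-split {suc (K₁ + 100 * K₁) <ᵇ suc (2 ^ σ)} r₄
... | e₅ , r₅ with ∧-split {5 * κ <ᵇ suc (192 + e)} r₅
... | e₆ , r₆ with ∧-split {piCap s (4 * (K₁ + 1)) * (e + 10) + 80 * (1 + σ) + 5 * κ * K₀ <ᵇ (192 + e) * K₀} r₆
... | e₇ , cov with n ≤? n₀
... | yes le = covered-sound f c K₀ K₁ n₀ K₀>0 cov k n K₀≤ ≤K₁ on n≥ le
... | no nle = group-large K₀ K₁ (piCap s (4 * (K₁ + 1))) n₀ κ σ e (piCap-sound s (4 * (K₁ + 1)) e₁) (≤-by _ K₀ e₂) (≤-by _ (n₀ ^ 80) e₃) (≤-by _ (2 ^ κ) e₄) (≤-by _ (2 ^ σ) e₅)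
      (≤-by (5 * κ) (192 + e) e₆) (<ᵇ-true e₇) k n (<-≤-trans K₀>0 K₀≤) K₀≤ ≤K₁ on n≥ (<⇒≤ (≰⇒> nle))

rows-sound : ∀ f c K₀ rs → 0 < K₀ → rows? f c K₀ rs ≡ true → ∀ k n → K₀ ≤ k → k < lastRow K₀ rs → Odd n → 60 * k ≤ n → ¬ AllSmooth (4 * (k + 1)) n k
rows-sound f c K₀ [] K₀>0 chk k n K₀≤ k< on n≥ = contradiction K₀≤ (<⇒≱ k<)
rows-sound f c K₀ (r ∷ rs) K₀>0 chk k n K₀≤ k< on n≥ with k ≤? Row.K₁ r
... | yes le = row-sound f c K₀ r K₀>0 (proj₁ (∧-split chk)) k n K₀≤ le on n≥
... | no nle = rows-sound f c (suc (Row.K₁ r)) rs z<s (proj₂ (∧-split {row? f c K₀ r} chk)) k n (≰⇒> nle) k< on n≥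

-- e/80 and κ/16 approximate log₂ n₀ and log₂ K₁, and s is the largest useful tier with 2^s ≤ 4 (K₁
-- + 1) / 9, or 0 below tier 12. The width of a row is a compromise: the primes up to 4 (K₁ + 1) are
-- weighed against only K₀ terms, so a wide row needs a large n₀ and thus a long chain.
midRows : List Row
midRows =
  row 205 0 1313514 1626 123 15 ∷
  row 212 0 1302183 1625 124 15 ∷
  row 219 0 1163468 1612 125 15 ∷
  row 226 0 1057701 1601 126 15 ∷
  row 233 0 844361 1575 126 15 ∷
  row 245 0 1495815 1641 127 15 ∷
  row 255 0 1004120 1595 128 15 ∷
  row 266 0 945030 1588 129 15 ∷
  row 277 0 794673 1568 130 15 ∷
  row 291 0 961549 1590 131 15 ∷
  row 303 0 716199 1556 132 15 ∷
  row 319 0 1039531 1599 134 15 ∷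
  row 336 0 1030563 1598 135 16 ∷
  row 357 0 1214980 1617 136 16 ∷
  row 375 0 794673 1568 137 16 ∷
  row 394 0 787817 1567 138 16 ∷
  row 418 0 1048577 1600 140 16 ∷
  row 444 0 1048577 1600 141 16 ∷
  row 467 0 781021 1566 142 16 ∷
  row 496 0 1173593 1613 144 16 ∷
  row 526 0 1095001 1605 145 16 ∷
  row 558 0 1066905 1602 146 16 ∷
  row 592 0 1183805 1614 148 16 ∷
  row 628 0 1225552 1618 149 16 ∷
  row 666 0 1336474 1628 151 17 ∷
  row 720 0 2247672 1688 152 17 ∷
  row 778 0 2472434 1699 154 17 ∷
  row 825 0 1748275 1659 156 17 ∷
  row 875 0 1778834 1661 157 17 ∷
  row 928 0 1841564 1665 158 17 ∷
  row 984 0 2152378 1683 160 17 ∷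
  row 1044 0 2286961 1690 161 17 ∷
  row 1107 0 2367610 1694 162 17 ∷
  row 1174 0 2815579 1714 164 17 ∷
  row 1245 0 2940235 1719 165 17 ∷
  row 1320 0 3124081 1726 166 18 ∷
  row 1400 0 3715179 1746 168 18 ∷
  row 1485 0 4051431 1756 169 18 ∷
  row 1575 0 4304756 1763 170 18 ∷
  row 1670 0 5119247 1783 172 18 ∷
  row 1771 0 5439340 1790 173 18 ∷
  row 1878 0 5880470 1799 174 18 ∷
  row 1991 0 6993097 1819 176 18 ∷
  row 2111 0 7560237 1828 177 18 ∷
  row 2217 0 6412698 1809 178 18 ∷
  row 2328 0 6932768 1818 179 18 ∷
  row 2468 0 10784830 1869 181 18 ∷
  row 2617 0 11863284 1880 182 19 ∷
  row 2748 0 10062602 1861 183 19 ∷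
  row 2886 0 10878679 1870 184 19 ∷
  row 3002 0 9470440 1854 185 19 ∷
  row 3153 0 13163137 1892 186 19 ∷
  row 3280 0 11360319 1875 187 19 ∷
  row 3412 0 12496321 1886 188 19 ∷
  row 3583 0 17368864 1924 189 19 ∷
  row 3727 0 14990031 1907 190 19 ∷
  row 3914 0 20834917 1945 191 19 ∷
  row 4071 0 17981375 1928 192 19 ∷
  row 4275 0 25210127 1967 193 19 ∷
  row 4447 0 21757358 1950 194 19 ∷
  row 4625 0 23933035 1961 195 19 ∷
  row 4857 0 33846423 2001 196 19 ∷
  row 5052 0 29210830 1984 197 19 ∷
  row 5305 0 40953971 2023 198 20 ∷
  row 5518 0 35040014 2005 199 20 ∷
  row 5739 0 38879330 2017 200 20 ∷
  row 6027 0 54983675 2057 201 20 ∷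
  row 6269 0 47043759 2039 202 20 ∷
  row 6583 0 67108865 2080 203 20 ∷
  row 6847 0 56922671 2061 204 20 ∷
  row 7190 0 81907942 2103 205 20 ∷
  row 7478 0 69475453 2084 206 20 ∷
  row 7778 0 77087842 2096 207 20 ∷
  row 8090 0 84796419 2107 208 20 ∷
  row 8414 0 94087518 2119 209 20 ∷
  row 8751 0 103496017 2130 210 20 ∷
  row 9277 12 159612678 2180 211 20 ∷
  row 9649 12 104396638 2131 212 20 ∷
  row 10036 12 115835322 2143 213 20 ∷
  row 10438 12 127418543 2154 214 21 ∷
  row 10856 12 140160055 2165 215 21 ∷
  row 11291 12 155517318 2177 216 21 ∷
  row 11743 12 171068632 2188 217 21 ∷
  row 12096 12 131911948 2158 217 21 ∷
  row 12580 12 188175036 2199 218 21 ∷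
  row 13084 12 206992034 2210 219 21 ∷
  row 13608 12 229672041 2222 220 21 ∷
  row 14153 12 252638628 2233 221 21 ∷
  row 14720 12 280320109 2245 222 21 ∷
  row 15309 12 308351367 2256 223 21 ∷
  row 15922 12 342137264 2268 224 21 ∷
  row 16559 12 379625063 2280 225 21 ∷
  row 18547 13 514109347 2315 227 21 ∷
  row 19475 13 106221459 2133 228 21 ∷
  row 20255 13 94087518 2119 229 21 ∷
  row 21066 13 103496017 2130 230 22 ∷
  row 22120 13 141379726 2166 231 22 ∷
  row 23005 13 124149224 2151 232 22 ∷
  row 24156 13 169592838 2187 233 22 ∷
  row 25123 13 150219827 2173 234 22 ∷
  row 26380 13 205206331 2209 235 22 ∷
  row 27436 13 180197031 2194 236 22 ∷
  row 28534 13 198216250 2205 237 22 ∷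
  row 29961 13 273127626 2242 238 22 ∷
  row 31160 13 237771408 2226 239 22 ∷
  row 32719 13 327631766 2263 240 22 ∷
  row 34028 13 287701999 2248 241 22 ∷
  row 37431 14 311034636 2257 244 22 ∷
  row 39677 14 150219827 2173 245 22 ∷
  row 42058 14 165241406 2184 246 23 ∷
  row 44161 14 147639141 2171 247 23 ∷
  row 46811 14 216156354 2215 249 23 ∷
  row 49620 14 235720175 2225 250 23 ∷
  row 52598 14 257054674 2235 251 23 ∷
  row 55754 14 308351367 2256 253 23 ∷
  row 59100 14 336259550 2266 254 23 ∷
  row 62647 14 366693640 2276 255 23 ∷
  row 66406 14 439869400 2297 257 23 ∷
  row 74375 15 475542816 2306 259 23 ∷
  row 80326 15 268435457 2240 261 23 ∷
  row 86753 15 316471425 2259 263 24 ∷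
  row 91959 15 241927579 2228 264 24 ∷
  row 99316 15 410412662 2289 266 24 ∷
  row 105276 15 311034636 2257 267 24 ∷
  row 113699 15 532239374 2319 269 24 ∷
  row 122796 15 632942850 2339 271 24 ∷
  row 130164 15 475542816 2306 272 24 ∷
  row 140578 15 820825324 2369 274 24 ∷
  row 150000 16 270771377 2241 276 24 ∷
  []

midRows-checked : rows? 1000000 200 201 midRows ≡ true
midRows-checked = refl

chain-31-34 : covered? 1000000 400 31 34 4194304 ≡ true
chain-31-34 = refl

chain-35-60 : covered? 1000000 400 35 60 65536 ≡ true
chain-35-60 = refl

chain-61-110 : covered? 1000000 400 61 110 65536 ≡ true
chain-61-110 = refl

chain-111-200 : covered? 1000000 400 111 200 65536 ≡ true
chain-111-200 = refl

-- Exact envelopes for 31 ≤ k ≤ 200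

power-ratio-mono : ∀ X n k P c → X ≤ n → P ≤ k → X ^ k * (n + c) ^ P ≤ n ^ k * (X + c) ^ P
power-ratio-mono X n k P c X≤n P≤k = begin
  X ^ k * (n + c) ^ P                          ≡⟨ cong (_* (n + c) ^ P) (split-^ X) ⟩
  X ^ (k ∸ P) * X ^ P * (n + c) ^ P            ≡⟨ *-assoc (X ^ (k ∸ P)) (X ^ P) _ ⟩
  X ^ (k ∸ P) * (X ^ P * (n + c) ^ P)          ≡⟨ cong (X ^ (k ∸ P) *_) (sym (^-distribʳ-* P X (n + c))) ⟩
  X ^ (k ∸ P) * (X * (n + c)) ^ P              ≤⟨ *-mono-≤ (^-monoˡ-≤ (k ∸ P) X≤n) (^-monoˡ-≤ P cross) ⟩
  n ^ (k ∸ P) * (n * (X + c)) ^ P              ≡⟨ cong (n ^ (k ∸ P) *_) (^-distribʳ-* P n (X + c)) ⟩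
  n ^ (k ∸ P) * (n ^ P * (X + c) ^ P)          ≡⟨ sym (*-assoc (n ^ (k ∸ P)) (n ^ P) _) ⟩
  n ^ (k ∸ P) * n ^ P * (X + c) ^ P            ≡⟨ cong (_* (X + c) ^ P) (sym (split-^ n)) ⟩
  n ^ k * (X + c) ^ P ∎
  where
  open ≤-Reasoning
  split-^ : ∀ z → z ^ k ≡ z ^ (k ∸ P) * z ^ P
  split-^ z = trans (cong (z ^_) (sym (m∸n+n≡m P≤k))) (^-distribˡ-+-* z (k ∸ P) P)
  cross : X * (n + c) ≤ n * (X + c)
  cross = begin
    X * (n + c)      ≡⟨ *-distribˡ-+ X n c ⟩
    X * n + X * c    ≤⟨ +-mono-≤ (≤-reflexive (*-comm X n)) (*-monoˡ-≤ c X≤n) ⟩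
    n * X + n * c    ≡⟨ sym (*-distribˡ-+ n X c) ⟩
    n * (X + c) ∎

envelope : List ℕ → ℕ → ℕ
envelope []       N = 1
envelope (p ∷ ps) N = powFloor p N * envelope ps N

envelope≡ : ∀ b N → envelope (oddPrimesTo b) N ≡ prodOver oddPrime? (λ p → powFloor p N) b
envelope≡ zero N = refl
envelope≡ (suc b) N with oddPrime? (suc b)
... | true = cong (powFloor (suc b) N *_) (envelope≡ b N)
... | false = envelope≡ b N

-- For P ≤ k the ratio n^k / (n + 4k)^P increases with n, so this single test at X settles all n ≥
-- X.
tail? : ℕ → ℕ → ℕ → ℕ → Bool
tail? k o P X = (P <ᵇ suc k) ∧ (o * (X + 4 * k) ^ P <ᵇ X ^ k)

mutual
  -- Until the tail test succeeds, n runs through cells [X, X + X/8]. In a cell n^k is bounded below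
  -- at the left end and the product of exact prime powers above at the right end, which is far
  -- sharper than N^P.
  cells? : ℕ → ℕ → ℕ → ℕ → List ℕ → ℕ → Bool
  cells? zero    k o P ps X = false
  cells? (suc f) k o P ps X = if tail? k o P X then true else cell? f k o P ps X (X + X / 8)

  cell? : ℕ → ℕ → ℕ → ℕ → List ℕ → ℕ → ℕ → Bool
  cell? f k o P ps X Y = (o * envelope ps (Y + 4 * k) <ᵇ X ^ k) ∧ cells? f k o P ps Y

module CellsSound (κ n : ℕ) (on : Odd n) (sm : AllSmooth (4 * (suc κ + 1)) n (suc κ)) where
  k = suc κ
  b = 4 * (suc κ + 1)
  o = oddFac κ

  power≤ : ∀ N → 0 < n → n + 4 * k ≤ N → n ^ k ≤ o * prodOver oddPrime? (λ p → powFloor p N) b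
  power≤ N n>0 N≥ = ≤-trans (prodAP4≥ k n) (≤-trans (prodAP4≤ κ n _ on (powEnvelope>0 b N)
    (powEnvelope b n k N on n>0 (<-≤-trans n>0 (≤-trans (m≤m+n n (4 * k)) N≥)) (λ i i< → ≤-trans (+-monoʳ-≤ n (*-monoʳ-≤ 4 (<⇒≤ i<))) N≥) sm)) (≤-reflexive (*-comm _ o)))

  tail-sound : ∀ X → 0 < X → X ≤ n → tail? k o (π′ b) X ≡ true → ⊥
  tail-sound X X>0 X≤n e with ∧-split {π′ b <ᵇ suc k} e
  ... | e₁ , e₂ = <⇒≱ (<ᵇ-true {o * (X + 4 * k) ^ P} {X ^ k} e₂) (*-cancelˡ-≤ (n ^ k) ⦃ m^n≢0 n k ⦃ >-nonZero n>0 ⦄ ⦄ (begin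
    n ^ k * X ^ k                        ≤⟨ *-monoˡ-≤ (X ^ k) (≤-trans (power≤ (n + 4 * k) n>0 ≤-refl) (*-monoʳ-≤ o (powEnvelope≤ b (n + 4 * k) (≤-trans n>0 (m≤m+n n (4 * k)))))) ⟩
    o * (n + 4 * k) ^ P * X ^ k          ≡⟨ trans (*-assoc o _ _) (cong (o *_) (*-comm _ (X ^ k))) ⟩
    o * (X ^ k * (n + 4 * k) ^ P)        ≤⟨ *-monoʳ-≤ o (power-ratio-mono X n k P (4 * k) X≤n (s≤s⁻¹ (<ᵇ-true {P} {suc k} e₁))) ⟩
    o * (n ^ k * (X + 4 * k) ^ P)        ≡⟨ solve 3 (λ a b c → a :* (b :* c) := b :* (a :* c)) refl o (n ^ k) _ ⟩
    n ^ k * (o * (X + 4 * k) ^ P) ∎))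
    where
    open ≤-Reasoning
    P = π′ b
    n>0 : 0 < n
    n>0 = <-≤-trans X>0 X≤n

  cells-sound : ∀ f X → 0 < X → X ≤ n → cells? f k o (π′ b) (oddPrimesTo b) X ≡ true → ⊥
  cells-sound (suc f) X X>0 X≤n e with tail? k o (π′ b) X in e₁
  ... | true = tail-sound X X>0 X≤n e₁
  ... | false with ∧-split {o * envelope (oddPrimesTo b) (X + X / 8 + 4 * k) <ᵇ X ^ k} e
  ... | e₂ , e₃ with X + X / 8 ≤? n
  ... | yes le = cells-sound f (X + X / 8) (<-≤-trans X>0 (m≤m+n X (X / 8))) le e₃
  ... | no nle = <⇒≱ (<ᵇ-true {o * envelope (oddPrimesTo b) (X + X / 8 + 4 * k)} {X ^ k} e₂)
        (≤-trans (^-monoˡ-≤ k X≤n) (≤-trans (power≤ (X + X / 8 + 4 * k) (<-≤-trans X>0 X≤n) (+-monoˡ-≤ (4 * k) (<⇒≤ (≰⇒> nle)))) (≤-reflexive (cong (o *_) (sym (envelope≡ b _))))))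

envelope? : ℕ → ℕ → ℕ → Bool
envelope? f X κ = cells? f (suc κ) (oddFac κ) (π′ b) (oddPrimesTo b) X
  where b = 4 * (suc κ + 1)

envelope-sound : ∀ f X a l → 0 < X → allFrom (envelope? f X) a l ≡ true → ∀ k n → a < k → k ≤ a + l → Odd n → X ≤ n → ¬ AllSmooth (4 * (k + 1)) n k
envelope-sound f X a l X>0 chk (suc κ) n a<k k≤ on X≤n sm = CellsSound.cells-sound κ n on sm f X X>0 X≤n (allFrom-sound (envelope? f X) a l chk κ (s≤s⁻¹ a<k) k≤)

envelope-31-34 : allFrom (envelope? 500 4194304) 30 4 ≡ true
envelope-31-34 = refl

envelope-35-200 : allFrom (envelope? 500 65536) 34 166 ≡ true
envelope-35-200 = refl

-- Primes in the block when n ≤ 64k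

down : ℕ → ℕ → ℕ → Bool × ℕ
down zero    t y = false , y
down (suc f) t y = if oddPrime? (t ∸ 4 * y) then (true , y) else down f t (suc y)

down-sound : ∀ f t y z → down f t y ≡ (true , z) → z < y + f × oddPrime? (t ∸ 4 * z) ≡ true
down-sound (suc f) t y z e with oddPrime? (t ∸ 4 * y) in e′
down-sound (suc f) t y z refl | true = m<m+n y z<s , e′
... | false with down-sound f t (suc y) z e
... | lt , pz = subst (z <_) (sym (+-suc y f)) lt , pz

-- The window may not be longer than any block concerned: m ≤ n ≤ 64k gives m / 64 ≤ k, and k ≥ 30
-- allows 30. It grows with m, so a chain has only logarithmically many links.
windowSize : ℕ → ℕ
windowSize m = if m / 64 <ᵇ 30 then 30 else m / 64

windowSize≤ : ∀ k m → 30 ≤ k → m ≤ 64 * k → windowSize m ≤ k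
windowSize≤ k m k≥ m≤ with m / 64 <ᵇ 30
... | true = k≥
... | false = ≤-trans (/-monoˡ-≤ 64 (≤-trans m≤ (≤-reflexive (*-comm 64 k)))) (≤-reflexive (m*n/n≡m k 64))

mutual
  -- Unlike in `chain`, the term itself is to be prime; any term of the block exceeds 4k + 8 because
  -- n does. Searching from the top of the window makes each link as long as possible.
  primeChain : ℕ → ℕ → ℕ → Bool
  primeChain zero    top v = false
  primeChain (suc f) top v = if top <ᵇ suc v then true else primeWindow f top v (windowSize (v + 4))

  primeWindow : ℕ → ℕ → ℕ → ℕ → Bool
  primeWindow f top v K = primeLink f top v K (down K (v + 4 * K) 0)

  primeLink : ℕ → ℕ → ℕ → ℕ → Bool × ℕ → Bool
  primeLink f top v K (false , y) = false
  primeLink f top v K (true , y)  = primeChain f top (v + 4 * (K ∸ y))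

primeChain-sound : ∀ f top v → primeChain f top v ≡ true → ∀ k x → 30 ≤ k → v + 4 * suc x ≤ 64 * k → 4 * k + 8 < v + 4 * suc x → v + 4 * suc x ≤ top →
  Hit (4 * k + 8) (v + 4 * suc x) k
primeChain-sound (suc f) top v e k x k≥ ≤64k >4k le with top <ᵇ suc v in e₀
... | true = contradiction (≤-trans le (s≤s⁻¹ (<ᵇ-true {top} {suc v} e₀))) (<⇒≱ (m<m+n v (*-mono-< {0} {4} z<s z<s)))
... | false with windowSize (v + 4) | windowSize≤ k (v + 4) k≥ (≤-trans (+-monoʳ-≤ v (*-monoʳ-≤ 4 (s≤s z≤n))) ≤64k)
... | K | K≤k with down K (v + 4 * K) 0 in e₁
... | true , y with down-sound K (v + 4 * K) 0 y e₁
... | y<K , isP with hit-or-advance (4 * k + 8) K v y x y<K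
        (v + 4 * (K ∸ y) , oddPrime?-sound _ (subst (λ z → oddPrime? z ≡ true) (shift-window v K y (<⇒≤ y<K)) isP) , ∣-refl , λ x< → <-≤-trans >4k (+-monoʳ-≤ v (*-monoʳ-≤ 4 x<)))
... | inj₁ (mkHit i q i< pq d lt) = mkHit i q (<-≤-trans i< K≤k) pq d lt
... | inj₂ (x′ , eq) = subst (λ n → Hit (4 * k + 8) n k) (sym eq) (primeChain-sound f top (v + 4 * (K ∸ y)) e k x′ k≥
        (≤-trans (≤-reflexive (sym eq)) ≤64k) (<-≤-trans >4k (≤-reflexive eq)) (≤-trans (≤-reflexive (sym eq)) le))

-- 1073741824 is 64 · 4¹², the largest n that occurs for n ≤ 64k and k ≤ 4¹². The starts 125 and 127
-- cover both odd classes above 128 = 4 · 30 + 8.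
primeChain-1 : primeChain 1000 1073741824 125 ≡ true
primeChain-1 = refl

primeChain-3 : primeChain 1000 1073741824 127 ≡ true
primeChain-3 = refl

prime-in-progression : ∀ k n → 30 ≤ k → Odd n → 4 * k + 8 < n → n ≤ 64 * k → n ≤ 1073741824 → Hit (4 * k + 8) n k
prime-in-progression k n k≥ on n> n≤ n≤top = go (n % 4) (odd%4 n on) refl
  where
  from : ∀ v → v < n → v % 4 ≡ n % 4 → primeChain 1000 1073741824 v ≡ true → Hit (4 * k + 8) n k
  from v v< e ch with class-offset n v e v<
  ... | x , eq = subst (λ n → Hit (4 * k + 8) n k) (sym eq) (primeChain-sound 1000 1073741824 v ch k x k≥ (≤-trans (≤-reflexive (sym eq)) n≤) (<-≤-trans n> (≤-reflexive eq)) (≤-trans (≤-reflexive (sym eq)) n≤top))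
  n>128 : 128 < n
  n>128 = ≤-<-trans (+-monoˡ-≤ 8 (*-monoʳ-≤ 4 k≥)) n>
  go : ∀ r → OddClass r → n % 4 ≡ r → Hit (4 * k + 8) n k
  go _ (inj₁ refl) e = from 125 (<-trans (≤-by 126 128 refl) n>128) (sym e) primeChain-1
  go _ (inj₂ refl) e = from 127 (<-trans (≤-by 128 128 refl) n>128) (sym e) primeChain-3

-- Assembling the ranges of k and n

wide-31-200 : ∀ k n → 31 ≤ k → k ≤ 200 → Odd n → 60 * k ≤ n → ¬ AllSmooth (4 * (k + 1)) n k
wide-31-200 k n k≥ k≤ on n≥ with k ≤? 34
... | yes k≤34 with n ≤? 4194304
... | yes n≤ = covered-sound 1000000 400 31 34 4194304 z<s chain-31-34 k n k≥ k≤34 on n≥ n≤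
... | no n≰ = envelope-sound 500 4194304 30 4 z<s envelope-31-34 k n k≥ k≤34 on (<⇒≤ (≰⇒> n≰))
wide-31-200 k n k≥ k≤ on n≥ | no k≰34 with n ≤? 65536
... | no n≰ = envelope-sound 500 65536 34 166 z<s envelope-35-200 k n (≰⇒> k≰34) k≤ on (<⇒≤ (≰⇒> n≰))
... | yes n≤ with k ≤? 60
... | yes k≤60 = covered-sound 1000000 400 35 60 65536 z<s chain-35-60 k n (≰⇒> k≰34) k≤60 on n≥ n≤
... | no k≰60 with k ≤? 110
... | yes k≤110 = covered-sound 1000000 400 61 110 65536 z<s chain-61-110 k n (≰⇒> k≰60) k≤110 on n≥ n≤
... | no k≰110 = covered-sound 1000000 400 111 200 65536 z<s chain-111-200 k n (≰⇒> k≰110) k≤ on n≥ n≤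

wide-31-150000 : ∀ k n → 31 ≤ k → k ≤ 150000 → Odd n → 60 * k ≤ n → ¬ AllSmooth (4 * (k + 1)) n k
wide-31-150000 k n k≥ k≤ on n≥ with k ≤? 200
... | yes k≤200 = wide-31-200 k n k≥ k≤200 on n≥
... | no k≰200 = rows-sound 1000000 200 201 midRows z<s midRows-checked k n (≰⇒> k≰200) (s≤s k≤) on n≥

beyond-4^12 : ∀ k n → 4 ^ 12 ≤ k → Odd n → 4 * k + 8 < n → ¬ AllSmooth (4 * k + 8) n k
beyond-4^12 k n k≥ on n> sm with 32 * k ≤? n
... | yes n≥ = large-n k n (≤-trans (≤-by 150000 (4 ^ 12) refl) k≥) on n> sm (inj₂ (k≥ , n≥))
... | no n≱ with logFloor 4 (s≤s (s≤s z≤n)) k (<-≤-trans (≤-by 1 (4 ^ 12) refl) k≥)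
... | q , q≤ , q> = ClassRange.impossible q k n (≮⇒≥ (λ q< → <⇒≱ q> (≤-trans (^-monoʳ-≤ 4 q<) k≥))) q≤ q> on n> (≰⇒> n≱) sm

-- Dropping the first term makes n exceed the smoothness bound.
drop-first : ∀ k n → AllSmooth (4 * (suc k + 1)) n (suc k) → AllSmooth (4 * k + 8) (n + 4) k
drop-first k n sm i i< p pp d = ≤-trans (sm (suc i) (s≤s i<) p pp (subst (p ∣_) (solve 2 (λ n i → n :+ con 4 :+ con 4 :* i := n :+ con 4 :* (con 1 :+ i)) refl n i) d))
  (≤-reflexive (solve 1 (λ k → con 4 :* (con 1 :+ k :+ con 1) := con 4 :* k :+ con 8) refl k))

drop-first-< : ∀ k n → 4 * suc k < n → 4 * k + 8 < n + 4
drop-first-< k n lt = ≤-<-trans (≤-reflexive (solve 1 (λ k → con 4 :* k :+ con 8 := con 4 :* (con 1 :+ k) :+ con 4) refl k)) (+-monoˡ-< 4 lt)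

-- The split at 64k concerns the block without its first term; 60 in place of 64 absorbs the shift
-- of both n and k on returning to the full block.
wide⇒60k≤n : ∀ k n → 16 ≤ k → 64 * k < n + 4 → 60 * suc k ≤ n
wide⇒60k≤n k n k≥ lt = +-cancelʳ-≤ 4 _ _ (begin
  60 * suc k + 4     ≡⟨ solve 1 (λ k → con 60 :* (con 1 :+ k) :+ con 4 := con 60 :* k :+ con 4 :* con 16) refl k ⟩
  60 * k + 4 * 16    ≤⟨ +-monoʳ-≤ (60 * k) (*-monoʳ-≤ 4 k≥) ⟩
  60 * k + 4 * k     ≡⟨ solve 1 (λ k → con 60 :* k :+ con 4 :* k := con 64 :* k) refl k ⟩
  64 * k             ≤⟨ <⇒≤ lt ⟩
  n + 4 ∎)
  where open ≤-Reasoning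

not-smooth-k≥31 : ∀ k n → 31 ≤ k → Odd n → 4 * k < n → ¬ AllSmooth (4 * (k + 1)) n k
not-smooth-k≥31 (suc k) n k≥ on n> sm with 4 ^ 12 ≤? k
... | yes big = beyond-4^12 k (n + 4) big (odd-term n 1 on) (drop-first-< k n n>) (drop-first k n sm)
... | no small with n + 4 ≤? 64 * k
... | yes n≤ = hit⇒⊥ ≤-refl (drop-first k n sm) (prime-in-progression k (n + 4) (s≤s⁻¹ k≥) (odd-term n 1 on) (drop-first-< k n n>) n≤ (≤-trans n≤ (*-monoʳ-≤ 64 (<⇒≤ (≰⇒> small)))))
... | no n≰ with suc k ≤? 150000
... | yes k≤ = wide-31-150000 (suc k) n k≥ k≤ on (wide⇒60k≤n k n (≤-trans (≤-by 16 30 refl) (s≤s⁻¹ k≥)) (≰⇒> n≰)) sm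
... | no k≰ = large-n k (n + 4) (s≤s⁻¹ (≰⇒> k≰)) (odd-term n 1 on) (drop-first-< k n n>) (drop-first k n sm) (inj₁ (<⇒≤ (≰⇒> n≰)))

term∣prodAP4 : ∀ n k i → i < k → n + 4 * i ∣ prodAP4 n k
term∣prodAP4 n (suc k) i i< with i ≟ k
... | yes refl = n∣m*n (prodAP4 n k)
... | no ne = ∣-trans (term∣prodAP4 n k i (≤∧≢⇒< (s≤s⁻¹ i<) ne)) (m∣m*n (n + 4 * k))

not-smooth : ∀ k n → 2 ≤ k → Odd n → 4 * k < n → ¬ Exceptional k n → ¬ AllSmooth (4 * (k + 1)) n k
not-smooth k n k≥2 on n> nex with k ≤? 30
... | yes k≤30 = not-smooth-k≤30 k n k≥2 k≤30 on n> nex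
... | no k≰30 = not-smooth-k≥31 k n (≰⇒> k≰30) on n>

theorem4 : (k n : ℕ) → 2 ≤ k → ¬ (2 ∣ n) → 4 * k < n →
    ¬ ((k ≡ 2 × (n ≡ 11 ⊎ n ≡ 21 ⊎ n ≡ 45 ⊎ n ≡ 77 ⊎ n ≡ 121)) ⊎ (k ≡ 3 × n ≡ 117)) →
    (q : ℕ) → GreatestPrimeFactor (prodAP4 n k) q → 4 * (k + 1) < q
theorem4 k n k≥2 on n> nex q gpf = ≰⇒> λ q≤ → not-smooth k n k≥2 on n> nex λ i i< p pp d → ≤-trans (greatest gpf p pp (∣-trans d (term∣prodAP4 n k i i<))) q≤
  where
  greatest : GreatestPrimeFactor (prodAP4 n k) q → ∀ p → Prime p → p ∣ prodAP4 n k → p ≤ q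
  -- The product 1 has no prime divisor, so this case is vacuous.
  greatest (inj₁ (one , _)) p pp d = contradiction (∣⇒≤ (subst (p ∣_) one d)) (<⇒≱ (prime>1 pp))
  greatest (inj₂ (_ , _ , _ , max)) = max
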